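{- Let $k$ be a positive even integer and let $f:\mathcal H\to\mathbb C$ be a holomorphic function on the upper half-plane with a Fourier expansion $f(z)=\sum_{n=1}^\infty a_n e^{2\pi i n z}$ such that $f|H_{13}=\pm f$ (for one of the two signs) and, for every prime $p$, $f|T_p=p^{1-k/2}a_p f$, where $H_{13}=\begin{pmatrix}0&-1\\13&0\end{pmatrix}$ and $T_p$ is the level $13$ Hecke operator with trivial character. Put $$\gamma=\begin{pmatrix}3&1\\-13&-4\end{pmatrix},\quad \varepsilon_1=\begin{pmatrix}\sqrt{13}&\frac{14}{3\sqrt{13}}\\-3\sqrt{13}&-\sqrt{13}\end{pmatrix},\quad \varepsilon_2=\begin{pmatrix}-\sqrt{13}&\frac{ -4}{\sqrt{13}}\\ \frac{7\sqrt{13}}{2}&\sqrt{13}\end{pmatrix}.$$ Then $$f\big|\,(1-\gamma)(1-\varepsilon)=0$$ for every $\varepsilon$ in the group generated by $\varepsilon_1$ and $\varepsilon_2$.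
   Context: $\mathcal H=\{x+iy\in\mathbb C: y>0\}$. For $M=\begin{pmatrix}a&b\\c&d\end{pmatrix}\in GL_2(\mathbb R)$ with $\det M>0$, the weight $k$ action is $(f|M)(z)=(\det M)^{k/2}(cz+d)^{ -k}f\left(\frac{az+b}{cz+d}\right)$. It is a right action, so $f|(XY)=(f|X)|Y$, and it is extended linearly to the group ring $\mathbb C[GL_2(\mathbb R)^+]$; $1$ denotes the identity of the group ring. Since $k$ is even, nonzero scalar matrices act trivially. The level $13$ Hecke operators with trivial character are the group ring elements $$T_p=\chi_0(p)\begin{pmatrix}p&0\\0&1\end{pmatrix}+\sum_{a=0}^{p-1}\begin{pmatrix}1&a\\0&p\end{pmatrix}$$ for $p$ prime, where $\chi_0(p)=1$ if $p\ne 13$ and $\chi_0(13)=0$. With this normalization, the condition $f|T_p=p^{1-k/2}a_pf$ for all primes $p$ is equivalent to $a_{pn}+\chi_0(p)p^{k-1}a_{n/p}=a_pa_n$ for all $n\ge1$ and all primes $p$ (with $a_{n/p}=0$ if $p\nmid n$). -}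

module Defs where

open import Algebra.Bundles using (CommutativeRing; CommutativeSemiring)
import Algebra.Definitions.RawSemiring
open import Data.Bool.Base using (if_then_else_)
open import Data.Empty using (⊥-elim)
open import Data.Integer.Base as ℤ using (ℤ; +_; -[1+_]; 0ℤ)
import Data.Integer.Properties as ℤₚ
open import Data.List.Base using (List; []; _∷_; _++_; map; foldr; upTo; cartesianProductWith)
open import Data.Nat.Base as ℕ using (ℕ; zero; suc; NonZero; _!)
open import Data.Nat.Coprimality using (1-coprimeTo) renaming (sym to coprime-sym)
import Data.Nat.Properties as ℕₚ
open import Data.Product.Base using (∃; _×_; _,_; proj₁; proj₂)
open import Data.Rational.Base as ℚ using (ℚ; 0ℚ; 1ℚ; ½; mkℚ; toℚᵘ; *≤*; *<*)
import Data.Rational.Properties as ℚₚ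
open import Data.Rational.Solver using (module +-*-Solver)
open import Data.Rational.Unnormalised.Base as ℚᵘ using (ℚᵘ; mkℚᵘ; *≡*)
import Data.Rational.Unnormalised.Properties as ℚᵘₚ
open import Data.Sum.Base using (_⊎_; inj₁; inj₂)
open import Level using (0ℓ)
open import Relation.Binary.PropositionalEquality
  using (_≡_; refl; sym; trans; cong; cong₂; subst₂)
open import Relation.Nullary using (¬_; yes; no; does)

opaque

  ≤l : ∀ {a b c} → a ≡ b → a ℚ.≤ c → b ℚ.≤ c
  ≤l refl p = p

  ≤r : ∀ {a b c} → b ≡ c → a ℚ.≤ b → a ℚ.≤ c
  ≤r refl p = p

  <l : ∀ {a b c} → a ≡ b → a ℚ.< c → b ℚ.< c
  <l refl p = p

  <r : ∀ {a b c} → b ≡ c → a ℚ.< b → a ℚ.< c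
  <r refl p = p

  +ε-pos : ∀ {a b} → 0ℚ ℚ.< a → 0ℚ ℚ.< b → 0ℚ ℚ.< a ℚ.+ b
  +ε-pos {a} {b} p q = ℚₚ.positive⁻¹ (a ℚ.+ b) {{ℚₚ.pos+pos⇒pos a {{ℚ.positive p}} b {{ℚ.positive q}}}}

  *ε-pos : ∀ {a b} → 0ℚ ℚ.< a → 0ℚ ℚ.< b → 0ℚ ℚ.< a ℚ.* b
  *ε-pos {a} {b} p q = ℚₚ.positive⁻¹ (a ℚ.* b) {{ℚₚ.pos*pos⇒pos a {{ℚ.positive p}} b {{ℚ.positive q}}}}

  0<1 : 0ℚ ℚ.< 1ℚ
  0<1 = ℚₚ.positive⁻¹ 1ℚ

  0<½ : 0ℚ ℚ.< ½
  0<½ = ℚₚ.positive⁻¹ ½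

  ½-pos : ∀ {ε} → 0ℚ ℚ.< ε → 0ℚ ℚ.< ½ ℚ.* ε
  ½-pos = *ε-pos 0<½

  ½+½ : ∀ ε → ½ ℚ.* ε ℚ.+ ½ ℚ.* ε ≡ ε
  ½+½ = solve 1 (λ f → con ½ :* f :+ con ½ :* f := f) refl
    where open +-*-Solver

  *-monoˡ : ∀ a {b c} → 0ℚ ℚ.≤ a → b ℚ.≤ c → a ℚ.* b ℚ.≤ a ℚ.* c
  *-monoˡ a 0≤a = ℚₚ.*-monoˡ-≤-nonNeg a {{ℚ.nonNegative 0≤a}}

  *-monoʳ : ∀ a {b c} → 0ℚ ℚ.≤ a → b ℚ.≤ c → b ℚ.* a ℚ.≤ c ℚ.* a
  *-monoʳ a 0≤a = ℚₚ.*-monoʳ-≤-nonNeg a {{ℚ.nonNegative 0≤a}}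

  *-mono-≤ : ∀ {a b c d} → 0ℚ ℚ.≤ c → 0ℚ ℚ.≤ b → a ℚ.≤ b → c ℚ.≤ d → a ℚ.* c ℚ.≤ b ℚ.* d
  *-mono-≤ {a} {b} {c} {d} 0≤c 0≤b a≤b c≤d = ℚₚ.≤-trans (*-monoʳ c 0≤c a≤b) (*-monoˡ b 0≤b c≤d)

  0≤+ : ∀ {a b} → 0ℚ ℚ.≤ a → 0ℚ ℚ.≤ b → 0ℚ ℚ.≤ a ℚ.+ b
  0≤+ {a} {b} p q = ℚₚ.nonNegative⁻¹ (a ℚ.+ b) {{ℚₚ.nonNeg+nonNeg⇒nonNeg a {{ℚ.nonNegative p}} b {{ℚ.nonNegative q}}}}

  0≤* : ∀ {a b} → 0ℚ ℚ.≤ a → 0ℚ ℚ.≤ b → 0ℚ ℚ.≤ a ℚ.* b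
  0≤* {a} {b} p q = ℚₚ.nonNegative⁻¹ (a ℚ.* b) {{ℚₚ.nonNeg*nonNeg⇒nonNeg a {{ℚ.nonNegative p}} b {{ℚ.nonNegative q}}}}

  0≤a² : ∀ a → 0ℚ ℚ.≤ a ℚ.* a
  0≤a² a with ℚₚ.≤-total 0ℚ a
  ... | inj₁ p = 0≤* p p
  ... | inj₂ p = ℚₚ.nonNegative⁻¹ (a ℚ.* a)
                   {{ℚₚ.nonPos*nonPos⇒nonPos a {{ℚ.nonPositive p}} a {{ℚ.nonPositive p}}}}

  ≤∣∣ : ∀ a → a ℚ.≤ ℚ.∣ a ∣
  ≤∣∣ a with ℚₚ.≤-total 0ℚ a
  ... | inj₁ p = ℚₚ.≤-reflexive (sym (ℚₚ.0≤p⇒∣p∣≡p p))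
  ... | inj₂ p = ℚₚ.≤-trans p (ℚₚ.0≤∣p∣ a)

  ∣a-a∣ : ∀ a → ℚ.∣ a ℚ.- a ∣ ≡ 0ℚ
  ∣a-a∣ a = cong ℚ.∣_∣ (ℚₚ.+-inverseʳ a)

  ∣-∣-comm : ∀ a b → ℚ.∣ a ℚ.- b ∣ ≡ ℚ.∣ b ℚ.- a ∣
  ∣-∣-comm a b = trans (sym (ℚₚ.∣-p∣≡∣p∣ (a ℚ.- b))) (cong ℚ.∣_∣ (lem a b))
    where open +-*-Solver
          lem : ∀ a b → ℚ.- (a ℚ.- b) ≡ b ℚ.- a
          lem = solve 2 (λ a b → :- (a :- b) := b :- a) refl

  tri : ∀ a b c {δ η} → ℚ.∣ a ℚ.- b ∣ ℚ.< δ → ℚ.∣ b ℚ.- c ∣ ℚ.< η → ℚ.∣ a ℚ.- c ∣ ℚ.< δ ℚ.+ η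
  tri a b c p q = ℚₚ.≤-<-trans
      (ℚₚ.≤-trans (ℚₚ.≤-reflexive (cong ℚ.∣_∣ (sym (lem a b c)))) (ℚₚ.∣p+q∣≤∣p∣+∣q∣ (a ℚ.- b) (b ℚ.- c)))
      (ℚₚ.+-mono-< p q)
    where open +-*-Solver
          lem : ∀ a b c → (a ℚ.- b) ℚ.+ (b ℚ.- c) ≡ a ℚ.- c
          lem = solve 3 (λ a b c → (a :- b) :+ (b :- c) := a :- c) refl

  tri½ : ∀ a b c {ε} → ℚ.∣ a ℚ.- b ∣ ℚ.< ½ ℚ.* ε → ℚ.∣ b ℚ.- c ∣ ℚ.< ½ ℚ.* ε → ℚ.∣ a ℚ.- c ∣ ℚ.< ε
  tri½ a b c {ε} p q = <r (½+½ ε) (tri a b c p q)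

  ∣+-+∣ : ∀ a b c d {δ η} → ℚ.∣ a ℚ.- c ∣ ℚ.< δ → ℚ.∣ b ℚ.- d ∣ ℚ.< η →
          ℚ.∣ (a ℚ.+ b) ℚ.- (c ℚ.+ d) ∣ ℚ.< δ ℚ.+ η
  ∣+-+∣ a b c d p q = ℚₚ.≤-<-trans
      (ℚₚ.≤-trans (ℚₚ.≤-reflexive (cong ℚ.∣_∣ (sym (lem a b c d)))) (ℚₚ.∣p+q∣≤∣p∣+∣q∣ (a ℚ.- c) (b ℚ.- d)))
      (ℚₚ.+-mono-< p q)
    where open +-*-Solver
          lem : ∀ a b c d → (a ℚ.- c) ℚ.+ (b ℚ.- d) ≡ (a ℚ.+ b) ℚ.- (c ℚ.+ d)
          lem = solve 4 (λ a b c d → (a :- c) :+ (b :- d) := (a :+ b) :- (c :+ d)) refl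

  ∣neg-neg∣ : ∀ a b → ℚ.∣ ℚ.- a ℚ.- ℚ.- b ∣ ≡ ℚ.∣ a ℚ.- b ∣
  ∣neg-neg∣ a b = trans (cong ℚ.∣_∣ (lem a b)) (∣-∣-comm b a)
    where open +-*-Solver
          lem : ∀ a b → ℚ.- a ℚ.- ℚ.- b ≡ b ℚ.- a
          lem = solve 2 (λ a b → :- a :- :- b := b :- a) refl

  ∣*-*∣ : ∀ a b c d {B C δ η} → 0ℚ ℚ.< B → 0ℚ ℚ.< C → ℚ.∣ a ∣ ℚ.≤ B → ℚ.∣ d ∣ ℚ.≤ C →
          ℚ.∣ b ℚ.- d ∣ ℚ.< δ → ℚ.∣ a ℚ.- c ∣ ℚ.< η →
          ℚ.∣ (a ℚ.* b) ℚ.- (c ℚ.* d) ∣ ℚ.< B ℚ.* δ ℚ.+ C ℚ.* η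
  ∣*-*∣ a b c d {B} {C} 0<B 0<C a≤B d≤C p q =
    ℚₚ.≤-<-trans
      (ℚₚ.≤-trans (ℚₚ.≤-reflexive (cong ℚ.∣_∣ (sym (lem a b c d))))
        (ℚₚ.∣p+q∣≤∣p∣+∣q∣ (a ℚ.* (b ℚ.- d)) (d ℚ.* (a ℚ.- c))))
      (ℚₚ.+-mono-< (bd a (b ℚ.- d) 0<B a≤B p) (bd d (a ℚ.- c) 0<C d≤C q))
    where
      open +-*-Solver
      lem : ∀ a b c d → (a ℚ.* (b ℚ.- d)) ℚ.+ (d ℚ.* (a ℚ.- c)) ≡ (a ℚ.* b) ℚ.- (c ℚ.* d)
      lem = solve 4 (λ a b c d → (a :* (b :- d)) :+ (d :* (a :- c)) := (a :* b) :- (c :* d)) refl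
      bd : ∀ u v {K κ} → 0ℚ ℚ.< K → ℚ.∣ u ∣ ℚ.≤ K → ℚ.∣ v ∣ ℚ.< κ → ℚ.∣ u ℚ.* v ∣ ℚ.< K ℚ.* κ
      bd u v {K} 0<K u≤K v<κ = <l (sym (ℚₚ.∣p*q∣≡∣p∣*∣q∣ u v))
        (ℚₚ.≤-<-trans (*-monoʳ ℚ.∣ v ∣ (ℚₚ.0≤∣p∣ v) u≤K)
                      (ℚₚ.*-monoʳ-<-pos K {{ℚ.positive 0<K}} v<κ))

opaque

  -- Total inverse; the value at 0 plays no role, since it is only applied to
  -- sequences that are eventually bounded below by a positive rational.
  invℚ : ℚ → ℚ
  invℚ q with q ℚₚ.≟ 0ℚ
  ... | yes _   = 0ℚ
  ... | no  q≢0 = ℚ.1/_ q {{ℚ.≢-nonZero q≢0}}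

opaque
  unfolding invℚ

  invℚ-inverse : ∀ {q} → 0ℚ ℚ.< q → q ℚ.* invℚ q ≡ 1ℚ
  invℚ-inverse {q} 0<q with q ℚₚ.≟ 0ℚ
  ... | yes q≡0 = ⊥-elim (ℚₚ.<⇒≢ 0<q (sym q≡0))
  ... | no  q≢0 = ℚₚ.*-inverseʳ q {{ℚ.≢-nonZero q≢0}}

opaque

  invℚ-pos : ∀ {q} → 0ℚ ℚ.< q → 0ℚ ℚ.< invℚ q
  invℚ-pos {q} 0<q = ℚₚ.*-cancelˡ-<-nonNeg q {{ℚₚ.pos⇒nonNeg q {{ℚ.positive 0<q}}}}
    (subst₂ ℚ._<_ (sym (ℚₚ.*-zeroʳ q)) (sym (invℚ-inverse 0<q)) 0<1)

  cancel-inv : ∀ {B} ε → 0ℚ ℚ.< B → B ℚ.* (ε ℚ.* invℚ B) ≡ ε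
  cancel-inv {B} ε 0<B = trans (lem B ε (invℚ B))
      (trans (cong (ε ℚ.*_) (invℚ-inverse 0<B)) (ℚₚ.*-identityʳ ε))
    where open +-*-Solver
          lem : ∀ B ε i → B ℚ.* (ε ℚ.* i) ≡ ε ℚ.* (B ℚ.* i)
          lem = solve 3 (λ B ε i → B :* (ε :* i) := ε :* (B :* i)) refl

  invℚ-anti : ∀ {e q} → 0ℚ ℚ.< e → e ℚ.≤ q → invℚ q ℚ.≤ invℚ e
  invℚ-anti {e} {q} 0<e e≤q = ℚₚ.*-cancelˡ-≤-pos e {{ℚ.positive 0<e}}
      (≤r (trans (invℚ-inverse 0<q) (sym (invℚ-inverse 0<e)))
        (*-monoʳ (invℚ q) (ℚₚ.<⇒≤ (invℚ-pos 0<q)) e≤q))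
    where 0<q : 0ℚ ℚ.< q
          0<q = ℚₚ.<-≤-trans 0<e e≤q

  ∣inv-inv∣ : ∀ {e a b δ} → 0ℚ ℚ.< e → e ℚ.≤ a → e ℚ.≤ b → ℚ.∣ a ℚ.- b ∣ ℚ.< δ →
              ℚ.∣ invℚ a ℚ.- invℚ b ∣ ℚ.< (invℚ e ℚ.* invℚ e) ℚ.* δ
  ∣inv-inv∣ {e} {a} {b} {δ} 0<e e≤a e≤b p =
    ℚₚ.≤-<-trans (≤l (sym eq)
        (*-monoʳ ℚ.∣ b ℚ.- a ∣ (ℚₚ.0≤∣p∣ _)
          (*-mono-≤ (ℚₚ.<⇒≤ ib) (ℚₚ.<⇒≤ ie) (invℚ-anti 0<e e≤a) (invℚ-anti 0<e e≤b))))
      (ℚₚ.*-monoʳ-<-pos (invℚ e ℚ.* invℚ e) {{ℚ.positive (*ε-pos ie ie)}}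
        (<l (∣-∣-comm a b) p))
    where
      open +-*-Solver
      0<a : 0ℚ ℚ.< a
      0<a = ℚₚ.<-≤-trans 0<e e≤a
      0<b : 0ℚ ℚ.< b
      0<b = ℚₚ.<-≤-trans 0<e e≤b
      ia : 0ℚ ℚ.< invℚ a
      ia = invℚ-pos 0<a
      ib : 0ℚ ℚ.< invℚ b
      ib = invℚ-pos 0<b
      ie : 0ℚ ℚ.< invℚ e
      ie = invℚ-pos 0<e
      lem : ∀ a b i j → (i ℚ.* j) ℚ.* (b ℚ.- a) ≡ i ℚ.* (b ℚ.* j) ℚ.- j ℚ.* (a ℚ.* i)
      lem = solve 4 (λ a b i j → (i :* j) :* (b :- a) := i :* (b :* j) :- j :* (a :* i)) refl
      eq₀ : (invℚ a ℚ.* invℚ b) ℚ.* (b ℚ.- a) ≡ invℚ a ℚ.- invℚ b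
      eq₀ = trans (lem a b (invℚ a) (invℚ b))
        (cong₂ ℚ._-_ (trans (cong (invℚ a ℚ.*_) (invℚ-inverse 0<b)) (ℚₚ.*-identityʳ (invℚ a)))
                     (trans (cong (invℚ b ℚ.*_) (invℚ-inverse 0<a)) (ℚₚ.*-identityʳ (invℚ b))))
      eq : ℚ.∣ invℚ a ℚ.- invℚ b ∣ ≡ (invℚ a ℚ.* invℚ b) ℚ.* ℚ.∣ b ℚ.- a ∣
      eq = trans (cong ℚ.∣_∣ (sym eq₀)) (trans (ℚₚ.∣p*q∣≡∣p∣*∣q∣ (invℚ a ℚ.* invℚ b) (b ℚ.- a))
            (cong (ℚ._* ℚ.∣ b ℚ.- a ∣) (ℚₚ.0≤p⇒∣p∣≡p (ℚₚ.<⇒≤ (*ε-pos ia ib)))))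

-- ℝ is the setoid of Cauchy sequences of rationals modulo null sequences.
-- As ∃ is a Σ-type, each real carries a modulus of convergence; this is what makes
-- ℝ Cauchy complete (limᵣ) without choice.
IsCauchy : (ℕ → ℚ) → Set
IsCauchy x = ∀ ε → 0ℚ ℚ.< ε →
  ∃ λ N → ∀ m n → N ℕ.≤ m → N ℕ.≤ n → ℚ.∣ x m ℚ.- x n ∣ ℚ.< ε

record ℝ : Set where
  constructor mkℝ
  field
    seq    : ℕ → ℚ
    cauchy : IsCauchy seq
open ℝ public

infix 4 _≈ᵣ_ _<ᵣ_ _≤ᵣ_

record _≈ᵣ_ (x y : ℝ) : Set where
  constructor mk≈
  field
    close : ∀ ε → 0ℚ ℚ.< ε →
      ∃ λ N → ∀ n → N ℕ.≤ n → ℚ.∣ seq x n ℚ.- seq y n ∣ ℚ.< ε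
open _≈ᵣ_ public

record _<ᵣ_ (x y : ℝ) : Set where
  constructor mk<
  field
    gap       : ℚ
    gap-pos   : 0ℚ ℚ.< gap
    from      : ℕ
    separated : ∀ n → from ℕ.≤ n → seq x n ℚ.+ gap ℚ.≤ seq y n
open _<ᵣ_ public

_≤ᵣ_ : ℝ → ℝ → Set
x ≤ᵣ y = ¬ (y <ᵣ x)

⊔ˡ : ∀ {m n k} → m ℕ.⊔ n ℕ.≤ k → m ℕ.≤ k
⊔ˡ {m} {n} = ℕₚ.≤-trans (ℕₚ.m≤m⊔n m n)

⊔ʳ : ∀ {m n k} → m ℕ.⊔ n ℕ.≤ k → n ℕ.≤ k
⊔ʳ {m} {n} = ℕₚ.≤-trans (ℕₚ.m≤n⊔m m n)

opaque

  bounded : ∀ x → IsCauchy x →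
    ∃ λ B → 0ℚ ℚ.< B × ∃ λ N → ∀ n → N ℕ.≤ n → ℚ.∣ x n ∣ ℚ.≤ B
  bounded x cx with cx 1ℚ 0<1
  ... | N , h = ℚ.∣ x N ∣ ℚ.+ 1ℚ , B-pos , N , λ n N≤n →
      ℚₚ.≤-trans
        (ℚₚ.≤-trans (ℚₚ.≤-reflexive (cong ℚ.∣_∣ (sym (lem (x N) (x n))))) (ℚₚ.∣p+q∣≤∣p∣+∣q∣ (x N) (x n ℚ.- x N)))
        (ℚₚ.+-monoʳ-≤ ℚ.∣ x N ∣ (ℚₚ.<⇒≤ (h n N N≤n ℕₚ.≤-refl)))
    where
      open +-*-Solver
      lem : ∀ a b → a ℚ.+ (b ℚ.- a) ≡ b
      lem = solve 2 (λ a b → a :+ (b :- a) := b) refl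
      B-pos : 0ℚ ℚ.< ℚ.∣ x N ∣ ℚ.+ 1ℚ
      B-pos = ℚₚ.<-≤-trans 0<1 (≤l (ℚₚ.+-identityˡ 1ℚ)
                (ℚₚ.+-monoˡ-≤ 1ℚ (ℚₚ.0≤∣p∣ (x N))))

  const-cauchy : ∀ q → IsCauchy (λ _ → q)
  const-cauchy q ε 0<ε = 0 , λ _ _ _ _ → <l (sym (∣a-a∣ q)) 0<ε

  +-cauchy : ∀ {x y} → IsCauchy x → IsCauchy y → IsCauchy (λ n → x n ℚ.+ y n)
  +-cauchy {x} {y} cx cy ε 0<ε with cx (½ ℚ.* ε) (½-pos 0<ε) | cy (½ ℚ.* ε) (½-pos 0<ε)
  ... | M , f | N , g = M ℕ.⊔ N , λ m n p q → <r (½+½ ε)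
      (∣+-+∣ (x m) (y m) (x n) (y n)
        (f m n (⊔ˡ {M} {N} p) (⊔ˡ {M} {N} q)) (g m n (⊔ʳ {M} {N} p) (⊔ʳ {M} {N} q)))

  neg-cauchy : ∀ {x} → IsCauchy x → IsCauchy (λ n → ℚ.- x n)
  neg-cauchy {x} cx ε 0<ε with cx ε 0<ε
  ... | M , f = M , λ m n p q → <l (sym (∣neg-neg∣ (x m) (x n))) (f m n p q)

  *-cauchy : ∀ {x y} → IsCauchy x → IsCauchy y → IsCauchy (λ n → x n ℚ.* y n)
  *-cauchy {x} {y} cx cy ε 0<ε = go (bounded x cx) (bounded y cy)
    where
      Bd : (ℕ → ℚ) → Set
      Bd x = ∃ λ B → 0ℚ ℚ.< B × ∃ λ N → ∀ n → N ℕ.≤ n → ℚ.∣ x n ∣ ℚ.≤ B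
      Res : (ℕ → ℚ) → ℚ → Set
      Res x δ = ∃ λ N → ∀ m n → N ℕ.≤ m → N ℕ.≤ n → ℚ.∣ x m ℚ.- x n ∣ ℚ.< δ
      go₂ : ∀ B C → 0ℚ ℚ.< B → 0ℚ ℚ.< C → ∀ M₁ N₁ →
            (∀ n → M₁ ℕ.≤ n → ℚ.∣ x n ∣ ℚ.≤ B) → (∀ n → N₁ ℕ.≤ n → ℚ.∣ y n ∣ ℚ.≤ C) →
            Res x ((½ ℚ.* ε) ℚ.* invℚ C) → Res y ((½ ℚ.* ε) ℚ.* invℚ B) → Res (λ n → x n ℚ.* y n) ε
      go₂ B C 0<B 0<C M₁ N₁ bx by (M , f) (N , g) = (M₁ ℕ.⊔ N₁) ℕ.⊔ (M ℕ.⊔ N) , λ m n p q → <r eq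
        (∣*-*∣ (x m) (y m) (x n) (y n) 0<B 0<C
          (bx m (⊔ˡ {M₁} {N₁} (⊔ˡ {M₁ ℕ.⊔ N₁} {M ℕ.⊔ N} p)))
          (by n (⊔ʳ {M₁} {N₁} (⊔ˡ {M₁ ℕ.⊔ N₁} {M ℕ.⊔ N} q)))
          (g m n (⊔ʳ {M} {N} (⊔ʳ {M₁ ℕ.⊔ N₁} {M ℕ.⊔ N} p)) (⊔ʳ {M} {N} (⊔ʳ {M₁ ℕ.⊔ N₁} {M ℕ.⊔ N} q)))
          (f m n (⊔ˡ {M} {N} (⊔ʳ {M₁ ℕ.⊔ N₁} {M ℕ.⊔ N} p)) (⊔ˡ {M} {N} (⊔ʳ {M₁ ℕ.⊔ N₁} {M ℕ.⊔ N} q))))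
        where
          eq : B ℚ.* ((½ ℚ.* ε) ℚ.* invℚ B) ℚ.+ C ℚ.* ((½ ℚ.* ε) ℚ.* invℚ C) ≡ ε
          eq = trans (cong₂ ℚ._+_ (cancel-inv (½ ℚ.* ε) 0<B) (cancel-inv (½ ℚ.* ε) 0<C)) (½+½ ε)
      go : Bd x → Bd y → Res (λ n → x n ℚ.* y n) ε
      go (B , 0<B , M₁ , bx) (C , 0<C , N₁ , by) = go₂ B C 0<B 0<C M₁ N₁ bx by
        (cx _ (*ε-pos (½-pos 0<ε) (invℚ-pos 0<C))) (cy _ (*ε-pos (½-pos 0<ε) (invℚ-pos 0<B)))

infixl 6 _+ᵣ_ _-ᵣ_
infixl 7 _*ᵣ_
infix  8 -ᵣ_

_+ᵣ_ : ℝ → ℝ → ℝ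
x +ᵣ y = mkℝ (λ n → seq x n ℚ.+ seq y n) (+-cauchy {seq x} {seq y} (cauchy x) (cauchy y))

_*ᵣ_ : ℝ → ℝ → ℝ
x *ᵣ y = mkℝ (λ n → seq x n ℚ.* seq y n) (*-cauchy {seq x} {seq y} (cauchy x) (cauchy y))

-ᵣ_ : ℝ → ℝ
-ᵣ x = mkℝ (λ n → ℚ.- seq x n) (neg-cauchy {seq x} (cauchy x))

_-ᵣ_ : ℝ → ℝ → ℝ
x -ᵣ y = x +ᵣ (-ᵣ y)

fromℚ : ℚ → ℝ
fromℚ q = mkℝ (λ _ → q) (const-cauchy q)

fromℤ : ℤ → ℝ
fromℤ i = fromℚ (i ℚ./ 1)

fromℕ : ℕ → ℝ
fromℕ n = fromℤ (+ n)

0ᵣ 1ᵣ : ℝ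
0ᵣ = fromℕ 0
1ᵣ = fromℕ 1

opaque

  ≡⇒≈ᵣ : ∀ {x y} → (∀ n → seq x n ≡ seq y n) → x ≈ᵣ y
  ≡⇒≈ᵣ {x} {y} h = mk≈ λ ε 0<ε → 0 , λ n _ →
    <l (sym (trans (cong (λ t → ℚ.∣ t ℚ.- seq y n ∣) (h n)) (∣a-a∣ (seq y n)))) 0<ε

  ≈ᵣ-refl : ∀ {x} → x ≈ᵣ x
  ≈ᵣ-refl = ≡⇒≈ᵣ λ _ → refl

  ≈ᵣ-sym : ∀ {x y} → x ≈ᵣ y → y ≈ᵣ x
  ≈ᵣ-sym {x} {y} h = mk≈ λ ε 0<ε → proj₁ (close h ε 0<ε) , λ n p →
    <l (∣-∣-comm (seq x n) (seq y n)) (proj₂ (close h ε 0<ε) n p)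

  ≈ᵣ-trans : ∀ {x y z} → x ≈ᵣ y → y ≈ᵣ z → x ≈ᵣ z
  ≈ᵣ-trans {x} {y} {z} h k = mk≈ go
    where
      go : ∀ ε → 0ℚ ℚ.< ε → ∃ λ N → ∀ n → N ℕ.≤ n → ℚ.∣ seq x n ℚ.- seq z n ∣ ℚ.< ε
      go ε 0<ε with close h (½ ℚ.* ε) (½-pos 0<ε) | close k (½ ℚ.* ε) (½-pos 0<ε)
      ... | M , f | N , g = M ℕ.⊔ N , λ n p →
        tri½ (seq x n) (seq y n) (seq z n) (f n (⊔ˡ {M} {N} p)) (g n (⊔ʳ {M} {N} p))

  +ᵣ-cong : ∀ {x y u v} → x ≈ᵣ y → u ≈ᵣ v → x +ᵣ u ≈ᵣ y +ᵣ v
  +ᵣ-cong {x} {y} {u} {v} h k = mk≈ go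
    where
      go : ∀ ε → 0ℚ ℚ.< ε → ∃ λ N → ∀ n → N ℕ.≤ n → ℚ.∣ seq (x +ᵣ u) n ℚ.- seq (y +ᵣ v) n ∣ ℚ.< ε
      go ε 0<ε with close h (½ ℚ.* ε) (½-pos 0<ε) | close k (½ ℚ.* ε) (½-pos 0<ε)
      ... | M , f | N , g = M ℕ.⊔ N , λ n p → <r (½+½ ε)
        (∣+-+∣ (seq x n) (seq u n) (seq y n) (seq v n) (f n (⊔ˡ {M} {N} p)) (g n (⊔ʳ {M} {N} p)))

  -ᵣ-cong : ∀ {x y} → x ≈ᵣ y → -ᵣ x ≈ᵣ -ᵣ y
  -ᵣ-cong {x} {y} h = mk≈ λ ε 0<ε → proj₁ (close h ε 0<ε) , λ n p →
    <l (sym (∣neg-neg∣ (seq x n) (seq y n))) (proj₂ (close h ε 0<ε) n p)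

  *ᵣ-cong : ∀ {x y u v} → x ≈ᵣ y → u ≈ᵣ v → x *ᵣ u ≈ᵣ y *ᵣ v
  *ᵣ-cong {x} {y} {u} {v} h k = mk≈ go
    where
      go : ∀ ε → 0ℚ ℚ.< ε → ∃ λ N → ∀ n → N ℕ.≤ n → ℚ.∣ seq (x *ᵣ u) n ℚ.- seq (y *ᵣ v) n ∣ ℚ.< ε
      go ε 0<ε = go₁ (bounded (seq x) (cauchy x)) (bounded (seq v) (cauchy v))
        where
          Bd : (ℕ → ℚ) → Set
          Bd x = ∃ λ B → 0ℚ ℚ.< B × ∃ λ N → ∀ n → N ℕ.≤ n → ℚ.∣ x n ∣ ℚ.≤ B
          Res : (ℕ → ℚ) → (ℕ → ℚ) → ℚ → Set
          Res x y δ = ∃ λ N → ∀ n → N ℕ.≤ n → ℚ.∣ x n ℚ.- y n ∣ ℚ.< δ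
          go₂ : ∀ B C → 0ℚ ℚ.< B → 0ℚ ℚ.< C → ∀ M₁ N₁ →
                (∀ n → M₁ ℕ.≤ n → ℚ.∣ seq x n ∣ ℚ.≤ B) → (∀ n → N₁ ℕ.≤ n → ℚ.∣ seq v n ∣ ℚ.≤ C) →
                Res (seq x) (seq y) ((½ ℚ.* ε) ℚ.* invℚ C) → Res (seq u) (seq v) ((½ ℚ.* ε) ℚ.* invℚ B) →
                Res (seq (x *ᵣ u)) (seq (y *ᵣ v)) ε
          go₂ B C 0<B 0<C M₁ N₁ bx bv (M , f) (N , g) = (M₁ ℕ.⊔ N₁) ℕ.⊔ (M ℕ.⊔ N) , λ n p →
            <r (trans (cong₂ ℚ._+_ (cancel-inv (½ ℚ.* ε) 0<B) (cancel-inv (½ ℚ.* ε) 0<C)) (½+½ ε))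
            (∣*-*∣ (seq x n) (seq u n) (seq y n) (seq v n) 0<B 0<C
              (bx n (⊔ˡ {M₁} {N₁} (⊔ˡ {M₁ ℕ.⊔ N₁} {M ℕ.⊔ N} p)))
              (bv n (⊔ʳ {M₁} {N₁} (⊔ˡ {M₁ ℕ.⊔ N₁} {M ℕ.⊔ N} p)))
              (g n (⊔ʳ {M} {N} (⊔ʳ {M₁ ℕ.⊔ N₁} {M ℕ.⊔ N} p)))
              (f n (⊔ˡ {M} {N} (⊔ʳ {M₁ ℕ.⊔ N₁} {M ℕ.⊔ N} p))))
          go₁ : Bd (seq x) → Bd (seq v) → Res (seq (x *ᵣ u)) (seq (y *ᵣ v)) ε
          go₁ (B , 0<B , M₁ , bx) (C , 0<C , N₁ , bv) = go₂ B C 0<B 0<C M₁ N₁ bx bv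
            (close h _ (*ε-pos (½-pos 0<ε) (invℚ-pos 0<C))) (close k _ (*ε-pos (½-pos 0<ε) (invℚ-pos 0<B)))

  >0-resp : ∀ {x y} → x ≈ᵣ y → 0ᵣ <ᵣ x → 0ᵣ <ᵣ y
  >0-resp {x} {y} h (mk< g 0<g N s) with close h (½ ℚ.* g) (½-pos 0<g)
  ... | M , f = mk< (½ ℚ.* g) (½-pos 0<g) (M ℕ.⊔ N) λ n p →
      go (seq x n) (seq y n) (s n (⊔ʳ {M} {N} p)) (f n (⊔ˡ {M} {N} p))
    where
      open +-*-Solver
      lem : ∀ a b → (a ℚ.- b) ℚ.+ b ≡ a
      lem = solve 2 (λ a b → (a :- b) :+ b := a) refl
      lem₂ : ∀ h b → (h ℚ.+ b) ℚ.+ (ℚ.- h) ≡ b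
      lem₂ = solve 2 (λ h b → (h :+ b) :+ (:- h) := b) refl
      lem₃ : ∀ g → (0ℚ ℚ.+ g) ℚ.+ (ℚ.- (½ ℚ.* g)) ≡ 0ℚ ℚ.+ ½ ℚ.* g
      lem₃ = solve 1 (λ g → (con 0ℚ :+ g) :+ (:- (con ½ :* g)) := con 0ℚ :+ con ½ :* g) refl
      go : ∀ a b → 0ℚ ℚ.+ g ℚ.≤ a → ℚ.∣ a ℚ.- b ∣ ℚ.< ½ ℚ.* g → 0ℚ ℚ.+ ½ ℚ.* g ℚ.≤ b
      go a b p q = subst₂ ℚ._≤_ (lem₃ g) (lem₂ (½ ℚ.* g) b)
        (ℚₚ.+-monoˡ-≤ (ℚ.- (½ ℚ.* g)) (ℚₚ.≤-trans p (≤l (lem a b)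
          (ℚₚ.+-monoˡ-≤ b (ℚₚ.≤-trans (≤∣∣ (a ℚ.- b)) (ℚₚ.<⇒≤ q))))))

  >0-* : ∀ {x y} → 0ᵣ <ᵣ x → 0ᵣ <ᵣ y → 0ᵣ <ᵣ x *ᵣ y
  >0-* {x} {y} (mk< g 0<g N s) (mk< h 0<h M t) = mk< (g ℚ.* h) (*ε-pos 0<g 0<h) (M ℕ.⊔ N) λ n p →
      ≤l (sym (ℚₚ.+-identityˡ (g ℚ.* h)))
        (go (⊔ʳ {M} {N} p) (⊔ˡ {M} {N} p))
    where
      go : ∀ {n} → N ℕ.≤ n → M ℕ.≤ n → g ℚ.* h ℚ.≤ seq x n ℚ.* seq y n
      go {n} p q = *-mono-≤ (ℚₚ.<⇒≤ 0<h) (ℚₚ.≤-trans (ℚₚ.<⇒≤ 0<g) g≤) g≤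
                     (≤l (ℚₚ.+-identityˡ h) (t n q))
        where g≤ : g ℚ.≤ seq x n
              g≤ = ≤l (ℚₚ.+-identityˡ g) (s n p)

  >0-+≥0 : ∀ {x y} → 0ᵣ <ᵣ x → (∀ n → 0ℚ ℚ.≤ seq y n) → 0ᵣ <ᵣ x +ᵣ y
  >0-+≥0 {x} {y} (mk< g 0<g N s) h = mk< g 0<g N λ n p →
    ≤l (ℚₚ.+-identityʳ (0ℚ ℚ.+ g)) (ℚₚ.+-mono-≤ (s n p) (h n))

  >0-factor : ∀ {x y} → (∀ n → 0ℚ ℚ.≤ seq y n) → 0ᵣ <ᵣ x *ᵣ y → 0ᵣ <ᵣ y
  >0-factor {x} {y} h (mk< g 0<g N s) with bounded (seq x) (cauchy x)
  ... | B , 0<B , M , b = mk< (g ℚ.* invℚ B) (*ε-pos 0<g (invℚ-pos 0<B)) (M ℕ.⊔ N) λ n p →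
      ≤l (sym (ℚₚ.+-identityˡ _))
        (ℚₚ.*-cancelˡ-≤-pos B {{ℚ.positive 0<B}}
          (≤l (sym (cancel-inv g 0<B))
            (ℚₚ.≤-trans (≤l (ℚₚ.+-identityˡ g) (s n (⊔ʳ {M} {N} p)))
              (*-monoʳ (seq y n) (h n) (ℚₚ.≤-trans (≤∣∣ _) (b n (⊔ˡ {M} {N} p)))))))

  >0-fromℚ : ∀ {q} → 0ℚ ℚ.< q → 0ᵣ <ᵣ fromℚ q
  >0-fromℚ {q} 0<q = mk< q 0<q 0 λ _ _ → ℚₚ.≤-reflexive (ℚₚ.+-identityˡ q)

  inv-cauchy : ∀ {x} → 0ᵣ <ᵣ x → IsCauchy (λ n → invℚ (seq x n))
  inv-cauchy {x} (mk< g 0<g N s) ε 0<ε = go (cauchy x _ (*ε-pos 0<ε (invℚ-pos 0<g²)))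
    where
      0<g² : 0ℚ ℚ.< invℚ g ℚ.* invℚ g
      0<g² = *ε-pos (invℚ-pos 0<g) (invℚ-pos 0<g)
      lo : ∀ n → N ℕ.≤ n → g ℚ.≤ seq x n
      lo n p = ≤l (ℚₚ.+-identityˡ g) (s n p)
      go : (∃ λ M → ∀ m n → M ℕ.≤ m → M ℕ.≤ n →
              ℚ.∣ seq x m ℚ.- seq x n ∣ ℚ.< ε ℚ.* invℚ (invℚ g ℚ.* invℚ g)) →
           ∃ λ M → ∀ m n → M ℕ.≤ m → M ℕ.≤ n → ℚ.∣ invℚ (seq x m) ℚ.- invℚ (seq x n) ∣ ℚ.< ε
      go (M , f) = M ℕ.⊔ N , λ m n p q →
        <r (cancel-inv ε 0<g²)
          (∣inv-inv∣ 0<g (lo m (⊔ʳ {M} {N} p)) (lo n (⊔ʳ {M} {N} q)) (f m n (⊔ˡ {M} {N} p) (⊔ˡ {M} {N} q)))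

invᵣ : (x : ℝ) → 0ᵣ <ᵣ x → ℝ
invᵣ x 0<x = mkℝ (λ n → invℚ (seq x n)) (inv-cauchy {x} 0<x)

opaque

  invᵣ-inverse : ∀ x (0<x : 0ᵣ <ᵣ x) → x *ᵣ invᵣ x 0<x ≈ᵣ 1ᵣ
  invᵣ-inverse x (mk< g 0<g N s) = mk≈ λ ε 0<ε → N , λ n p →
      <l (sym (trans (cong (λ t → ℚ.∣ t ℚ.- 1ℚ ∣) (one n p)) (∣a-a∣ 1ℚ))) 0<ε
    where
      one : ∀ n → N ℕ.≤ n → seq x n ℚ.* invℚ (seq x n) ≡ 1ℚ
      one n p = invℚ-inverse (ℚₚ.<-≤-trans 0<g (≤l (ℚₚ.+-identityˡ g) (s n p)))

  invᵣ-pos : ∀ x (0<x : 0ᵣ <ᵣ x) → 0ᵣ <ᵣ invᵣ x 0<x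
  invᵣ-pos x (mk< g 0<g N s) with bounded (seq x) (cauchy x)
  ... | B , 0<B , M , b = mk< (invℚ B) (invℚ-pos 0<B) (M ℕ.⊔ N) λ n p →
      ≤l (sym (ℚₚ.+-identityˡ (invℚ B)))
        (invℚ-anti (ℚₚ.<-≤-trans 0<g (≤l (ℚₚ.+-identityˡ g) (s n (⊔ʳ {M} {N} p))))
          (ℚₚ.≤-trans (≤∣∣ _) (b n (⊔ˡ {M} {N} p))))

recip : ∀ n → .{{ℕ.NonZero n}} → ℚ
recip n = + 1 ℚ./ n

opaque

  natℚ : ℕ → ℚ
  natℚ n = mkℚ (+ n) 0 (coprime-sym (1-coprimeTo n))

  recip-suc : ∀ n → natℚ (suc n) ℚ.* recip (suc n) ≡ 1ℚ
  recip-suc n = trans (cong (natℚ (suc n) ℚ.*_) (ℚₚ.normalize-coprime (1-coprimeTo (suc n))))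
                      (ℚₚ.*-inverseʳ (natℚ (suc n)))

  <-natℚ : ∀ t → ∃ λ K → ∀ n → K ℕ.≤ n → t ℚ.< natℚ (suc n)
  <-natℚ t@(mkℚ i d _) = ℤ.∣ i ∣ , λ n K≤n → *<* (ℤₚ.≤-<-trans (step₁ i) (step₂ n K≤n))
    where
      step₁ : ∀ i → i ℤ.* + 1 ℤ.≤ + ℤ.∣ i ∣
      step₁ (+ n)    = ℤₚ.≤-reflexive (ℤₚ.*-identityʳ (+ n))
      step₁ -[1+ n ] = ℤ.-≤+
      step₂ : ∀ n → ℤ.∣ i ∣ ℕ.≤ n → + ℤ.∣ i ∣ ℤ.< + suc n ℤ.* + suc d
      step₂ n K≤n = ℤ.+<+ (ℕₚ.≤-trans (ℕ.s≤s K≤n) (ℕₚ.m≤m*n (suc n) (suc d)))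

  recip-* : ∀ m n .{{_ : ℕ.NonZero m}} .{{_ : ℕ.NonZero n}} .{{_ : ℕ.NonZero (m ℕ.* n)}} →
            recip (m ℕ.* n) ≡ recip m ℚ.* recip n
  recip-* (suc m) (suc n) = ℚₚ.toℚᵘ-injective (ℚᵘₚ.≃-trans (ℚₚ.toℚᵘ-fromℚᵘ (mkℚᵘ (+ 1) _))
      (ℚᵘₚ.≃-sym (ℚᵘₚ.≃-trans (ℚₚ.toℚᵘ-homo-* (recip (suc m)) (recip (suc n)))
        (ℚᵘₚ.≃-trans (ℚᵘₚ.*-cong (ℚₚ.toℚᵘ-fromℚᵘ (mkℚᵘ (+ 1) m)) (ℚₚ.toℚᵘ-fromℚᵘ (mkℚᵘ (+ 1) n)))
          (*≡* refl)))))

  ½recip : ∀ n → ½ ℚ.* recip (suc n) ℚ.≤ recip (suc (suc n))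
  ½recip n = ≤l (recip-* 2 (suc n)) (ℚₚ.toℚᵘ-cancel-≤ (ℚᵘₚ.≤-respˡ-≃
      (ℚᵘₚ.≃-sym (ℚₚ.toℚᵘ-fromℚᵘ (mkℚᵘ (+ 1) (n ℕ.+ suc (n ℕ.+ 0)))))
      (ℚᵘₚ.≤-respʳ-≃ (ℚᵘₚ.≃-sym (ℚₚ.toℚᵘ-fromℚᵘ (mkℚᵘ (+ 1) (suc n))))
        (ℚᵘ.*≤* (ℤₚ.*-monoˡ-≤-nonNeg (+ 1) (ℤ.+≤+ (ℕ.s≤s
          (ℕₚ.≤-trans (ℕₚ.m≤n+m (suc n) n)
            (ℕₚ.≤-reflexive (cong (λ t → n ℕ.+ suc t) (sym (ℕₚ.+-identityʳ n))))))))))))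

  recip-pos : ∀ n .{{_ : ℕ.NonZero n}} → 0ℚ ℚ.< recip n
  recip-pos n = ℚₚ.positive⁻¹ (recip n) {{ℚₚ.normalize-pos 1 n}}

opaque

  arch : ∀ q ε → 0ℚ ℚ.< ε → ∃ λ K → ∀ n → K ℕ.≤ n → q ℚ.* recip (suc n) ℚ.< ε
  arch q ε 0<ε = proj₁ K , λ n K≤n →
      <l (cong (ℚ._* recip (suc n)) (cancel-inv q 0<ε))
        (<r (trans (ℚₚ.*-assoc ε (natℚ (suc n)) (recip (suc n)))
                   (trans (cong (ε ℚ.*_) (recip-suc n)) (ℚₚ.*-identityʳ ε)))
          (ℚₚ.*-monoˡ-<-pos (recip (suc n)) {{ℚ.positive (recip-pos (suc n))}}
            (ℚₚ.*-monoʳ-<-pos ε {{ℚ.positive 0<ε}} (proj₂ K n K≤n))))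
    where K : ∃ λ K → ∀ n → K ℕ.≤ n → q ℚ.* invℚ ε ℚ.< natℚ (suc n)
          K = <-natℚ (q ℚ.* invℚ ε)

-- √13 is the limit of Newton's iteration x ↦ (x + 13/x)/2 started at 4.
newton : ℚ → ℚ
newton x = ½ ℚ.* (x ℚ.+ (+ 13 ℚ./ 1) ℚ.* invℚ x)

√13seq : ℕ → ℚ
√13seq zero    = + 4 ℚ./ 1
√13seq (suc n) = newton (√13seq n)

13ℚ 3ℚ : ℚ
13ℚ = + 13 ℚ./ 1
3ℚ  = + 3 ℚ./ 1

err : ℚ → ℚ
err x = x ℚ.* x ℚ.- 13ℚ

record Newton (x e : ℚ) : Set where
  field
    1≤x   : 1ℚ ℚ.≤ x
    0≤err : 0ℚ ℚ.≤ err x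
    err≤  : err x ℚ.≤ e

opaque

  newton-step : ∀ {x e} → Newton x e → Newton (newton x) (½ ℚ.* e)
  newton-step {x} {e} N = record { 1≤x = 1≤x' ; 0≤err = 0≤err' ; err≤ = err≤' }
    where
      open Newton N
      open +-*-Solver
      i x' : ℚ
      i = invℚ x
      x' = newton x
      0<x : 0ℚ ℚ.< x
      0<x = ℚₚ.<-≤-trans 0<1 1≤x
      xi : x ℚ.* i ≡ 1ℚ
      xi = invℚ-inverse 0<x
      0<i : 0ℚ ℚ.< i
      0<i = invℚ-pos 0<x
      w : ℚ
      w = ½ ℚ.* (x ℚ.- 13ℚ ℚ.* i)
      lem : ∀ x i → err (½ ℚ.* (x ℚ.+ 13ℚ ℚ.* i))
          ≡ (½ ℚ.* (x ℚ.- 13ℚ ℚ.* i)) ℚ.* (½ ℚ.* (x ℚ.- 13ℚ ℚ.* i)) ℚ.+ 13ℚ ℚ.* (x ℚ.* i ℚ.- 1ℚ)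
      lem = solve 2 (λ x i → (con ½ :* (x :+ con 13ℚ :* i)) :* (con ½ :* (x :+ con 13ℚ :* i)) :- con 13ℚ
          := (con ½ :* (x :- con 13ℚ :* i)) :* (con ½ :* (x :- con 13ℚ :* i))
             :+ con 13ℚ :* (x :* i :- con 1ℚ)) refl
      lem₁ : ∀ w → w ℚ.+ 13ℚ ℚ.* (1ℚ ℚ.- 1ℚ) ≡ w
      lem₁ = solve 1 (λ w → w :+ con 13ℚ :* (con 1ℚ :- con 1ℚ) := w) refl
      err-eq : err x' ≡ w ℚ.* w
      err-eq = trans (lem x i) (trans (cong (λ t → w ℚ.* w ℚ.+ 13ℚ ℚ.* (t ℚ.- 1ℚ)) xi) (lem₁ (w ℚ.* w)))
      0≤err' : 0ℚ ℚ.≤ err x'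
      0≤err' = ≤r (sym err-eq) (0≤a² w)
      -- modulo x i = 1 this says w² + rest = ½ err x, with rest ≥ 0
      lem₂ : ∀ x i → (½ ℚ.* (x ℚ.- 13ℚ ℚ.* i)) ℚ.* (½ ℚ.* (x ℚ.- 13ℚ ℚ.* i))
               ℚ.+ (½ ℚ.* ½) ℚ.* ((x ℚ.* x ℚ.- 13ℚ) ℚ.+ 13ℚ ℚ.* ((x ℚ.* x ℚ.- 13ℚ) ℚ.* (i ℚ.* i)))
             ≡ ½ ℚ.* (x ℚ.* x ℚ.- 13ℚ)
               ℚ.+ 13ℚ ℚ.* ((½ ℚ.* ½) ℚ.* ((x ℚ.* i) ℚ.* (x ℚ.* i) ℚ.+ 1ℚ) ℚ.- ½ ℚ.* (x ℚ.* i))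
      lem₂ = solve 2 (λ x i → (con ½ :* (x :- con 13ℚ :* i)) :* (con ½ :* (x :- con 13ℚ :* i))
               :+ (con ½ :* con ½) :* ((x :* x :- con 13ℚ) :+ con 13ℚ :* ((x :* x :- con 13ℚ) :* (i :* i)))
             := con ½ :* (x :* x :- con 13ℚ)
               :+ con 13ℚ :* ((con ½ :* con ½) :* ((x :* i) :* (x :* i) :+ con 1ℚ) :- con ½ :* (x :* i))) refl
      lem₃ : ∀ w → w ℚ.+ 13ℚ ℚ.* ((½ ℚ.* ½) ℚ.* (1ℚ ℚ.* 1ℚ ℚ.+ 1ℚ) ℚ.- ½ ℚ.* 1ℚ) ≡ w
      lem₃ = solve 1 (λ w → w :+ con 13ℚ :* ((con ½ :* con ½) :* (con 1ℚ :* con 1ℚ :+ con 1ℚ) :- con ½ :* con 1ℚ) := w) refl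
      rest : ℚ
      rest = (½ ℚ.* ½) ℚ.* (err x ℚ.+ 13ℚ ℚ.* (err x ℚ.* (i ℚ.* i)))
      0≤rest : 0ℚ ℚ.≤ rest
      0≤rest = 0≤* (ℚₚ.nonNegative⁻¹ (½ ℚ.* ½))
        (0≤+ 0≤err (0≤* (ℚₚ.nonNegative⁻¹ 13ℚ) (0≤* 0≤err (0≤a² i))))
      w²≤ : w ℚ.* w ℚ.≤ ½ ℚ.* err x
      w²≤ = ≤l (ℚₚ.+-identityʳ (w ℚ.* w)) (≤r (trans (lem₂ x i)
              (trans (cong (λ t → ½ ℚ.* err x ℚ.+ 13ℚ ℚ.* ((½ ℚ.* ½) ℚ.* (t ℚ.* t ℚ.+ 1ℚ) ℚ.- ½ ℚ.* t)) xi)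
                     (lem₃ (½ ℚ.* err x))))
              (ℚₚ.+-monoʳ-≤ (w ℚ.* w) 0≤rest))
      err≤' : err x' ℚ.≤ ½ ℚ.* e
      err≤' = ≤l (sym err-eq) (ℚₚ.≤-trans w²≤ (*-monoˡ ½ (ℚₚ.<⇒≤ 0<½) err≤))
      0<x' : 0ℚ ℚ.< x'
      0<x' = *ε-pos 0<½ (+ε-pos 0<x (*ε-pos (ℚₚ.positive⁻¹ 13ℚ) 0<i))
      lem₄ : ∀ t → t ℚ.- 13ℚ ℚ.+ 13ℚ ≡ t
      lem₄ = solve 1 (λ t → t :- con 13ℚ :+ con 13ℚ := t) refl
      13≤x'² : 0ℚ ℚ.+ 13ℚ ℚ.≤ x' ℚ.* x'
      13≤x'² = ≤r (lem₄ (x' ℚ.* x')) (ℚₚ.+-monoˡ-≤ 13ℚ 0≤err')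
      1≤x' : 1ℚ ℚ.≤ x'
      1≤x' = ℚₚ.≮⇒≥ λ x'<1 → ℚₚ.<-irrefl refl (ℚₚ.≤-<-trans 13≤x'²
        (ℚₚ.<-trans (ℚₚ.*-monoʳ-<-pos x' {{ℚ.positive 0<x'}} x'<1)
          (<l (sym (ℚₚ.*-identityʳ x')) (ℚₚ.<-trans x'<1 (ℚₚ.<-≤-trans {1ℚ} {13ℚ} (*<* (ℤ.+<+ (ℕ.s≤s (ℕ.s≤s ℕ.z≤n))))
             (ℚₚ.≤-reflexive (sym (ℚₚ.+-identityˡ 13ℚ))))))))

  √13-newton : ∀ n → Newton (√13seq n) (3ℚ ℚ.* recip (suc n))
  √13-newton zero = record { 1≤x = *≤* (ℤ.+≤+ (ℕ.s≤s ℕ.z≤n))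
                           ; 0≤err = *≤* (ℤ.+≤+ ℕ.z≤n)
                           ; err≤ = ℚₚ.≤-refl }
  √13-newton (suc n) = record { 1≤x = 1≤x ; 0≤err = 0≤err ; err≤ = ℚₚ.≤-trans err≤
        (≤l (lem ½ 3ℚ (recip (suc n))) (*-monoˡ 3ℚ (ℚₚ.nonNegative⁻¹ 3ℚ) (½recip n))) }
    where
      open Newton (newton-step (√13-newton n))
      open +-*-Solver
      lem : ∀ a b c → b ℚ.* (a ℚ.* c) ≡ a ℚ.* (b ℚ.* c)
      lem = solve 3 (λ a b c → b :* (a :* c) := a :* (b :* c)) refl

  √13-err : ∀ ε → 0ℚ ℚ.< ε → ∃ λ K → ∀ n → K ℕ.≤ n → err (√13seq n) ℚ.< ε
  √13-err ε 0<ε = proj₁ A , λ n p → ℚₚ.≤-<-trans (Newton.err≤ (√13-newton n)) (proj₂ A n p)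
    where A : ∃ λ K → ∀ n → K ℕ.≤ n → 3ℚ ℚ.* recip (suc n) ℚ.< ε
          A = arch 3ℚ ε 0<ε

  ∣∣< : ∀ {a ε} → a ℚ.< ε → ℚ.- a ℚ.< ε → ℚ.∣ a ∣ ℚ.< ε
  ∣∣< {a} p q with ℚₚ.∣p∣≡p∨∣p∣≡-p a
  ... | inj₁ e = <l (sym e) p
  ... | inj₂ e = <l (sym e) q

  √13-cauchy : IsCauchy √13seq
  √13-cauchy ε 0<ε = proj₁ A , λ m n p q →
      go (√13seq m) (√13seq n) (Newton.1≤x (√13-newton m)) (Newton.1≤x (√13-newton n))
         (Newton.0≤err (√13-newton m)) (Newton.0≤err (√13-newton n)) (proj₂ A m p) (proj₂ A n q)
    where
      A : ∃ λ K → ∀ n → K ℕ.≤ n → err (√13seq n) ℚ.< ε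
      A = √13-err ε 0<ε
      open +-*-Solver
      lem : ∀ a b → (a ℚ.+ b) ℚ.* (a ℚ.- b) ≡ err a ℚ.- err b
      lem = solve 2 (λ a b → (a :+ b) :* (a :- b) := (a :* a :- con 13ℚ) :- (b :* b :- con 13ℚ)) refl
      sub< : ∀ {s t} → 0ℚ ℚ.≤ t → s ℚ.< ε → s ℚ.- t ℚ.< ε
      sub< {s} {t} 0≤t s<ε = ℚₚ.≤-<-trans (≤r (ℚₚ.+-identityʳ s) (ℚₚ.+-monoʳ-≤ s (ℚₚ.neg-antimono-≤ 0≤t))) s<ε
      neg : ∀ s t → t ℚ.- s ≡ ℚ.- (s ℚ.- t)
      neg = solve 2 (λ s t → t :- s := :- (s :- t)) refl
      go : ∀ a b → 1ℚ ℚ.≤ a → 1ℚ ℚ.≤ b → 0ℚ ℚ.≤ err a → 0ℚ ℚ.≤ err b →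
           err a ℚ.< ε → err b ℚ.< ε → ℚ.∣ a ℚ.- b ∣ ℚ.< ε
      go a b 1≤a 1≤b 0≤ea 0≤eb ea eb = ℚₚ.≤-<-trans
          (≤r (trans (cong (ℚ._* ℚ.∣ a ℚ.- b ∣) (sym (ℚₚ.0≤p⇒∣p∣≡p 0≤a+b)))
                (trans (sym (ℚₚ.∣p*q∣≡∣p∣*∣q∣ (a ℚ.+ b) (a ℚ.- b))) (cong ℚ.∣_∣ (lem a b))))
            (≤l (ℚₚ.*-identityˡ ℚ.∣ a ℚ.- b ∣) (*-monoʳ ℚ.∣ a ℚ.- b ∣ (ℚₚ.0≤∣p∣ (a ℚ.- b)) 1≤a+b)))
          (∣∣< (sub< 0≤eb ea) (<l (neg (err a) (err b)) (sub< 0≤ea eb)))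
        where
          0≤b : 0ℚ ℚ.≤ b
          0≤b = ℚₚ.≤-trans (ℚₚ.<⇒≤ 0<1) 1≤b
          0≤a+b : 0ℚ ℚ.≤ a ℚ.+ b
          0≤a+b = 0≤+ (ℚₚ.≤-trans (ℚₚ.<⇒≤ 0<1) 1≤a) 0≤b
          1≤a+b : 1ℚ ℚ.≤ a ℚ.+ b
          1≤a+b = ≤l (ℚₚ.+-identityʳ 1ℚ) (ℚₚ.+-mono-≤ 1≤a 0≤b)

√13 : ℝ
√13 = mkℝ √13seq √13-cauchy

opaque

  √13-pos : 0ᵣ <ᵣ √13
  √13-pos = mk< 1ℚ 0<1 0 λ n _ → ≤l (sym (ℚₚ.+-identityˡ 1ℚ)) (Newton.1≤x (√13-newton n))

  √13² : √13 *ᵣ √13 ≈ᵣ fromℕ 13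
  √13² = mk≈ λ ε 0<ε → proj₁ (√13-err ε 0<ε) , λ n p →
    <l (sym (ℚₚ.0≤p⇒∣p∣≡p (Newton.0≤err (√13-newton n)))) (proj₂ (√13-err ε 0<ε) n p)

ℝ-commutativeRing : CommutativeRing 0ℓ 0ℓ
ℝ-commutativeRing = record
  { Carrier = ℝ ; _≈_ = _≈ᵣ_ ; _+_ = _+ᵣ_ ; _*_ = _*ᵣ_ ; -_ = -ᵣ_ ; 0# = 0ᵣ ; 1# = 1ᵣ
  ; isCommutativeRing = record
    { isRing = record
      { +-isAbelianGroup = record
        { isGroup = record
          { isMonoid = record
            { isSemigroup = record
              { isMagma = record
                { isEquivalence = record { refl = ≈ᵣ-refl ; sym = ≈ᵣ-sym ; trans = ≈ᵣ-trans }
                ; ∙-cong = +ᵣ-cong }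
              ; assoc = λ x y z → ≡⇒≈ᵣ λ n → ℚₚ.+-assoc (seq x n) (seq y n) (seq z n) }
            ; identity = (λ x → ≡⇒≈ᵣ λ n → ℚₚ.+-identityˡ (seq x n))
                       , (λ x → ≡⇒≈ᵣ λ n → ℚₚ.+-identityʳ (seq x n)) }
          ; inverse = (λ x → ≡⇒≈ᵣ λ n → ℚₚ.+-inverseˡ (seq x n))
                    , (λ x → ≡⇒≈ᵣ λ n → ℚₚ.+-inverseʳ (seq x n))
          ; ⁻¹-cong = -ᵣ-cong }
        ; comm = λ x y → ≡⇒≈ᵣ λ n → ℚₚ.+-comm (seq x n) (seq y n) }
      ; *-cong = *ᵣ-cong
      ; *-assoc = λ x y z → ≡⇒≈ᵣ λ n → ℚₚ.*-assoc (seq x n) (seq y n) (seq z n)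
      ; *-identity = (λ x → ≡⇒≈ᵣ λ n → ℚₚ.*-identityˡ (seq x n))
                   , (λ x → ≡⇒≈ᵣ λ n → ℚₚ.*-identityʳ (seq x n))
      ; distrib = (λ x y z → ≡⇒≈ᵣ λ n → ℚₚ.*-distribˡ-+ (seq x n) (seq y n) (seq z n))
                , (λ x y z → ≡⇒≈ᵣ λ n → ℚₚ.*-distribʳ-+ (seq x n) (seq y n) (seq z n)) }
    ; *-comm = λ x y → ≡⇒≈ᵣ λ n → ℚₚ.*-comm (seq x n) (seq y n) } }

opaque

  recip< : ∀ ε → 0ℚ ℚ.< ε → ∃ λ K → ∀ n → K ℕ.≤ n → recip (suc n) ℚ.< ε
  recip< ε 0<ε = proj₁ A , λ n p → <l (ℚₚ.*-identityˡ (recip (suc n))) (proj₂ A n p)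
    where A : ∃ λ K → ∀ n → K ℕ.≤ n → 1ℚ ℚ.* recip (suc n) ℚ.< ε
          A = arch 1ℚ ε 0<ε

-- |x - y| < ε up to the usual slack at the boundary, which is immaterial below
-- because ε always ranges over all positive rationals.
Within : ℚ → ℝ → ℝ → Set
Within ε x y = ∃ λ N → ∀ n → N ℕ.≤ n → ℚ.∣ seq x n ℚ.- seq y n ∣ ℚ.< ε

IsCauchyᵣ : (ℕ → ℝ) → Set
IsCauchyᵣ X = ∀ ε → 0ℚ ℚ.< ε → ∃ λ N → ∀ m n → N ℕ.≤ m → N ℕ.≤ n → Within ε (X m) (X n)

module _ (X : ℕ → ℝ) where

  modulus : ∀ k → ∃ λ N → ∀ m n → N ℕ.≤ m → N ℕ.≤ n →
            ℚ.∣ seq (X k) m ℚ.- seq (X k) n ∣ ℚ.< recip (suc k)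
  modulus k = cauchy (X k) (recip (suc k)) (recip-pos (suc k))

  diagonal : ℕ → ℚ
  diagonal k = seq (X k) (proj₁ (modulus k))

  opaque

    diagonal-close : IsCauchyᵣ X → ∀ ε → 0ℚ ℚ.< ε →
      ∃ λ K → ∀ k → K ℕ.≤ k → ∃ λ I → ∀ i → I ℕ.≤ i → ℚ.∣ seq (X k) i ℚ.- diagonal i ∣ ℚ.< ε
    diagonal-close c ε 0<ε = proj₁ C ℕ.⊔ proj₁ R , near
      where
        δ : ℚ
        δ = ½ ℚ.* (½ ℚ.* ε)
        0<δ : 0ℚ ℚ.< δ
        0<δ = ½-pos (½-pos 0<ε)
        C : ∃ λ N → ∀ m n → N ℕ.≤ m → N ℕ.≤ n → Within δ (X m) (X n)
        C = c δ 0<δ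
        R : ∃ λ K → ∀ n → K ℕ.≤ n → recip (suc n) ℚ.< δ
        R = recip< δ 0<δ
        0<½ε : 0ℚ ℚ.< ½ ℚ.* ε
        0<½ε = ½-pos 0<ε
        near : ∀ k → proj₁ C ℕ.⊔ proj₁ R ℕ.≤ k → ∃ λ I → ∀ i → I ℕ.≤ i → ℚ.∣ seq (X k) i ℚ.- diagonal i ∣ ℚ.< ε
        near k p = I , λ i q → go i q (proj₂ C k i (⊔ˡ {proj₁ C} {proj₁ R} p)
                                        (ℕₚ.≤-trans (⊔ˡ {proj₁ C} {proj₁ R} p) (⊔ˡ {k} {J} q)))
          where
            D : ∃ λ N → ∀ m n → N ℕ.≤ m → N ℕ.≤ n → ℚ.∣ seq (X k) m ℚ.- seq (X k) n ∣ ℚ.< ½ ℚ.* ε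
            D = cauchy (X k) (½ ℚ.* ε) 0<½ε
            J I : ℕ
            J = proj₁ D
            I = k ℕ.⊔ J
            go : ∀ i → I ℕ.≤ i → Within δ (X k) (X i) → ℚ.∣ seq (X k) i ℚ.- diagonal i ∣ ℚ.< ε
            go i q (N , w) = tri½ (seq (X k) i) (seq (X k) j) (diagonal i)
                (proj₂ D i j (⊔ʳ {k} {J} q) (ℕₚ.≤-trans (⊔ʳ {k} {J} q) i≤j))
                (tri½ (seq (X k) j) (seq (X i) j) (diagonal i)
                  (w j N≤j)
                  (<l (∣-∣-comm (diagonal i) (seq (X i) j))
                    (ℚₚ.<-trans (proj₂ (modulus i) (proj₁ (modulus i)) j ℕₚ.≤-refl M≤j)
                      (proj₂ R i (ℕₚ.≤-trans (⊔ʳ {proj₁ C} {proj₁ R} p) (⊔ˡ {k} {J} q))))))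
              where
                j : ℕ
                j = i ℕ.⊔ (N ℕ.⊔ proj₁ (modulus i))
                i≤j : i ℕ.≤ j
                i≤j = ℕₚ.m≤m⊔n i _
                N≤j : N ℕ.≤ j
                N≤j = ⊔ˡ {N} {proj₁ (modulus i)} (⊔ʳ {i} {N ℕ.⊔ proj₁ (modulus i)} ℕₚ.≤-refl)
                M≤j : proj₁ (modulus i) ℕ.≤ j
                M≤j = ⊔ʳ {N} {proj₁ (modulus i)} (⊔ʳ {i} {N ℕ.⊔ proj₁ (modulus i)} ℕₚ.≤-refl)

    diagonal-cauchy : IsCauchyᵣ X → IsCauchy diagonal
    diagonal-cauchy c ε 0<ε = go (proj₂ A (proj₁ A) ℕₚ.≤-refl)
        (cauchy (X (proj₁ A)) (½ ℚ.* (½ ℚ.* ε)) 0<δ)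
      where
        0<δ : 0ℚ ℚ.< ½ ℚ.* (½ ℚ.* ε)
        0<δ = ½-pos (½-pos 0<ε)
        A : ∃ λ K → ∀ k → K ℕ.≤ k → ∃ λ I → ∀ i → I ℕ.≤ i →
              ℚ.∣ seq (X k) i ℚ.- diagonal i ∣ ℚ.< ½ ℚ.* (½ ℚ.* ε)
        A = diagonal-close c (½ ℚ.* (½ ℚ.* ε)) 0<δ
        go : (∃ λ I → ∀ i → I ℕ.≤ i → ℚ.∣ seq (X (proj₁ A)) i ℚ.- diagonal i ∣ ℚ.< ½ ℚ.* (½ ℚ.* ε)) →
             (∃ λ N → ∀ m n → N ℕ.≤ m → N ℕ.≤ n →
               ℚ.∣ seq (X (proj₁ A)) m ℚ.- seq (X (proj₁ A)) n ∣ ℚ.< ½ ℚ.* (½ ℚ.* ε)) →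
             ∃ λ N → ∀ m n → N ℕ.≤ m → N ℕ.≤ n → ℚ.∣ diagonal m ℚ.- diagonal n ∣ ℚ.< ε
        go (I , f) (N , g) = I ℕ.⊔ N , λ m n p q → tri½ (diagonal m) (seq x m) (diagonal n)
            (ℚₚ.<-trans (<l (∣-∣-comm (seq x m) (diagonal m)) (f m (⊔ˡ {I} {N} p))) δ<)
            (tri½ (seq x m) (seq x n) (diagonal n) (g m n (⊔ʳ {I} {N} p) (⊔ʳ {I} {N} q)) (f n (⊔ˡ {I} {N} q)))
          where
            x : ℝ
            x = X (proj₁ A)
            δ< : ½ ℚ.* (½ ℚ.* ε) ℚ.< ½ ℚ.* ε
            δ< = <l (ℚₚ.+-identityʳ _) (<r (½+½ (½ ℚ.* ε)) (ℚₚ.+-monoʳ-< (½ ℚ.* (½ ℚ.* ε)) 0<δ))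

  limᵣ : IsCauchyᵣ X → ℝ
  limᵣ c = mkℝ diagonal (diagonal-cauchy c)

  opaque
    limᵣ-converges : ∀ c ε → 0ℚ ℚ.< ε → ∃ λ K → ∀ k → K ℕ.≤ k → Within ε (X k) (limᵣ c)
    limᵣ-converges c = diagonal-close c

infix  4 _≈_
infixl 6 _+_ _-_
infixl 7 _*_
infix  8 -_

record ℂ : Set where
  constructor _+i_
  field
    re im : ℝ
open ℂ public

infix 5 _+i_

record _≈_ (z w : ℂ) : Set where
  constructor _,_
  field
    re≈ : re z ≈ᵣ re w
    im≈ : im z ≈ᵣ im w
open _≈_ public

_+_ _*_ : ℂ → ℂ → ℂ
z + w = (re z +ᵣ re w) +i (im z +ᵣ im w)
z * w = (re z *ᵣ re w -ᵣ im z *ᵣ im w) +i (re z *ᵣ im w +ᵣ im z *ᵣ re w)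

-_ : ℂ → ℂ
- z = (-ᵣ re z) +i (-ᵣ im z)

_-_ : ℂ → ℂ → ℂ
z - w = z + (- w)

ι : ℝ → ℂ
ι x = x +i 0ᵣ

0ᶜ 1ᶜ 𝕚 : ℂ
0ᶜ = ι 0ᵣ
1ᶜ = ι 1ᵣ
𝕚  = 0ᵣ +i 1ᵣ

∣_∣² : ℂ → ℝ
∣ z ∣² = re z *ᵣ re z +ᵣ im z *ᵣ im z

private
  module R = CommutativeRing ℝ-commutativeRing

opaque
  ℂ-*-assoc : ∀ z w v → (z * w) * v ≈ z * (w * v)
  ℂ-*-assoc (a +i b) (c +i d) (e +i f) =
      ≡⇒≈ᵣ (λ n → lem₁ (seq a n) (seq b n) (seq c n) (seq d n) (seq e n) (seq f n))
    , ≡⇒≈ᵣ (λ n → lem₂ (seq a n) (seq b n) (seq c n) (seq d n) (seq e n) (seq f n))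
    where
      open +-*-Solver
      lem₁ : ∀ a b c d e f → (a ℚ.* c ℚ.- b ℚ.* d) ℚ.* e ℚ.- (a ℚ.* d ℚ.+ b ℚ.* c) ℚ.* f
                           ≡ a ℚ.* (c ℚ.* e ℚ.- d ℚ.* f) ℚ.- b ℚ.* (c ℚ.* f ℚ.+ d ℚ.* e)
      lem₁ = solve 6 (λ a b c d e f → (a :* c :- b :* d) :* e :- (a :* d :+ b :* c) :* f
                                   := a :* (c :* e :- d :* f) :- b :* (c :* f :+ d :* e)) refl
      lem₂ : ∀ a b c d e f → (a ℚ.* c ℚ.- b ℚ.* d) ℚ.* f ℚ.+ (a ℚ.* d ℚ.+ b ℚ.* c) ℚ.* e
                           ≡ a ℚ.* (c ℚ.* f ℚ.+ d ℚ.* e) ℚ.+ b ℚ.* (c ℚ.* e ℚ.- d ℚ.* f)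
      lem₂ = solve 6 (λ a b c d e f → (a :* c :- b :* d) :* f :+ (a :* d :+ b :* c) :* e
                                   := a :* (c :* f :+ d :* e) :+ b :* (c :* e :- d :* f)) refl

  ℂ-*-comm : ∀ z w → z * w ≈ w * z
  ℂ-*-comm (a +i b) (c +i d) =
      ≡⇒≈ᵣ (λ n → lem₁ (seq a n) (seq b n) (seq c n) (seq d n))
    , ≡⇒≈ᵣ (λ n → lem₂ (seq a n) (seq b n) (seq c n) (seq d n))
    where
      open +-*-Solver
      lem₁ : ∀ a b c d → a ℚ.* c ℚ.- b ℚ.* d ≡ c ℚ.* a ℚ.- d ℚ.* b
      lem₁ = solve 4 (λ a b c d → a :* c :- b :* d := c :* a :- d :* b) refl
      lem₂ : ∀ a b c d → a ℚ.* d ℚ.+ b ℚ.* c ≡ c ℚ.* b ℚ.+ d ℚ.* a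
      lem₂ = solve 4 (λ a b c d → a :* d :+ b :* c := c :* b :+ d :* a) refl

  ℂ-*-identityˡ : ∀ z → 1ᶜ * z ≈ z
  ℂ-*-identityˡ (a +i b) = ≡⇒≈ᵣ (λ n → lem₁ (seq a n) (seq b n)) , ≡⇒≈ᵣ (λ n → lem₂ (seq a n) (seq b n))
    where
      open +-*-Solver
      lem₁ : ∀ a b → 1ℚ ℚ.* a ℚ.- 0ℚ ℚ.* b ≡ a
      lem₁ = solve 2 (λ a b → con 1ℚ :* a :- con 0ℚ :* b := a) refl
      lem₂ : ∀ a b → 1ℚ ℚ.* b ℚ.+ 0ℚ ℚ.* a ≡ b
      lem₂ = solve 2 (λ a b → con 1ℚ :* b :+ con 0ℚ :* a := b) refl

  ℂ-distribˡ : ∀ z w v → z * (w + v) ≈ z * w + z * v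
  ℂ-distribˡ (a +i b) (c +i d) (e +i f) =
      ≡⇒≈ᵣ (λ n → lem₁ (seq a n) (seq b n) (seq c n) (seq d n) (seq e n) (seq f n))
    , ≡⇒≈ᵣ (λ n → lem₂ (seq a n) (seq b n) (seq c n) (seq d n) (seq e n) (seq f n))
    where
      open +-*-Solver
      lem₁ : ∀ a b c d e f → a ℚ.* (c ℚ.+ e) ℚ.- b ℚ.* (d ℚ.+ f) ≡ (a ℚ.* c ℚ.- b ℚ.* d) ℚ.+ (a ℚ.* e ℚ.- b ℚ.* f)
      lem₁ = solve 6 (λ a b c d e f → a :* (c :+ e) :- b :* (d :+ f) := (a :* c :- b :* d) :+ (a :* e :- b :* f)) refl
      lem₂ : ∀ a b c d e f → a ℚ.* (d ℚ.+ f) ℚ.+ b ℚ.* (c ℚ.+ e) ≡ (a ℚ.* d ℚ.+ b ℚ.* c) ℚ.+ (a ℚ.* f ℚ.+ b ℚ.* e)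
      lem₂ = solve 6 (λ a b c d e f → a :* (d :+ f) :+ b :* (c :+ e) := (a :* d :+ b :* c) :+ (a :* f :+ b :* e)) refl

  ℂ-*-cong : ∀ {z w u v} → z ≈ w → u ≈ v → z * u ≈ w * v
  ℂ-*-cong (p , q) (r , s) = R.+-cong (R.*-cong p r) (R.-‿cong (R.*-cong q s)) , R.+-cong (R.*-cong p s) (R.*-cong q r)

  ≈-refl : ∀ {z} → z ≈ z
  ≈-refl = R.refl , R.refl

  ≈-sym : ∀ {z w} → z ≈ w → w ≈ z
  ≈-sym (p , q) = R.sym p , R.sym q

  ≈-trans : ∀ {z w v} → z ≈ w → w ≈ v → z ≈ v
  ≈-trans (p , q) (r , s) = R.trans p r , R.trans q s

  ℂ-+-cong : ∀ {z w u v} → z ≈ w → u ≈ v → z + u ≈ w + v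
  ℂ-+-cong (p , q) (r , s) = R.+-cong p r , R.+-cong q s

ℂ-commutativeRing : CommutativeRing 0ℓ 0ℓ
ℂ-commutativeRing = record
  { Carrier = ℂ ; _≈_ = _≈_ ; _+_ = _+_ ; _*_ = _*_ ; -_ = -_ ; 0# = 0ᶜ ; 1# = 1ᶜ
  ; isCommutativeRing = record
    { isRing = record
      { +-isAbelianGroup = record
        { isGroup = record
          { isMonoid = record
            { isSemigroup = record
              { isMagma = record
                { isEquivalence = record { refl = ≈-refl ; sym = ≈-sym ; trans = ≈-trans }
                ; ∙-cong = ℂ-+-cong }
              ; assoc = λ x y z → R.+-assoc (re x) (re y) (re z) , R.+-assoc (im x) (im y) (im z) }
            ; identity = (λ x → R.+-identityˡ (re x) , R.+-identityˡ (im x))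
                       , (λ x → R.+-identityʳ (re x) , R.+-identityʳ (im x)) }
          ; inverse = (λ x → R.-‿inverseˡ (re x) , R.-‿inverseˡ (im x))
                    , (λ x → R.-‿inverseʳ (re x) , R.-‿inverseʳ (im x))
          ; ⁻¹-cong = λ p → R.-‿cong (re≈ p) , R.-‿cong (im≈ p) }
        ; comm = λ x y → R.+-comm (re x) (re y) , R.+-comm (im x) (im y) }
      ; *-cong = ℂ-*-cong
      ; *-assoc = ℂ-*-assoc
      ; *-identity = ℂ-*-identityˡ , (λ x → ≈-trans (ℂ-*-comm x 1ᶜ) (ℂ-*-identityˡ x))
      ; distrib = ℂ-distribˡ , (λ x y z → ≈-trans (ℂ-*-comm (y + z) x)
          (≈-trans (ℂ-distribˡ x y z) (ℂ-+-cong (ℂ-*-comm x y) (ℂ-*-comm x z)))) }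
    ; *-comm = ℂ-*-comm } }

open Algebra.Definitions.RawSemiring
  (CommutativeSemiring.rawSemiring (CommutativeRing.commutativeSemiring ℂ-commutativeRing)) public
  using (_^_)

-- Distances in ℂ are compared through their squares, so that no square root is needed:
-- |s n - l|² < ε² with ε > 0 means |s n - l| < ε.
_⟶_ : (ℕ → ℂ) → ℂ → Set
s ⟶ l = ∀ ε → 0ᵣ <ᵣ ε → ∃ λ N → ∀ n → N ℕ.≤ n → ∣ s n - l ∣² <ᵣ ε *ᵣ ε

partialSum : (ℕ → ℂ) → ℕ → ℂ
partialSum s zero    = 0ᶜ
partialSum s (suc n) = partialSum s n + s n

HasSum : (ℕ → ℂ) → ℂ → Set
HasSum s l = partialSum s ⟶ l

expTerm : ℂ → ℕ → ℂ
expTerm z n = ι (fromℚ (recip (n !) {{n ℕₚ.!≢0}})) * z ^ n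

-- The ℓ¹-norm of the i-th rational approximation, which is submultiplicative.
n₁ : ℂ → ℕ → ℚ
n₁ z i = ℚ.∣ seq (re z) i ∣ ℚ.+ ℚ.∣ seq (im z) i ∣

opaque

  0≤n₁ : ∀ z i → 0ℚ ℚ.≤ n₁ z i
  0≤n₁ z i = 0≤+ (ℚₚ.0≤∣p∣ (seq (re z) i)) (ℚₚ.0≤∣p∣ (seq (im z) i))

  n₁-* : ∀ z w i → n₁ (z * w) i ℚ.≤ n₁ z i ℚ.* n₁ w i
  n₁-* z w i = go (seq (re z) i) (seq (im z) i) (seq (re w) i) (seq (im w) i)
    where
      open +-*-Solver
      lem : ∀ a b c d → (a ℚ.* c ℚ.+ b ℚ.* d) ℚ.+ (a ℚ.* d ℚ.+ b ℚ.* c) ≡ (a ℚ.+ b) ℚ.* (c ℚ.+ d)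
      lem = solve 4 (λ a b c d → (a :* c :+ b :* d) :+ (a :* d :+ b :* c) := (a :+ b) :* (c :+ d)) refl
      go : ∀ a b c d → ℚ.∣ a ℚ.* c ℚ.- b ℚ.* d ∣ ℚ.+ ℚ.∣ a ℚ.* d ℚ.+ b ℚ.* c ∣
                 ℚ.≤ (ℚ.∣ a ∣ ℚ.+ ℚ.∣ b ∣) ℚ.* (ℚ.∣ c ∣ ℚ.+ ℚ.∣ d ∣)
      go a b c d = ≤r (trans (cong₂ ℚ._+_
            (cong₂ ℚ._+_ (ℚₚ.∣p*q∣≡∣p∣*∣q∣ a c) (ℚₚ.∣p*q∣≡∣p∣*∣q∣ b d))
            (cong₂ ℚ._+_ (ℚₚ.∣p*q∣≡∣p∣*∣q∣ a d) (ℚₚ.∣p*q∣≡∣p∣*∣q∣ b c)))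
            (lem ℚ.∣ a ∣ ℚ.∣ b ∣ ℚ.∣ c ∣ ℚ.∣ d ∣))
          (ℚₚ.+-mono-≤ (ℚₚ.∣p-q∣≤∣p∣+∣q∣ (a ℚ.* c) (b ℚ.* d)) (ℚₚ.∣p+q∣≤∣p∣+∣q∣ (a ℚ.* d) (b ℚ.* c)))

module ExpConvergence (z : ℂ) where

  S : ℕ → ℂ
  S = partialSum (expTerm z)

  r : ℕ → ℚ
  r n = recip (n !) {{n ℕₚ.!≢0}}

  bnd : ℚ → ℕ → ℚ
  bnd q zero    = 1ℚ
  bnd q (suc n) = q ℚ.* bnd q n

  b : ℚ → ℕ → ℚ
  b q n = r n ℚ.* bnd q n

  dist : ℕ → ℕ → ℕ → ℚ
  dist m n i = ℚ.∣ seq (re (S n)) i ℚ.- seq (re (S m)) i ∣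
         ℚ.+ ℚ.∣ seq (im (S n)) i ℚ.- seq (im (S m)) i ∣

  opaque

    r-pos : ∀ n → 0ℚ ℚ.< r n
    r-pos n = recip-pos (n !) {{n ℕₚ.!≢0}}

    bnd-nonneg : ∀ {q} → 0ℚ ℚ.≤ q → ∀ n → 0ℚ ℚ.≤ bnd q n
    bnd-nonneg 0≤q zero    = ℚₚ.<⇒≤ 0<1
    bnd-nonneg 0≤q (suc n) = 0≤* 0≤q (bnd-nonneg 0≤q n)

    b-nonneg : ∀ {q} → 0ℚ ℚ.≤ q → ∀ n → 0ℚ ℚ.≤ b q n
    b-nonneg 0≤q n = 0≤* (ℚₚ.<⇒≤ (r-pos n)) (bnd-nonneg 0≤q n)

    n₁-^ : ∀ {q i} → 0ℚ ℚ.≤ q → n₁ z i ℚ.≤ q → ∀ n → n₁ (z ^ n) i ℚ.≤ bnd q n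
    n₁-^ 0≤q h zero    = ℚₚ.≤-refl
    n₁-^ {q} {i} 0≤q h (suc n) = ℚₚ.≤-trans (n₁-* z (z ^ n) i)
      (*-mono-≤ (0≤n₁ (z ^ n) i) 0≤q h (n₁-^ 0≤q h n))

    n₁-term : ∀ {q i} → 0ℚ ℚ.≤ q → n₁ z i ℚ.≤ q → ∀ n → n₁ (expTerm z n) i ℚ.≤ b q n
    n₁-term {q} {i} 0≤q h n = ℚₚ.≤-trans (n₁-* (ι (fromℚ (r n))) (z ^ n) i)
      (*-mono-≤ (0≤n₁ (z ^ n) i) (ℚₚ.<⇒≤ (r-pos n))
        (ℚₚ.≤-reflexive (trans (ℚₚ.+-identityʳ _) (ℚₚ.0≤p⇒∣p∣≡p (ℚₚ.<⇒≤ (r-pos n)))))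
        (n₁-^ 0≤q h n))

    b-suc : ∀ {q} n → b q (suc n) ≡ (q ℚ.* recip (suc n)) ℚ.* b q n
    b-suc {q} n = trans (cong (ℚ._* (q ℚ.* bnd q n))
        (recip-* (suc n) (n !) {{_}} {{n ℕₚ.!≢0}} {{suc n ℕₚ.!≢0}}))
        (lem (recip (suc n)) (r n) q (bnd q n))
      where
        open +-*-Solver
        lem : ∀ s r q b → (s ℚ.* r) ℚ.* (q ℚ.* b) ≡ (q ℚ.* s) ℚ.* (r ℚ.* b)
        lem = solve 4 (λ s r q b → (s :* r) :* (q :* b) := (q :* s) :* (r :* b)) refl

    b-half : ∀ {q} → 0ℚ ℚ.≤ q → ∃ λ K → ∀ n → K ℕ.≤ n → b q (suc n) ℚ.≤ ½ ℚ.* b q n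
    b-half {q} 0≤q = proj₁ A , λ n p → ≤l (sym (b-suc {q} n))
        (*-monoʳ (b q n) (b-nonneg 0≤q n) (ℚₚ.<⇒≤ (proj₂ A n p)))
      where A : ∃ λ K → ∀ n → K ℕ.≤ n → q ℚ.* recip (suc n) ℚ.< ½
            A = arch q ½ 0<½

    b-decay : ∀ {q} (0≤q : 0ℚ ℚ.≤ q) t →
              b q (proj₁ (b-half 0≤q) ℕ.+ t) ℚ.≤ b q (proj₁ (b-half 0≤q)) ℚ.* recip (suc t)
    b-decay {q} 0≤q zero = ≤l (cong (b q) (sym (ℕₚ.+-identityʳ K)))
        (ℚₚ.≤-reflexive (sym (ℚₚ.*-identityʳ (b q K))))
      where K : ℕ
            K = proj₁ (b-half 0≤q)
    b-decay {q} 0≤q (suc t) = ≤l (cong (b q) (sym (ℕₚ.+-suc K t)))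
        (ℚₚ.≤-trans (proj₂ (b-half 0≤q) (K ℕ.+ t) (ℕₚ.m≤m+n K t))
          (ℚₚ.≤-trans (*-monoˡ ½ (ℚₚ.<⇒≤ 0<½) (b-decay 0≤q t))
            (≤l (lem ½ (b q K) (recip (suc t))) (*-monoˡ (b q K) (b-nonneg 0≤q K) (½recip t)))))
      where
        K : ℕ
        K = proj₁ (b-half 0≤q)
        open +-*-Solver
        lem : ∀ a b c → b ℚ.* (a ℚ.* c) ≡ a ℚ.* (b ℚ.* c)
        lem = solve 3 (λ a b c → b :* (a :* c) := a :* (b :* c)) refl

    dist-refl : ∀ m i → dist m m i ≡ 0ℚ
    dist-refl m i = cong₂ ℚ._+_ (∣a-a∣ (seq (re (S m)) i)) (∣a-a∣ (seq (im (S m)) i))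

    dist-suc : ∀ m n i → dist m (suc n) i ℚ.≤ dist m n i ℚ.+ n₁ (expTerm z n) i
    dist-suc m n i = ≤r (lem ℚ.∣ x ℚ.- x' ∣ ℚ.∣ s ∣ ℚ.∣ y ℚ.- y' ∣ ℚ.∣ t ∣)
                        (ℚₚ.+-mono-≤ (one x s x') (one y t y'))
      where
        x x' y y' s t : ℚ
        x  = seq (re (S n)) i
        x' = seq (re (S m)) i
        y  = seq (im (S n)) i
        y' = seq (im (S m)) i
        s  = seq (re (expTerm z n)) i
        t  = seq (im (expTerm z n)) i
        open +-*-Solver
        lem : ∀ a b c d → (a ℚ.+ b) ℚ.+ (c ℚ.+ d) ≡ (a ℚ.+ c) ℚ.+ (b ℚ.+ d)
        lem = solve 4 (λ a b c d → (a :+ b) :+ (c :+ d) := (a :+ c) :+ (b :+ d)) refl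
        lem' : ∀ x s x' → (x ℚ.- x') ℚ.+ s ≡ (x ℚ.+ s) ℚ.- x'
        lem' = solve 3 (λ x s x' → (x :- x') :+ s := (x :+ s) :- x') refl
        one : ∀ x s x' → ℚ.∣ (x ℚ.+ s) ℚ.- x' ∣ ℚ.≤ ℚ.∣ x ℚ.- x' ∣ ℚ.+ ℚ.∣ s ∣
        one x s x' = ≤l (cong ℚ.∣_∣ (lem' x s x')) (ℚₚ.∣p+q∣≤∣p∣+∣q∣ (x ℚ.- x') s)

    dist-bound : ∀ {q i} (0≤q : 0ℚ ℚ.≤ q) → n₁ z i ℚ.≤ q → ∀ m → proj₁ (b-half 0≤q) ℕ.≤ m → ∀ t →
                 dist m (m ℕ.+ t) i ℚ.+ (b q (m ℕ.+ t) ℚ.+ b q (m ℕ.+ t)) ℚ.≤ b q m ℚ.+ b q m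
    dist-bound {q} {i} 0≤q h m K≤m zero = ℚₚ.≤-reflexive
      (trans (cong (λ n → dist m n i ℚ.+ (b q n ℚ.+ b q n)) (ℕₚ.+-identityʳ m))
        (trans (cong (ℚ._+ (b q m ℚ.+ b q m)) (dist-refl m i)) (ℚₚ.+-identityˡ (b q m ℚ.+ b q m))))
    dist-bound {q} {i} 0≤q h m K≤m (suc t) =
      ≤l (cong (λ n → dist m n i ℚ.+ (b q n ℚ.+ b q n)) (sym (ℕₚ.+-suc m t)))
        (ℚₚ.≤-trans (ℚₚ.+-mono-≤
            (ℚₚ.≤-trans (dist-suc m n i) (ℚₚ.+-monoʳ-≤ (dist m n i) (n₁-term 0≤q h n)))
            (≤r (½+½ (b q n)) (ℚₚ.+-mono-≤ hb hb)))
          (≤l (sym (ℚₚ.+-assoc (dist m n i) (b q n) (b q n))) (dist-bound 0≤q h m K≤m t)))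
      where
        n : ℕ
        n = m ℕ.+ t
        hb : b q (suc n) ℚ.≤ ½ ℚ.* b q n
        hb = proj₂ (b-half 0≤q) n (ℕₚ.≤-trans K≤m (ℕₚ.m≤m+n m t))

    z-bound : ∃ λ q → 0ℚ ℚ.≤ q × ∃ λ I → ∀ i → I ℕ.≤ i → n₁ z i ℚ.≤ q
    z-bound = go (bounded (seq (re z)) (cauchy (re z))) (bounded (seq (im z)) (cauchy (im z)))
      where
        Bd : (ℕ → ℚ) → Set
        Bd x = ∃ λ B → 0ℚ ℚ.< B × ∃ λ N → ∀ n → N ℕ.≤ n → ℚ.∣ x n ∣ ℚ.≤ B
        go : Bd (seq (re z)) → Bd (seq (im z)) → ∃ λ q → 0ℚ ℚ.≤ q × ∃ λ I → ∀ i → I ℕ.≤ i → n₁ z i ℚ.≤ q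
        go (B , 0<B , M , f) (C , 0<C , N , g) = B ℚ.+ C , ℚₚ.<⇒≤ (+ε-pos 0<B 0<C) , M ℕ.⊔ N ,
          λ i p → ℚₚ.+-mono-≤ (f i (⊔ˡ {M} {N} p)) (g i (⊔ʳ {M} {N} p))

    dist-small : ∀ ε → 0ℚ ℚ.< ε → ∃ λ N → ∃ λ I → ∀ m t i → N ℕ.≤ m → I ℕ.≤ i → dist m (m ℕ.+ t) i ℚ.< ε
    dist-small ε 0<ε = K ℕ.+ proj₁ A , I , λ m t i p i≥ →
        ℚₚ.≤-<-trans (≤l (ℚₚ.+-identityʳ (dist m (m ℕ.+ t) i))
            (ℚₚ.≤-trans (ℚₚ.+-monoʳ-≤ (dist m (m ℕ.+ t) i) (0≤+ (b-nonneg 0≤q (m ℕ.+ t)) (b-nonneg 0≤q (m ℕ.+ t))))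
              (dist-bound 0≤q (h i i≥) m (ℕₚ.≤-trans (ℕₚ.m≤m+n K (proj₁ A)) p) t)))
          (small m p)
      where
        q : ℚ
        q = proj₁ z-bound
        0≤q : 0ℚ ℚ.≤ q
        0≤q = proj₁ (proj₂ z-bound)
        I : ℕ
        I = proj₁ (proj₂ (proj₂ z-bound))
        h : ∀ i → I ℕ.≤ i → n₁ z i ℚ.≤ q
        h = proj₂ (proj₂ (proj₂ z-bound))
        K : ℕ
        K = proj₁ (b-half 0≤q)
        c : ℚ
        c = b q K ℚ.+ b q K
        A : ∃ λ N → ∀ n → N ℕ.≤ n → c ℚ.* recip (suc n) ℚ.< ε
        A = arch c ε 0<ε
        small' : ∀ t → proj₁ A ℕ.≤ t → b q (K ℕ.+ t) ℚ.+ b q (K ℕ.+ t) ℚ.< ε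
        small' t p = ℚₚ.≤-<-trans
          (≤r (sym (ℚₚ.*-distribʳ-+ (recip (suc t)) (b q K) (b q K)))
            (ℚₚ.+-mono-≤ (b-decay 0≤q t) (b-decay 0≤q t)))
          (proj₂ A t p)
        small : ∀ m → K ℕ.+ proj₁ A ℕ.≤ m → b q m ℚ.+ b q m ℚ.< ε
        small m p = <l (cong (λ n → b q n ℚ.+ b q n) (ℕₚ.m+[n∸m]≡n (ℕₚ.≤-trans (ℕₚ.m≤m+n K (proj₁ A)) p)))
          (small' (m ℕ.∸ K) (ℕₚ.≤-trans (ℕₚ.≤-reflexive (sym (ℕₚ.m+n∸m≡n K (proj₁ A)))) (ℕₚ.∸-monoˡ-≤ K p)))

    pair-small : ∀ ε → 0ℚ ℚ.< ε → ∃ λ N → ∀ m n → N ℕ.≤ m → N ℕ.≤ n →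
                 Within ε (re (S m)) (re (S n)) × Within ε (im (S m)) (im (S n))
    pair-small ε 0<ε = N , λ m n p q → by m n p q (ℕₚ.≤-total m n)
      where
        D : ∃ λ N → ∃ λ I → ∀ m t i → N ℕ.≤ m → I ℕ.≤ i → dist m (m ℕ.+ t) i ℚ.< ε
        D = dist-small ε 0<ε
        N I : ℕ
        N = proj₁ D
        I = proj₁ (proj₂ D)
        up : ∀ m n → N ℕ.≤ m → m ℕ.≤ n → ∀ i → I ℕ.≤ i →
             ℚ.∣ seq (re (S n)) i ℚ.- seq (re (S m)) i ∣ ℚ.< ε × ℚ.∣ seq (im (S n)) i ℚ.- seq (im (S m)) i ∣ ℚ.< ε
        up m n p q i r = ℚₚ.≤-<-trans (≤l (ℚₚ.+-identityʳ u) (ℚₚ.+-monoʳ-≤ u (ℚₚ.0≤∣p∣ v'))) d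
                       , ℚₚ.≤-<-trans (≤l (ℚₚ.+-identityˡ v) (ℚₚ.+-monoˡ-≤ v (ℚₚ.0≤∣p∣ u'))) d
          where
            u u' v v' : ℚ
            u' = seq (re (S n)) i ℚ.- seq (re (S m)) i
            v' = seq (im (S n)) i ℚ.- seq (im (S m)) i
            u = ℚ.∣ u' ∣
            v = ℚ.∣ v' ∣
            d : dist m n i ℚ.< ε
            d = <l (cong (λ k → dist m k i) (ℕₚ.m+[n∸m]≡n q)) (proj₂ (proj₂ D) m (n ℕ.∸ m) i p r)
        by : ∀ m n → N ℕ.≤ m → N ℕ.≤ n → m ℕ.≤ n ⊎ n ℕ.≤ m →
             Within ε (re (S m)) (re (S n)) × Within ε (im (S m)) (im (S n))
        by m n p q (inj₁ m≤n) =
            (I , λ i r → <l (∣-∣-comm (seq (re (S n)) i) (seq (re (S m)) i)) (proj₁ (up m n p m≤n i r)))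
          , (I , λ i r → <l (∣-∣-comm (seq (im (S n)) i) (seq (im (S m)) i)) (proj₂ (up m n p m≤n i r)))
        by m n p q (inj₂ n≤m) = (I , λ i r → proj₁ (up n m q n≤m i r)) , (I , λ i r → proj₂ (up n m q n≤m i r))

    exp-cauchy-re : IsCauchyᵣ (λ n → re (S n))
    exp-cauchy-re ε 0<ε = proj₁ (pair-small ε 0<ε) , λ m n p q → proj₁ (proj₂ (pair-small ε 0<ε) m n p q)

    exp-cauchy-im : IsCauchyᵣ (λ n → im (S n))
    exp-cauchy-im ε 0<ε = proj₁ (pair-small ε 0<ε) , λ m n p q → proj₂ (proj₂ (pair-small ε 0<ε) m n p q)

exp : ℂ → ℂ
exp z = limᵣ (λ n → re (partialSum (expTerm z) n)) (ExpConvergence.exp-cauchy-re z)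
     +i limᵣ (λ n → im (partialSum (expTerm z) n)) (ExpConvergence.exp-cauchy-im z)

opaque

  exp-hasSum : ∀ z → HasSum (expTerm z) (exp z)
  exp-hasSum z ε (mk< g 0<g N s) = K , λ k p →
      go k (proj₂ A k (⊔ˡ {proj₁ A} {proj₁ B} p)) (proj₂ B k (⊔ʳ {proj₁ A} {proj₁ B} p))
    where
      S : ℕ → ℂ
      S = partialSum (expTerm z)
      δ : ℚ
      δ = ½ ℚ.* g
      0<δ : 0ℚ ℚ.< δ
      0<δ = ½-pos 0<g
      A : ∃ λ K → ∀ k → K ℕ.≤ k → Within δ (re (S k)) (re (exp z))
      A = limᵣ-converges (λ n → re (S n)) (ExpConvergence.exp-cauchy-re z) δ 0<δ
      B : ∃ λ K → ∀ k → K ℕ.≤ k → Within δ (im (S k)) (im (exp z))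
      B = limᵣ-converges (λ n → im (S n)) (ExpConvergence.exp-cauchy-im z) δ 0<δ
      K : ℕ
      K = proj₁ A ℕ.⊔ proj₁ B
      open +-*-Solver
      lem : ∀ g → ((½ ℚ.* g) ℚ.* (½ ℚ.* g) ℚ.+ (½ ℚ.* g) ℚ.* (½ ℚ.* g)) ℚ.+ ½ ℚ.* (g ℚ.* g) ≡ g ℚ.* g
      lem = solve 1 (λ g → ((con ½ :* g) :* (con ½ :* g) :+ (con ½ :* g) :* (con ½ :* g)) :+ con ½ :* (g :* g)
                         := g :* g) refl
      lem' : ∀ x → (ℚ.- x) ℚ.* (ℚ.- x) ≡ x ℚ.* x
      lem' = solve 1 (λ x → (:- x) :* (:- x) := x :* x) refl
      sq : ∀ x → ℚ.∣ x ∣ ℚ.* ℚ.∣ x ∣ ≡ x ℚ.* x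
      sq x with ℚₚ.∣p∣≡p∨∣p∣≡-p x
      ... | inj₁ e = cong₂ ℚ._*_ e e
      ... | inj₂ e = trans (cong₂ ℚ._*_ e e) (lem' x)
      sq≤ : ∀ x → ℚ.∣ x ∣ ℚ.< δ → x ℚ.* x ℚ.≤ δ ℚ.* δ
      sq≤ x p = ≤l (sq x) (*-mono-≤ (ℚₚ.0≤∣p∣ x) (ℚₚ.<⇒≤ 0<δ) (ℚₚ.<⇒≤ p) (ℚₚ.<⇒≤ p))
      bound : ∀ x y e → ℚ.∣ x ∣ ℚ.< δ → ℚ.∣ y ∣ ℚ.< δ → g ℚ.≤ e →
              (x ℚ.* x ℚ.+ y ℚ.* y) ℚ.+ ½ ℚ.* (g ℚ.* g) ℚ.≤ e ℚ.* e
      bound x y e p q r = ℚₚ.≤-trans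
        (≤r (lem g) (ℚₚ.+-monoˡ-≤ (½ ℚ.* (g ℚ.* g)) (ℚₚ.+-mono-≤ (sq≤ x p) (sq≤ y q))))
        (*-mono-≤ (ℚₚ.<⇒≤ 0<g) (ℚₚ.≤-trans (ℚₚ.<⇒≤ 0<g) r) r r)
      go : ∀ k → Within δ (re (S k)) (re (exp z)) → Within δ (im (S k)) (im (exp z)) →
           ∣ S k - exp z ∣² <ᵣ ε *ᵣ ε
      go k (I , f) (J , h) = mk< (½ ℚ.* (g ℚ.* g)) (½-pos (*ε-pos 0<g 0<g)) (N ℕ.⊔ (I ℕ.⊔ J)) λ i p →
        bound (seq (re (S k)) i ℚ.- seq (re (exp z)) i) (seq (im (S k)) i ℚ.- seq (im (exp z)) i) (seq ε i)
          (f i (⊔ˡ {I} {J} (⊔ʳ {N} {I ℕ.⊔ J} p))) (h i (⊔ʳ {I} {J} (⊔ʳ {N} {I ℕ.⊔ J} p)))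
          (≤l (ℚₚ.+-identityˡ g) (s i (⊔ˡ {N} {I ℕ.⊔ J} p)))

invᶜ : (w : ℂ) → 0ᵣ <ᵣ ∣ w ∣² → ℂ
invᶜ w p = (re w *ᵣ invᵣ ∣ w ∣² p) +i ((-ᵣ im w) *ᵣ invᵣ ∣ w ∣² p)

record ℋ : Set where
  constructor _,_
  field
    pt     : ℂ
    im-pos : 0ᵣ <ᵣ im pt
open ℋ public

_≈ℋ_ : ℋ → ℋ → Set
z ≈ℋ w = pt z ≈ pt w

record GL₂⁺ : Set where
  field
    a b c d : ℝ
  det : ℝ
  det = a *ᵣ d -ᵣ b *ᵣ c
  field
    det-pos : 0ᵣ <ᵣ det
open GL₂⁺

mat : (a b c d : ℝ) → 0ᵣ <ᵣ a *ᵣ d -ᵣ b *ᵣ c → GL₂⁺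
mat a b c d p = record { a = a ; b = b ; c = c ; d = d ; det-pos = p }

record _≈ₘ_ (M N : GL₂⁺) : Set where
  field
    a≈ : a M ≈ᵣ a N
    b≈ : b M ≈ᵣ b N
    c≈ : c M ≈ᵣ c N
    d≈ : d M ≈ᵣ d N

opaque

  intDet-pos : ∀ a b c d → 0ℤ ℤ.< a ℤ.* d ℤ.- b ℤ.* c →
               0ᵣ <ᵣ fromℤ a *ᵣ fromℤ d -ᵣ fromℤ b *ᵣ fromℤ c
  intDet-pos a b c d p = mk< q 0<q 0 λ _ _ → ℚₚ.≤-reflexive (ℚₚ.+-identityˡ q)
    where
      q : ℚ
      q = (a ℚ./ 1) ℚ.* (d ℚ./ 1) ℚ.- (b ℚ./ 1) ℚ.* (c ℚ./ 1)
      qᵘ : ℚᵘ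
      qᵘ = mkℚᵘ a 0 ℚᵘ.* mkℚᵘ d 0 ℚᵘ.- mkℚᵘ b 0 ℚᵘ.* mkℚᵘ c 0
      prod : ∀ i j → toℚᵘ ((i ℚ./ 1) ℚ.* (j ℚ./ 1)) ℚᵘ.≃ mkℚᵘ i 0 ℚᵘ.* mkℚᵘ j 0
      prod i j = ℚᵘₚ.≃-trans (ℚₚ.toℚᵘ-homo-* (i ℚ./ 1) (j ℚ./ 1))
        (ℚᵘₚ.*-cong (ℚₚ.toℚᵘ-fromℚᵘ (mkℚᵘ i 0)) (ℚₚ.toℚᵘ-fromℚᵘ (mkℚᵘ j 0)))
      q≃ : toℚᵘ q ℚᵘ.≃ qᵘ
      q≃ = ℚᵘₚ.≃-trans (ℚₚ.toℚᵘ-homo-+ ((a ℚ./ 1) ℚ.* (d ℚ./ 1)) (ℚ.- ((b ℚ./ 1) ℚ.* (c ℚ./ 1))))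
        (ℚᵘₚ.+-cong (prod a d)
          (ℚᵘₚ.≃-trans (ℚₚ.toℚᵘ-homo‿- ((b ℚ./ 1) ℚ.* (c ℚ./ 1))) (ℚᵘₚ.-‿cong (prod b c))))
      num : a ℤ.* d ℤ.- b ℤ.* c ≡ ((a ℤ.* d) ℤ.* + 1 ℤ.+ (ℤ.- (b ℤ.* c)) ℤ.* + 1) ℤ.* + 1
      num = sym (trans (ℤₚ.*-identityʳ _) (cong₂ ℤ._+_ (ℤₚ.*-identityʳ (a ℤ.* d)) (ℤₚ.*-identityʳ (ℤ.- (b ℤ.* c)))))
      0<qᵘ : toℚᵘ 0ℚ ℚᵘ.< qᵘ
      0<qᵘ = ℚᵘ.*<* (ℤₚ.<-≤-trans p (ℤₚ.≤-reflexive num))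
      0<q : 0ℚ ℚ.< q
      0<q = ℚₚ.toℚᵘ-cancel-< (ℚᵘₚ.<-respʳ-≃ (ℚᵘₚ.≃-sym q≃) 0<qᵘ)

intMat : (a b c d : ℤ) → 0ℤ ℤ.< a ℤ.* d ℤ.- b ℤ.* c → GL₂⁺
intMat a b c d p = mat (fromℤ a) (fromℤ b) (fromℤ c) (fromℤ d) (intDet-pos a b c d p)

Iₘ : GL₂⁺
Iₘ = intMat (+ 1) (+ 0) (+ 0) (+ 1) (ℤ.+<+ (ℕ.s≤s ℕ.z≤n))

infixl 7 _*ₘ_

opaque

  *ₘ-det : ∀ M N → 0ᵣ <ᵣ (a M *ᵣ a N +ᵣ b M *ᵣ c N) *ᵣ (c M *ᵣ b N +ᵣ d M *ᵣ d N)
                     -ᵣ (a M *ᵣ b N +ᵣ b M *ᵣ d N) *ᵣ (c M *ᵣ a N +ᵣ d M *ᵣ c N)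
  *ₘ-det M N = >0-resp (≡⇒≈ᵣ λ n → lem (seq (a M) n) (seq (b M) n) (seq (c M) n) (seq (d M) n)
                                       (seq (a N) n) (seq (b N) n) (seq (c N) n) (seq (d N) n))
                       (>0-* (det-pos M) (det-pos N))
    where
      open +-*-Solver
      lem : ∀ a b c d a' b' c' d' →
            (a ℚ.* d ℚ.- b ℚ.* c) ℚ.* (a' ℚ.* d' ℚ.- b' ℚ.* c')
            ≡ (a ℚ.* a' ℚ.+ b ℚ.* c') ℚ.* (c ℚ.* b' ℚ.+ d ℚ.* d')
              ℚ.- (a ℚ.* b' ℚ.+ b ℚ.* d') ℚ.* (c ℚ.* a' ℚ.+ d ℚ.* c')
      lem = solve 8 (λ a b c d a' b' c' d' →
            (a :* d :- b :* c) :* (a' :* d' :- b' :* c')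
            := (a :* a' :+ b :* c') :* (c :* b' :+ d :* d')
              :- (a :* b' :+ b :* d') :* (c :* a' :+ d :* c')) refl

  inv-det : ∀ a b c d r → 0ᵣ <ᵣ a *ᵣ d -ᵣ b *ᵣ c → 0ᵣ <ᵣ r →
            0ᵣ <ᵣ (d *ᵣ r) *ᵣ (a *ᵣ r) -ᵣ ((-ᵣ b) *ᵣ r) *ᵣ ((-ᵣ c) *ᵣ r)
  inv-det a b c d r p q = >0-resp
      (≡⇒≈ᵣ λ n → lem (seq a n) (seq b n) (seq c n) (seq d n) (seq r n)) (>0-* p (>0-* q q))
    where
      open +-*-Solver
      lem : ∀ a b c d r → (a ℚ.* d ℚ.- b ℚ.* c) ℚ.* (r ℚ.* r)
            ≡ (d ℚ.* r) ℚ.* (a ℚ.* r) ℚ.- ((ℚ.- b) ℚ.* r) ℚ.* ((ℚ.- c) ℚ.* r)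
      lem = solve 5 (λ a b c d r → (a :* d :- b :* c) :* (r :* r)
            := (d :* r) :* (a :* r) :- ((:- b) :* r) :* ((:- c) :* r)) refl

_*ₘ_ : GL₂⁺ → GL₂⁺ → GL₂⁺
M *ₘ N = mat (a M *ᵣ a N +ᵣ b M *ᵣ c N) (a M *ᵣ b N +ᵣ b M *ᵣ d N)
             (c M *ᵣ a N +ᵣ d M *ᵣ c N) (c M *ᵣ b N +ᵣ d M *ᵣ d N)
             (*ₘ-det M N)

invₘ : GL₂⁺ → GL₂⁺
invₘ M = mat (d M *ᵣ r) ((-ᵣ b M) *ᵣ r) ((-ᵣ c M) *ᵣ r) (a M *ᵣ r)
             (inv-det (a M) (b M) (c M) (d M) r (det-pos M) (invᵣ-pos (det M) (det-pos M)))
  where r : ℝ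
        r = invᵣ (det M) (det-pos M)

-- (a z + b) and (c z + d)
num den : GL₂⁺ → ℋ → ℂ
num M z = ι (a M) * pt z + ι (b M)
den M z = ι (c M) * pt z + ι (d M)

opaque

  den-pos : ∀ M z → 0ᵣ <ᵣ ∣ den M z ∣²
  den-pos M z = >0-factor {∣ num M z ∣²} (λ n → 0≤+ (0≤a² (seq (re (den M z)) n)) (0≤a² (seq (im (den M z)) n)))
      (>0-resp (≡⇒≈ᵣ λ n → lem (seq (a M) n) (seq (b M) n) (seq (c M) n) (seq (d M) n)
                               (seq (re (pt z)) n) (seq (im (pt z)) n))
        (>0-+≥0 {D *ᵣ D} {w *ᵣ w} (>0-* pos pos) (λ n → 0≤a² (seq w n))))
    where
      D w : ℝ
      D = det M *ᵣ im (pt z)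
      w = re (num M z) *ᵣ re (den M z) +ᵣ im (num M z) *ᵣ im (den M z)
      pos : 0ᵣ <ᵣ D
      pos = >0-* (det-pos M) (im-pos z)
      open +-*-Solver
      lem : ∀ a b c d x y →
        ((a ℚ.* d ℚ.- b ℚ.* c) ℚ.* y) ℚ.* ((a ℚ.* d ℚ.- b ℚ.* c) ℚ.* y)
        ℚ.+ (((a ℚ.* x ℚ.- 0ℚ ℚ.* y) ℚ.+ b) ℚ.* ((c ℚ.* x ℚ.- 0ℚ ℚ.* y) ℚ.+ d)
             ℚ.+ ((a ℚ.* y ℚ.+ 0ℚ ℚ.* x) ℚ.+ 0ℚ) ℚ.* ((c ℚ.* y ℚ.+ 0ℚ ℚ.* x) ℚ.+ 0ℚ))
            ℚ.* (((a ℚ.* x ℚ.- 0ℚ ℚ.* y) ℚ.+ b) ℚ.* ((c ℚ.* x ℚ.- 0ℚ ℚ.* y) ℚ.+ d)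
             ℚ.+ ((a ℚ.* y ℚ.+ 0ℚ ℚ.* x) ℚ.+ 0ℚ) ℚ.* ((c ℚ.* y ℚ.+ 0ℚ ℚ.* x) ℚ.+ 0ℚ))
        ≡ (((a ℚ.* x ℚ.- 0ℚ ℚ.* y) ℚ.+ b) ℚ.* ((a ℚ.* x ℚ.- 0ℚ ℚ.* y) ℚ.+ b)
             ℚ.+ ((a ℚ.* y ℚ.+ 0ℚ ℚ.* x) ℚ.+ 0ℚ) ℚ.* ((a ℚ.* y ℚ.+ 0ℚ ℚ.* x) ℚ.+ 0ℚ))
          ℚ.* (((c ℚ.* x ℚ.- 0ℚ ℚ.* y) ℚ.+ d) ℚ.* ((c ℚ.* x ℚ.- 0ℚ ℚ.* y) ℚ.+ d)
             ℚ.+ ((c ℚ.* y ℚ.+ 0ℚ ℚ.* x) ℚ.+ 0ℚ) ℚ.* ((c ℚ.* y ℚ.+ 0ℚ ℚ.* x) ℚ.+ 0ℚ))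
      lem = solve 6 (λ a b c d x y →
        let o = con 0ℚ
            nr = (a :* x :- o :* y) :+ b
            ni = (a :* y :+ o :* x) :+ o
            dr = (c :* x :- o :* y) :+ d
            di = (c :* y :+ o :* x) :+ o
        in ((a :* d :- b :* c) :* y) :* ((a :* d :- b :* c) :* y)
             :+ (nr :* dr :+ ni :* di) :* (nr :* dr :+ ni :* di)
           := (nr :* nr :+ ni :* ni) :* (dr :* dr :+ di :* di)) refl

denInv : GL₂⁺ → ℋ → ℂ
denInv M z = invᶜ (den M z) (den-pos M z)

opaque

  möbius-pos : ∀ M z → 0ᵣ <ᵣ im (num M z * denInv M z)
  möbius-pos M z = >0-resp (≡⇒≈ᵣ λ n → lem (seq (a M) n) (seq (b M) n) (seq (c M) n) (seq (d M) n)
                               (seq (re (pt z)) n) (seq (im (pt z)) n) (seq r n))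
      (>0-* (>0-* (det-pos M) (im-pos z)) (invᵣ-pos ∣ den M z ∣² (den-pos M z)))
    where
      r : ℝ
      r = invᵣ ∣ den M z ∣² (den-pos M z)
      open +-*-Solver
      lem : ∀ a b c d x y r → ((a ℚ.* d ℚ.- b ℚ.* c) ℚ.* y) ℚ.* r
        ≡ ((a ℚ.* x ℚ.- 0ℚ ℚ.* y) ℚ.+ b) ℚ.* ((ℚ.- ((c ℚ.* y ℚ.+ 0ℚ ℚ.* x) ℚ.+ 0ℚ)) ℚ.* r)
          ℚ.+ ((a ℚ.* y ℚ.+ 0ℚ ℚ.* x) ℚ.+ 0ℚ) ℚ.* (((c ℚ.* x ℚ.- 0ℚ ℚ.* y) ℚ.+ d) ℚ.* r)
      lem = solve 7 (λ a b c d x y r → let o = con 0ℚ in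
        ((a :* d :- b :* c) :* y) :* r
        := ((a :* x :- o :* y) :+ b) :* ((:- ((c :* y :+ o :* x) :+ o)) :* r)
          :+ ((a :* y :+ o :* x) :+ o) :* (((c :* x :- o :* y) :+ d) :* r)) refl

möbius : GL₂⁺ → ℋ → ℋ
möbius M z = num M z * denInv M z , möbius-pos M z

infixl 5 _∣[_]_ _∥[_]_

-- det(M)^(k/2) (cz+d)^(-k) f(Mz). The quotient k / 2 is that of ℕ, hence exact
-- precisely for the even weights under consideration.
_∣[_]_ : (ℋ → ℂ) → ℕ → GL₂⁺ → (ℋ → ℂ)
(f ∣[ k ] M) z = ι (det M) ^ (k ℕ./ 2) * denInv M z ^ k * f (möbius M z)

-- Elements of ℂ[GL₂(ℝ)⁺] are presented as formal linear combinations. Two lists may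
-- present the same element; only the action ∥ of an element is ever compared.
GroupRing : Set
GroupRing = List (ℂ × GL₂⁺)

⟦_⟧ : GL₂⁺ → GroupRing
⟦ M ⟧ = (1ᶜ , M) ∷ []

infixl 6 _⊞_ _⊟_
infixl 7 _⊠_ _⊙_

_⊞_ _⊟_ _⊠_ : GroupRing → GroupRing → GroupRing
_⊙_ : ℂ → GroupRing → GroupRing
𝟏 : GroupRing

𝟏 = ⟦ Iₘ ⟧
w ⊙ x = map (λ (v , M) → w * v , M) x
x ⊞ y = x ++ y
x ⊟ y = x ⊞ (- 1ᶜ) ⊙ y
x ⊠ y = cartesianProductWith (λ (v , M) (w , N) → v * w , M *ₘ N) x y

_∥[_]_ : (ℋ → ℂ) → ℕ → GroupRing → (ℋ → ℂ)
(f ∥[ k ] x) z = foldr (λ (v , M) s → v * (f ∣[ k ] M) z + s) 0ᶜ x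

infix 4 _≐_
_≐_ : (ℋ → ℂ) → (ℋ → ℂ) → Set
f ≐ g = ∀ z → f z ≈ g z

-- The subgroup generated by A and B, as a predicate on matrices; closure under ≈ₘ is
-- needed because equality of real matrices is a setoid equality.
data ⟨_,_⟩ (A B : GL₂⁺) : GL₂⁺ → Set where
  gen₁    : ⟨ A , B ⟩ A
  gen₂    : ⟨ A , B ⟩ B
  unit    : ⟨ A , B ⟩ Iₘ
  product : ∀ {M N} → ⟨ A , B ⟩ M → ⟨ A , B ⟩ N → ⟨ A , B ⟩ (M *ₘ N)
  inverse : ∀ {M} → ⟨ A , B ⟩ M → ⟨ A , B ⟩ (invₘ M)
  resp-≈  : ∀ {M N} → M ≈ₘ N → ⟨ A , B ⟩ M → ⟨ A , B ⟩ N

χ₀ : ℕ → ℂ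
χ₀ p = if does (p ℕₚ.≟ 13) then 0ᶜ else 1ᶜ

opaque
  diag-pos : ∀ p .{{_ : NonZero p}} → 0ℤ ℤ.< + p ℤ.* + 1 ℤ.- + 0 ℤ.* + 0
  diag-pos (suc p) = ℤ.+<+ (ℕ.s≤s ℕ.z≤n)

  upper-pos : ∀ p a .{{_ : NonZero p}} → 0ℤ ℤ.< + 1 ℤ.* + p ℤ.- + a ℤ.* + 0
  upper-pos (suc p) a = ℤₚ.<-≤-trans (ℤ.+<+ {0} {suc p} (ℕ.s≤s ℕ.z≤n)) (ℤₚ.≤-reflexive
    (sym (trans (cong₂ ℤ._-_ (ℤₚ.*-identityˡ (+ suc p)) (ℤₚ.*-zeroʳ (+ a))) (ℤₚ.+-identityʳ (+ suc p)))))

T : (p : ℕ) → .{{NonZero p}} → GroupRing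
T p = χ₀ p ⊙ ⟦ intMat (+ p) (+ 0) (+ 0) (+ 1) (diag-pos p) ⟧
    ⊞ foldr (λ j x → ⟦ intMat (+ 1) (+ j) (+ 0) (+ p) (upper-pos p j) ⟧ ⊞ x) [] (upTo p)

-- p^(1 - k/2) for even k
heckeScalar : ℕ → (p : ℕ) → .{{NonZero p}} → ℂ
heckeScalar k p = ι (fromℕ p) * ι (fromℚ (recip p)) ^ (k ℕ./ 2)

H₁₃ γ : GL₂⁺
H₁₃ = intMat (+ 0) (ℤ.- + 1) (+ 13) (+ 0) (ℤ.+<+ (ℕ.s≤s ℕ.z≤n))
γ   = intMat (+ 3) (+ 1) (ℤ.- + 13) (ℤ.- + 4) (ℤ.+<+ (ℕ.s≤s ℕ.z≤n))

opaque

  3√13-pos : 0ᵣ <ᵣ fromℕ 3 *ᵣ √13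
  3√13-pos = >0-* (>0-fromℚ (ℚₚ.positive⁻¹ (+ 3 ℚ./ 1))) √13-pos

  one-pos : 0ᵣ <ᵣ fromℕ 14 *ᵣ 1ᵣ -ᵣ fromℕ 13
  one-pos = >0-resp (≡⇒≈ᵣ λ _ → refl) (>0-fromℚ {1ℚ} 0<1)

  ε₁-det : 0ᵣ <ᵣ √13 *ᵣ (-ᵣ √13)
               -ᵣ (fromℕ 14 *ᵣ invᵣ (fromℕ 3 *ᵣ √13) 3√13-pos) *ᵣ (fromℤ (ℤ.- + 3) *ᵣ √13)
  ε₁-det = >0-resp (R.trans (R.+-cong (R.*-cong R.refl (R.sym (invᵣ-inverse (fromℕ 3 *ᵣ √13) 3√13-pos)))
                                      (R.-‿cong (R.sym √13²)))
                            (≡⇒≈ᵣ λ n → lem (seq √13 n) (seq u n)))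
                   one-pos
    where
      u : ℝ
      u = invᵣ (fromℕ 3 *ᵣ √13) 3√13-pos
      open +-*-Solver
      lem : ∀ t u → (+ 14 ℚ./ 1) ℚ.* ((+ 3 ℚ./ 1 ℚ.* t) ℚ.* u) ℚ.- t ℚ.* t
          ≡ t ℚ.* (ℚ.- t) ℚ.- ((+ 14 ℚ./ 1) ℚ.* u) ℚ.* ((ℤ.- + 3 ℚ./ 1) ℚ.* t)
      lem = solve 2 (λ t u → con (+ 14 ℚ./ 1) :* ((con (+ 3 ℚ./ 1) :* t) :* u) :- t :* t
          := t :* (:- t) :- (con (+ 14 ℚ./ 1) :* u) :* (con (ℤ.- + 3 ℚ./ 1) :* t)) refl

  ε₂-det : 0ᵣ <ᵣ (-ᵣ √13) *ᵣ √13
               -ᵣ (fromℤ (ℤ.- + 4) *ᵣ invᵣ √13 √13-pos) *ᵣ (fromℚ (+ 7 ℚ./ 2) *ᵣ √13)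
  ε₂-det = >0-resp (R.trans (R.+-cong (R.*-cong R.refl (R.sym (invᵣ-inverse √13 √13-pos)))
                                      (R.-‿cong (R.sym √13²)))
                            (≡⇒≈ᵣ λ n → lem (seq √13 n) (seq (invᵣ √13 √13-pos) n)))
                   one-pos
    where
      open +-*-Solver
      lem : ∀ t v → (+ 14 ℚ./ 1) ℚ.* (t ℚ.* v) ℚ.- t ℚ.* t
          ≡ (ℚ.- t) ℚ.* t ℚ.- ((ℤ.- + 4 ℚ./ 1) ℚ.* v) ℚ.* ((+ 7 ℚ./ 2) ℚ.* t)
      lem = solve 2 (λ t v → con (+ 14 ℚ./ 1) :* (t :* v) :- t :* t
          := (:- t) :* t :- (con (ℤ.- + 4 ℚ./ 1) :* v) :* (con (+ 7 ℚ./ 2) :* t)) refl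

ε₁ ε₂ : GL₂⁺
ε₁ = mat √13                          (fromℕ 14 *ᵣ invᵣ (fromℕ 3 *ᵣ √13) 3√13-pos)
         (fromℤ (ℤ.- + 3) *ᵣ √13)     (-ᵣ √13)
         ε₁-det
ε₂ = mat (-ᵣ √13)                     (fromℤ (ℤ.- + 4) *ᵣ invᵣ √13 √13-pos)
         (fromℚ (+ 7 ℚ./ 2) *ᵣ √13)   √13
         ε₂-det

-- Complex differentiability at every point of ℋ, with derivative f′:
-- |f w - f z - f′ (w - z)| ≤ ε |w - z| whenever |w - z| < δ, both inequalities squared.
Holomorphic : (ℋ → ℂ) → Set
Holomorphic f = ∀ z → ∃ λ f′ → ∀ ε → 0ᵣ <ᵣ ε → ∃ λ δ → 0ᵣ <ᵣ δ × (∀ w →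
  ∣ pt w - pt z ∣² <ᵣ δ *ᵣ δ →
  ∣ f w - f z - f′ * (pt w - pt z) ∣² ≤ᵣ ε *ᵣ ε *ᵣ ∣ pt w - pt z ∣²)

cos : ℝ → ℝ
cos t = re (exp (𝕚 * ι t))

-- π is characterised by π/2 being the least positive zero of the cosine.
record IsPi (π : ℝ) : Set where
  field
    pos       : 0ᵣ <ᵣ π
    cos-½π    : cos (fromℚ ½ *ᵣ π) ≈ᵣ 0ᵣ
    least     : ∀ t → 0ᵣ <ᵣ t → t <ᵣ fromℚ ½ *ᵣ π → ¬ (cos t ≈ᵣ 0ᵣ)

-- f(z) = Σ_{n ≥ 1} a n e^{2πinz}, summed with m = n - 1 ≥ 0; the value a 0 is unused.
FourierExpansion : ℝ → (ℕ → ℂ) → (ℋ → ℂ) → Set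
FourierExpansion π a f = ∀ z →
  HasSum (λ m → a (suc m) * exp (ι (fromℕ 2 *ᵣ π) * 𝕚 * ι (fromℕ (suc m)) * pt z)) (f z)

{-# OPTIONS --safe #-}
module Submission where

-- Let s be the sign in f | H₁₃ = s f. Comparing T₂, T₂² and T₃ with their conjugates by H₁₃ yields
-- linear relations between functions f | M which say that g = f | (1 - γ) satisfies g | ε₁ = s g,
-- g | ε₂ = s g and g | ε₃ = - g, where ε₃ = (5 2; -13 -5). If s = -1, the first of these equations
-- implies the theorem only when g = 0; but g vanishes for either sign, for the following reason.
-- The fixed points of the three half-turns εᵢ lie on one geodesic, so products of two of them are
-- translations along it; they make g invariant under the elements 7 + √13 and 19 - 5√13 of a torus
-- ℚ(√13)^×. Reduction modulo 3 shows that no product of these two is rational, so that (by the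
-- pigeonhole principle) g is invariant under nontrivial torus elements arbitrarily close to 1. Hence g
-- solves a first order differential equation given by the quadratic form of the geodesic, and g | γ
-- and g | γ² solve the conjugate equations. The sum of these three functions is 0 because γ has
-- order 3, and differentiating this relation twice leaves only g = 0.

-- Equality in `ℂ` is undecidable, so only quantities that are provably nonzero on all of `ℋ` can be
-- divided by. The quadratic form Q of the geodesic is one, since its zeros are real; its equation Q
-- g′ = - (k/2) Q′ g says that g is a multiple of Q^(-k/2). The elimination also produces w = 13z² +
-- 7z + 1, which does vanish in `ℋ`, at the fixed point of γ. It is removed by differentiating w g =
-- 0 and using that a complex number with square 0 is 0.
--
-- The geodesic passes through the fixed point of γ. Therefore its matrix N satisfies N + γ⁻¹Nγ +
-- γ⁻²Nγ² = 0, and the three quadratic forms add up to 0 just as the three functions do.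
--
-- The half-turns multiply g by s, s and -1, and only products in which these factors cancel are
-- useful: up to scalars, 7 + N is ε₁ε₂ and 19 - 5N is ε₁ε₃ε₂ε₃. The quotient of 7 + √13 by 19 -
-- 5√13 is the unit (11 + 3√13)/2. Modulo this unit both are the same rotation of a circle, and the
-- small elements are the close returns of its orbit.

open import Defs
open import Algebra.Bundles using (CommutativeRing; RawRing)
import Algebra.Properties.CommutativeSemiring.Exp
import Algebra.Solver.Ring
open import Algebra.Solver.Ring.AlmostCommutativeRing 
  using (fromCommutativeRing; _-Raw-AlmostCommutative⟶_; Induced-equivalence)
open import Data.Empty using (⊥-elim)
open import Data.Fin.Base using (Fin; toℕ; fromℕ<)
import Data.Fin.Properties as Finₚ
open import Data.Integer.Base as ℤ using (ℤ; +_; -[1+_])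
import Data.Integer.Properties as ℤₚ
import Data.Integer.Solver
open import Data.Integer.Solver using () renaming (module +-*-Solver to ℤ-ring)
open import Data.List.Base using (List; []; _∷_; foldr; map; _++_; concatMap)
import Data.List.Properties as Listₚ
open import Data.List.Relation.Binary.Pointwise.Base using (Pointwise; []; _∷_)
import Data.Maybe.Base
open import Data.Nat.Base as ℕ using (ℕ; zero; suc; NonZero; _!; z≤n; s≤s)
open import Data.Nat.Divisibility using (_∣_; divides)
import Data.Nat.DivMod as ℕ
open import Data.Nat.Primality using (Prime; prime?)
import Data.Nat.Properties as ℕₚ
open import Data.Product.Base using (∃; _×_; _,_; proj₁; proj₂)
open import Data.Rational.Base as ℚ using (ℚ; 0ℚ; 1ℚ; ½)
import Data.Rational.Properties as ℚₚ
open import Data.Rational.Solver using (module +-*-Solver)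
import Data.Rational.Unnormalised.Base as ℚᵘ
import Data.Rational.Unnormalised.Properties as ℚᵘₚ
open import Data.Sum.Base using (_⊎_; inj₁; inj₂)
open import Data.Vec.Base as Vec using ([]; _∷_; allFin)
open import Data.Vec.N-ary using (N-ary; _$ⁿ_)
open import Function.Definitions using (Congruent)
open import Level using (0ℓ)
open import Relation.Binary.Definitions using (WeaklyDecidable)
import Relation.Binary.Reasoning.Setoid as SetoidReasoning
open import Relation.Binary.PropositionalEquality
  using (_≡_; _≢_; refl; sym; trans; cong; cong₂; subst)
open import Relation.Nullary using (¬_; Dec; yes; no)
open import Relation.Nullary.Decidable using (dec⇒maybe; True; toWitness; from-yes; _×-dec_; ¬?)

-- Ring identities

ℤ-raw : RawRing 0ℓ 0ℓ
ℤ-raw = record { Carrier = ℤ ; _≈_ = _≡_ ; _+_ = ℤ._+_ ; _*_ = ℤ._*_ ; -_ = ℤ.-_ ; 0# = + 0 ; 1# = + 1 }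

-- Ring identities are checked by comparing syntactic normal forms with coefficients in ℤ;
-- the (expensive) interpretations of the normal forms are never compared.
module ℤ-Solver (R : CommutativeRing 0ℓ 0ℓ) (morphism : ℤ-raw -Raw-AlmostCommutative⟶ fromCommutativeRing R) where

  private
    open CommutativeRing R using () renaming (_≈_ to _≃_)

    same-coefficient : WeaklyDecidable (Induced-equivalence morphism)
    same-coefficient i j = Data.Maybe.Base.map (λ { refl → CommutativeRing.refl R }) (dec⇒maybe (i ℤₚ.≟ j))

    module Solver = Algebra.Solver.Ring ℤ-raw (fromCommutativeRing R) morphism same-coefficient

  open Solver public using (Polynomial; con; _:+_; _:*_; _:-_; :-_)

  infix 4 _≔_
  _≔_ : ∀ {n} → Polynomial n → Polynomial n → Polynomial n × Polynomial n
  _≔_ = _,_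

  private
    closeⁿ : ∀ n → N-ary n (Polynomial n) (Polynomial n × Polynomial n) → Polynomial n × Polynomial n
    closeⁿ n f = f $ⁿ Vec.map Solver.var (allFin n)

  solveℤ : ∀ n (f : N-ary n (Polynomial n) (Polynomial n × Polynomial n)) →
           Solver.normalise (proj₁ (closeⁿ n f)) ≡ Solver.normalise (proj₂ (closeⁿ n f)) →
           ∀ ρ → Solver.⟦ proj₁ (closeⁿ n f) ⟧ ρ ≃ Solver.⟦ proj₂ (closeⁿ n f) ⟧ ρ
  solveℤ n f eq ρ = CommutativeRing.trans R (CommutativeRing.sym R (Solver.correct (proj₁ (closeⁿ n f)) ρ))
    (subst (λ p → Solver.⟦ p ⟧N ρ ≃ Solver.⟦ proj₂ (closeⁿ n f) ⟧ ρ) (sym eq) (Solver.correct (proj₂ (closeⁿ n f)) ρ))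

module ℝr = CommutativeRing ℝ-commutativeRing
module ℂr = CommutativeRing ℂ-commutativeRing

opaque
  /1-+ : ∀ i j → (i ℤ.+ j) ℚ./ 1 ≡ (i ℚ./ 1) ℚ.+ (j ℚ./ 1)
  /1-+ i j = ℚₚ.toℚᵘ-injective (ℚᵘₚ.≃-trans (ℚₚ.toℚᵘ-fromℚᵘ (ℚᵘ.mkℚᵘ (i ℤ.+ j) 0))
    (ℚᵘₚ.≃-trans (ℚᵘ.*≡* (cong (ℤ._* + 1) (sym (cong₂ ℤ._+_ (ℤₚ.*-identityʳ i) (ℤₚ.*-identityʳ j)))))
    (ℚᵘₚ.≃-sym (ℚᵘₚ.≃-trans (ℚₚ.toℚᵘ-homo-+ (i ℚ./ 1) (j ℚ./ 1))
      (ℚᵘₚ.+-cong (ℚₚ.toℚᵘ-fromℚᵘ (ℚᵘ.mkℚᵘ i 0)) (ℚₚ.toℚᵘ-fromℚᵘ (ℚᵘ.mkℚᵘ j 0)))))))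

  /1-* : ∀ i j → (i ℤ.* j) ℚ./ 1 ≡ (i ℚ./ 1) ℚ.* (j ℚ./ 1)
  /1-* i j = ℚₚ.toℚᵘ-injective (ℚᵘₚ.≃-trans (ℚₚ.toℚᵘ-fromℚᵘ (ℚᵘ.mkℚᵘ (i ℤ.* j) 0))
    (ℚᵘₚ.≃-sym (ℚᵘₚ.≃-trans (ℚₚ.toℚᵘ-homo-* (i ℚ./ 1) (j ℚ./ 1))
      (ℚᵘₚ.*-cong (ℚₚ.toℚᵘ-fromℚᵘ (ℚᵘ.mkℚᵘ i 0)) (ℚₚ.toℚᵘ-fromℚᵘ (ℚᵘ.mkℚᵘ j 0))))))

  /1-neg : ∀ i → (ℤ.- i) ℚ./ 1 ≡ ℚ.- (i ℚ./ 1)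
  /1-neg i = ℚₚ.toℚᵘ-injective (ℚᵘₚ.≃-trans (ℚₚ.toℚᵘ-fromℚᵘ (ℚᵘ.mkℚᵘ (ℤ.- i) 0))
    (ℚᵘₚ.≃-sym (ℚᵘₚ.≃-trans (ℚₚ.toℚᵘ-homo‿- (i ℚ./ 1))
      (ℚᵘₚ.-‿cong (ℚₚ.toℚᵘ-fromℚᵘ (ℚᵘ.mkℚᵘ i 0))))))

fromℤ-+ : ∀ i j → fromℤ (i ℤ.+ j) ≈ᵣ fromℤ i +ᵣ fromℤ j
fromℤ-+ i j = ≡⇒≈ᵣ λ _ → /1-+ i j

fromℤ-* : ∀ i j → fromℤ (i ℤ.* j) ≈ᵣ fromℤ i *ᵣ fromℤ j
fromℤ-* i j = ≡⇒≈ᵣ λ _ → /1-* i j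

fromℤ-neg : ∀ i → fromℤ (ℤ.- i) ≈ᵣ -ᵣ fromℤ i
fromℤ-neg i = ≡⇒≈ᵣ λ _ → /1-neg i

fromℤ-morphism : ℤ-raw -Raw-AlmostCommutative⟶ fromCommutativeRing ℝ-commutativeRing
fromℤ-morphism = record { ⟦_⟧ = fromℤ ; +-homo = fromℤ-+ ; *-homo = fromℤ-* ; -‿homo = fromℤ-neg
                        ; 0-homo = ≈ᵣ-refl ; 1-homo = ≈ᵣ-refl }

module ℝ-Solver = ℤ-Solver ℝ-commutativeRing fromℤ-morphism

ι-cong : ∀ {x y} → x ≈ᵣ y → ι x ≈ ι y
ι-cong p = p , ≈ᵣ-refl

ι-+ : ∀ x y → ι (x +ᵣ y) ≈ ι x + ι y
ι-+ x y = ≈ᵣ-refl , ℝr.sym (ℝr.+-identityˡ 0ᵣ)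

ι-neg : ∀ x → ι (-ᵣ x) ≈ - ι x
ι-neg x = ≈ᵣ-refl , solveℤ 0 (con (+ 0) ≔ :- con (+ 0)) refl []
  where open ℝ-Solver

ι-* : ∀ x y → ι (x *ᵣ y) ≈ ι x * ι y
ι-* x y = solveℤ 2 (λ x y → x :* y ≔ x :* y :- con (+ 0) :* con (+ 0)) refl (x ∷ y ∷ [])
        , solveℤ 2 (λ x y → con (+ 0) ≔ x :* con (+ 0) :+ con (+ 0) :* y) refl (x ∷ y ∷ [])
  where open ℝ-Solver

ιℤ : ℤ → ℂ
ιℤ i = ι (fromℤ i)

ιℤ-+ : ∀ i j → ιℤ (i ℤ.+ j) ≈ ιℤ i + ιℤ j
ιℤ-+ i j = ≈-trans (ι-cong (fromℤ-+ i j)) (ι-+ _ _)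

ιℤ-* : ∀ i j → ιℤ (i ℤ.* j) ≈ ιℤ i * ιℤ j
ιℤ-* i j = ≈-trans (ι-cong (fromℤ-* i j)) (ι-* _ _)

ιℤ-neg : ∀ i → ιℤ (ℤ.- i) ≈ - ιℤ i
ιℤ-neg i = ≈-trans (ι-cong (fromℤ-neg i)) (ι-neg _)

ιℤ-morphism : ℤ-raw -Raw-AlmostCommutative⟶ fromCommutativeRing ℂ-commutativeRing
ιℤ-morphism = record { ⟦_⟧ = ιℤ ; +-homo = ιℤ-+ ; *-homo = ιℤ-* ; -‿homo = ιℤ-neg
                     ; 0-homo = ≈-refl ; 1-homo = ≈-refl }

module ℂ-Solver = ℤ-Solver ℂ-commutativeRing ιℤ-morphism

-- Limits

opaque
  ∣x∣² : ∀ x → ℚ.∣ x ∣ ℚ.* ℚ.∣ x ∣ ≡ x ℚ.* x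
  ∣x∣² x with ℚₚ.∣p∣≡p∨∣p∣≡-p x
  ... | inj₁ e = cong₂ ℚ._*_ e e
  ... | inj₂ e = trans (cong₂ ℚ._*_ e e) (neg² x)
    where
      open +-*-Solver
      neg² : ∀ x → (ℚ.- x) ℚ.* (ℚ.- x) ≡ x ℚ.* x
      neg² = solve 1 (λ x → (:- x) :* (:- x) := x :* x) refl

  sq<⇒∣∣< : ∀ {x ε} → 0ℚ ℚ.< ε → x ℚ.* x ℚ.< ε ℚ.* ε → ℚ.∣ x ∣ ℚ.< ε
  sq<⇒∣∣< {x} {ε} 0<ε h = ℚₚ.≰⇒> λ ε≤x → ℚₚ.<-irrefl refl (ℚₚ.<-≤-trans h (≤r (∣x∣² x) (*-mono-≤ (ℚₚ.<⇒≤ 0<ε) (ℚₚ.0≤∣p∣ x) ε≤x ε≤x)))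

  ∣∣<⇒sq< : ∀ {x ε} → ℚ.∣ x ∣ ℚ.< ε → x ℚ.* x ℚ.< ε ℚ.* ε
  ∣∣<⇒sq< {x} {ε} h = ℚₚ.≤-<-trans (≤l (∣x∣² x) (ℚₚ.*-monoˡ-≤-nonNeg ℚ.∣ x ∣ {{ℚₚ.∣-∣-nonNeg x}} (ℚₚ.<⇒≤ h)))
      (ℚₚ.*-monoˡ-<-pos ε {{ℚ.positive (ℚₚ.≤-<-trans (ℚₚ.0≤∣p∣ x) h)}} h)

-- Tolerances are rational and refer to the approximating sequences, so that the limit laws reduce
-- to estimates between rationals. Wrapping the property in a record lets `s` and `l` be inferred
-- from a proof.
record Limᵣ (s : ℕ → ℝ) (l : ℝ) : Set where
  constructor mkLimᵣ
  field
    eventually : ∀ ε → 0ℚ ℚ.< ε → ∃ λ N → ∀ n → N ℕ.≤ n → Within ε (s n) l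
open Limᵣ public

opaque
  within-trans : ∀ {ε x y z} → Within (½ ℚ.* ε) x y → Within (½ ℚ.* ε) y z → Within ε x z
  within-trans {ε} {x} {y} {z} (M , f) (N , g) = M ℕ.⊔ N , λ i p →
    tri½ (seq x i) (seq y i) (seq z i) (f i (⊔ˡ {M} {N} p)) (g i (⊔ʳ {M} {N} p))

  within-sym : ∀ {ε x y} → Within ε x y → Within ε y x
  within-sym {ε} {x} {y} (N , f) = N , λ i p → <l (∣-∣-comm (seq x i) (seq y i)) (f i p)

  limᵣ-resp : ∀ {s t l m} → (∀ n → s n ≈ᵣ t n) → l ≈ᵣ m → Limᵣ s l → Limᵣ t m
  limᵣ-resp {s} {t} {l} {m} s≈t l≈m L = mkLimᵣ λ ε 0<ε →
    let 0<δ = ½-pos 0<ε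
        0<η = ½-pos 0<δ
        N , h = eventually L (½ ℚ.* (½ ℚ.* ε)) 0<η
    in N , λ n p → within-trans {ε} {t n} {s n} {m} (within-sym {_} {s n} {t n} (close (s≈t n) (½ ℚ.* ε) 0<δ))
         (within-trans {_} {s n} {l} {m} (h n p) (close l≈m (½ ℚ.* (½ ℚ.* ε)) 0<η))

  limᵣ-const : ∀ x → Limᵣ (λ _ → x) x
  limᵣ-const x = mkLimᵣ λ ε 0<ε → 0 , λ _ _ → 0 , λ i _ → <l (sym (∣a-a∣ (seq x i))) 0<ε

  limᵣ-unique : ∀ {s l m} → Limᵣ s l → Limᵣ s m → l ≈ᵣ m
  limᵣ-unique {s} {l} {m} L M = mk≈ λ ε 0<ε →
    let N₁ , h₁ = eventually L (½ ℚ.* ε) (½-pos 0<ε)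
        N₂ , h₂ = eventually M (½ ℚ.* ε) (½-pos 0<ε)
        n = N₁ ℕ.⊔ N₂
    in within-trans {ε} {l} {s n} {m} (within-sym {_} {s n} {l} (h₁ n (⊔ˡ {N₁} {N₂} ℕₚ.≤-refl)))
         (h₂ n (⊔ʳ {N₁} {N₂} ℕₚ.≤-refl))

  limᵣ-+ : ∀ {s t l m} → Limᵣ s l → Limᵣ t m → Limᵣ (λ n → s n +ᵣ t n) (l +ᵣ m)
  limᵣ-+ {s} {t} {l} {m} L M = mkLimᵣ λ ε 0<ε →
    let N₁ , h₁ = eventually L (½ ℚ.* ε) (½-pos 0<ε)
        N₂ , h₂ = eventually M (½ ℚ.* ε) (½-pos 0<ε)
    in N₁ ℕ.⊔ N₂ , λ n p →
       let I₁ , f₁ = h₁ n (⊔ˡ {N₁} {N₂} p)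
           I₂ , f₂ = h₂ n (⊔ʳ {N₁} {N₂} p)
       in I₁ ℕ.⊔ I₂ , λ i q → <r (½+½ ε) (∣+-+∣ (seq (s n) i) (seq (t n) i) (seq l i) (seq m i)
            (f₁ i (⊔ˡ {I₁} {I₂} q)) (f₂ i (⊔ʳ {I₁} {I₂} q)))

  limᵣ-neg : ∀ {s l} → Limᵣ s l → Limᵣ (λ n → -ᵣ s n) (-ᵣ l)
  limᵣ-neg {s} {l} L = mkLimᵣ λ ε 0<ε →
    let N , h = eventually L ε 0<ε
    in N , λ n p → proj₁ (h n p) , λ i q → <l (sym (∣neg-neg∣ (seq (s n) i) (seq l i))) (proj₂ (h n p) i q)

  limᵣ-* : ∀ {s t l m} → Limᵣ s l → Limᵣ t m → Limᵣ (λ n → s n *ᵣ t n) (l *ᵣ m)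
  limᵣ-* {s} {t} {l} {m} L M = mkLimᵣ go
    where
      -- The added 1 makes B a bound for `s n` too, once `s n` is within 1 of the limit.
      B C : ℚ
      B = proj₁ (bounded (seq l) (cauchy l)) ℚ.+ 1ℚ
      C = proj₁ (bounded (seq m) (cauchy m))
      J K : ℕ
      J = proj₁ (proj₂ (proj₂ (bounded (seq l) (cauchy l))))
      K = proj₁ (proj₂ (proj₂ (bounded (seq m) (cauchy m))))
      0<C : 0ℚ ℚ.< C
      0<C = proj₁ (proj₂ (bounded (seq m) (cauchy m)))
      0<B : 0ℚ ℚ.< B
      0<B = +ε-pos (proj₁ (proj₂ (bounded (seq l) (cauchy l)))) 0<1
      l≤ : ∀ i → J ℕ.≤ i → ℚ.∣ seq l i ∣ ℚ.≤ proj₁ (bounded (seq l) (cauchy l))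
      l≤ = proj₂ (proj₂ (proj₂ (bounded (seq l) (cauchy l))))
      m≤ : ∀ i → K ℕ.≤ i → ℚ.∣ seq m i ∣ ℚ.≤ C
      m≤ = proj₂ (proj₂ (proj₂ (bounded (seq m) (cauchy m))))
      open +-*-Solver
      lem : ∀ a b → b ℚ.+ (a ℚ.- b) ≡ a
      lem = solve 2 (λ a b → b :+ (a :- b) := a) refl
      bound : ∀ a b → ℚ.∣ b ∣ ℚ.≤ proj₁ (bounded (seq l) (cauchy l)) → ℚ.∣ a ℚ.- b ∣ ℚ.< 1ℚ → ℚ.∣ a ∣ ℚ.≤ B
      bound a b p q = ℚₚ.≤-trans (≤l (cong ℚ.∣_∣ (lem a b)) (ℚₚ.∣p+q∣≤∣p∣+∣q∣ b (a ℚ.- b)))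
                        (ℚₚ.+-mono-≤ p (ℚₚ.<⇒≤ q))
      go : ∀ ε → 0ℚ ℚ.< ε → ∃ λ N → ∀ n → N ℕ.≤ n → Within ε (s n *ᵣ t n) (l *ᵣ m)
      go ε 0<ε =
        let N₀ , h₀ = eventually L 1ℚ 0<1
            N₁ , h₁ = eventually L ((½ ℚ.* ε) ℚ.* invℚ C) (*ε-pos (½-pos 0<ε) (invℚ-pos 0<C))
            N₂ , h₂ = eventually M ((½ ℚ.* ε) ℚ.* invℚ B) (*ε-pos (½-pos 0<ε) (invℚ-pos 0<B))
        in N₀ ℕ.⊔ (N₁ ℕ.⊔ N₂) , λ n p →
           let p' = ⊔ʳ {N₀} {N₁ ℕ.⊔ N₂} p
               I₀ , f₀ = h₀ n (⊔ˡ {N₀} {N₁ ℕ.⊔ N₂} p)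
               I₁ , f₁ = h₁ n (⊔ˡ {N₁} {N₂} p')
               I₂ , f₂ = h₂ n (⊔ʳ {N₁} {N₂} p')
               R = (I₀ ℕ.⊔ I₁) ℕ.⊔ (I₂ ℕ.⊔ (J ℕ.⊔ K))
           in R , λ i q →
              let qˡ = ⊔ˡ {I₀ ℕ.⊔ I₁} {I₂ ℕ.⊔ (J ℕ.⊔ K)} q
                  qʳ = ⊔ʳ {I₀ ℕ.⊔ I₁} {I₂ ℕ.⊔ (J ℕ.⊔ K)} q
                  q₂ = ⊔ʳ {I₂} {J ℕ.⊔ K} qʳ
              in <r (trans (cong₂ ℚ._+_ (cancel-inv (½ ℚ.* ε) 0<B) (cancel-inv (½ ℚ.* ε) 0<C)) (½+½ ε))
                 (∣*-*∣ (seq (s n) i) (seq (t n) i) (seq l i) (seq m i) 0<B 0<C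
                   (bound (seq (s n) i) (seq l i) (l≤ i (⊔ˡ {J} {K} q₂)) (f₀ i (⊔ˡ {I₀} {I₁} qˡ)))
                   (m≤ i (⊔ʳ {J} {K} q₂))
                   (f₂ i (⊔ˡ {I₂} {J ℕ.⊔ K} qʳ)) (f₁ i (⊔ʳ {I₀} {I₁} qˡ)))

  limᵣ-inv : ∀ {s l} (p : ∀ n → 0ᵣ <ᵣ s n) (q : 0ᵣ <ᵣ l) → Limᵣ s l →
             Limᵣ (λ n → invᵣ (s n) (p n)) (invᵣ l q)
  limᵣ-inv {s} {l} p (mk< g 0<g K sep) L = mkLimᵣ λ ε 0<ε →
    let N₁ , h₁ = eventually L e 0<e
        N₂ , h₂ = eventually L (ε ℚ.* invℚ (invℚ e ℚ.* invℚ e)) (*ε-pos 0<ε (invℚ-pos 0<e²))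
    in N₁ ℕ.⊔ N₂ , λ n r →
       let I₁ , f₁ = h₁ n (⊔ˡ {N₁} {N₂} r)
           I₂ , f₂ = h₂ n (⊔ʳ {N₁} {N₂} r)
       in K ℕ.⊔ (I₁ ℕ.⊔ I₂) , λ i u →
          let u' = ⊔ʳ {K} {I₁ ℕ.⊔ I₂} u
              g≤ = ≤l (ℚₚ.+-identityˡ g) (sep i (⊔ˡ {K} {I₁ ℕ.⊔ I₂} u))
          in <r (cancel-inv ε 0<e²) (∣inv-inv∣ 0<e (lower (seq (s n) i) (seq l i) g≤ (f₁ i (⊔ˡ {I₁} {I₂} u')))
               (ℚₚ.≤-trans e≤g g≤) (f₂ i (⊔ʳ {I₁} {I₂} u')))
    where
      -- Half of the gap bounds both the limit and, eventually, the terms from below; inversion is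
      -- Lipschitz above it.
      e : ℚ
      e = ½ ℚ.* g
      0<e : 0ℚ ℚ.< e
      0<e = ½-pos 0<g
      0<e² : 0ℚ ℚ.< invℚ e ℚ.* invℚ e
      0<e² = *ε-pos (invℚ-pos 0<e) (invℚ-pos 0<e)
      e≤g : e ℚ.≤ g
      e≤g = ≤l (ℚₚ.+-identityʳ e) (≤r (½+½ g) (ℚₚ.+-monoʳ-≤ e (ℚₚ.<⇒≤ 0<e)))
      open +-*-Solver
      lem : ∀ a b → (b ℚ.- (b ℚ.- a)) ≡ a
      lem = solve 2 (λ a b → b :- (b :- a) := a) refl
      lem₂ : ∀ g → g ℚ.- ½ ℚ.* g ≡ ½ ℚ.* g
      lem₂ = solve 1 (λ g → g :- con ½ :* g := con ½ :* g) refl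
      lower : ∀ a b → g ℚ.≤ b → ℚ.∣ a ℚ.- b ∣ ℚ.< e → e ℚ.≤ a
      lower a b g≤b d = ≤l (lem₂ g) (≤r (lem a b) (ℚₚ.+-mono-≤ g≤b (ℚₚ.neg-antimono-≤
        (ℚₚ.≤-trans (≤∣∣ (b ℚ.- a)) (ℚₚ.<⇒≤ (<l (∣-∣-comm a b) d))))))

  limᵣ-fromℚ : ∀ {t : ℕ → ℚ} → (∀ ε → 0ℚ ℚ.< ε → ∃ λ N → ∀ n → N ℕ.≤ n → ℚ.∣ t n ∣ ℚ.< ε) →
               Limᵣ (λ n → fromℚ (t n)) 0ᵣ
  limᵣ-fromℚ {t} h = mkLimᵣ λ ε 0<ε → proj₁ (h ε 0<ε) , λ n p → 0 , λ _ _ →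
    <l (cong ℚ.∣_∣ (sym (ℚₚ.+-identityʳ (t n)))) (proj₂ (h ε 0<ε) n p)

record Lim (s : ℕ → ℂ) (l : ℂ) : Set where
  constructor mkLim
  field
    lim-re : Limᵣ (λ n → re (s n)) (re l)
    lim-im : Limᵣ (λ n → im (s n)) (im l)

lim-resp : ∀ {s t l m} → (∀ n → s n ≈ t n) → l ≈ m → Lim s l → Lim t m
lim-resp p q (mkLim r i) = mkLim (limᵣ-resp (λ n → re≈ (p n)) (re≈ q) r) (limᵣ-resp (λ n → im≈ (p n)) (im≈ q) i)

lim-const : ∀ z → Lim (λ _ → z) z
lim-const z = mkLim (limᵣ-const (re z)) (limᵣ-const (im z))

lim-unique : ∀ {s l m} → Lim s l → Lim s m → l ≈ m
lim-unique (mkLim r i) (mkLim r' i') = limᵣ-unique r r' , limᵣ-unique i i'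

lim-+ : ∀ {s t l m} → Lim s l → Lim t m → Lim (λ n → s n + t n) (l + m)
lim-+ (mkLim r i) (mkLim r' i') = mkLim (limᵣ-+ r r') (limᵣ-+ i i')

lim-neg : ∀ {s l} → Lim s l → Lim (λ n → - s n) (- l)
lim-neg (mkLim r i) = mkLim (limᵣ-neg r) (limᵣ-neg i)

lim-* : ∀ {s t l m} → Lim s l → Lim t m → Lim (λ n → s n * t n) (l * m)
lim-* (mkLim r i) (mkLim r' i') = mkLim (limᵣ-+ (limᵣ-* r r') (limᵣ-neg (limᵣ-* i i')))
                                        (limᵣ-+ (limᵣ-* r i') (limᵣ-* i r'))

lim-difference : ∀ {s t l m} → Lim s l → Lim t m → Lim (λ n → s n - t n) (l - m)
lim-difference L M = lim-+ L (lim-neg M)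

lim-ι : ∀ {s l} → Limᵣ s l → Lim (λ n → ι (s n)) (ι l)
lim-ι L = mkLim L (limᵣ-const 0ᵣ)

lim-invᶜ : ∀ {s l} (p : ∀ n → 0ᵣ <ᵣ ∣ s n ∣²) (q : 0ᵣ <ᵣ ∣ l ∣²) → Lim s l →
           Lim (λ n → invᶜ (s n) (p n)) (invᶜ l q)
lim-invᶜ p q (mkLim r i) = mkLim (limᵣ-* r inv) (limᵣ-* (limᵣ-neg i) inv)
  where inv = limᵣ-inv p q (limᵣ-+ (limᵣ-* r r) (limᵣ-* i i))

opaque
  ⟶⇒lim : ∀ {s l} → s ⟶ l → Lim s l
  ⟶⇒lim {s} {l} h = mkLim (mkLimᵣ λ ε 0<ε → N ε 0<ε , λ n p → Dre ε 0<ε n (get ε 0<ε n p))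
                          (mkLimᵣ λ ε 0<ε → N ε 0<ε , λ n p → Dim ε 0<ε n (get ε 0<ε n p))
    where
      N : ∀ ε → 0ℚ ℚ.< ε → ℕ
      N ε 0<ε = proj₁ (h (fromℚ ε) (>0-fromℚ 0<ε))
      get : ∀ ε 0<ε n → N ε 0<ε ℕ.≤ n → ∣ s n - l ∣² <ᵣ fromℚ ε *ᵣ fromℚ ε
      get ε 0<ε = proj₂ (h (fromℚ ε) (>0-fromℚ 0<ε))
      module _ (ε : ℚ) (0<ε : 0ℚ ℚ.< ε) (n : ℕ) where
        x y : ℕ → ℚ
        x i = seq (re (s n - l)) i
        y i = seq (im (s n - l)) i
        drop : ∀ u v g → 0ℚ ℚ.< g → 0ℚ ℚ.≤ v → (u ℚ.+ v) ℚ.+ g ℚ.≤ ε ℚ.* ε → u ℚ.< ε ℚ.* ε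
        drop u v g 0<g 0≤v r = ℚₚ.≤-<-trans
          (≤l (ℚₚ.+-identityʳ u) (ℚₚ.+-monoʳ-≤ u 0≤v))
          (ℚₚ.<-≤-trans (<l (ℚₚ.+-identityʳ (u ℚ.+ v)) (ℚₚ.+-monoʳ-< (u ℚ.+ v) 0<g)) r)
        Dre : ∣ s n - l ∣² <ᵣ fromℚ ε *ᵣ fromℚ ε → Within ε (re (s n)) (re l)
        Dre (mk< g 0<g K sep) = K , λ i q → sq<⇒∣∣< 0<ε
          (drop (x i ℚ.* x i) (y i ℚ.* y i) g 0<g (0≤a² (y i)) (sep i q))
        Dim : ∣ s n - l ∣² <ᵣ fromℚ ε *ᵣ fromℚ ε → Within ε (im (s n)) (im l)
        Dim (mk< g 0<g K sep) = K , λ i q → sq<⇒∣∣< 0<ε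
          (drop (y i ℚ.* y i) (x i ℚ.* x i) g 0<g (0≤a² (x i))
            (≤l (cong (ℚ._+ g) (ℚₚ.+-comm (x i ℚ.* x i) (y i ℚ.* y i))) (sep i q)))

-- The exponential function

module Convolution (R : CommutativeRing 0ℓ 0ℓ) where
  private
    module R = CommutativeRing R
  open R using (Carrier; 0#; 1#) renaming (_≈_ to _≃_; _+_ to _⊕_; _*_ to _⊗_; -_ to ⊖_)
  open SetoidReasoning R.setoid

  Σ< : (ℕ → Carrier) → ℕ → Carrier
  Σ< f zero    = 0#
  Σ< f (suc n) = Σ< f n ⊕ f n

  +-interchange : ∀ a b c d → (a ⊕ b) ⊕ (c ⊕ d) ≃ (a ⊕ c) ⊕ (b ⊕ d)
  +-interchange a b c d = begin
    (a ⊕ b) ⊕ (c ⊕ d) ≈⟨ R.+-assoc a b (c ⊕ d) ⟩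
    a ⊕ (b ⊕ (c ⊕ d)) ≈⟨ R.+-congˡ (R.+-assoc b c d) ⟨
    a ⊕ ((b ⊕ c) ⊕ d) ≈⟨ R.+-congˡ (R.+-congʳ (R.+-comm b c)) ⟩
    a ⊕ ((c ⊕ b) ⊕ d) ≈⟨ R.+-congˡ (R.+-assoc c b d) ⟩
    a ⊕ (c ⊕ (b ⊕ d)) ≈⟨ R.+-assoc a c (b ⊕ d) ⟨
    (a ⊕ c) ⊕ (b ⊕ d) ∎

  Σ<-cong : ∀ {f g} n → (∀ i → i ℕ.< n → f i ≃ g i) → Σ< f n ≃ Σ< g n
  Σ<-cong zero    h = R.refl
  Σ<-cong (suc n) h = R.+-cong (Σ<-cong n λ i p → h i (ℕₚ.m≤n⇒m≤1+n p)) (h n ℕₚ.≤-refl)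

  Σ<-+ : ∀ f g n → Σ< (λ i → f i ⊕ g i) n ≃ Σ< f n ⊕ Σ< g n
  Σ<-+ f g zero    = R.sym (R.+-identityˡ 0#)
  Σ<-+ f g (suc n) = R.trans (R.+-congʳ (Σ<-+ f g n)) (+-interchange (Σ< f n) (Σ< g n) (f n) (g n))

  Σ<-*ˡ : ∀ x f n → Σ< (λ i → x ⊗ f i) n ≃ x ⊗ Σ< f n
  Σ<-*ˡ x f zero    = R.sym (R.zeroʳ x)
  Σ<-*ˡ x f (suc n) = R.trans (R.+-congʳ (Σ<-*ˡ x f n)) (R.sym (R.distribˡ x (Σ< f n) (f n)))

  Σ<-*ʳ : ∀ x f n → Σ< (λ i → f i ⊗ x) n ≃ Σ< f n ⊗ x
  Σ<-*ʳ x f zero    = R.sym (R.zeroˡ x)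
  Σ<-*ʳ x f (suc n) = R.trans (R.+-congʳ (Σ<-*ʳ x f n)) (R.sym (R.distribʳ x (Σ< f n) (f n)))

  Σ<-head : ∀ f n → Σ< f (suc n) ≃ f 0 ⊕ Σ< (λ i → f (suc i)) n
  Σ<-head f zero    = R.+-comm 0# (f 0)
  Σ<-head f (suc n) = R.trans (R.+-congʳ (Σ<-head f n)) (R.+-assoc (f 0) _ _)

  infixl 7 _⋆_
  _⋆_ : (ℕ → Carrier) → (ℕ → Carrier) → ℕ → Carrier
  (u ⋆ v) n = Σ< (λ i → u i ⊗ v (n ℕ.∸ i)) (suc n)

  -- The products u i * v j with i + j < n, grouped by i. Grouped by i + j they give the partial sum
  -- of the convolution.
  triangle : (ℕ → Carrier) → (ℕ → Carrier) → ℕ → Carrier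
  triangle u v n = Σ< (λ i → u i ⊗ Σ< v (n ℕ.∸ i)) n

  triangle-⋆ : ∀ u v n → triangle u v n ≃ Σ< (u ⋆ v) n
  triangle-⋆ u v zero    = R.refl
  triangle-⋆ u v (suc n) = begin
    Σ< (λ i → u i ⊗ Σ< v (suc n ℕ.∸ i)) (suc n)
      ≈⟨ Σ<-cong (suc n) (λ { i (s≤s i≤n) → R.trans
           (R.*-congˡ (R.reflexive (cong (Σ< v) (ℕₚ.+-∸-assoc 1 i≤n)))) (R.distribˡ (u i) _ _) }) ⟩
    Σ< (λ i → u i ⊗ Σ< v (n ℕ.∸ i) ⊕ u i ⊗ v (n ℕ.∸ i)) (suc n)
      ≈⟨ Σ<-+ _ _ (suc n) ⟩
    (triangle u v n ⊕ u n ⊗ Σ< v (n ℕ.∸ n)) ⊕ (u ⋆ v) n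
      ≈⟨ R.+-congʳ (R.+-cong (triangle-⋆ u v n)
           (R.trans (R.*-congˡ (R.reflexive (cong (Σ< v) (ℕₚ.n∸n≡0 n)))) (R.zeroʳ (u n)))) ⟩
    (Σ< (u ⋆ v) n ⊕ 0#) ⊕ (u ⋆ v) n ≈⟨ R.+-congʳ (R.+-identityʳ _) ⟩
    Σ< (u ⋆ v) n ⊕ (u ⋆ v) n ∎

  -- The square i, j < n is cut along the antidiagonal; the first sum on the right collects the part
  -- i + j ≥ n, which has to be shown to be negligible.
  square-triangle : ∀ u v n → Σ< u n ⊗ Σ< v n
    ≃ Σ< (λ i → u i ⊗ (Σ< v n ⊕ ⊖ Σ< v (n ℕ.∸ i))) n ⊕ Σ< (u ⋆ v) n
  square-triangle u v n = begin
    Σ< u n ⊗ Σ< v n ≈⟨ Σ<-*ʳ (Σ< v n) u n ⟨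
    Σ< (λ i → u i ⊗ Σ< v n) n
      ≈⟨ Σ<-cong n (λ i _ → R.trans (R.*-congˡ (split (Σ< v n) (Σ< v (n ℕ.∸ i)))) (R.distribˡ (u i) _ _)) ⟩
    Σ< (λ i → u i ⊗ (Σ< v n ⊕ ⊖ Σ< v (n ℕ.∸ i)) ⊕ u i ⊗ Σ< v (n ℕ.∸ i)) n ≈⟨ Σ<-+ _ _ n ⟩
    Σ< (λ i → u i ⊗ (Σ< v n ⊕ ⊖ Σ< v (n ℕ.∸ i))) n ⊕ triangle u v n ≈⟨ R.+-congˡ (triangle-⋆ u v n) ⟩
    Σ< (λ i → u i ⊗ (Σ< v n ⊕ ⊖ Σ< v (n ℕ.∸ i))) n ⊕ Σ< (u ⋆ v) n ∎
    where
      split : ∀ a b → a ≃ (a ⊕ ⊖ b) ⊕ b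
      split a b = R.sym (R.trans (R.+-assoc a (⊖ b) b) (R.trans (R.+-congˡ (R.-‿inverseˡ b)) (R.+-identityʳ a)))

  -- Exponential series are characterised by a recursion instead of a formula with factorials. Since
  -- `N` is additive, a Cauchy product satisfies the recursion for x + y by the Leibniz rule, and
  -- uniqueness then takes the place of the binomial theorem. The ring is a parameter because the
  -- series over `ℂ` and their majorants over `ℚ` are both treated this way.
  module ExpLike (N κ : ℕ → Carrier) (N-0 : N 0 ≃ 0#) (N-+ : ∀ m n → N (m ℕ.+ n) ≃ N m ⊕ N n)
                 (κN : ∀ n → κ n ⊗ N (suc n) ≃ 1#) where

    record IsExp (x : Carrier) (u : ℕ → Carrier) : Set where
      field
        at-0   : u 0 ≃ 1#
        at-suc : ∀ n → N (suc n) ⊗ u (suc n) ≃ x ⊗ u n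

    cancel-N : ∀ n y → κ n ⊗ (N (suc n) ⊗ y) ≃ y
    cancel-N n y = R.trans (R.sym (R.*-assoc _ _ _)) (R.trans (R.*-congʳ (κN n)) (R.*-identityˡ y))

    exp-unique : ∀ {x u v} → IsExp x u → IsExp x v → ∀ n → u n ≃ v n
    exp-unique U V zero    = R.trans (IsExp.at-0 U) (R.sym (IsExp.at-0 V))
    exp-unique {x} {u} {v} U V (suc n) = begin
      u (suc n)                       ≈⟨ cancel-N n _ ⟨
      κ n ⊗ (N (suc n) ⊗ u (suc n))   ≈⟨ R.*-congˡ (IsExp.at-suc U n) ⟩
      κ n ⊗ (x ⊗ u n)                 ≈⟨ R.*-congˡ (R.*-congˡ (exp-unique U V n)) ⟩
      κ n ⊗ (x ⊗ v n)                 ≈⟨ R.*-congˡ (IsExp.at-suc V n) ⟨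
      κ n ⊗ (N (suc n) ⊗ v (suc n))   ≈⟨ cancel-N n _ ⟩
      v (suc n)                       ∎

    ⋆-exp : ∀ {x y u v} → IsExp x u → IsExp y v → IsExp (x ⊕ y) (u ⋆ v)
    ⋆-exp {x} {y} {u} {v} U V = record
      { at-0   = R.trans (R.+-identityˡ _) (R.trans (R.*-cong (IsExp.at-0 U) (IsExp.at-0 V)) (R.*-identityˡ 1#))
      ; at-suc = λ n → begin
          N (suc n) ⊗ (u ⋆ v) (suc n) ≈⟨ Σ<-*ˡ (N (suc n)) _ (suc (suc n)) ⟨
          Σ< (λ i → N (suc n) ⊗ (u i ⊗ v (suc n ℕ.∸ i))) (suc (suc n))
            ≈⟨ Σ<-cong (suc (suc n)) (λ { i (s≤s i≤) → Leibniz n i i≤ }) ⟩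
          Σ< (λ i → (N i ⊗ u i) ⊗ v (suc n ℕ.∸ i) ⊕ u i ⊗ (N (suc n ℕ.∸ i) ⊗ v (suc n ℕ.∸ i))) (suc (suc n))
            ≈⟨ Σ<-+ _ _ (suc (suc n)) ⟩
          Σ< (λ i → (N i ⊗ u i) ⊗ v (suc n ℕ.∸ i)) (suc (suc n))
            ⊕ Σ< (λ i → u i ⊗ (N (suc n ℕ.∸ i) ⊗ v (suc n ℕ.∸ i))) (suc (suc n))
            ≈⟨ R.+-cong (left n) (right n) ⟩
          x ⊗ (u ⋆ v) n ⊕ y ⊗ (u ⋆ v) n ≈⟨ R.distribʳ _ x y ⟨
          (x ⊕ y) ⊗ (u ⋆ v) n ∎ }
      where
        swap : ∀ a b c → a ⊗ (b ⊗ c) ≃ b ⊗ (a ⊗ c)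
        swap a b c = R.trans (R.sym (R.*-assoc a b c)) (R.trans (R.*-congʳ (R.*-comm a b)) (R.*-assoc b a c))
        Leibniz : ∀ n i → i ℕ.≤ suc n → N (suc n) ⊗ (u i ⊗ v (suc n ℕ.∸ i))
          ≃ (N i ⊗ u i) ⊗ v (suc n ℕ.∸ i) ⊕ u i ⊗ (N (suc n ℕ.∸ i) ⊗ v (suc n ℕ.∸ i))
        Leibniz n i i≤ = R.trans
          (R.*-congʳ (R.trans (R.reflexive (cong N (sym (ℕₚ.m+[n∸m]≡n i≤)))) (N-+ i (suc n ℕ.∸ i))))
          (R.trans (R.distribʳ _ _ _) (R.+-cong (R.sym (R.*-assoc _ _ _)) (swap _ _ _)))
        left : ∀ n → Σ< (λ i → (N i ⊗ u i) ⊗ v (suc n ℕ.∸ i)) (suc (suc n)) ≃ x ⊗ (u ⋆ v) n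
        left n = begin
          Σ< (λ i → (N i ⊗ u i) ⊗ v (suc n ℕ.∸ i)) (suc (suc n)) ≈⟨ Σ<-head _ (suc n) ⟩
          (N 0 ⊗ u 0) ⊗ v (suc n) ⊕ Σ< (λ i → (N (suc i) ⊗ u (suc i)) ⊗ v (n ℕ.∸ i)) (suc n)
            ≈⟨ R.+-cong (R.trans (R.*-congʳ (R.trans (R.*-congʳ N-0) (R.zeroˡ _))) (R.zeroˡ _))
                 (Σ<-cong (suc n) λ i _ → R.trans (R.*-congʳ (IsExp.at-suc U i)) (R.*-assoc x _ _)) ⟩
          0# ⊕ Σ< (λ i → x ⊗ (u i ⊗ v (n ℕ.∸ i))) (suc n) ≈⟨ R.+-identityˡ _ ⟩
          Σ< (λ i → x ⊗ (u i ⊗ v (n ℕ.∸ i))) (suc n) ≈⟨ Σ<-*ˡ x _ (suc n) ⟩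
          x ⊗ (u ⋆ v) n ∎
        right : ∀ n → Σ< (λ i → u i ⊗ (N (suc n ℕ.∸ i) ⊗ v (suc n ℕ.∸ i))) (suc (suc n)) ≃ y ⊗ (u ⋆ v) n
        right n = begin
          Σ< (λ i → u i ⊗ (N (suc n ℕ.∸ i) ⊗ v (suc n ℕ.∸ i))) (suc n)
            ⊕ u (suc n) ⊗ (N (n ℕ.∸ n) ⊗ v (n ℕ.∸ n))
            ≈⟨ R.+-cong (Σ<-cong (suc n) λ { i (s≤s i≤n) → R.trans
                   (R.*-congˡ (R.trans (R.reflexive (cong (λ m → N m ⊗ v m) (ℕₚ.+-∸-assoc 1 i≤n)))
                     (IsExp.at-suc V (n ℕ.∸ i)))) (swap _ y _) })
                 (R.trans (R.*-congˡ (R.trans (R.*-congʳ (R.trans (R.reflexive (cong N (ℕₚ.n∸n≡0 n))) N-0))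
                   (R.zeroˡ _))) (R.zeroʳ _)) ⟩
          Σ< (λ i → y ⊗ (u i ⊗ v (n ℕ.∸ i))) (suc n) ⊕ 0# ≈⟨ R.+-identityʳ _ ⟩
          Σ< (λ i → y ⊗ (u i ⊗ v (n ℕ.∸ i))) (suc n) ≈⟨ Σ<-*ˡ y _ (suc n) ⟩
          y ⊗ (u ⋆ v) n ∎

/1≡natℚ : ∀ n → + n ℚ./ 1 ≡ natℚ n
/1≡natℚ n = help
  where
    opaque
      unfolding natℚ
      help : + n ℚ./ 1 ≡ natℚ n
      help = ℚₚ.↥p/↧p≡p (natℚ n)

recip-inverse : ∀ n → recip (suc n) ℚ.* (+ suc n ℚ./ 1) ≡ 1ℚ
recip-inverse n = trans (ℚₚ.*-comm (recip (suc n)) _) (trans (cong (ℚ._* recip (suc n)) (/1≡natℚ (suc n))) (recip-suc n))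

ℤ-inverse : ∀ m → m ≢ + 0 → ∃ λ x → x *ᵣ fromℤ m ≈ᵣ 1ᵣ
ℤ-inverse (+ zero)    m≢0 = ⊥-elim (m≢0 refl)
ℤ-inverse (+ suc n)   m≢0 = fromℚ (recip (suc n)) , ≡⇒≈ᵣ λ _ → recip-inverse n
ℤ-inverse (-[1+ n ])  m≢0 = -ᵣ fromℚ (recip (suc n)) , ℝr.trans (ℝr.*-congˡ (fromℤ-neg (+ suc n)))
  (ℝr.trans (solveℤ 2 (λ x y → (:- x) :* (:- y) ≔ x :* y) refl (fromℚ (recip (suc n)) ∷ fromℤ (+ suc n) ∷ []))
    (≡⇒≈ᵣ λ _ → recip-inverse n))
  where open ℝ-Solver

module ℂ-Conv = Convolution ℂ-commutativeRing
module ℚ-Conv = Convolution ℚₚ.+-*-commutativeRing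

κᶜ : ℕ → ℂ
κᶜ n = ι (fromℚ (recip (suc n)))

κN≈1 : ∀ n → κᶜ n * ιℤ (+ suc n) ≈ 1ᶜ
κN≈1 n = ≈-trans (≈-sym (ι-* _ _)) (ι-cong (≡⇒≈ᵣ λ _ → recip-inverse n))

open ℂ-Conv.ExpLike (λ n → ιℤ (+ n)) κᶜ ≈-refl (λ m n → ≈-trans (ι-cong (fromℤ-+ (+ m) (+ n))) (ι-+ _ _)) κN≈1
  using () renaming (IsExp to IsExpᶜ; exp-unique to expᶜ-unique; ⋆-exp to ⋆-expᶜ)
open ℚ-Conv.ExpLike (λ n → + n ℚ./ 1) (λ n → recip (suc n)) refl (λ m n → /1-+ (+ m) (+ n)) recip-inverse
  using () renaming (IsExp to IsExpℚ; exp-unique to expℚ-unique; ⋆-exp to ⋆-expℚ)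

expTerm-isExp : ∀ z → IsExpᶜ z (expTerm z)
expTerm-isExp z = record { at-0 = ℂr.*-identityʳ 1ᶜ ; at-suc = step }
  where
    open ℂ-Solver
    step : ∀ n → ιℤ (+ suc n) * expTerm z (suc n) ≈ z * expTerm z n
    step n = ≈-trans
      (ℂr.*-congˡ (ℂr.*-congʳ (≈-trans (ι-cong (≡⇒≈ᵣ λ _ → recip-* (suc n) (n !) {{_}} {{n ℕₚ.!≢0}} {{suc n ℕₚ.!≢0}})) (ι-* _ _))))
      (≈-trans (solveℤ 5 (λ N k r z p → N :* ((k :* r) :* (z :* p)) ≔ (k :* N) :* (z :* (r :* p))) refl
                 (ιℤ (+ suc n) ∷ κᶜ n ∷ ι (fromℚ (recip (n !) {{n ℕₚ.!≢0}})) ∷ z ∷ (z ^ n) ∷ []))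
        (≈-trans (ℂr.*-congʳ (κN≈1 n)) (ℂr.*-identityˡ _)))

private
  module E = ExpConvergence 0ᶜ

expℚ-isExp : ∀ q → IsExpℚ q (E.b q)
expℚ-isExp q = record { at-0 = refl ; at-suc = λ n → trans (cong ((+ suc n ℚ./ 1) ℚ.*_) (E.b-suc {q} n))
  (trans (lem (+ suc n ℚ./ 1) (recip (suc n)) q (E.b q n))
    (trans (cong (ℚ._* (q ℚ.* E.b q n)) (recip-inverse n)) (ℚₚ.*-identityˡ _))) }
  where
    open +-*-Solver
    lem : ∀ N k q b → N ℚ.* ((q ℚ.* k) ℚ.* b) ≡ (k ℚ.* N) ℚ.* (q ℚ.* b)
    lem = solve 4 (λ N k q b → N :* ((q :* k) :* b) := (k :* N) :* (q :* b)) refl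

-- The majorants involve only the bound q and not the point z, so the instance at 0 serves for all
-- points.
b-indep : ∀ z q n → ExpConvergence.b z q n ≡ E.b q n
b-indep z q n = cong (E.r n ℚ.*_) (go n)
  where
    go : ∀ n → ExpConvergence.bnd z q n ≡ E.bnd q n
    go zero    = refl
    go (suc n) = cong (q ℚ.*_) (go n)

n₁-+ : ∀ z w i → n₁ (z + w) i ℚ.≤ n₁ z i ℚ.+ n₁ w i
n₁-+ z w i = ≤r (lem ℚ.∣ seq (re z) i ∣ ℚ.∣ seq (re w) i ∣ ℚ.∣ seq (im z) i ∣ ℚ.∣ seq (im w) i ∣)
  (ℚₚ.+-mono-≤ (ℚₚ.∣p+q∣≤∣p∣+∣q∣ (seq (re z) i) (seq (re w) i)) (ℚₚ.∣p+q∣≤∣p∣+∣q∣ (seq (im z) i) (seq (im w) i)))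
  where
    open +-*-Solver
    lem : ∀ a b c d → (a ℚ.+ b) ℚ.+ (c ℚ.+ d) ≡ (a ℚ.+ c) ℚ.+ (b ℚ.+ d)
    lem = solve 4 (λ a b c d → (a :+ b) :+ (c :+ d) := (a :+ c) :+ (b :+ d)) refl

lim-0 : ∀ {s : ℕ → ℂ} → (∀ ε → 0ℚ ℚ.< ε → ∃ λ N → ∀ n → N ℕ.≤ n → ∃ λ I → ∀ i → I ℕ.≤ i → n₁ (s n) i ℚ.< ε) → Lim s 0ᶜ
lim-0 {s} h = mkLim
    (mkLimᵣ λ ε 0<ε → proj₁ (h ε 0<ε) , λ n p → proj₁ (proj₂ (h ε 0<ε) n p) , λ i q →
      <l (cong ℚ.∣_∣ (sym (ℚₚ.+-identityʳ (seq (re (s n)) i))))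
        (ℚₚ.≤-<-trans (re≤ n i) (proj₂ (proj₂ (h ε 0<ε) n p) i q)))
    (mkLimᵣ λ ε 0<ε → proj₁ (h ε 0<ε) , λ n p → proj₁ (proj₂ (h ε 0<ε) n p) , λ i q →
      <l (cong ℚ.∣_∣ (sym (ℚₚ.+-identityʳ (seq (im (s n)) i))))
        (ℚₚ.≤-<-trans (im≤ n i) (proj₂ (proj₂ (h ε 0<ε) n p) i q)))
  where
    re≤ : ∀ n i → ℚ.∣ seq (re (s n)) i ∣ ℚ.≤ n₁ (s n) i
    re≤ n i = ≤l (ℚₚ.+-identityʳ _) (ℚₚ.+-monoʳ-≤ ℚ.∣ seq (re (s n)) i ∣ (ℚₚ.0≤∣p∣ (seq (im (s n)) i)))
    im≤ : ∀ n i → ℚ.∣ seq (im (s n)) i ∣ ℚ.≤ n₁ (s n) i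
    im≤ n i = ≤l (ℚₚ.+-identityˡ _) (ℚₚ.+-monoˡ-≤ ℚ.∣ seq (im (s n)) i ∣ (ℚₚ.0≤∣p∣ (seq (re (s n)) i)))

open ℚ-Conv using () renaming (Σ< to Σℚ; _⋆_ to _⋆ℚ_)
open ℂ-Conv using () renaming (Σ< to Σᶜ; _⋆_ to _⋆ᶜ_)

opaque
  Σℚ-mono : ∀ {f g} n → (∀ i → i ℕ.< n → f i ℚ.≤ g i) → Σℚ f n ℚ.≤ Σℚ g n
  Σℚ-mono zero    h = ℚₚ.≤-refl
  Σℚ-mono (suc n) h = ℚₚ.+-mono-≤ (Σℚ-mono n λ i p → h i (ℕₚ.m≤n⇒m≤1+n p)) (h n ℕₚ.≤-refl)

  Σℚ-extend : ∀ {f} → (∀ i → 0ℚ ℚ.≤ f i) → ∀ m t → Σℚ f m ℚ.≤ Σℚ f (m ℕ.+ t)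
  Σℚ-extend {f} h m zero = ℚₚ.≤-reflexive (cong (Σℚ f) (sym (ℕₚ.+-identityʳ m)))
  Σℚ-extend {f} h m (suc t) = ≤r (cong (Σℚ f) (sym (ℕₚ.+-suc m t)))
    (ℚₚ.≤-trans (Σℚ-extend h m t) (≤l (ℚₚ.+-identityʳ _) (ℚₚ.+-monoʳ-≤ (Σℚ f (m ℕ.+ t)) (h (m ℕ.+ t)))))

  Σℚ-extend-≤ : ∀ {f m n} → (∀ i → 0ℚ ℚ.≤ f i) → m ℕ.≤ n → Σℚ f m ℚ.≤ Σℚ f n
  Σℚ-extend-≤ {f} {m} {n} h m≤n = ≤r (cong (Σℚ f) (ℕₚ.m+[n∸m]≡n m≤n)) (Σℚ-extend h m (n ℕ.∸ m))

  n₁-0 : ∀ i → n₁ 0ᶜ i ≡ 0ℚ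
  n₁-0 i = refl

  n₁-Σ : ∀ {f g i} n → (∀ j → j ℕ.< n → n₁ (f j) i ℚ.≤ g j) → n₁ (Σᶜ f n) i ℚ.≤ Σℚ g n
  n₁-Σ {f} {g} {i} zero    h = ℚₚ.≤-reflexive (n₁-0 i)
  n₁-Σ {f} {g} {i} (suc n) h = ℚₚ.≤-trans (n₁-+ (Σᶜ f n) (f n) i)
    (ℚₚ.+-mono-≤ (n₁-Σ n λ j p → h j (ℕₚ.m≤n⇒m≤1+n p)) (h n ℕₚ.≤-refl))

  n₁-Σ-diff : ∀ {f g i} → (∀ j → n₁ (f j) i ℚ.≤ g j) → ∀ m t →
              n₁ (Σᶜ f (m ℕ.+ t) - Σᶜ f m) i ℚ.≤ Σℚ g (m ℕ.+ t) ℚ.- Σℚ g m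
  n₁-Σ-diff {f} {g} {i} h m zero = ℚₚ.≤-reflexive (trans
      (cong (λ k → n₁ (Σᶜ f k - Σᶜ f m) i) (ℕₚ.+-identityʳ m))
      (trans (cong₂ ℚ._+_ (∣a-a∣ (seq (re (Σᶜ f m)) i)) (∣a-a∣ (seq (im (Σᶜ f m)) i)))
        (sym (trans (cong (λ k → Σℚ g k ℚ.- Σℚ g m) (ℕₚ.+-identityʳ m)) (ℚₚ.+-inverseʳ (Σℚ g m))))))
  n₁-Σ-diff {f} {g} {i} h m (suc t) = ≤l (cong (λ k → n₁ (Σᶜ f k - Σᶜ f m) i) (sym (ℕₚ.+-suc m t)))
      (≤r (cong (λ k → Σℚ g k ℚ.- Σℚ g m) (sym (ℕₚ.+-suc m t)))
        (≤r (swap (Σℚ g (m ℕ.+ t)) (Σℚ g m) (g (m ℕ.+ t)))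
          (≤l (cong₂ ℚ._+_ (cong ℚ.∣_∣ (swap (seq (re S) i) (seq (re R) i) (seq (re F) i)))
                           (cong ℚ.∣_∣ (swap (seq (im S) i) (seq (im R) i) (seq (im F) i))))
            (ℚₚ.≤-trans (n₁-+ (S - R) F i) (ℚₚ.+-mono-≤ (n₁-Σ-diff h m t) (h (m ℕ.+ t)))))))
    where
      S R F : ℂ
      S = Σᶜ f (m ℕ.+ t)
      R = Σᶜ f m
      F = f (m ℕ.+ t)
      open +-*-Solver
      swap : ∀ a b c → (a ℚ.- b) ℚ.+ c ≡ (a ℚ.+ c) ℚ.- b
      swap = solve 3 (λ a b c → (a :- b) :+ c := (a :+ c) :- b) refl

  b-nonneg : ∀ {q} → 0ℚ ℚ.≤ q → ∀ n → 0ℚ ℚ.≤ E.b q n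
  b-nonneg = E.b-nonneg

  -- Once the terms at least halve from one to the next, a tail is at most twice its first term.
  -- Twice the next term is added on the left so that the induction closes.
  expℚ-tail : ∀ {q} (0≤q : 0ℚ ℚ.≤ q) m → proj₁ (E.b-half 0≤q) ℕ.≤ m → ∀ t →
              (Σℚ (E.b q) (m ℕ.+ t) ℚ.- Σℚ (E.b q) m) ℚ.+ (E.b q (m ℕ.+ t) ℚ.+ E.b q (m ℕ.+ t)) ℚ.≤ E.b q m ℚ.+ E.b q m
  expℚ-tail {q} 0≤q m K≤m zero = ℚₚ.≤-reflexive (trans
    (cong (λ k → (Σℚ (E.b q) k ℚ.- Σℚ (E.b q) m) ℚ.+ (E.b q k ℚ.+ E.b q k)) (ℕₚ.+-identityʳ m))
    (trans (cong (ℚ._+ (E.b q m ℚ.+ E.b q m)) (ℚₚ.+-inverseʳ (Σℚ (E.b q) m))) (ℚₚ.+-identityˡ _)))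
  expℚ-tail {q} 0≤q m K≤m (suc t) =
    ≤l (cong (λ k → (Σℚ (E.b q) k ℚ.- Σℚ (E.b q) m) ℚ.+ (E.b q k ℚ.+ E.b q k)) (sym (ℕₚ.+-suc m t)))
      (ℚₚ.≤-trans (ℚₚ.+-monoʳ-≤ ((S ℚ.+ c) ℚ.- R) (≤r (½+½ c) (ℚₚ.+-mono-≤ hb hb)))
        (≤l (lem S R c) (expℚ-tail 0≤q m K≤m t)))
    where
      S R c : ℚ
      S = Σℚ (E.b q) (m ℕ.+ t)
      R = Σℚ (E.b q) m
      c = E.b q (m ℕ.+ t)
      hb : E.b q (suc (m ℕ.+ t)) ℚ.≤ ½ ℚ.* c
      hb = proj₂ (E.b-half 0≤q) (m ℕ.+ t) (ℕₚ.≤-trans K≤m (ℕₚ.m≤m+n m t))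
      open +-*-Solver
      lem : ∀ S R c → (S ℚ.- R) ℚ.+ (c ℚ.+ c) ≡ ((S ℚ.+ c) ℚ.- R) ℚ.+ c
      lem = solve 3 (λ S R c → (S :- R) :+ (c :+ c) := ((S :+ c) :- R) :+ c) refl

  expℚ-tail-small : ∀ {q} → 0ℚ ℚ.≤ q → ∀ ε → 0ℚ ℚ.< ε →
    ∃ λ N → ∀ m t → N ℕ.≤ m → Σℚ (E.b q) (m ℕ.+ t) ℚ.- Σℚ (E.b q) m ℚ.< ε
  expℚ-tail-small {q} 0≤q ε 0<ε = K ℕ.+ proj₁ A , λ m t p →
      ℚₚ.≤-<-trans (≤l (ℚₚ.+-identityʳ _) (ℚₚ.≤-trans
          (ℚₚ.+-monoʳ-≤ (Σℚ (E.b q) (m ℕ.+ t) ℚ.- Σℚ (E.b q) m) (0≤+ (b-nonneg 0≤q (m ℕ.+ t)) (b-nonneg 0≤q (m ℕ.+ t))))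
          (expℚ-tail 0≤q m (ℕₚ.≤-trans (ℕₚ.m≤m+n K (proj₁ A)) p) t)))
        (<l (cong (λ n → E.b q n ℚ.+ E.b q n) (ℕₚ.m+[n∸m]≡n (ℕₚ.≤-trans (ℕₚ.m≤m+n K (proj₁ A)) p)))
          (small (m ℕ.∸ K) (ℕₚ.≤-trans (ℕₚ.≤-reflexive (sym (ℕₚ.m+n∸m≡n K (proj₁ A)))) (ℕₚ.∸-monoˡ-≤ K p))))
    where
      K : ℕ
      K = proj₁ (E.b-half 0≤q)
      c : ℚ
      c = E.b q K ℚ.+ E.b q K
      A : ∃ λ N → ∀ n → N ℕ.≤ n → c ℚ.* recip (suc n) ℚ.< ε
      A = arch c ε 0<ε
      small : ∀ t → proj₁ A ℕ.≤ t → E.b q (K ℕ.+ t) ℚ.+ E.b q (K ℕ.+ t) ℚ.< ε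
      small t p = ℚₚ.≤-<-trans
        (≤r (sym (ℚₚ.*-distribʳ-+ (recip (suc t)) (E.b q K) (E.b q K)))
          (ℚₚ.+-mono-≤ (E.b-decay 0≤q t) (E.b-decay 0≤q t)))
        (proj₂ A t p)

partialSum≡Σ : ∀ s n → partialSum s n ≡ Σᶜ s n
partialSum≡Σ s zero    = refl
partialSum≡Σ s (suc n) = cong (_+ s n) (partialSum≡Σ s n)

exp-lim : ∀ z → Lim (Σᶜ (expTerm z)) (exp z)
exp-lim z = lim-resp (λ n → ℂr.reflexive (partialSum≡Σ (expTerm z) n)) ≈-refl (⟶⇒lim (exp-hasSum z))

-- The Cauchy product differs from the product of the partial sums by terms u i * v j with
-- i, j < n ≤ i + j; their majorants are among the terms of exp (p + q) between n and 2n.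
opaque
  cauchy-defect : ∀ z w → Lim (λ n → Σᶜ (λ i → expTerm z i * (Σᶜ (expTerm w) n - Σᶜ (expTerm w) (n ℕ.∸ i))) n) 0ᶜ
  cauchy-defect z w = go (ExpConvergence.z-bound z) (ExpConvergence.z-bound w)
    where
      Bd : ℂ → Set
      Bd z = ∃ λ q → 0ℚ ℚ.≤ q × ∃ λ I → ∀ i → I ℕ.≤ i → n₁ z i ℚ.≤ q
      D : ℕ → ℂ
      D n = Σᶜ (λ i → expTerm z i * (Σᶜ (expTerm w) n - Σᶜ (expTerm w) (n ℕ.∸ i))) n
      go : Bd z → Bd w → Lim D 0ᶜ
      go (p , 0≤p , I , z≤) (q , 0≤q , J , w≤) = lim-0 λ ε 0<ε →
          let N , h = expℚ-tail-small (0≤+ 0≤p 0≤q) ε 0<ε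
          in N , λ n N≤n → I ℕ.⊔ J , λ i r → ℚₚ.≤-<-trans
               (ℚₚ.≤-trans (bound n i (⊔ˡ {I} {J} r) (⊔ʳ {I} {J} r)) (majorant n)) (h n n N≤n)
        where
          A B : ℕ → ℚ
          A = Σℚ (E.b p)
          B = Σℚ (E.b q)
          term≤ : ∀ {z q i} → 0ℚ ℚ.≤ q → n₁ z i ℚ.≤ q → ∀ n → n₁ (expTerm z n) i ℚ.≤ E.b q n
          term≤ {z} {q} 0≤q h n = ≤r (b-indep z q n) (ExpConvergence.n₁-term z 0≤q h n)
          Dℚ : ℕ → ℚ
          Dℚ n = Σℚ (λ j → E.b p j ℚ.* (B n ℚ.- B (n ℕ.∸ j))) n
          bound : ∀ n i → I ℕ.≤ i → J ℕ.≤ i → n₁ (D n) i ℚ.≤ Dℚ n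
          bound n i I≤i J≤i = n₁-Σ n λ j j<n → ℚₚ.≤-trans
            (n₁-* (expTerm z j) (Σᶜ (expTerm w) n - Σᶜ (expTerm w) (n ℕ.∸ j)) i)
            (*-mono-≤ (0≤n₁ (Σᶜ (expTerm w) n - Σᶜ (expTerm w) (n ℕ.∸ j)) i) (b-nonneg 0≤p j)
              (term≤ 0≤p (z≤ i I≤i) j)
              (subst (λ m → n₁ (Σᶜ (expTerm w) m - Σᶜ (expTerm w) (n ℕ.∸ j)) i ℚ.≤ B m ℚ.- B (n ℕ.∸ j))
                (ℕₚ.m∸n+n≡m (ℕₚ.<⇒≤ j<n))
                (n₁-Σ-diff (term≤ 0≤q (w≤ i J≤i)) (n ℕ.∸ j) j)))
          C : ℕ → ℚ
          C = Σℚ (E.b (p ℚ.+ q))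
          conv : ∀ n → Σℚ (E.b p ⋆ℚ E.b q) n ≡ C n
          conv n = ℚ-Conv.Σ<-cong n λ i _ → expℚ-unique (⋆-expℚ (expℚ-isExp p) (expℚ-isExp q)) (expℚ-isExp (p ℚ.+ q)) i
          square : ∀ n → A n ℚ.* B n ≡ Dℚ n ℚ.+ C n
          square n = trans (ℚ-Conv.square-triangle (E.b p) (E.b q) n) (cong (Dℚ n ℚ.+_) (conv n))
          AB≤C : ∀ n → A n ℚ.* B n ℚ.≤ C (n ℕ.+ n)
          AB≤C n = ≤r (trans (ℚ-Conv.triangle-⋆ (E.b p) (E.b q) (n ℕ.+ n)) (conv (n ℕ.+ n)))
            (ℚₚ.≤-trans (≤l (ℚ-Conv.Σ<-*ʳ (B n) (E.b p) n) (Σℚ-mono n λ i i<n → *-monoˡ (E.b p i) (b-nonneg 0≤p i)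
                (Σℚ-extend-≤ {E.b q} {n} {n ℕ.+ n ℕ.∸ i} (b-nonneg 0≤q)
                  (ℕₚ.≤-trans (ℕₚ.m≤m+n n (n ℕ.∸ i)) (ℕₚ.≤-reflexive (sym (ℕₚ.+-∸-assoc n (ℕₚ.<⇒≤ i<n))))))))
              (Σℚ-extend (λ i → 0≤* (b-nonneg 0≤p i) (Σℚ-extend-≤ {E.b q} {0} {n ℕ.+ n ℕ.∸ i} (b-nonneg 0≤q) z≤n)) n n))
          open +-*-Solver
          lem : ∀ d c → (d ℚ.+ c) ℚ.- c ≡ d
          lem = solve 2 (λ d c → (d :+ c) :- c := d) refl
          majorant : ∀ n → Dℚ n ℚ.≤ C (n ℕ.+ n) ℚ.- C n
          majorant n = ≤l (lem (Dℚ n) (C n)) (ℚₚ.+-monoˡ-≤ (ℚ.- C n) (≤l (square n) (AB≤C n)))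

  exp-+ : ∀ z w → exp (z + w) ≈ exp z * exp w
  exp-+ z w = lim-unique (exp-lim (z + w))
    (lim-resp (λ n → ≈-trans (ℂr.+-congʳ (ℂ-Conv.square-triangle (expTerm z) (expTerm w) n))
        (≈-trans (cancel (D n) (Σᶜ (expTerm z ⋆ᶜ expTerm w) n))
          (ℂ-Conv.Σ<-cong n λ i _ → expᶜ-unique (⋆-expᶜ (expTerm-isExp z) (expTerm-isExp w)) (expTerm-isExp (z + w)) i)))
      (solveℤ 1 (λ e → e :- con (+ 0) ≔ e) refl ((exp z * exp w) ∷ []))
      (lim-difference (lim-* (exp-lim z) (exp-lim w)) (cauchy-defect z w)))
    where
      open ℂ-Solver
      D : ℕ → ℂ
      D n = Σᶜ (λ i → expTerm z i * (Σᶜ (expTerm w) n - Σᶜ (expTerm w) (n ℕ.∸ i))) n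
      cancel : ∀ d t → d + t - d ≈ t
      cancel d t = solveℤ 2 (λ d t → d :+ t :- d ≔ t) refl (d ∷ t ∷ [])

  exp-cong : ∀ {z w} → z ≈ w → exp z ≈ exp w
  exp-cong {z} {w} p = lim-unique (exp-lim z)
    (lim-resp (λ n → ℂ-Conv.Σ<-cong n λ i _ → ℂr.*-congˡ (^-congˡ i (≈-sym p))) ≈-refl (exp-lim w))
    where open Algebra.Properties.CommutativeSemiring.Exp ℂr.commutativeSemiring using (^-congˡ)

module ≈-Reasoning = SetoidReasoning ℂr.setoid

open Algebra.Properties.CommutativeSemiring.Exp ℂr.commutativeSemiring
  using (^-congˡ; ^-homo-*; ^-distrib-*)

1^≈1 : ∀ n → 1ᶜ ^ n ≈ 1ᶜ
1^≈1 zero    = ≈-refl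
1^≈1 (suc n) = ≈-trans (ℂr.*-identityˡ _) (1^≈1 n)

-- Complex conjugation and the period 2πi

conj : ℂ → ℂ
conj z = re z +i (-ᵣ im z)

conj-* : ∀ z w → conj (z * w) ≈ conj z * conj w
conj-* (a +i b) (c +i d) = solveℤ 4 (λ a b c d → a :* c :- b :* d ≔ a :* c :- (:- b) :* (:- d)) refl (a ∷ b ∷ c ∷ d ∷ [])
                         , solveℤ 4 (λ a b c d → :- (a :* d :+ b :* c) ≔ a :* (:- d) :+ (:- b) :* c) refl (a ∷ b ∷ c ∷ d ∷ [])
  where open ℝ-Solver

conj-+ : ∀ z w → conj (z + w) ≈ conj z + conj w
conj-+ z w = ≈ᵣ-refl , solveℤ 2 (λ b d → :- (b :+ d) ≔ :- b :+ :- d) refl (im z ∷ im w ∷ [])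
  where open ℝ-Solver

conj-ι : ∀ x → conj (ι x) ≈ ι x
conj-ι x = ≈ᵣ-refl , solveℤ 0 (:- con (+ 0) ≔ con (+ 0)) refl []
  where open ℝ-Solver

conj-^ : ∀ z n → conj (z ^ n) ≈ conj z ^ n
conj-^ z zero    = conj-ι 1ᵣ
conj-^ z (suc n) = ≈-trans (conj-* z (z ^ n)) (ℂr.*-congˡ (conj-^ z n))

conj-expTerm : ∀ z n → conj (expTerm z n) ≈ expTerm (conj z) n
conj-expTerm z n = ≈-trans (conj-* _ (z ^ n)) (ℂr.*-cong (conj-ι _) (conj-^ z n))

lim-conj : ∀ {s l} → Lim s l → Lim (λ n → conj (s n)) (conj l)
lim-conj (mkLim r i) = mkLim r (limᵣ-neg i)

exp-conj : ∀ z → exp (conj z) ≈ conj (exp z)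
exp-conj z = lim-unique (exp-lim (conj z)) (lim-resp conj-Σ ≈-refl (lim-conj (exp-lim z)))
  where
    conj-Σ : ∀ n → conj (Σᶜ (expTerm z) n) ≈ Σᶜ (expTerm (conj z)) n
    conj-Σ zero    = conj-ι 0ᵣ
    conj-Σ (suc n) = ≈-trans (conj-+ _ _) (ℂr.+-cong (conj-Σ n) (conj-expTerm z n))

exp-0 : exp 0ᶜ ≈ 1ᶜ
exp-0 = lim-unique (exp-lim 0ᶜ) (lim-resp′ (lim-const 1ᶜ))
  where
    const : ∀ n → 1ᶜ ≈ Σᶜ (expTerm 0ᶜ) (suc n)
    const zero    = ≈-sym (≈-trans (ℂr.+-identityˡ _) (ℂr.*-identityʳ 1ᶜ))
    const (suc n) = ≈-sym (≈-trans (ℂr.+-cong (≈-sym (const n))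
      (≈-trans (ℂr.*-congˡ (ℂr.zeroˡ (0ᶜ ^ n))) (ℂr.zeroʳ _))) (ℂr.+-identityʳ 1ᶜ))
    -- The empty partial sum is 0 and all others are 1, so the comparison starts at index 1.
    shift : ∀ {s t : ℕ → ℝ} {l} → (∀ n → s (suc n) ≈ᵣ t (suc n)) → Limᵣ s l → Limᵣ t l
    shift {s} {t} {l} h L = mkLimᵣ λ ε 0<ε → let N , g = eventually L (½ ℚ.* ε) (½-pos 0<ε) in
      suc N , λ { (suc n) (s≤s p) → within-trans {ε} {t (suc n)} {s (suc n)} {l}
        (within-sym {_} {s (suc n)} {t (suc n)} (close (h n) (½ ℚ.* ε) (½-pos 0<ε))) (g (suc n) (ℕₚ.m≤n⇒m≤1+n p)) }
    lim-resp′ : Lim (λ _ → 1ᶜ) 1ᶜ → Lim (Σᶜ (expTerm 0ᶜ)) 1ᶜ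
    lim-resp′ (mkLim r i) = mkLim (shift (λ n → re≈ (const n)) r) (shift (λ n → im≈ (const n)) i)

-- When the real part vanishes, |e| = 1 forces y² = 1, and e² = - y². This settles e² without
-- deciding the sign of y.
re≈0⇒²≈-1 : ∀ e → re e ≈ᵣ 0ᵣ → e * conj e ≈ 1ᶜ → e * e ≈ - 1ᶜ
re≈0⇒²≈-1 (x +i y) x≈0 (norm , _) =
    ℝr.trans (ℝr.+-cong (ℝr.trans (ℝr.*-congʳ x≈0) (ℝr.zeroˡ x)) (ℝr.-‿cong y²))
      (solveℤ 0 (con (+ 0) :- con (+ 1) ≔ :- con (+ 1)) refl [])
  , ℝr.trans (ℝr.+-cong (ℝr.trans (ℝr.*-congʳ x≈0) (ℝr.zeroˡ y)) (ℝr.trans (ℝr.*-congˡ x≈0) (ℝr.zeroʳ y)))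
      (solveℤ 0 (con (+ 0) :+ con (+ 0) ≔ :- con (+ 0)) refl [])
  where
    open ℝ-Solver
    y² : y *ᵣ y ≈ᵣ 1ᵣ
    y² = ℝr.trans (solveℤ 2 (λ x y → y :* y ≔ (x :* x :- y :* (:- y)) :- x :* x) refl (x ∷ y ∷ []))
      (ℝr.trans (ℝr.+-cong norm (ℝr.-‿cong (ℝr.trans (ℝr.*-congʳ x≈0) (ℝr.zeroˡ x))))
        (solveℤ 0 (con (+ 1) :- con (+ 0) ≔ con (+ 1)) refl []))

exp-multiple : ∀ {c} → exp c ≈ 1ᶜ → ∀ n → exp (c * ι (fromℕ n)) ≈ 1ᶜ
exp-multiple {c} e zero    = ≈-trans (exp-cong (ℂr.zeroʳ c)) exp-0
exp-multiple {c} e (suc n) = begin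
  exp (c * ι (fromℕ (suc n)))     ≈⟨ exp-cong (ℂr.*-congˡ (≈-trans (ι-cong (fromℤ-+ (+ 1) (+ n))) (ι-+ _ _))) ⟩
  exp (c * (1ᶜ + ι (fromℕ n)))    ≈⟨ exp-cong (≈-trans (ℂr.distribˡ c 1ᶜ (ι (fromℕ n))) (ℂr.+-congʳ (ℂr.*-identityʳ c))) ⟩
  exp (c + c * ι (fromℕ n))       ≈⟨ exp-+ c (c * ι (fromℕ n)) ⟩
  exp c * exp (c * ι (fromℕ n))   ≈⟨ ℂr.*-cong e (exp-multiple e n) ⟩
  1ᶜ * 1ᶜ                         ≈⟨ ℂr.*-identityˡ 1ᶜ ⟩
  1ᶜ                              ∎
  where open ≈-Reasoning

exp-period : ∀ {c} → exp c ≈ 1ᶜ → ∀ n {z w} → w ≈ z + 1ᶜ →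
             exp (c * ι (fromℕ n) * z) ≈ exp (c * ι (fromℕ n) * w)
exp-period {c} e n {z} {w} w≈ = begin
  exp (c * ι (fromℕ n) * z)                          ≈⟨ ℂr.*-identityʳ _ ⟨
  exp (c * ι (fromℕ n) * z) * 1ᶜ                     ≈⟨ ℂr.*-congˡ (exp-multiple e n) ⟨
  exp (c * ι (fromℕ n) * z) * exp (c * ι (fromℕ n))  ≈⟨ exp-+ (c * ι (fromℕ n) * z) (c * ι (fromℕ n)) ⟨
  exp (c * ι (fromℕ n) * z + c * ι (fromℕ n))        ≈⟨ exp-cong expand ⟩
  exp (c * ι (fromℕ n) * w)                          ∎
  where
    open ≈-Reasoning
    open ℂ-Solver
    expand : c * ι (fromℕ n) * z + c * ι (fromℕ n) ≈ c * ι (fromℕ n) * w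
    expand = ≈-trans (solveℤ 3 (λ c n z → c :* n :* z :+ c :* n ≔ c :* n :* (z :+ con (+ 1))) refl (c ∷ ι (fromℕ n) ∷ z ∷ []))
               (ℂr.*-congˡ (≈-sym w≈))

module _ {π : ℝ} (isPi : IsPi π) where

  private
    w e : ℂ
    w = 𝕚 * ι (fromℚ ½ *ᵣ π)
    e = exp w

  conj-w : conj w ≈ - w
  conj-w = solveℤ 1 (λ t → con (+ 0) :* t :- con (+ 1) :* con (+ 0) ≔ :- (con (+ 0) :* t :- con (+ 1) :* con (+ 0))) refl (t ∷ [])
         , ℝr.refl
    where
      open ℝ-Solver
      t : ℝ
      t = fromℚ ½ *ᵣ π

  -- The number exp(iπ/2) has absolute value 1 because conjugation negates its exponent, and its
  -- real part is cos(π/2) = 0.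
  e²≈-1 : e * e ≈ - 1ᶜ
  e²≈-1 = re≈0⇒²≈-1 e (IsPi.cos-½π isPi) (≈-trans (ℂr.*-congˡ (≈-trans (≈-sym (exp-conj w)) (exp-cong conj-w)))
        (≈-trans (≈-sym (exp-+ w (- w))) (≈-trans (exp-cong (ℂr.-‿inverseʳ w)) exp-0)))

  2πi≈4w : ι (fromℕ 2 *ᵣ π) * 𝕚 ≈ (w + w) + (w + w)
  2πi≈4w = ≈-trans (ℂr.*-congʳ (≈-trans (ι-cong (ℝr.trans (ℝr.*-congʳ (≡⇒≈ᵣ λ _ → refl)) (ℝr.*-assoc (fromℤ (+ 4)) (fromℚ ½) π))) (ι-* _ _)))
      (solveℤ 2 (λ i t → (con (+ 4) :* t) :* i ≔ (i :* t :+ i :* t) :+ (i :* t :+ i :* t)) refl (𝕚 ∷ ι (fromℚ ½ *ᵣ π) ∷ []))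
    where open ℂ-Solver

  exp-2πi : exp (ι (fromℕ 2 *ᵣ π) * 𝕚) ≈ 1ᶜ
  exp-2πi = begin
    exp (ι (fromℕ 2 *ᵣ π) * 𝕚)   ≈⟨ exp-cong 2πi≈4w ⟩
    exp ((w + w) + (w + w))      ≈⟨ exp-+ (w + w) (w + w) ⟩
    exp (w + w) * exp (w + w)    ≈⟨ ℂr.*-cong ww ww ⟩
    - 1ᶜ * - 1ᶜ                  ≈⟨ solveℤ 0 (:- con (+ 1) :* :- con (+ 1) ≔ con (+ 1)) refl [] ⟩
    1ᶜ                           ∎
    where
      open ≈-Reasoning
      open ℂ-Solver
      ww : exp (w + w) ≈ - 1ᶜ
      ww = ≈-trans (exp-+ w w) e²≈-1

  -- The two series agree term by term because exp(2πi) = 1, and the sum of a series is unique.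
  fourier-periodic : ∀ {a f} → FourierExpansion π a f → ∀ {z w} → pt w ≈ pt z + 1ᶜ → f z ≈ f w
  fourier-periodic {a} {f} fe {z} {w} w≈z+1 = lim-unique (⟶⇒lim {partialSum (term z)} {f z} (fe z))
      (lim-resp same ≈-refl (⟶⇒lim {partialSum (term w)} {f w} (fe w)))
    where
      term : ℋ → ℕ → ℂ
      term z m = a (suc m) * exp (ι (fromℕ 2 *ᵣ π) * 𝕚 * ι (fromℕ (suc m)) * pt z)
      same : ∀ n → partialSum (term w) n ≈ partialSum (term z) n
      same zero    = ≈-refl
      same (suc n) = ℂr.+-cong (same n) (ℂr.*-congˡ {a (suc n)}
        (≈-sym (exp-period {ι (fromℕ 2 *ᵣ π) * 𝕚} exp-2πi (suc n) {pt z} {pt w} w≈z+1)))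

-- Small elements of ℤ[√13]

module _ where
  open ℤ-ring

  -- Word n p q: the element p + q√13 of ℤ[√13] is a product of n factors 7 + √13 and 19 - 5√13.
  data Word : ℕ → ℤ → ℤ → Set where
    []  : Word 0 (+ 1) (+ 0)
    _▹A : ∀ {n p q} → Word n p q → Word (suc n) (+ 7 ℤ.* p ℤ.+ + 13 ℤ.* q) (p ℤ.+ + 7 ℤ.* q)
    _▹B : ∀ {n p q} → Word n p q → Word (suc n) (+ 19 ℤ.* p ℤ.- + 65 ℤ.* q) (+ 19 ℤ.* q ℤ.- + 5 ℤ.* p)

  norm : ℤ → ℤ → ℤ
  norm p q = p ℤ.* p ℤ.- + 13 ℤ.* (q ℤ.* q)

  private
    ℤ-0<* : ∀ {i j} → + 0 ℤ.< i → + 0 ℤ.< j → + 0 ℤ.< i ℤ.* j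
    ℤ-0<* {+ suc i} {+ suc j} _ _ = ℤ.+<+ (s≤s z≤n)
    ℤ-0<* {+ zero} (ℤ.+<+ ())
    ℤ-0<* {+ suc i} {+ zero} _ (ℤ.+<+ ())

    ℤ-0≤* : ∀ {i j} → + 0 ℤ.≤ i → + 0 ℤ.≤ j → + 0 ℤ.≤ i ℤ.* j
    ℤ-0≤* {+ i} {+ j} _ _ = ℤₚ.≤-trans (ℤ.+≤+ z≤n) (ℤₚ.≤-reflexive (ℤₚ.pos-* i j))

    ℤ-0≤+ : ∀ {i j} → + 0 ℤ.≤ i → + 0 ℤ.≤ j → + 0 ℤ.≤ i ℤ.+ j
    ℤ-0≤+ = ℤₚ.+-mono-≤

    ℤ-0<+ : ∀ {i j} → + 0 ℤ.< i → + 0 ℤ.≤ j → + 0 ℤ.< i ℤ.+ j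
    ℤ-0<+ = ℤₚ.+-mono-<-≤

    ℤ-0<-cancel : ∀ i {j} → + 0 ℤ.< i → + 0 ℤ.< i ℤ.* j → + 0 ℤ.< j
    ℤ-0<-cancel i {+ suc j}  _ _ = ℤ.+<+ (s≤s z≤n)
    ℤ-0<-cancel i {+ zero}   _ h = ⊥-elim (ℤₚ.<-irrefl refl (ℤₚ.<-≤-trans h (ℤₚ.≤-reflexive (ℤₚ.*-zeroʳ i))))
    ℤ-0<-cancel (+ suc i) { -[1+ j ]} _ ()
    ℤ-0<-cancel (+ zero) { -[1+ j ]} (ℤ.+<+ ())

    <-subst : ∀ {i j} → i ≡ j → + 0 ℤ.< i → + 0 ℤ.< j
    <-subst refl h = h

    i<j⇒0<j-i : ∀ {i j} → i ℤ.< j → + 0 ℤ.< j ℤ.- i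
    i<j⇒0<j-i {i} {j} h = ℤₚ.≤-<-trans (ℤₚ.≤-reflexive (sym (ℤₚ.+-inverseʳ i))) (ℤₚ.+-monoˡ-< (ℤ.- i) h)

    0<j-i⇒i<j : ∀ {i j} → + 0 ℤ.< j ℤ.- i → i ℤ.< j
    0<j-i⇒i<j {i} {j} h = ℤₚ.≤-<-trans (ℤₚ.≤-reflexive (sym (ℤₚ.+-identityˡ i)))
      (ℤₚ.<-≤-trans (ℤₚ.+-monoˡ-< i h) (ℤₚ.≤-reflexive (eq i j)))
      where
        eq : ∀ i j → j ℤ.- i ℤ.+ i ≡ j
        eq = solve 2 (λ i j → j :- i :+ i := j) refl

    0<+suc : ∀ {n} → + 0 ℤ.< + suc n
    0<+suc = ℤ.+<+ (s≤s z≤n)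

    0≤pos : ∀ {n} → + 0 ℤ.≤ + n
    0≤pos = ℤ.+≤+ z≤n

  -- Both factors have norm 36. Positivity of the norm is what makes the matrix p + qN an element of
  -- `GL₂⁺`.
  norm-word : ∀ {n p q} → Word n p q → + 0 ℤ.< norm p q
  norm-word [] = 0<+suc
  norm-word (_▹A {p = p} {q} w) = <-subst (eq p q) (ℤ-0<* {+ 36} 0<+suc (norm-word w))
    where
      eq : ∀ p q → + 36 ℤ.* norm p q ≡ norm (+ 7 ℤ.* p ℤ.+ + 13 ℤ.* q) (p ℤ.+ + 7 ℤ.* q)
      eq = solve 2 (λ p q → con (+ 36) :* (p :* p :- con (+ 13) :* (q :* q))
        := (con (+ 7) :* p :+ con (+ 13) :* q) :* (con (+ 7) :* p :+ con (+ 13) :* q)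
           :- con (+ 13) :* ((p :+ con (+ 7) :* q) :* (p :+ con (+ 7) :* q))) refl
  norm-word (_▹B {p = p} {q} w) = <-subst (eq p q) (ℤ-0<* {+ 36} 0<+suc (norm-word w))
    where
      eq : ∀ p q → + 36 ℤ.* norm p q ≡ norm (+ 19 ℤ.* p ℤ.- + 65 ℤ.* q) (+ 19 ℤ.* q ℤ.- + 5 ℤ.* p)
      eq = solve 2 (λ p q → con (+ 36) :* (p :* p :- con (+ 13) :* (q :* q))
        := (con (+ 19) :* p :- con (+ 65) :* q) :* (con (+ 19) :* p :- con (+ 65) :* q)
           :- con (+ 13) :* ((con (+ 19) :* q :- con (+ 5) :* p) :* (con (+ 19) :* q :- con (+ 5) :* p))) refl

  -- Under √13 ↦ 1 the two factors are units modulo 3, under √13 ↦ -1 they vanish modulo 3.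
  unit-mod-3 : ∀ {n p q} → Word n p q → ∃ λ b → ∃ λ s → p ℤ.+ q ≡ + 3 ℤ.* b ℤ.+ s × s ℤ.* s ≡ + 1
  unit-mod-3 [] = + 0 , + 1 , refl , refl
  unit-mod-3 (_▹A {p = p} {q} w) with unit-mod-3 w
  ... | b , s , e , s² = + 8 ℤ.* b ℤ.+ + 3 ℤ.* s ℤ.+ + 4 ℤ.* q , ℤ.- s
      , trans (eq p q) (trans (cong (λ x → + 8 ℤ.* x ℤ.+ + 12 ℤ.* q) e) (eq′ b s q)) , trans (solve 1 (λ s → :- s :* :- s := s :* s) refl s) s²
    where
      eq : ∀ p q → + 7 ℤ.* p ℤ.+ + 13 ℤ.* q ℤ.+ (p ℤ.+ + 7 ℤ.* q) ≡ + 8 ℤ.* (p ℤ.+ q) ℤ.+ + 12 ℤ.* q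
      eq = solve 2 (λ p q → con (+ 7) :* p :+ con (+ 13) :* q :+ (p :+ con (+ 7) :* q) := con (+ 8) :* (p :+ q) :+ con (+ 12) :* q) refl
      eq′ : ∀ b s q → + 8 ℤ.* (+ 3 ℤ.* b ℤ.+ s) ℤ.+ + 12 ℤ.* q ≡ + 3 ℤ.* (+ 8 ℤ.* b ℤ.+ + 3 ℤ.* s ℤ.+ + 4 ℤ.* q) ℤ.+ ℤ.- s
      eq′ = solve 3 (λ b s q → con (+ 8) :* (con (+ 3) :* b :+ s) :+ con (+ 12) :* q
        := con (+ 3) :* (con (+ 8) :* b :+ con (+ 3) :* s :+ con (+ 4) :* q) :+ :- s) refl
  unit-mod-3 (_▹B {p = p} {q} w) with unit-mod-3 w
  ... | b , s , e , s² = + 14 ℤ.* b ℤ.+ + 5 ℤ.* s ℤ.- + 20 ℤ.* q , ℤ.- s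
      , trans (eq p q) (trans (cong (λ x → + 14 ℤ.* x ℤ.- + 60 ℤ.* q) e) (eq′ b s q)) , trans (solve 1 (λ s → :- s :* :- s := s :* s) refl s) s²
    where
      eq : ∀ p q → + 19 ℤ.* p ℤ.- + 65 ℤ.* q ℤ.+ (+ 19 ℤ.* q ℤ.- + 5 ℤ.* p) ≡ + 14 ℤ.* (p ℤ.+ q) ℤ.- + 60 ℤ.* q
      eq = solve 2 (λ p q → con (+ 19) :* p :- con (+ 65) :* q :+ (con (+ 19) :* q :- con (+ 5) :* p) := con (+ 14) :* (p :+ q) :- con (+ 60) :* q) refl
      eq′ : ∀ b s q → + 14 ℤ.* (+ 3 ℤ.* b ℤ.+ s) ℤ.- + 60 ℤ.* q ≡ + 3 ℤ.* (+ 14 ℤ.* b ℤ.+ + 5 ℤ.* s ℤ.- + 20 ℤ.* q) ℤ.+ ℤ.- s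
      eq′ = solve 3 (λ b s q → con (+ 14) :* (con (+ 3) :* b :+ s) :- con (+ 60) :* q
        := con (+ 3) :* (con (+ 14) :* b :+ con (+ 5) :* s :- con (+ 20) :* q) :+ :- s) refl

  zero-mod-3 : ∀ {n p q} → Word (suc n) p q → ∃ λ a → p ≡ + 3 ℤ.* a ℤ.+ q
  zero-mod-3 (_▹A {p = p} {q} w) = + 2 ℤ.* p ℤ.+ + 2 ℤ.* q , solve 2 (λ p q →
    con (+ 7) :* p :+ con (+ 13) :* q := con (+ 3) :* (con (+ 2) :* p :+ con (+ 2) :* q) :+ (p :+ con (+ 7) :* q)) refl p q
  zero-mod-3 (_▹B {p = p} {q} w) = + 8 ℤ.* p ℤ.- + 28 ℤ.* q , solve 2 (λ p q →
    con (+ 19) :* p :- con (+ 65) :* q := con (+ 3) :* (con (+ 8) :* p :- con (+ 28) :* q) :+ (con (+ 19) :* q :- con (+ 5) :* p)) refl p q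

  3∤1 : ∀ c → ¬ (+ 3 ℤ.* c ≡ + 1)
  3∤1 c e with ℕₚ.m*n≡1⇒m≡1 3 ℤ.∣ c ∣ (trans (sym (ℤₚ.abs-* (+ 3) c)) (cong ℤ.∣_∣ e))
  ... | ()

  -- For q = 0 the residues of p + q and p - q modulo 3 would coincide, whereas the first is a unit
  -- and the second is 0.
  word-irrational : ∀ {n p q} → Word (suc n) p q → q ≢ + 0
  word-irrational {n} {p} w refl with zero-mod-3 w | unit-mod-3 w
  ... | a , e | b , s , e′ , s² = 3∤1 ((a ℤ.- b) ℤ.* s)
      (trans (trans (eq a b s) (cong (ℤ._* s) (trans (cong (ℤ._- + 3 ℤ.* b) (trans (sym e) (trans (sym (ℤₚ.+-identityʳ p)) e′))) (eq′ b s)))) s²)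
    where
      eq : ∀ a b s → + 3 ℤ.* ((a ℤ.- b) ℤ.* s) ≡ (+ 3 ℤ.* a ℤ.+ + 0 ℤ.- + 3 ℤ.* b) ℤ.* s
      eq = solve 3 (λ a b s → con (+ 3) :* ((a :- b) :* s) := (con (+ 3) :* a :+ con (+ 0) :- con (+ 3) :* b) :* s) refl
      eq′ : ∀ b s → + 3 ℤ.* b ℤ.+ s ℤ.- + 3 ℤ.* b ≡ s
      eq′ = solve 2 (λ b s → con (+ 3) :* b :+ s :- con (+ 3) :* b := s) refl

  -- A point u = P + Q√13 of the walk, with u / √(norm u) in the fundamental domain of multiplication
  -- by (11 + 3√13) / 2.
  record Point : Set where
    constructor point
    field
      P Q  : ℤ
      0≤Q  : + 0 ℤ.≤ Q
      0<3P-11Q : + 0 ℤ.< + 3 ℤ.* P ℤ.- + 11 ℤ.* Q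

    0<P : + 0 ℤ.< P
    0<P = ℤ-0<-cancel (+ 3) 0<+suc (<-subst (eq P Q) (ℤ-0<+ 0<3P-11Q (ℤ-0≤* {+ 11} 0≤pos 0≤Q)))
      where
        eq : ∀ P Q → + 3 ℤ.* P ℤ.- + 11 ℤ.* Q ℤ.+ + 11 ℤ.* Q ≡ + 3 ℤ.* P
        eq = solve 2 (λ P Q → con (+ 3) :* P :- con (+ 11) :* Q :+ con (+ 11) :* Q := con (+ 3) :* P) refl

  data Step (u v : Point) : Set where
    stepA : Point.P v ≡ + 7 ℤ.* Point.P u ℤ.+ + 13 ℤ.* Point.Q u → Point.Q v ≡ Point.P u ℤ.+ + 7 ℤ.* Point.Q u → Step u v
    stepB : Point.P v ≡ + 19 ℤ.* Point.P u ℤ.- + 65 ℤ.* Point.Q u → Point.Q v ≡ + 19 ℤ.* Point.Q u ℤ.- + 5 ℤ.* Point.P u → Step u v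

  -- The two factors differ by the unit (11 + 3√13)/2, so one of them always leads back into the
  -- domain 0 ≤ Q/P < 3/11. Multiplication by 7 + √13 turns 3P - 11Q into 2(5P - 19Q), which gives
  -- the test; when it fails, 19Q - 5P ≥ 0 is the new second coordinate.
  next : ∀ u → ∃ (Step u)
  next u@(point P Q 0≤Q 0<d) with + 19 ℤ.* Q ℤₚ.<? + 5 ℤ.* P
  ... | yes h = point _ _ (ℤ-0≤+ (ℤₚ.<⇒≤ (Point.0<P u)) (ℤ-0≤* {+ 7} 0≤pos 0≤Q))
                  (<-subst (eq P Q) (ℤ-0<* {+ 2} 0<+suc (i<j⇒0<j-i h)))
              , stepA refl refl
    where
      eq : ∀ P Q → + 2 ℤ.* (+ 5 ℤ.* P ℤ.- + 19 ℤ.* Q) ≡ + 3 ℤ.* (+ 7 ℤ.* P ℤ.+ + 13 ℤ.* Q) ℤ.- + 11 ℤ.* (P ℤ.+ + 7 ℤ.* Q)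
      eq = solve 2 (λ P Q → con (+ 2) :* (con (+ 5) :* P :- con (+ 19) :* Q)
        := con (+ 3) :* (con (+ 7) :* P :+ con (+ 13) :* Q) :- con (+ 11) :* (P :+ con (+ 7) :* Q)) refl
  ... | no h = point _ _ (ℤₚ.i≤j⇒0≤j-i (ℤₚ.≮⇒≥ h))
                 (ℤ-0<-cancel (+ 11) 0<+suc (<-subst (eq P Q) (ℤ-0<+ (ℤ-0<* {+ 404} 0<+suc 0<d) (ℤ-0≤* {+ 20} 0≤pos (ℤₚ.<⇒≤ (Point.0<P u))))))
             , stepB refl refl
    where
      eq : ∀ P Q → + 404 ℤ.* (+ 3 ℤ.* P ℤ.- + 11 ℤ.* Q) ℤ.+ + 20 ℤ.* P
         ≡ + 11 ℤ.* (+ 3 ℤ.* (+ 19 ℤ.* P ℤ.- + 65 ℤ.* Q) ℤ.- + 11 ℤ.* (+ 19 ℤ.* Q ℤ.- + 5 ℤ.* P))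
      eq = solve 2 (λ P Q → con (+ 404) :* (con (+ 3) :* P :- con (+ 11) :* Q) :+ con (+ 20) :* P
        := con (+ 11) :* (con (+ 3) :* (con (+ 19) :* P :- con (+ 65) :* Q) :- con (+ 11) :* (con (+ 19) :* Q :- con (+ 5) :* P))) refl

  walk : ℕ → Point
  walk zero    = point (+ 1) (+ 0) 0≤pos 0<+suc
  walk (suc n) = proj₁ (next (walk n))

  -- v = u (p + q√13)
  record Quotient (u v : Point) (n : ℕ) : Set where
    field
      p q  : ℤ
      word : Word n p q
      P≡   : Point.P v ≡ Point.P u ℤ.* p ℤ.+ + 13 ℤ.* (Point.Q u ℤ.* q)
      Q≡   : Point.Q v ≡ Point.P u ℤ.* q ℤ.+ Point.Q u ℤ.* p

  quotient : ∀ m n → Quotient (walk m) (walk (n ℕ.+ m)) n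
  quotient m zero = record { p = + 1 ; q = + 0 ; word = []
      ; P≡ = solve 2 (λ P Q → P := P :* con (+ 1) :+ con (+ 13) :* (Q :* con (+ 0))) refl P Q
      ; Q≡ = solve 2 (λ P Q → Q := P :* con (+ 0) :+ Q :* con (+ 1)) refl P Q }
    where open Point (walk m)
  quotient m (suc n) with next (walk (n ℕ.+ m)) | quotient m n
  ... | v , stepA eP eQ | record { p = p ; q = q ; word = w ; P≡ = P≡ ; Q≡ = Q≡ } = record
      { word = w ▹A
      ; P≡ = trans eP (trans (cong₂ (λ x y → + 7 ℤ.* x ℤ.+ + 13 ℤ.* y) P≡ Q≡) (solve 4 (λ P Q p q →
          con (+ 7) :* (P :* p :+ con (+ 13) :* (Q :* q)) :+ con (+ 13) :* (P :* q :+ Q :* p)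
          := P :* (con (+ 7) :* p :+ con (+ 13) :* q) :+ con (+ 13) :* (Q :* (p :+ con (+ 7) :* q))) refl P Q p q))
      ; Q≡ = trans eQ (trans (cong₂ (λ x y → x ℤ.+ + 7 ℤ.* y) P≡ Q≡) (solve 4 (λ P Q p q →
          (P :* p :+ con (+ 13) :* (Q :* q)) :+ con (+ 7) :* (P :* q :+ Q :* p)
          := P :* (p :+ con (+ 7) :* q) :+ Q :* (con (+ 7) :* p :+ con (+ 13) :* q)) refl P Q p q)) }
    where open Point (walk m)
  ... | v , stepB eP eQ | record { p = p ; q = q ; word = w ; P≡ = P≡ ; Q≡ = Q≡ } = record
      { word = w ▹B
      ; P≡ = trans eP (trans (cong₂ (λ x y → + 19 ℤ.* x ℤ.- + 65 ℤ.* y) P≡ Q≡) (solve 4 (λ P Q p q →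
          con (+ 19) :* (P :* p :+ con (+ 13) :* (Q :* q)) :- con (+ 65) :* (P :* q :+ Q :* p)
          := P :* (con (+ 19) :* p :- con (+ 65) :* q) :+ con (+ 13) :* (Q :* (con (+ 19) :* q :- con (+ 5) :* p))) refl P Q p q))
      ; Q≡ = trans eQ (trans (cong₂ (λ x y → + 19 ℤ.* y ℤ.- + 5 ℤ.* x) P≡ Q≡) (solve 4 (λ P Q p q →
          con (+ 19) :* (P :* q :+ Q :* p) :- con (+ 5) :* (P :* p :+ con (+ 13) :* (Q :* q))
          := P :* (con (+ 19) :* q :- con (+ 5) :* p) :+ Q :* (con (+ 19) :* p :- con (+ 65) :* q)) refl P Q p q)) }
    where open Point (walk m)

  -- Here b = ⌊11KQ / 3P⌋ with remainder r: the interval [0, 3/11) of the slopes Q/P is cut into K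
  -- equal pieces.
  record Bucket (K : ℕ) (u : Point) (b : ℕ) : Set where
    open Point u
    field
      r     : ℤ
      split : + 11 ℤ.* (+ K ℤ.* Q) ≡ + b ℤ.* (+ 3 ℤ.* P) ℤ.+ r
      0≤r   : + 0 ℤ.≤ r
      r<    : + 0 ℤ.< + 3 ℤ.* P ℤ.- r

  bucket : ∀ K .{{_ : NonZero K}} u → ∃ λ b → b ℕ.< K × Bucket K u b
  bucket K u@(point (+ suc P) (+ Q) _ 0<d) = b , b<K , record
      { r = + (a ℕ.% m) ; split = split ; 0≤r = 0≤pos
      ; r< = i<j⇒0<j-i (ℤₚ.<-≤-trans (ℤ.+<+ (ℕ.m%n<n a m)) (ℤₚ.≤-reflexive (ℤₚ.pos-* 3 (suc P)))) }
    where
      a m b : ℕ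
      a = 11 ℕ.* (K ℕ.* Q)
      m = 3 ℕ.* suc P
      b = a ℕ./ m
      cast : + a ≡ + 11 ℤ.* (+ K ℤ.* + Q)
      cast = trans (ℤₚ.pos-* 11 (K ℕ.* Q)) (cong (+ 11 ℤ.*_) (ℤₚ.pos-* K Q))
      split : + 11 ℤ.* (+ K ℤ.* + Q) ≡ + b ℤ.* (+ 3 ℤ.* + suc P) ℤ.+ + (a ℕ.% m)
      split = trans (sym cast) (trans (cong +_ (trans (ℕ.m≡m%n+[m/n]*n a m) (ℕₚ.+-comm (a ℕ.% m) (b ℕ.* m))))
        (cong (ℤ._+ + (a ℕ.% m)) (trans (ℤₚ.pos-* b m) (cong (+ b ℤ.*_) (ℤₚ.pos-* 3 (suc P))))))
      11Q<3P : 11 ℕ.* Q ℕ.< m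
      11Q<3P = ℤₚ.drop‿+<+ (ℤₚ.≤-<-trans (ℤₚ.≤-reflexive (ℤₚ.pos-* 11 Q))
        (ℤₚ.<-≤-trans (0<j-i⇒i<j 0<d) (ℤₚ.≤-reflexive (sym (ℤₚ.pos-* 3 (suc P))))))
      b<K : b ℕ.< K
      b<K = ℕ.m<n*o⇒m/o<n (ℕₚ.≤-<-trans (ℕₚ.≤-reflexive (trans (sym (ℕₚ.*-assoc 11 K Q)) (trans (cong (ℕ._* Q) (ℕₚ.*-comm 11 K)) (ℕₚ.*-assoc K 11 Q))))
        (ℕₚ.*-monoʳ-< K 11Q<3P))
  bucket K (point (+ suc P) -[1+ Q ] () _)
  bucket K (point (+ zero) Q 0≤Q 0<d) = ⊥-elim (ℤₚ.<-irrefl refl (Point.0<P (point (+ zero) Q 0≤Q 0<d)))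
  bucket K (point -[1+ P ] Q 0≤Q 0<d) with Point.0<P (point -[1+ P ] Q 0≤Q 0<d)
  ... | ()

  -- Slopes in the same bucket differ by less than 3/(11K), so |P₁Q₂ - Q₁P₂| < 3P₁P₂/(11K). Slopes
  -- below 3/11 give P₁P₂ - 13Q₁Q₂ ≥ (1 - 117/121) P₁P₂ = (4/121) P₁P₂. These two expressions are q
  -- and p times the norm of u, whence |q|/p < 33/(4K).
  module _ {u v : Point} {K b n : ℕ} (Bu : Bucket K u b) (Bv : Bucket K v b) (W : Quotient u v n) where
    private
      open Point u using () renaming (P to P₁; Q to Q₁; 0≤Q to 0≤Q₁; 0<3P-11Q to 0<d₁; 0<P to 0<P₁)
      open Point v using () renaming (P to P₂; Q to Q₂; 0≤Q to 0≤Q₂; 0<3P-11Q to 0<d₂; 0<P to 0<P₂)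
      open Bucket Bu using () renaming (r to r₁; split to split₁; 0≤r to 0≤r₁; r< to r₁<)
      open Bucket Bv using () renaming (r to r₂; split to split₂; 0≤r to 0≤r₂; r< to r₂<)
      open Quotient W

      rest : ℤ
      rest = + 39 ℤ.* ((+ 3 ℤ.* P₁ ℤ.- + 11 ℤ.* Q₁) ℤ.* (+ 3 ℤ.* P₂) ℤ.+ + 11 ℤ.* (Q₁ ℤ.* (+ 3 ℤ.* P₂ ℤ.- + 11 ℤ.* Q₂)))

      0≤rest : + 0 ℤ.≤ rest
      0≤rest = ℤ-0≤* {+ 39} 0≤pos (ℤ-0≤+ (ℤ-0≤* (ℤₚ.<⇒≤ 0<d₁) (ℤ-0≤* {+ 3} 0≤pos (ℤₚ.<⇒≤ 0<P₂)))
        (ℤ-0≤* {+ 11} 0≤pos (ℤ-0≤* 0≤Q₁ (ℤₚ.<⇒≤ 0<d₂))))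

      0<norm : + 0 ℤ.< norm P₁ Q₁
      0<norm = ℤ-0<-cancel (+ 121) 0<+suc (<-subst (eq P₁ Q₁) (ℤ-0<+ (ℤ-0<* {+ 4} 0<+suc (ℤ-0<* 0<P₁ 0<P₁))
          (ℤ-0≤* {+ 13} 0≤pos (ℤ-0≤* (ℤₚ.<⇒≤ 0<d₁) (ℤ-0≤+ (ℤ-0≤* {+ 3} 0≤pos (ℤₚ.<⇒≤ 0<P₁)) (ℤ-0≤* {+ 11} 0≤pos 0≤Q₁))))))
        where
          eq : ∀ P Q → + 4 ℤ.* (P ℤ.* P) ℤ.+ + 13 ℤ.* ((+ 3 ℤ.* P ℤ.- + 11 ℤ.* Q) ℤ.* (+ 3 ℤ.* P ℤ.+ + 11 ℤ.* Q)) ≡ + 121 ℤ.* norm P Q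
          eq = solve 2 (λ P Q → con (+ 4) :* (P :* P) :+ con (+ 13) :* ((con (+ 3) :* P :- con (+ 11) :* Q) :* (con (+ 3) :* P :+ con (+ 11) :* Q))
            := con (+ 121) :* (P :* P :- con (+ 13) :* (Q :* Q))) refl

      -- The parameter `s` takes the values 1 and -1, so that one identity yields both bounds. The
      -- norm of u clears the denominator of the quotient v/u.
      main-eq : ∀ s → + 11 ℤ.* (norm P₁ Q₁ ℤ.* (+ 33 ℤ.* p ℤ.+ s ℤ.* (+ 4 ℤ.* (+ K ℤ.* q))))
        ≡ + 12 ℤ.* (P₁ ℤ.* P₂) ℤ.+ rest ℤ.+ s ℤ.* (+ 4 ℤ.* (P₁ ℤ.* r₂ ℤ.- P₂ ℤ.* r₁))
      main-eq s = trans (solve 6 (λ P Q p q K s →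
            con (+ 11) :* ((P :* P :- con (+ 13) :* (Q :* Q)) :* (con (+ 33) :* p :+ s :* (con (+ 4) :* (K :* q))))
            := con (+ 363) :* (P :* (P :* p :+ con (+ 13) :* (Q :* q)) :- con (+ 13) :* (Q :* (P :* q :+ Q :* p)))
               :+ s :* (con (+ 4) :* (P :* (con (+ 11) :* (K :* (P :* q :+ Q :* p)))
                    :- (P :* p :+ con (+ 13) :* (Q :* q)) :* (con (+ 11) :* (K :* Q))))) refl P₁ Q₁ p q (+ K) s)
        (trans (cong₂ (λ x y → + 363 ℤ.* (P₁ ℤ.* x ℤ.- + 13 ℤ.* (Q₁ ℤ.* y))
                 ℤ.+ s ℤ.* (+ 4 ℤ.* (P₁ ℤ.* (+ 11 ℤ.* (+ K ℤ.* y)) ℤ.- x ℤ.* (+ 11 ℤ.* (+ K ℤ.* Q₁))))) (sym P≡) (sym Q≡))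
        (trans (cong₂ (λ x y → + 363 ℤ.* (P₁ ℤ.* P₂ ℤ.- + 13 ℤ.* (Q₁ ℤ.* Q₂))
                 ℤ.+ s ℤ.* (+ 4 ℤ.* (P₁ ℤ.* x ℤ.- P₂ ℤ.* y))) split₂ split₁)
          (solve 8 (λ P₁ Q₁ P₂ Q₂ b r₁ r₂ s →
            con (+ 363) :* (P₁ :* P₂ :- con (+ 13) :* (Q₁ :* Q₂))
              :+ s :* (con (+ 4) :* (P₁ :* (b :* (con (+ 3) :* P₂) :+ r₂) :- P₂ :* (b :* (con (+ 3) :* P₁) :+ r₁)))
            := con (+ 12) :* (P₁ :* P₂)
               :+ con (+ 39) :* ((con (+ 3) :* P₁ :- con (+ 11) :* Q₁) :* (con (+ 3) :* P₂) :+ con (+ 11) :* (Q₁ :* (con (+ 3) :* P₂ :- con (+ 11) :* Q₂)))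
               :+ s :* (con (+ 4) :* (P₁ :* r₂ :- P₂ :* r₁))) refl P₁ Q₁ P₂ Q₂ (+ b) r₁ r₂ s)))

      conclude : ∀ s → + 0 ℤ.< + 12 ℤ.* (P₁ ℤ.* P₂) ℤ.+ rest ℤ.+ s ℤ.* (+ 4 ℤ.* (P₁ ℤ.* r₂ ℤ.- P₂ ℤ.* r₁)) →
                 + 0 ℤ.< + 33 ℤ.* p ℤ.+ s ℤ.* (+ 4 ℤ.* (+ K ℤ.* q))
      conclude s h = ℤ-0<-cancel (norm P₁ Q₁) 0<norm (ℤ-0<-cancel (+ 11) 0<+suc (<-subst (sym (main-eq s)) h))

    quotient-upper : + 0 ℤ.< + 33 ℤ.* p ℤ.+ -[1+ 0 ] ℤ.* (+ 4 ℤ.* (+ K ℤ.* q))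
    quotient-upper = conclude -[1+ 0 ] (<-subst (eq P₁ P₂ r₁ r₂ rest)
        (ℤ-0<+ (ℤ-0<+ (ℤ-0<* {+ 4} 0<+suc (ℤ-0<* 0<P₁ r₂<)) (ℤ-0≤* {+ 4} 0≤pos (ℤ-0≤* (ℤₚ.<⇒≤ 0<P₂) 0≤r₁))) 0≤rest))
      where
        eq : ∀ P₁ P₂ r₁ r₂ R → + 4 ℤ.* (P₁ ℤ.* (+ 3 ℤ.* P₂ ℤ.- r₂)) ℤ.+ + 4 ℤ.* (P₂ ℤ.* r₁) ℤ.+ R
           ≡ + 12 ℤ.* (P₁ ℤ.* P₂) ℤ.+ R ℤ.+ -[1+ 0 ] ℤ.* (+ 4 ℤ.* (P₁ ℤ.* r₂ ℤ.- P₂ ℤ.* r₁))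
        eq = solve 5 (λ P₁ P₂ r₁ r₂ R → con (+ 4) :* (P₁ :* (con (+ 3) :* P₂ :- r₂)) :+ con (+ 4) :* (P₂ :* r₁) :+ R
           := con (+ 12) :* (P₁ :* P₂) :+ R :+ con -[1+ 0 ] :* (con (+ 4) :* (P₁ :* r₂ :- P₂ :* r₁))) refl

    quotient-lower : + 0 ℤ.< + 33 ℤ.* p ℤ.+ + 1 ℤ.* (+ 4 ℤ.* (+ K ℤ.* q))
    quotient-lower = conclude (+ 1) (<-subst (eq P₁ P₂ r₁ r₂ rest)
        (ℤ-0<+ (ℤ-0<+ (ℤ-0<* {+ 4} 0<+suc (ℤ-0<* 0<P₂ r₁<)) (ℤ-0≤* {+ 4} 0≤pos (ℤ-0≤* (ℤₚ.<⇒≤ 0<P₁) 0≤r₂))) 0≤rest))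
      where
        eq : ∀ P₁ P₂ r₁ r₂ R → + 4 ℤ.* (P₂ ℤ.* (+ 3 ℤ.* P₁ ℤ.- r₁)) ℤ.+ + 4 ℤ.* (P₁ ℤ.* r₂) ℤ.+ R
           ≡ + 12 ℤ.* (P₁ ℤ.* P₂) ℤ.+ R ℤ.+ + 1 ℤ.* (+ 4 ℤ.* (P₁ ℤ.* r₂ ℤ.- P₂ ℤ.* r₁))
        eq = solve 5 (λ P₁ P₂ r₁ r₂ R → con (+ 4) :* (P₂ :* (con (+ 3) :* P₁ :- r₁)) :+ con (+ 4) :* (P₁ :* r₂) :+ R
           := con (+ 12) :* (P₁ :* P₂) :+ R :+ con (+ 1) :* (con (+ 4) :* (P₁ :* r₂ :- P₂ :* r₁))) refl

  record SmallWord (K : ℕ) : Set where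
    field
      {len} : ℕ
      {p q} : ℤ
      word  : Word (suc len) p q
      upper : + 0 ℤ.< + 33 ℤ.* p ℤ.+ -[1+ 0 ] ℤ.* (+ 4 ℤ.* (+ K ℤ.* q))
      lower : + 0 ℤ.< + 33 ℤ.* p ℤ.+ + 1 ℤ.* (+ 4 ℤ.* (+ K ℤ.* q))

  opaque
    -- The first K + 1 points of the walk fall into K buckets. Because i < j is strict, the word
    -- leading from one point to the other is not empty, as irrationality requires.
    small-word : ∀ K .{{_ : NonZero K}} → SmallWord K
    small-word K with Finₚ.pigeonhole (ℕₚ.n<1+n K) (λ (i : Fin (suc K)) → fromℕ< (proj₁ (proj₂ (bucket K (walk (toℕ i))))))
    ... | i , j , i<j , eq with ℕₚ.m≤n⇒∃[o]m+o≡n i<j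
    ... | o , i+o≡j = record { word = Quotient.word W ; upper = quotient-upper Bu Bv W ; lower = quotient-lower Bu Bv W }
      where
        index : ℕ → ℕ
        index n = proj₁ (bucket K (walk n))
        same : index (toℕ j) ≡ index (toℕ i)
        same = trans (sym (Finₚ.toℕ-fromℕ< (proj₁ (proj₂ (bucket K (walk (toℕ j)))))))
          (trans (cong toℕ (sym eq)) (Finₚ.toℕ-fromℕ< (proj₁ (proj₂ (bucket K (walk (toℕ i)))))))
        Bu : Bucket K (walk (toℕ i)) (index (toℕ i))
        Bu = proj₂ (proj₂ (bucket K (walk (toℕ i))))
        Bv : Bucket K (walk (toℕ j)) (index (toℕ i))
        Bv = subst (Bucket K (walk (toℕ j))) same (proj₂ (proj₂ (bucket K (walk (toℕ j)))))
        W : Quotient (walk (toℕ i)) (walk (toℕ j)) (suc o)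
        W = subst (λ n → Quotient (walk (toℕ i)) (walk n) (suc o))
              (trans (cong suc (ℕₚ.+-comm o (toℕ i))) i+o≡j) (quotient (toℕ i) (suc o))

-- Nonzero slopes tending to 0

opaque
  /1-pos : ∀ {i} → + 0 ℤ.< i → 0ℚ ℚ.< i ℚ./ 1
  /1-pos {+ suc n}  _ = ℚₚ.positive⁻¹ (+ suc n ℚ./ 1) {{ℚₚ.normalize-pos (suc n) 1}}
  /1-pos {+ zero} (ℤ.+<+ ())

  pos⇒suc : ∀ {i} → + 0 ℤ.< + 66 ℤ.* i → ∃ λ n → i ≡ + suc n
  pos⇒suc {+ suc n} _ = n , refl
  pos⇒suc {+ zero} (ℤ.+<+ ())
  pos⇒suc { -[1+ n ]} ()

-- With t = q/p the element p + qN is 1 + tN up to a scalar. The inverse of t is recorded because t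
-- is to occur in the denominator of a difference quotient.
record Slope (n : ℕ) : Set where
  field
    {len} : ℕ
    {p q} : ℤ
    word  : Word len p q
    t t⁻¹ : ℝ
    tp≈q  : t *ᵣ fromℤ p ≈ᵣ fromℤ q
    t⁻¹t  : t⁻¹ *ᵣ t ≈ᵣ 1ᵣ

opaque
  slope : ∀ n → ∃ λ (t : ℚ) → ℚ.∣ t ∣ ℚ.< (+ 33 ℚ./ 4) ℚ.* recip (suc n) × ∃ λ (S : Slope n) → Slope.t S ≈ᵣ fromℚ t
  slope n = t , t-small , S′ , ≈ᵣ-refl
    where
      S : SmallWord (suc n)
      S = small-word (suc n)
      open SmallWord S
      -- The bounds for both signs add up to 66p > 0, so division by p is possible.
      0<66p : ∀ {p q : ℤ} → + 0 ℤ.< + 33 ℤ.* p ℤ.+ -[1+ 0 ] ℤ.* q → + 0 ℤ.< + 33 ℤ.* p ℤ.+ + 1 ℤ.* q → + 0 ℤ.< + 66 ℤ.* p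
      0<66p {p} {q} h h′ = subst (+ 0 ℤ.<_) (eq p q) (ℤₚ.+-mono-< h h′)
        where
          open Data.Integer.Solver.+-*-Solver
          eq : ∀ p q → (+ 33 ℤ.* p ℤ.+ -[1+ 0 ] ℤ.* q) ℤ.+ (+ 33 ℤ.* p ℤ.+ + 1 ℤ.* q) ≡ + 66 ℤ.* p
          eq = solve 2 (λ p q → (con (+ 33) :* p :+ con -[1+ 0 ] :* q) :+ (con (+ 33) :* p :+ con (+ 1) :* q) := con (+ 66) :* p) refl
      positive : ∃ λ n → p ≡ + suc n
      positive = pos⇒suc (0<66p {p} {+ 4 ℤ.* (+ suc n ℤ.* q)} upper lower)
      p′ : ℕ
      p′ = proj₁ positive
      p≡ : p ≡ + suc p′
      p≡ = proj₂ positive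
      Pq Qq K rp rK t : ℚ
      Pq = p ℚ./ 1
      Qq = q ℚ./ 1
      K  = + suc n ℚ./ 1
      rp = recip (suc p′)
      rK = recip (suc n)
      t  = Qq ℚ.* rp
      rpP : rp ℚ.* Pq ≡ 1ℚ
      rpP = trans (cong (λ i → rp ℚ.* (i ℚ./ 1)) p≡) (recip-inverse p′)
      cast : ∀ s → (+ 33 ℤ.* p ℤ.+ s ℤ.* (+ 4 ℤ.* (+ suc n ℤ.* q))) ℚ./ 1
           ≡ (+ 33 ℚ./ 1) ℚ.* Pq ℚ.+ (s ℚ./ 1) ℚ.* ((+ 4 ℚ./ 1) ℚ.* (K ℚ.* Qq))
      cast s = trans (/1-+ (+ 33 ℤ.* p) (s ℤ.* (+ 4 ℤ.* (+ suc n ℤ.* q)))) (cong₂ ℚ._+_ (/1-* (+ 33) p)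
        (trans (/1-* s (+ 4 ℤ.* (+ suc n ℤ.* q))) (cong ((s ℚ./ 1) ℚ.*_) (trans (/1-* (+ 4) (+ suc n ℤ.* q)) (cong ((+ 4 ℚ./ 1) ℚ.*_) (/1-* (+ suc n) q))))))
      module R = +-*-Solver
      scaled : ∀ s → (+ 1 ℚ./ 4) ℚ.* ((rp ℚ.* rK) ℚ.* ((+ 33 ℚ./ 1) ℚ.* Pq ℚ.+ s ℚ.* ((+ 4 ℚ./ 1) ℚ.* (K ℚ.* Qq))))
             ≡ (+ 33 ℚ./ 4) ℚ.* rK ℚ.+ s ℚ.* t
      scaled s = trans (identity (+ 1 ℚ./ 4) (+ 33 ℚ./ 1) (+ 4 ℚ./ 1) rp rK Pq s K Qq)
        (cong₂ (λ x y → (+ 33 ℚ./ 4) ℚ.* x ℚ.+ s ℚ.* y)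
          (trans (cong (rK ℚ.*_) rpP) (ℚₚ.*-identityʳ rK))
          (trans (ℚₚ.*-identityˡ _) (trans (cong (t ℚ.*_) (recip-inverse n)) (ℚₚ.*-identityʳ t))))
        where
          identity : ∀ f c d rp rK P s K Q → f ℚ.* ((rp ℚ.* rK) ℚ.* (c ℚ.* P ℚ.+ s ℚ.* (d ℚ.* (K ℚ.* Q))))
                   ≡ (f ℚ.* c) ℚ.* (rK ℚ.* (rp ℚ.* P)) ℚ.+ s ℚ.* ((f ℚ.* d) ℚ.* ((Q ℚ.* rp) ℚ.* (rK ℚ.* K)))
          identity = R.solve 9 (λ f c d rp rK P s K Q → f R.:* ((rp R.:* rK) R.:* (c R.:* P R.:+ s R.:* (d R.:* (K R.:* Q))))
            R.:= (f R.:* c) R.:* (rK R.:* (rp R.:* P)) R.:+ s R.:* ((f R.:* d) R.:* ((Q R.:* rp) R.:* (rK R.:* K)))) refl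
      bound : ∀ s → + 0 ℤ.< + 33 ℤ.* p ℤ.+ s ℤ.* (+ 4 ℤ.* (+ suc n ℤ.* q)) → 0ℚ ℚ.< (+ 33 ℚ./ 4) ℚ.* rK ℚ.+ (s ℚ./ 1) ℚ.* t
      bound s h = <r (scaled (s ℚ./ 1)) (*ε-pos (recip-pos 4) (*ε-pos (*ε-pos (recip-pos (suc p′)) (recip-pos (suc n)))
        (<r (cast s) (/1-pos h))))
      shift : ∀ c x → c ℚ.+ (-[1+ 0 ] ℚ./ 1) ℚ.* x ℚ.+ x ≡ c
      shift c x = trans (R.solve 3 (λ c m x → c R.:+ m R.:* x R.:+ x R.:= c R.:+ (m R.:+ R.con 1ℚ) R.:* x) refl c (-[1+ 0 ] ℚ./ 1) x)
        (trans (cong (c ℚ.+_) (ℚₚ.*-zeroˡ x)) (ℚₚ.+-identityʳ c))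
      shift′ : ∀ c x → c ℚ.+ (+ 1 ℚ./ 1) ℚ.* x ℚ.+ ℚ.- x ≡ c
      shift′ = R.solve 2 (λ c x → c R.:+ R.con 1ℚ R.:* x R.:+ R.:- x R.:= c) refl
      t-small : ℚ.∣ t ∣ ℚ.< (+ 33 ℚ./ 4) ℚ.* rK
      t-small = ∣∣< (<l (ℚₚ.+-identityˡ t) (<r (shift _ t) (ℚₚ.+-monoˡ-< t (bound -[1+ 0 ] upper))))
                    (<l (ℚₚ.+-identityˡ (ℚ.- t)) (<r (shift′ _ t) (ℚₚ.+-monoˡ-< (ℚ.- t) (bound (+ 1) lower))))
      -- Irrationality of nonempty words enters here: the slope must not be 0, or the group element
      -- would be trivial.
      q-inv : ∃ λ x → x *ᵣ fromℤ q ≈ᵣ 1ᵣ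
      q-inv = ℤ-inverse q (word-irrational word)
      tP : t ℚ.* Pq ≡ Qq
      tP = trans (ℚₚ.*-assoc Qq rp Pq) (trans (cong (Qq ℚ.*_) rpP) (ℚₚ.*-identityʳ Qq))
      S′ : Slope n
      S′ = record { word = word ; t = fromℚ t ; t⁻¹ = proj₁ q-inv *ᵣ fromℤ p
        ; tp≈q = ≡⇒≈ᵣ λ _ → tP
        ; t⁻¹t = ℝr.trans (ℝr.*-assoc _ (fromℤ p) (fromℚ t)) (ℝr.trans (ℝr.*-congˡ (≡⇒≈ᵣ λ _ → trans (ℚₚ.*-comm Pq t) tP)) (proj₂ q-inv)) }

  lim-slope : Limᵣ (λ n → Slope.t (proj₁ (proj₂ (proj₂ (slope n))))) 0ᵣ
  lim-slope = limᵣ-resp (λ n → ℝr.sym (proj₂ (proj₂ (proj₂ (slope n))))) ≈ᵣ-refl (limᵣ-fromℚ {λ n → proj₁ (slope n)} λ ε 0<ε →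
    let K , h = arch (+ 33 ℚ./ 4) ε 0<ε in K , λ n p → ℚₚ.<-trans (proj₁ (proj₂ (slope n))) (h n p))

Slopes : ∀ n → Slope n
Slopes n = proj₁ (proj₂ (proj₂ (slope n)))

-- Derivatives

opaque
  <⇒0<- : ∀ {x y} → x <ᵣ y → 0ᵣ <ᵣ y -ᵣ x
  <⇒0<- {x} {y} (mk< g 0<g N sep) = mk< g 0<g N λ i p →
      ≤l (lem (seq x i) g) (ℚₚ.+-monoˡ-≤ (ℚ.- seq x i) (sep i p))
    where
      open +-*-Solver
      lem : ∀ x g → (x ℚ.+ g) ℚ.- x ≡ 0ℚ ℚ.+ g
      lem = solve 2 (λ x g → (x :+ g) :- x := con 0ℚ :+ g) refl

  0<-⇒< : ∀ {x y} → 0ᵣ <ᵣ y -ᵣ x → x <ᵣ y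
  0<-⇒< {x} {y} (mk< g 0<g N sep) = mk< g 0<g N λ i p →
      ≤l (lem (seq x i) g) (≤r (lem′ (seq x i) (seq y i)) (ℚₚ.+-monoˡ-≤ (seq x i) (sep i p)))
    where
      open +-*-Solver
      lem : ∀ x g → (0ℚ ℚ.+ g) ℚ.+ x ≡ x ℚ.+ g
      lem = solve 2 (λ x g → (con 0ℚ :+ g) :+ x := x :+ g) refl
      lem′ : ∀ x y → (y ℚ.- x) ℚ.+ x ≡ y
      lem′ = solve 2 (λ x y → (y :- x) :+ x := y) refl

  ∣∣²-* : ∀ z w → ∣ z * w ∣² ≈ᵣ ∣ z ∣² *ᵣ ∣ w ∣²
  ∣∣²-* (a +i b) (c +i d) = solveℤ 4 (λ a b c d →
      (a :* c :- b :* d) :* (a :* c :- b :* d) :+ (a :* d :+ b :* c) :* (a :* d :+ b :* c)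
      ≔ (a :* a :+ b :* b) :* (c :* c :+ d :* d)) refl (a ∷ b ∷ c ∷ d ∷ [])
    where open ℝ-Solver

  ∣∣²-cong : ∀ {z w} → z ≈ w → ∣ z ∣² ≈ᵣ ∣ w ∣²
  ∣∣²-cong (p , q) = ℝr.+-cong (ℝr.*-cong p p) (ℝr.*-cong q q)

  ∣∣²-nonneg : ∀ z i → 0ℚ ℚ.≤ seq ∣ z ∣² i
  ∣∣²-nonneg z i = 0≤+ (0≤a² (seq (re z) i)) (0≤a² (seq (im z) i))

  invertible⇒∣∣²-pos : ∀ {v h} → v * h ≈ 1ᶜ → 0ᵣ <ᵣ ∣ h ∣²
  invertible⇒∣∣²-pos {v} {h} vh = >0-factor {∣ v ∣²} (∣∣²-nonneg h)
    (>0-resp (ℝr.trans (ℝr.sym one) (ℝr.trans (∣∣²-cong (≈-sym vh)) (∣∣²-* v h))) (>0-fromℚ 0<1))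
    where
      open ℝ-Solver
      one : ∣ 1ᶜ ∣² ≈ᵣ fromℚ 1ℚ
      one = ≡⇒≈ᵣ λ _ → refl

  -- A negated inequality supplies no index by itself. Beyond the N given by the modulus of |e|² its
  -- approximations vary by less than η = (ε/2)². A value of at least 3η at N would keep all later
  -- ones a gap η above η, contrary to the hypothesis; so that value is below 3η and all later ones
  -- are below 4η = ε².
  ∣∣²≤⇒within : ∀ {e ε} → 0ℚ ℚ.< ε → ∣ e ∣² ≤ᵣ fromℚ (½ ℚ.* ε) *ᵣ fromℚ (½ ℚ.* ε) →
                Within ε (re e) 0ᵣ × Within ε (im e) 0ᵣ
  ∣∣²≤⇒within {e} {ε} 0<ε h = (N , λ i p → part (x i) (y i) (0≤a² (y i)) (bound i p))
                            , (N , λ i p → part (y i) (x i) (0≤a² (x i)) (≤-comm i (bound i p)))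
    where
      x y a : ℕ → ℚ
      x = seq (re e)
      y = seq (im e)
      a = seq ∣ e ∣²
      η : ℚ
      η = (½ ℚ.* ε) ℚ.* (½ ℚ.* ε)
      0<η : 0ℚ ℚ.< η
      0<η = *ε-pos (½-pos 0<ε) (½-pos 0<ε)
      C : ∃ λ N → ∀ m n → N ℕ.≤ m → N ℕ.≤ n → ℚ.∣ a m ℚ.- a n ∣ ℚ.< η
      C = cauchy ∣ e ∣² η 0<η
      N : ℕ
      N = proj₁ C
      open +-*-Solver
      3η : ℚ
      3η = (η ℚ.+ η) ℚ.+ η
      sub : ∀ a b → b ℚ.+ (a ℚ.- b) ≡ a
      sub = solve 2 (λ a b → b :+ (a :- b) := a) refl
      cancel : ∀ η → ((η ℚ.+ η) ℚ.+ η) ℚ.- η ≡ η ℚ.+ η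
      cancel = solve 1 (λ η → ((η :+ η) :+ η) :- η := η :+ η) refl
      four : ∀ ε → (((½ ℚ.* ε) ℚ.* (½ ℚ.* ε) ℚ.+ (½ ℚ.* ε) ℚ.* (½ ℚ.* ε)) ℚ.+ (½ ℚ.* ε) ℚ.* (½ ℚ.* ε)) ℚ.+ (½ ℚ.* ε) ℚ.* (½ ℚ.* ε) ≡ ε ℚ.* ε
      four = solve 1 (λ ε → (((con ½ :* ε) :* (con ½ :* ε) :+ (con ½ :* ε) :* (con ½ :* ε)) :+ (con ½ :* ε) :* (con ½ :* ε)) :+ (con ½ :* ε) :* (con ½ :* ε) := ε :* ε) refl
      aN< : a N ℚ.< 3η
      aN< = ℚₚ.≰⇒> λ 3η≤ → h (mk< η 0<η N λ i p → ≤l (cancel η) (≤r (sub′ (a N) (a i))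
          (ℚₚ.+-mono-≤ 3η≤ (ℚₚ.neg-antimono-≤ (ℚₚ.≤-trans (≤∣∣ (a N ℚ.- a i)) (ℚₚ.<⇒≤ (proj₂ C N i ℕₚ.≤-refl p)))))))
        where
          sub′ : ∀ a b → a ℚ.- (a ℚ.- b) ≡ b
          sub′ = solve 2 (λ a b → a :- (a :- b) := b) refl
      bound : ∀ i → N ℕ.≤ i → x i ℚ.* x i ℚ.+ y i ℚ.* y i ℚ.< ε ℚ.* ε
      bound i p = <r (four ε) (<l (sub (a i) (a N)) (ℚₚ.+-mono-< aN<
        (ℚₚ.≤-<-trans (≤∣∣ (a i ℚ.- a N)) (proj₂ C i N p ℕₚ.≤-refl))))
      ≤-comm : ∀ i → x i ℚ.* x i ℚ.+ y i ℚ.* y i ℚ.< ε ℚ.* ε → y i ℚ.* y i ℚ.+ x i ℚ.* x i ℚ.< ε ℚ.* ε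
      ≤-comm i = <l (ℚₚ.+-comm (x i ℚ.* x i) (y i ℚ.* y i))
      part : ∀ u v → 0ℚ ℚ.≤ v ℚ.* v → u ℚ.* u ℚ.+ v ℚ.* v ℚ.< ε ℚ.* ε → ℚ.∣ u ℚ.- 0ℚ ∣ ℚ.< ε
      part u v 0≤v² q = <l (cong ℚ.∣_∣ (sym (ℚₚ.+-identityʳ u))) (sq<⇒∣∣< 0<ε
        (ℚₚ.≤-<-trans (≤l (ℚₚ.+-identityʳ (u ℚ.* u)) (ℚₚ.+-monoʳ-≤ (u ℚ.* u) 0≤v²)) q))

  lim-0-sq : ∀ {e : ℕ → ℂ} →
    (∀ ε → 0ℚ ℚ.< ε → ∃ λ N → ∀ n → N ℕ.≤ n → ∣ e n ∣² ≤ᵣ fromℚ ε *ᵣ fromℚ ε) → Lim e 0ᶜ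
  lim-0-sq h = mkLim
    (mkLimᵣ λ ε 0<ε → proj₁ (h (½ ℚ.* ε) (½-pos 0<ε)) , λ n p → proj₁ (∣∣²≤⇒within 0<ε (proj₂ (h (½ ℚ.* ε) (½-pos 0<ε)) n p)))
    (mkLimᵣ λ ε 0<ε → proj₁ (h (½ ℚ.* ε) (½-pos 0<ε)) , λ n p → proj₂ (∣∣²≤⇒within 0<ε (proj₂ (h (½ ℚ.* ε) (½-pos 0<ε)) n p)))

  lim⇒∣-∣²< : ∀ {s l δ} → Lim s l → 0ᵣ <ᵣ δ → ∃ λ N → ∀ n → N ℕ.≤ n → ∣ s n - l ∣² <ᵣ δ *ᵣ δ
  lim⇒∣-∣²< {s} {l} {δ} (mkLim r i) (mk< g 0<g K sep) =
    let h = ½ ℚ.* g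
        N₁ , f₁ = eventually r h (½-pos 0<g)
        N₂ , f₂ = eventually i h (½-pos 0<g)
    in N₁ ℕ.⊔ N₂ , λ n p →
       let I₁ , k₁ = f₁ n (⊔ˡ {N₁} {N₂} p)
           I₂ , k₂ = f₂ n (⊔ʳ {N₁} {N₂} p)
       in mk< (½ ℚ.* (g ℚ.* g)) (½-pos (*ε-pos 0<g 0<g)) (K ℕ.⊔ (I₁ ℕ.⊔ I₂)) λ j q →
          let q' = ⊔ʳ {K} {I₁ ℕ.⊔ I₂} q in
          bound (seq (re (s n)) j ℚ.- seq (re l) j) (seq (im (s n)) j ℚ.- seq (im l) j) (seq δ j)
            (k₁ j (⊔ˡ {I₁} {I₂} q')) (k₂ j (⊔ʳ {I₁} {I₂} q')) (≤l (ℚₚ.+-identityˡ g) (sep j (⊔ˡ {K} {I₁ ℕ.⊔ I₂} q)))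
    where
      open +-*-Solver
      lem : ∀ g → ((½ ℚ.* g) ℚ.* (½ ℚ.* g) ℚ.+ (½ ℚ.* g) ℚ.* (½ ℚ.* g)) ℚ.+ ½ ℚ.* (g ℚ.* g) ≡ g ℚ.* g
      lem = solve 1 (λ g → ((con ½ :* g) :* (con ½ :* g) :+ (con ½ :* g) :* (con ½ :* g)) :+ con ½ :* (g :* g) := g :* g) refl
      bound : ∀ x y d → ℚ.∣ x ∣ ℚ.< ½ ℚ.* g → ℚ.∣ y ∣ ℚ.< ½ ℚ.* g → g ℚ.≤ d →
              (x ℚ.* x ℚ.+ y ℚ.* y) ℚ.+ ½ ℚ.* (g ℚ.* g) ℚ.≤ d ℚ.* d
      bound x y d p q r = ℚₚ.≤-trans
        (≤r (lem g) (ℚₚ.+-monoˡ-≤ (½ ℚ.* (g ℚ.* g)) (ℚₚ.<⇒≤ (ℚₚ.+-mono-< (∣∣<⇒sq< p) (∣∣<⇒sq< q)))))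
        (*-mono-≤ (ℚₚ.<⇒≤ 0<g) (ℚₚ.≤-trans (ℚₚ.<⇒≤ 0<g) r) r r)

-- Differentiability along sequences of points w n distinct from z; v n is the inverse of w n - z.
record HasDeriv (F : ℋ → ℂ) (z : ℋ) (L : ℂ) : Set where
  constructor mkDeriv
  field
    quotients : ∀ (w : ℕ → ℋ) (v : ℕ → ℂ) → Lim (λ n → pt (w n)) (pt z) →
                (∀ n → v n * (pt (w n) - pt z) ≈ 1ᶜ) → Lim (λ n → (F (w n) - F z) * v n) L
open HasDeriv public

holomorphic⇒hasDeriv : ∀ {f} → Holomorphic f → ∀ z → ∃ (HasDeriv f z)
holomorphic⇒hasDeriv {f} hol z = L , mkDeriv λ w v w→z vw →
    let e = λ n → (f (w n) - f z - L * (pt (w n) - pt z)) * v n in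
    lim-resp (λ n → recover (f (w n) - f z) (v n) (pt (w n) - pt z) (vw n)) (ℂr.+-identityˡ L)
      (lim-+ (lim-0-sq {e} λ ε 0<ε →
          let δ , 0<δ , near = proj₂ (hol z) (fromℚ ε) (>0-fromℚ 0<ε)
              N , close-to = lim⇒∣-∣²< w→z 0<δ
          in N , λ n p → divide (fromℚ ε) (f (w n) - f z - L * (pt (w n) - pt z)) (v n) (pt (w n) - pt z) (vw n)
               (near (w n) (close-to n p)))
        (lim-const L))
  where
    L : ℂ
    L = proj₁ (hol z)
    recover : ∀ D v h → v * h ≈ 1ᶜ → (D - L * h) * v + L ≈ D * v
    recover D v h vh = ≈-trans (solveℤ 4 (λ D v h L → (D :- L :* h) :* v :+ L ≔ D :* v :- L :* (v :* h) :+ L) refl (D ∷ v ∷ h ∷ L ∷ []))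
      (≈-trans (ℂr.+-congʳ (ℂr.+-congˡ (ℂr.-‿cong (ℂr.*-congˡ vh))))
        (solveℤ 2 (λ x L → x :- L :* con (+ 1) :+ L ≔ x) refl (D * v ∷ L ∷ [])))
      where open ℂ-Solver
    -- As `≤ᵣ` is a negation, a violation of the conclusion is assumed; multiplied by |h|² > 0 it
    -- becomes a violation of the hypothesis.
    divide : ∀ ε X v h → v * h ≈ 1ᶜ → ∣ X ∣² ≤ᵣ ε *ᵣ ε *ᵣ ∣ h ∣² → ∣ X * v ∣² ≤ᵣ ε *ᵣ ε
    divide ε X v h vh X≤ ε<Xv = X≤ (0<-⇒< (>0-resp eq (>0-* (<⇒0<- ε<Xv) (invertible⇒∣∣²-pos {v} {h} vh))))
      where
        open ℝ-Solver
        one : ∣ v ∣² *ᵣ ∣ h ∣² ≈ᵣ 1ᵣ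
        one = ℝr.trans (ℝr.sym (∣∣²-* v h)) (ℝr.trans (∣∣²-cong vh) (≡⇒≈ᵣ λ _ → refl))
        eq : (∣ X * v ∣² -ᵣ ε *ᵣ ε) *ᵣ ∣ h ∣² ≈ᵣ ∣ X ∣² -ᵣ ε *ᵣ ε *ᵣ ∣ h ∣²
        eq = ℝr.trans (ℝr.*-congʳ (ℝr.+-congʳ (∣∣²-* X v)))
          (ℝr.trans (solveℤ 4 (λ x v h e → (x :* v :- e :* e) :* h ≔ x :* (v :* h) :- e :* e :* h) refl (∣ X ∣² ∷ ∣ v ∣² ∷ ∣ h ∣² ∷ ε ∷ []))
            (ℝr.+-congʳ (ℝr.trans (ℝr.*-congˡ one) (ℝr.*-identityʳ ∣ X ∣²))))

module _ {z : ℋ} where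
  open ℂ-Solver

  -- The product rule needs continuity only along sequences with w n ≠ z, where F (w n) is recovered
  -- from the difference quotient as (F (w n) - F z) * v n * (w n - z) + F z.
  deriv-continuous : ∀ {F L} → HasDeriv F z L → ∀ (w : ℕ → ℋ) (v : ℕ → ℂ) → Lim (λ n → pt (w n)) (pt z) →
                     (∀ n → v n * (pt (w n) - pt z) ≈ 1ᶜ) → Lim (λ n → F (w n)) (F z)
  deriv-continuous {F} {L} D w v w→z vw = lim-resp
      (λ n → recover (F (w n)) (F z) (v n) (pt (w n) - pt z) (vw n))
      (solveℤ 3 (λ L z y → L :* (z :- z) :+ y ≔ y) refl (L ∷ pt z ∷ F z ∷ []))
      (lim-+ (lim-* (quotients D w v w→z vw) (lim-difference w→z (lim-const (pt z)))) (lim-const (F z)))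
    where
      recover : ∀ x y v h → v * h ≈ 1ᶜ → (x - y) * v * h + y ≈ x
      recover x y v h vh = ≈-trans (ℂr.+-congʳ (≈-trans (ℂr.*-assoc (x - y) v h) (ℂr.*-congˡ vh)))
        (solveℤ 2 (λ x y → (x :- y) :* con (+ 1) :+ y ≔ x) refl (x ∷ y ∷ []))

  deriv-resp : ∀ {F G L} → F ≐ G → HasDeriv F z L → HasDeriv G z L
  deriv-resp F≐G D = mkDeriv λ w v w→z vw → lim-resp
    (λ n → ℂr.*-congʳ (ℂr.+-cong (F≐G (w n)) (ℂr.-‿cong (F≐G z)))) ≈-refl (quotients D w v w→z vw)

  deriv-const : ∀ x → HasDeriv (λ _ → x) z 0ᶜ
  deriv-const x = mkDeriv λ w v _ _ → lim-resp
    (λ n → solveℤ 2 (λ x v → con (+ 0) ≔ (x :- x) :* v) refl (x ∷ v n ∷ [])) ≈-refl (lim-const 0ᶜ)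

  deriv-id : HasDeriv pt z 1ᶜ
  deriv-id = mkDeriv λ w v _ vw → lim-resp (λ n → ≈-trans (≈-sym (vw n)) (ℂr.*-comm (v n) _)) ≈-refl (lim-const 1ᶜ)

  deriv-+ : ∀ {F G L M} → HasDeriv F z L → HasDeriv G z M → HasDeriv (λ w → F w + G w) z (L + M)
  deriv-+ {F} {G} D E = mkDeriv λ w v w→z vw → lim-resp
    (λ n → solveℤ 5 (λ x y x′ y′ v → (x :- x′) :* v :+ (y :- y′) :* v ≔ ((x :+ y) :- (x′ :+ y′)) :* v) refl
             (F (w n) ∷ G (w n) ∷ F z ∷ G z ∷ v n ∷ []))
    ≈-refl (lim-+ (quotients D w v w→z vw) (quotients E w v w→z vw))

  deriv-* : ∀ {F G L M} → HasDeriv F z L → HasDeriv G z M → HasDeriv (λ w → F w * G w) z (L * G z + F z * M)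
  deriv-* {F} {G} D E = mkDeriv λ w v w→z vw → lim-resp
    (λ n → solveℤ 5 (λ x y x′ y′ v → (x :- x′) :* v :* y :+ x′ :* ((y :- y′) :* v) ≔ (x :* y :- x′ :* y′) :* v) refl
             (F (w n) ∷ G (w n) ∷ F z ∷ G z ∷ v n ∷ []))
    ≈-refl (lim-+ (lim-* (quotients D w v w→z vw) (deriv-continuous E w v w→z vw))
                  (lim-* (lim-const (F z)) (quotients E w v w→z vw)))

  deriv-neg : ∀ {F L} → HasDeriv F z L → HasDeriv (λ w → - F w) z (- L)
  deriv-neg {F} D = mkDeriv λ w v w→z vw → lim-resp
    (λ n → solveℤ 3 (λ x x′ v → :- ((x :- x′) :* v) ≔ (:- x :- :- x′) :* v) refl (F (w n) ∷ F z ∷ v n ∷ []))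
    ≈-refl (lim-neg (quotients D w v w→z vw))

  deriv-^ : ∀ {F L} → HasDeriv F z L → ∀ n → ∃ (HasDeriv (λ w → F w ^ n) z)
  deriv-^ D zero    = _ , deriv-const 1ᶜ
  deriv-^ D (suc n) = _ , deriv-* D (proj₂ (deriv-^ D n))

  -- A derivative along sequences is determined as soon as one admissible sequence exists; z + 1/(n
  -- + 1), with inverse differences n + 1, is used.
  deriv-0 : ∀ {F L} → (∀ w → F w ≈ 0ᶜ) → HasDeriv F z L → L ≈ 0ᶜ
  deriv-0 {F} {L} F≈0 D = lim-unique (quotients D w v w→z vw)
      (lim-resp (λ n → ≈-sym (≈-trans (ℂr.*-congʳ (ℂr.+-cong (F≈0 (w n)) (ℂr.-‿cong (F≈0 z))))
        (solveℤ 1 (λ v → (con (+ 0) :- con (+ 0)) :* v ≔ con (+ 0)) refl (v n ∷ [])))) ≈-refl (lim-const 0ᶜ))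
    where
      w : ℕ → ℋ
      w n = pt z + ι (fromℚ (recip (suc n))) , >0-resp (ℝr.sym (ℝr.+-identityʳ (im (pt z)))) (im-pos z)
      v : ℕ → ℂ
      v n = ιℤ (+ suc n)
      w→z : Lim (λ n → pt (w n)) (pt z)
      w→z = lim-resp (λ _ → ≈-refl) (ℂr.+-identityʳ (pt z)) (lim-+ (lim-const (pt z)) (lim-ι (limᵣ-fromℚ λ ε 0<ε →
        proj₁ (recip< ε 0<ε) , λ n p → <l (sym (ℚₚ.0≤p⇒∣p∣≡p (ℚₚ.<⇒≤ (recip-pos (suc n))))) (proj₂ (recip< ε 0<ε) n p))))
      vw : ∀ n → v n * (pt (w n) - pt z) ≈ 1ᶜ
      vw n = ≈-trans (solveℤ 3 (λ v z r → v :* ((z :+ r) :- z) ≔ r :* v) refl (v n ∷ pt z ∷ κᶜ n ∷ [])) (κN≈1 n)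

-- The slash action

open GL₂⁺

opaque
  invᶜ-inverse : ∀ w (p : 0ᵣ <ᵣ ∣ w ∣²) → w * invᶜ w p ≈ 1ᶜ
  invᶜ-inverse (x +i y) p =
      ℝr.trans (solveℤ 3 (λ x y r → x :* (x :* r) :- y :* ((:- y) :* r) ≔ (x :* x :+ y :* y) :* r) refl (x ∷ y ∷ r ∷ []))
        (invᵣ-inverse ∣ x +i y ∣² p)
    , solveℤ 3 (λ x y r → x :* ((:- y) :* r) :+ y :* (x :* r) ≔ con (+ 0)) refl (x ∷ y ∷ r ∷ [])
    where
      open ℝ-Solver
      r : ℝ
      r = invᵣ ∣ x +i y ∣² p

  inverse-unique : ∀ {x y u v} → x ≈ y → x * u ≈ 1ᶜ → y * v ≈ 1ᶜ → u ≈ v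
  inverse-unique {x} {y} {u} {v} x≈y xu yv = begin
    u           ≈⟨ ℂr.*-identityˡ u ⟨
    1ᶜ * u      ≈⟨ ℂr.*-congʳ yv ⟨
    y * v * u   ≈⟨ solveℤ 3 (λ y v u → y :* v :* u ≔ v :* (y :* u)) refl (y ∷ v ∷ u ∷ []) ⟩
    v * (y * u) ≈⟨ ℂr.*-congˡ (ℂr.*-congʳ (≈-sym x≈y)) ⟩
    v * (x * u) ≈⟨ ℂr.*-congˡ xu ⟩
    v * 1ᶜ      ≈⟨ ℂr.*-identityʳ v ⟩
    v           ∎
    where
      open ≈-Reasoning
      open ℂ-Solver

  denInv-inverse : ∀ M z → den M z * denInv M z ≈ 1ᶜ
  denInv-inverse M z = invᶜ-inverse (den M z) (den-pos M z)

  -- For (p , q) a row of the left factor M of a product M N.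
  row-* : ∀ p q N z {u} → den N z * u ≈ 1ᶜ →
          ι (p *ᵣ a N +ᵣ q *ᵣ c N) * pt z + ι (p *ᵣ b N +ᵣ q *ᵣ d N) ≈ (ι p * (num N z * u) + ι q) * den N z
  row-* p q N z {u} du = begin
    ι (p *ᵣ a N +ᵣ q *ᵣ c N) * pt z + ι (p *ᵣ b N +ᵣ q *ᵣ d N)
      ≈⟨ ℂr.+-cong (ℂr.*-congʳ (expand p (a N) q (c N))) (expand p (b N) q (d N)) ⟩
    (P * A + Q * C) * Z + (P * B + Q * D)
      ≈⟨ solveℤ 7 (λ P Q A B C D Z → (P :* A :+ Q :* C) :* Z :+ (P :* B :+ Q :* D)
           ≔ P :* (A :* Z :+ B) :* con (+ 1) :+ Q :* (C :* Z :+ D)) refl (P ∷ Q ∷ A ∷ B ∷ C ∷ D ∷ Z ∷ []) ⟩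
    P * num N z * 1ᶜ + Q * den N z
      ≈⟨ ℂr.+-congʳ (ℂr.*-congˡ (≈-sym du)) ⟩
    P * num N z * (den N z * u) + Q * den N z
      ≈⟨ solveℤ 5 (λ P Q n e u → P :* n :* (e :* u) :+ Q :* e ≔ (P :* (n :* u) :+ Q) :* e) refl (P ∷ Q ∷ num N z ∷ den N z ∷ u ∷ []) ⟩
    (P * (num N z * u) + Q) * den N z ∎
    where
      open ≈-Reasoning
      open ℂ-Solver
      P Q A B C D Z : ℂ
      P = ι p
      Q = ι q
      A = ι (a N)
      B = ι (b N)
      C = ι (c N)
      D = ι (d N)
      Z = pt z
      expand : ∀ p x q y → ι (p *ᵣ x +ᵣ q *ᵣ y) ≈ ι p * ι x + ι q * ι y
      expand p x q y = ≈-trans (ι-+ _ _) (ℂr.+-cong (ι-* p x) (ι-* q y))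

  ι-det-* : ∀ M N → ι (det (M *ₘ N)) ≈ ι (det M) * ι (det N)
  ι-det-* M N = ≈-trans (ι-cong (solveℤ 8 (λ a b c d a' b' c' d' →
        (a :* a' :+ b :* c') :* (c :* b' :+ d :* d') :- (a :* b' :+ b :* d') :* (c :* a' :+ d :* c')
        ≔ (a :* d :- b :* c) :* (a' :* d' :- b' :* c')) refl
        (a M ∷ b M ∷ c M ∷ d M ∷ a N ∷ b N ∷ c N ∷ d N ∷ []))) (ι-* _ _)
    where open ℝ-Solver

num-cong : ∀ M {z w} → z ≈ℋ w → num M z ≈ num M w
num-cong M p = ℂr.+-congʳ (ℂr.*-congˡ p)

den-cong : ∀ M {z w} → z ≈ℋ w → den M z ≈ den M w
den-cong M p = ℂr.+-congʳ (ℂr.*-congˡ p)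

denInv-cong : ∀ M {z w} → z ≈ℋ w → denInv M z ≈ denInv M w
denInv-cong M {z} {w} p = inverse-unique (den-cong M {z} {w} p) (denInv-inverse M z) (denInv-inverse M w)

möbius-cong : ∀ M {z w} → z ≈ℋ w → möbius M z ≈ℋ möbius M w
möbius-cong M {z} {w} p = ℂr.*-cong (num-cong M {z} {w} p) (denInv-cong M {z} {w} p)

-- The two points are explicit because they cannot be inferred from their ≈ℋ-proof.
Respects : (ℋ → ℂ) → Set
Respects f = ∀ z w → z ≈ℋ w → f z ≈ f w

-- An opaque copy of the slash action: the conversion checker must never unfold it.
infixl 5 _∣⟨_⟩_
opaque
  _∣⟨_⟩_ : (ℋ → ℂ) → ℕ → GL₂⁺ → ℋ → ℂ
  f ∣⟨ k ⟩ M = f ∣[ k ] M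

  slash-def : ∀ f k M z → (f ∣⟨ k ⟩ M) z ≈ ι (det M) ^ (k ℕ./ 2) * denInv M z ^ k * f (möbius M z)
  slash-def f k M z = ≈-refl

  slash-≐ : ∀ f k M z → (f ∣⟨ k ⟩ M) z ≈ (f ∣[ k ] M) z
  slash-≐ f k M z = ≈-refl

module _ {f : ℋ → ℂ} (f-cong : Respects f) (k : ℕ) where

  slash-cong : ∀ M → Respects (f ∣⟨ k ⟩ M)
  slash-cong M z w p = ≈-trans (slash-def f k M z) (≈-trans
    (ℂr.*-cong (ℂr.*-congˡ (^-congˡ k (denInv-cong M {z} {w} p)))
               (f-cong (möbius M z) (möbius M w) (möbius-cong M {z} {w} p)))
    (≈-sym (slash-def f k M w)))

  -- The slash action may be evaluated with any inverse u of the denominator and any point w equal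
  -- to the image. For a product or a multiple of matrices, u can thus be assembled from inverses
  -- already at hand.
  slash-value : ∀ M z {u} w → den M z * u ≈ 1ᶜ → pt w ≈ num M z * u →
                (f ∣⟨ k ⟩ M) z ≈ ι (det M) ^ (k ℕ./ 2) * u ^ k * f w
  slash-value M z {u} w du w≈ = ≈-trans (slash-def f k M z) (ℂr.*-cong (ℂr.*-congˡ (^-congˡ k u≈))
      (f-cong (möbius M z) w (≈-trans (ℂr.*-congˡ u≈) (≈-sym w≈))))
    where
      u≈ : denInv M z ≈ u
      u≈ = inverse-unique ≈-refl (denInv-inverse M z) du

  slash-∘ : ∀ M N → f ∣⟨ k ⟩ M ∣⟨ k ⟩ N ≐ f ∣⟨ k ⟩ (M *ₘ N)
  slash-∘ M N z = ≈-sym (begin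
    (f ∣⟨ k ⟩ (M *ₘ N)) z ≈⟨ slash-value (M *ₘ N) z {u * v} (möbius M Nz) den≈ num≈ ⟩
    ι (det (M *ₘ N)) ^ h * (u * v) ^ k * F
      ≈⟨ ℂr.*-congʳ (ℂr.*-cong (≈-trans (^-congˡ h (ι-det-* M N)) (^-distrib-* _ _ h)) (^-distrib-* u v k)) ⟩
    (ι (det M) ^ h * ι (det N) ^ h) * (u ^ k * v ^ k) * F
      ≈⟨ solveℤ 5 (λ p q x y F → (p :* q) :* (x :* y) :* F ≔ q :* y :* (p :* x :* F)) refl
           (ι (det M) ^ h ∷ ι (det N) ^ h ∷ u ^ k ∷ v ^ k ∷ F ∷ []) ⟩
    ι (det N) ^ h * v ^ k * (ι (det M) ^ h * u ^ k * F) ≈⟨ ℂr.*-congˡ (slash-def f k M Nz) ⟨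
    ι (det N) ^ h * v ^ k * (f ∣⟨ k ⟩ M) Nz             ≈⟨ slash-def (f ∣⟨ k ⟩ M) k N z ⟨
    (f ∣⟨ k ⟩ M ∣⟨ k ⟩ N) z                             ∎)
    where
      open ≈-Reasoning
      open ℂ-Solver
      h : ℕ
      h = k ℕ./ 2
      Nz : ℋ
      Nz = möbius N z
      u v F : ℂ
      u = denInv M Nz
      v = denInv N z
      F = f (möbius M Nz)
      den≈ : den (M *ₘ N) z * (u * v) ≈ 1ᶜ
      den≈ = begin
        den (M *ₘ N) z * (u * v)       ≈⟨ ℂr.*-congʳ (row-* (c M) (d M) N z (denInv-inverse N z)) ⟩
        (den M Nz * den N z) * (u * v) ≈⟨ solveℤ 4 (λ x y u v → (x :* y) :* (u :* v) ≔ (x :* u) :* (y :* v)) refl (den M Nz ∷ den N z ∷ u ∷ v ∷ []) ⟩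
        (den M Nz * u) * (den N z * v) ≈⟨ ℂr.*-cong (denInv-inverse M Nz) (denInv-inverse N z) ⟩
        1ᶜ * 1ᶜ                        ≈⟨ ℂr.*-identityˡ 1ᶜ ⟩
        1ᶜ ∎
      num≈ : num M Nz * u ≈ num (M *ₘ N) z * (u * v)
      num≈ = ≈-sym (begin
        num (M *ₘ N) z * (u * v)       ≈⟨ ℂr.*-congʳ (row-* (a M) (b M) N z (denInv-inverse N z)) ⟩
        (num M Nz * den N z) * (u * v) ≈⟨ solveℤ 4 (λ x y u v → (x :* y) :* (u :* v) ≔ (x :* u) :* (y :* v)) refl (num M Nz ∷ den N z ∷ u ∷ v ∷ []) ⟩
        (num M Nz * u) * (den N z * v) ≈⟨ ℂr.*-congˡ (denInv-inverse N z) ⟩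
        (num M Nz * u) * 1ᶜ            ≈⟨ ℂr.*-identityʳ _ ⟩
        num M Nz * u ∎)

  slash-identity : ∀ M → a M ≈ᵣ 1ᵣ → b M ≈ᵣ 0ᵣ → c M ≈ᵣ 0ᵣ → d M ≈ᵣ 1ᵣ → f ∣⟨ k ⟩ M ≐ f
  slash-identity M a≈ b≈ c≈ d≈ z = begin
    (f ∣⟨ k ⟩ M) z                           ≈⟨ slash-value M z {1ᶜ} z den≈ num≈ ⟩
    ι (det M) ^ (k ℕ./ 2) * 1ᶜ ^ k * f z     ≈⟨ ℂr.*-congʳ (ℂr.*-cong (≈-trans (^-congˡ (k ℕ./ 2) (ι-cong det≈)) (1^≈1 (k ℕ./ 2))) (1^≈1 k)) ⟩
    1ᶜ * 1ᶜ * f z                            ≈⟨ solveℤ 1 (λ y → con (+ 1) :* con (+ 1) :* y ≔ y) refl (f z ∷ []) ⟩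
    f z                                      ∎
    where
      open ≈-Reasoning
      open ℂ-Solver
      det≈ : det M ≈ᵣ 1ᵣ
      det≈ = ℝr.trans (ℝr.+-cong (ℝr.*-cong a≈ d≈) (ℝr.-‿cong (ℝr.*-cong b≈ c≈))) (≡⇒≈ᵣ λ _ → refl)
      den≈ : den M z * 1ᶜ ≈ 1ᶜ
      den≈ = ≈-trans (ℂr.*-congʳ (ℂr.+-cong (ℂr.*-congʳ (ι-cong c≈)) (ι-cong d≈)))
        (solveℤ 1 (λ z → (con (+ 0) :* z :+ con (+ 1)) :* con (+ 1) ≔ con (+ 1)) refl (pt z ∷ []))
      num≈ : pt z ≈ num M z * 1ᶜ
      num≈ = ≈-sym (≈-trans (ℂr.*-congʳ (ℂr.+-cong (ℂr.*-congʳ (ι-cong a≈)) (ι-cong b≈)))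
        (solveℤ 1 (λ z → (con (+ 1) :* z :+ con (+ 0)) :* con (+ 1) ≔ z) refl (pt z ∷ [])))

  -- With h = k/2 the determinant contributes x^(2h) and the denominator y^k. They cancel because 2h
  -- = k, whatever the sign of x.
  slash-scale : k ℕ./ 2 ℕ.+ k ℕ./ 2 ≡ k → ∀ M N x y → x *ᵣ y ≈ᵣ 1ᵣ →
                a M ≈ᵣ x *ᵣ a N → b M ≈ᵣ x *ᵣ b N → c M ≈ᵣ x *ᵣ c N → d M ≈ᵣ x *ᵣ d N →
                f ∣⟨ k ⟩ M ≐ f ∣⟨ k ⟩ N
  slash-scale even M N x y xy a≈ b≈ c≈ d≈ z = begin
    (f ∣⟨ k ⟩ M) z
      ≈⟨ slash-value M z {Y * u} (möbius N z) den≈ num≈ ⟩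
    ι (det M) ^ h * (Y * u) ^ k * F
      ≈⟨ ℂr.*-congʳ (ℂr.*-cong (≈-trans (^-congˡ h det≈) (^-distrib-* (X * X) (ι (det N)) h)) (^-distrib-* Y u k)) ⟩
    ((X * X) ^ h * ι (det N) ^ h) * (Y ^ k * u ^ k) * F
      ≈⟨ solveℤ 5 (λ p q r s F → (p :* q) :* (r :* s) :* F ≔ (p :* r) :* (q :* s :* F)) refl
           ((X * X) ^ h ∷ ι (det N) ^ h ∷ Y ^ k ∷ u ^ k ∷ F ∷ []) ⟩
    (X * X) ^ h * Y ^ k * (ι (det N) ^ h * u ^ k * F) ≈⟨ ℂr.*-congʳ scalars-cancel ⟩
    1ᶜ * (ι (det N) ^ h * u ^ k * F) ≈⟨ ℂr.*-identityˡ _ ⟩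
    ι (det N) ^ h * u ^ k * F        ≈⟨ slash-def f k N z ⟨
    (f ∣⟨ k ⟩ N) z ∎
    where
      open ≈-Reasoning
      open ℂ-Solver
      h : ℕ
      h = k ℕ./ 2
      X Y u F : ℂ
      X = ι x
      Y = ι y
      u = denInv N z
      F = f (möbius N z)
      XY : X * Y ≈ 1ᶜ
      XY = ≈-trans (≈-sym (ι-* x y)) (ι-cong xy)
      row : ∀ {p q p' q'} → p ≈ᵣ x *ᵣ p' → q ≈ᵣ x *ᵣ q' → ι p * pt z + ι q ≈ X * (ι p' * pt z + ι q')
      row {p' = p'} {q'} pe qe = ≈-trans (ℂr.+-cong (ℂr.*-congʳ (≈-trans (ι-cong pe) (ι-* x p'))) (≈-trans (ι-cong qe) (ι-* x q')))
        (solveℤ 4 (λ X p q z → X :* p :* z :+ X :* q ≔ X :* (p :* z :+ q)) refl (X ∷ ι p' ∷ ι q' ∷ pt z ∷ []))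
      regroup : ∀ t → X * t * (Y * u) ≈ t * u
      regroup t = ≈-trans (solveℤ 4 (λ X Y t u → X :* t :* (Y :* u) ≔ (X :* Y) :* (t :* u)) refl (X ∷ Y ∷ t ∷ u ∷ []))
                    (≈-trans (ℂr.*-congʳ XY) (ℂr.*-identityˡ _))
      den≈ : den M z * (Y * u) ≈ 1ᶜ
      den≈ = ≈-trans (ℂr.*-congʳ (row c≈ d≈)) (≈-trans (regroup (den N z)) (denInv-inverse N z))
      num≈ : num N z * u ≈ num M z * (Y * u)
      num≈ = ≈-sym (≈-trans (ℂr.*-congʳ (row a≈ b≈)) (regroup (num N z)))
      det≈ : ι (det M) ≈ X * X * ι (det N)
      det≈ = ≈-trans (ι-cong (ℝr.trans (ℝr.+-cong (ℝr.*-cong a≈ d≈) (ℝr.-‿cong (ℝr.*-cong b≈ c≈)))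
          (solve₅ (a N) (b N) (c N) (d N)))) (≈-trans (ι-* _ _) (ℂr.*-congʳ (ι-* x x)))
        where
          solve₅ : ∀ a b c d → (x *ᵣ a) *ᵣ (x *ᵣ d) -ᵣ (x *ᵣ b) *ᵣ (x *ᵣ c) ≈ᵣ x *ᵣ x *ᵣ (a *ᵣ d -ᵣ b *ᵣ c)
          solve₅ a b c d = ℝ-Solver.solveℤ 5 (λ x a b c d →
            (x S.:* a) S.:* (x S.:* d) S.:- (x S.:* b) S.:* (x S.:* c) S.≔ x S.:* x S.:* (a S.:* d S.:- b S.:* c)) refl (x ∷ a ∷ b ∷ c ∷ d ∷ [])
            where module S = ℝ-Solver
      scalars-cancel : (X * X) ^ h * Y ^ k ≈ 1ᶜ
      scalars-cancel = begin
        (X * X) ^ h * Y ^ k          ≈⟨ ℂr.*-congˡ (ℂr.reflexive (cong (Y ^_) (sym even))) ⟩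
        (X * X) ^ h * Y ^ (h ℕ.+ h)  ≈⟨ ℂr.*-congˡ (≈-trans (^-homo-* Y h h) (≈-sym (^-distrib-* Y Y h))) ⟩
        (X * X) ^ h * (Y * Y) ^ h    ≈⟨ ^-distrib-* (X * X) (Y * Y) h ⟨
        (X * X * (Y * Y)) ^ h        ≈⟨ ^-congˡ h (≈-trans (solveℤ 2 (λ X Y → X :* X :* (Y :* Y) ≔ (X :* Y) :* (X :* Y)) refl (X ∷ Y ∷ []))
                                          (≈-trans (ℂr.*-cong XY XY) (ℂr.*-identityˡ 1ᶜ))) ⟩
        1ᶜ ^ h                       ≈⟨ 1^≈1 h ⟩
        1ᶜ ∎

slash-resp : ∀ {f g} k M → f ≐ g → f ∣⟨ k ⟩ M ≐ g ∣⟨ k ⟩ M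
slash-resp {f} {g} k M f≐g z = ≈-trans (slash-def f k M z)
  (≈-trans (ℂr.*-congˡ (f≐g (möbius M z))) (≈-sym (slash-def g k M z)))

slash-0 : ∀ k M → (λ _ → 0ᶜ) ∣⟨ k ⟩ M ≐ λ _ → 0ᶜ
slash-0 k M z = ≈-trans (slash-def _ k M z) (ℂr.zeroʳ _)

slash-+ : ∀ f g k M → (λ z → f z + g z) ∣⟨ k ⟩ M ≐ λ z → (f ∣⟨ k ⟩ M) z + (g ∣⟨ k ⟩ M) z
slash-+ f g k M z = ≈-trans (slash-def _ k M z) (≈-trans (ℂr.distribˡ _ _ _)
  (≈-sym (ℂr.+-cong (slash-def f k M z) (slash-def g k M z))))

slash-* : ∀ x f k M → (λ z → x * f z) ∣⟨ k ⟩ M ≐ λ z → x * (f ∣⟨ k ⟩ M) z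
slash-* x f k M z = ≈-trans (slash-def _ k M z)
  (≈-trans (swap _ x (f (möbius M z))) (≈-sym (ℂr.*-congˡ (slash-def f k M z))))
  where
    open ℂ-Solver
    swap : ∀ p x q → p * (x * q) ≈ x * (p * q)
    swap p x q = solveℤ 3 (λ x p q → p :* (x :* q) ≔ x :* (p :* q)) refl (x ∷ p ∷ q ∷ [])

slash-neg : ∀ f k M → (λ z → - f z) ∣⟨ k ⟩ M ≐ λ z → - (f ∣⟨ k ⟩ M) z
slash-neg f k M z = ≈-trans (slash-resp k M (λ z → neg≈ (f z)) z)
  (≈-trans (slash-* (- 1ᶜ) f k M z) (≈-sym (neg≈ _)))
  where
    open ℂ-Solver
    neg≈ : ∀ x → - x ≈ - 1ᶜ * x
    neg≈ x = solveℤ 1 (λ x → :- x ≔ :- con (+ 1) :* x) refl (x ∷ [])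

slash-difference : ∀ f g k M → (λ z → f z - g z) ∣⟨ k ⟩ M ≐ λ z → (f ∣⟨ k ⟩ M) z - (g ∣⟨ k ⟩ M) z
slash-difference f g k M z = ≈-trans (slash-+ f (λ z → - g z) k M z) (ℂr.+-congˡ (slash-neg g k M z))


-- Positivity of the determinant is checked by evaluation, for closed entries.
record ℤMat : Set where
  constructor ⟪_,_∣_,_⟫
  field
    a₁₁ a₁₂ a₂₁ a₂₂ : ℤ
    {pos} : True (+ 0 ℤₚ.<? a₁₁ ℤ.* a₂₂ ℤ.- a₁₂ ℤ.* a₂₁)
open ℤMat

gl : ℤMat → GL₂⁺
gl M = intMat (a₁₁ M) (a₁₂ M) (a₂₁ M) (a₂₂ M) (toWitness (pos M))

-- Integral matrices up to scalars

ℤ⁴ : Set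
ℤ⁴ = (ℤ × ℤ) × (ℤ × ℤ)

entries : ℤMat → ℤ⁴
entries M = (a₁₁ M , a₁₂ M) , (a₂₁ M , a₂₂ M)

infixl 7 _⊡_
_⊡_ : ℤ⁴ → ℤ⁴ → ℤ⁴
((p , q) , (r , s)) ⊡ ((p' , q') , (r' , s')) =
  (p ℤ.* p' ℤ.+ q ℤ.* r' , p ℤ.* q' ℤ.+ q ℤ.* s') , (r ℤ.* p' ℤ.+ s ℤ.* r' , r ℤ.* q' ℤ.+ s ℤ.* s')

-- If X = λ C then tr (X adj C) = 2 λ det C, so that λ = tr (X adj C) / (2 det C).
trace-adj : ℤ⁴ → ℤ⁴ → ℤ
trace-adj ((p , q) , (r , s)) ((p' , q') , (r' , s')) = (p ℤ.* s' ℤ.+ s ℤ.* p') ℤ.- (q ℤ.* r' ℤ.+ r ℤ.* q')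

infix 4 _∼_ _∼?_
-- Proportionality without division: n X = m C with nonzero integers n and m. It is decided by
-- evaluation, so that the concrete matrix identities among the Hecke matrices can be left to
-- implicit `True` arguments.
_∼_ : ℤ⁴ → ℤ⁴ → Set
X@((p , q) , (r , s)) ∼ C@((p' , q') , (r' , s')) =
  (n ≢ + 0 × m ≢ + 0) × ((n ℤ.* p ≡ m ℤ.* p' × n ℤ.* q ≡ m ℤ.* q') × (n ℤ.* r ≡ m ℤ.* r' × n ℤ.* s ≡ m ℤ.* s'))
  where
    n m : ℤ
    n = trace-adj C C
    m = trace-adj X C

_∼?_ : ∀ X C → Dec (X ∼ C)
X@((p , q) , (r , s)) ∼? C@((p' , q') , (r' , s')) =
  (¬? (n ℤₚ.≟ + 0) ×-dec ¬? (m ℤₚ.≟ + 0)) ×-dec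
  ((n ℤ.* p ℤₚ.≟ m ℤ.* p' ×-dec n ℤ.* q ℤₚ.≟ m ℤ.* q') ×-dec (n ℤ.* r ℤₚ.≟ m ℤ.* r' ×-dec n ℤ.* s ℤₚ.≟ m ℤ.* s'))
  where
    n m : ℤ
    n = trace-adj C C
    m = trace-adj X C

-- The entries of a product of real matrices equal integers only up to `≈ᵣ`. Exact integers are
-- therefore carried along beside the real matrix, and all computation takes place on them.
record Integral (M : GL₂⁺) (X : ℤ⁴) : Set where
  field
    a≈ : a M ≈ᵣ fromℤ (proj₁ (proj₁ X))
    b≈ : b M ≈ᵣ fromℤ (proj₂ (proj₁ X))
    c≈ : c M ≈ᵣ fromℤ (proj₁ (proj₂ X))
    d≈ : d M ≈ᵣ fromℤ (proj₂ (proj₂ X))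

gl-integral : ∀ M → Integral (gl M) (entries M)
gl-integral M = record { a≈ = ≈ᵣ-refl ; b≈ = ≈ᵣ-refl ; c≈ = ≈ᵣ-refl ; d≈ = ≈ᵣ-refl }

*ₘ-integral : ∀ {M N X Y} → Integral M X → Integral N Y → Integral (M *ₘ N) (X ⊡ Y)
*ₘ-integral {M} {N} {(p , q) , (r , s)} {(p' , q') , (r' , s')} I J = record
  { a≈ = entry p p' q r' (Integral.a≈ I) (Integral.a≈ J) (Integral.b≈ I) (Integral.c≈ J)
  ; b≈ = entry p q' q s' (Integral.a≈ I) (Integral.b≈ J) (Integral.b≈ I) (Integral.d≈ J)
  ; c≈ = entry r p' s r' (Integral.c≈ I) (Integral.a≈ J) (Integral.d≈ I) (Integral.c≈ J)
  ; d≈ = entry r q' s s' (Integral.c≈ I) (Integral.b≈ J) (Integral.d≈ I) (Integral.d≈ J) }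
  where
    entry : ∀ i j k l {x y u v} → x ≈ᵣ fromℤ i → y ≈ᵣ fromℤ j → u ≈ᵣ fromℤ k → v ≈ᵣ fromℤ l →
            x *ᵣ y +ᵣ u *ᵣ v ≈ᵣ fromℤ (i ℤ.* j ℤ.+ k ℤ.* l)
    entry i j k l x≈ y≈ u≈ v≈ = ℝr.trans (ℝr.+-cong (ℝr.*-cong x≈ y≈) (ℝr.*-cong u≈ v≈))
      (ℝr.sym (ℝr.trans (fromℤ-+ (i ℤ.* j) (k ℤ.* l)) (ℝr.+-cong (fromℤ-* i j) (fromℤ-* k l))))

module _ {f : ℋ → ℂ} (f-cong : Respects f) (k : ℕ) (even : k ℕ./ 2 ℕ.+ k ℕ./ 2 ≡ k) where

  slash-integral : ∀ {M X} C → Integral M X → {True (X ∼? entries C)} → f ∣⟨ k ⟩ M ≐ f ∣⟨ k ⟩ gl C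
  slash-integral {M} {X@((p , q) , (r , s))} C I {ok} = go (toWitness ok)
    where
      n m : ℤ
      n = trace-adj (entries C) (entries C)
      m = trace-adj X (entries C)
      go : X ∼ entries C → f ∣⟨ k ⟩ M ≐ f ∣⟨ k ⟩ gl C
      go ((n≢0 , m≢0) , ((e₁ , e₂) , (e₃ , e₄))) = slash-scale f-cong k even M (gl C)
          (ν *ᵣ fromℤ m) (μ *ᵣ fromℤ n) unit₁
          (scale p (a₁₁ C) e₁ (Integral.a≈ I)) (scale q (a₁₂ C) e₂ (Integral.b≈ I)) (scale r (a₂₁ C) e₃ (Integral.c≈ I)) (scale s (a₂₂ C) e₄ (Integral.d≈ I))
        where
          open ℝ-Solver
          ν μ : ℝ
          ν = proj₁ (ℤ-inverse n n≢0)
          μ = proj₁ (ℤ-inverse m m≢0)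
          unit₁ : (ν *ᵣ fromℤ m) *ᵣ (μ *ᵣ fromℤ n) ≈ᵣ 1ᵣ
          unit₁ = ℝr.trans (solveℤ 4 (λ ν m μ n → (ν :* m) :* (μ :* n) ≔ (ν :* n) :* (μ :* m)) refl (ν ∷ fromℤ m ∷ μ ∷ fromℤ n ∷ []))
            (ℝr.trans (ℝr.*-cong (proj₂ (ℤ-inverse n n≢0)) (proj₂ (ℤ-inverse m m≢0))) (ℝr.*-identityˡ 1ᵣ))
          scale : ∀ i j {x} → n ℤ.* i ≡ m ℤ.* j → x ≈ᵣ fromℤ i → x ≈ᵣ (ν *ᵣ fromℤ m) *ᵣ fromℤ j
          scale i j e x≈ = ℝr.trans x≈ (ℝr.trans (ℝr.sym (ℝr.*-identityˡ (fromℤ i)))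
            (ℝr.trans (ℝr.*-congʳ (ℝr.sym (proj₂ (ℤ-inverse n n≢0))))
            (ℝr.trans (ℝr.*-assoc ν (fromℤ n) (fromℤ i)) (ℝr.trans (ℝr.*-congˡ (ℝr.trans (ℝr.sym (fromℤ-* n i))
              (ℝr.trans (ℝr.reflexive (cong fromℤ e)) (fromℤ-* m j)))) (ℝr.sym (ℝr.*-assoc ν (fromℤ m) (fromℤ j)))))))

  compose : ∀ A B C → {True (entries A ⊡ entries B ∼? entries C)} → f ∣⟨ k ⟩ gl A ∣⟨ k ⟩ gl B ≐ f ∣⟨ k ⟩ gl C
  compose A B C {ok} z = ≈-trans (slash-∘ f-cong k (gl A) (gl B) z)
    (slash-integral C (*ₘ-integral (gl-integral A) (gl-integral B)) {ok} z)

-- Hecke relations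

≐-trans : ∀ {f g h} → f ≐ g → g ≐ h → f ≐ h
≐-trans p q z = ≈-trans (p z) (q z)

≐-sym : ∀ {f g} → f ≐ g → g ≐ f
≐-sym p z = ≈-sym (p z)

module Sums (k : ℕ) where

  sumOver : (ℋ → ℂ) → List GL₂⁺ → ℋ → ℂ
  sumOver f Ms z = foldr (λ M s → (f ∣⟨ k ⟩ M) z + s) 0ᶜ Ms

  sumOver-resp : ∀ {f g} Ms → f ≐ g → sumOver f Ms ≐ sumOver g Ms
  sumOver-resp []       e z = ≈-refl
  sumOver-resp (M ∷ Ms) e z = ℂr.+-cong (slash-resp k M e z) (sumOver-resp Ms e z)

  sumOver-* : ∀ x f Ms → sumOver (λ z → x * f z) Ms ≐ λ z → x * sumOver f Ms z
  sumOver-* x f []       z = ≈-sym (ℂr.zeroʳ x)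
  sumOver-* x f (M ∷ Ms) z = ≈-trans (ℂr.+-cong (slash-* x f k M z) (sumOver-* x f Ms z))
    (≈-sym (ℂr.distribˡ x _ _))

  sumOver-++ : ∀ f Ms Ns → sumOver f (Ms ++ Ns) ≐ λ z → sumOver f Ms z + sumOver f Ns z
  sumOver-++ f []       Ns z = ≈-sym (ℂr.+-identityˡ _)
  sumOver-++ f (M ∷ Ms) Ns z = ≈-trans (ℂr.+-congˡ (sumOver-++ f Ms Ns z)) (≈-sym (ℂr.+-assoc _ _ _))

  module _ {f : ℋ → ℂ} (f-cong : Respects f) where

    sumOver-slash : ∀ Ms N → sumOver f Ms ∣⟨ k ⟩ N ≐ sumOver f (map (_*ₘ N) Ms)
    sumOver-slash []       N z = slash-0 k N z
    sumOver-slash (M ∷ Ms) N z = ≈-trans (slash-+ (f ∣⟨ k ⟩ M) (sumOver f Ms) k N z)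
      (ℂr.+-cong (slash-∘ f-cong k M N z) (sumOver-slash Ms N z))

    slash-sumOver : ∀ N Ms → sumOver (f ∣⟨ k ⟩ N) Ms ≐ sumOver f (map (N *ₘ_) Ms)
    slash-sumOver N []       z = ≈-refl
    slash-sumOver N (M ∷ Ms) z = ℂr.+-cong (slash-∘ f-cong k N M z) (slash-sumOver N Ms z)

    sumOver-sumOver : ∀ Ms Ns → sumOver (sumOver f Ms) Ns ≐ sumOver f (concatMap (λ N → map (_*ₘ N) Ms) Ns)
    sumOver-sumOver Ms []       z = ≈-refl
    sumOver-sumOver Ms (N ∷ Ns) z = ≈-trans (ℂr.+-cong (sumOver-slash Ms N z) (sumOver-sumOver Ms Ns z))
      (≈-sym (sumOver-++ f (map (_*ₘ N) Ms) (concatMap (λ N → map (_*ₘ N) Ms) Ns) z))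

    -- f is an eigenfunction of both H and Ms, so conjugating Ms by the involution H does not change f | Ms.
    sumOver-conj : ∀ {H s x} → s * s ≈ 1ᶜ → (f ∣⟨ k ⟩ H ≐ λ z → s * f z) →
                   ∀ Ms → (sumOver f Ms ≐ λ z → x * f z) →
                   sumOver f (map (λ M → H *ₘ M *ₘ H) Ms) ≐ sumOver f Ms
    sumOver-conj {H} {s} {x} s² fH Ms fMs z = begin
      sumOver f (map (λ M → H *ₘ M *ₘ H) Ms) z
        ≈⟨ ℂr.reflexive (cong (λ l → sumOver f l z) (Listₚ.map-∘ {g = _*ₘ H} {f = H *ₘ_} Ms)) ⟩
      sumOver f (map (_*ₘ H) (map (H *ₘ_) Ms)) z  ≈⟨ sumOver-slash (map (H *ₘ_) Ms) H z ⟨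
      (sumOver f (map (H *ₘ_) Ms) ∣⟨ k ⟩ H) z     ≈⟨ slash-resp k H (≐-sym (slash-sumOver H Ms)) z ⟩
      (sumOver (f ∣⟨ k ⟩ H) Ms ∣⟨ k ⟩ H) z        ≈⟨ slash-resp k H (≐-trans (sumOver-resp Ms fH) (sumOver-* s f Ms)) z ⟩
      ((λ z → s * sumOver f Ms z) ∣⟨ k ⟩ H) z     ≈⟨ slash-resp k H (λ z → ≈-trans (ℂr.*-congˡ (fMs z)) (≈-sym (ℂr.*-assoc s x (f z)))) z ⟩
      ((λ z → (s * x) * f z) ∣⟨ k ⟩ H) z          ≈⟨ slash-* (s * x) f k H z ⟩
      (s * x) * (f ∣⟨ k ⟩ H) z                    ≈⟨ ℂr.*-congˡ (fH z) ⟩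
      (s * x) * (s * f z)                         ≈⟨ solveℤ 3 (λ s x y → (s :* x) :* (s :* y) ≔ (s :* s) :* (x :* y)) refl (s ∷ x ∷ f z ∷ []) ⟩
      (s * s) * (x * f z)                         ≈⟨ ≈-trans (ℂr.*-congʳ s²) (ℂr.*-identityˡ _) ⟩
      x * f z                                     ≈⟨ fMs z ⟨
      sumOver f Ms z                              ∎
      where
        open ≈-Reasoning
        open ℂ-Solver

Iᴹ Uᴹ Hᴹ Wᴹ γᴹ : ℤMat
Iᴹ = ⟪ + 1 , + 0 ∣ + 0 , + 1 ⟫
Uᴹ = ⟪ + 1 , + 1 ∣ + 0 , + 1 ⟫
Hᴹ = ⟪ + 0 , -[1+ 0 ] ∣ + 13 , + 0 ⟫
Wᴹ = ⟪ + 1 , + 0 ∣ ℤ.- + 13 , + 1 ⟫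
γᴹ = ⟪ + 3 , + 1 ∣ ℤ.- + 13 , ℤ.- + 4 ⟫

-- H₁₃ conjugates α to β, up to scalars.
α₂ α₃ α₃⁻ α₄ α₄⁻ β₂ β₃ β₃⁻ β₄ β₄⁻ : ℤMat
α₂  = ⟪ + 1 , + 1 ∣ + 0 , + 2 ⟫
α₃  = ⟪ + 1 , + 1 ∣ + 0 , + 3 ⟫
α₃⁻ = ⟪ + 1 , -[1+ 0 ] ∣ + 0 , + 3 ⟫
α₄  = ⟪ + 1 , + 1 ∣ + 0 , + 4 ⟫
α₄⁻ = ⟪ + 1 , -[1+ 0 ] ∣ + 0 , + 4 ⟫
β₂  = ⟪ + 2 , + 0 ∣ ℤ.- + 13 , + 1 ⟫
β₃  = ⟪ + 3 , + 0 ∣ ℤ.- + 13 , + 1 ⟫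
β₃⁻ = ⟪ + 3 , + 0 ∣ + 13 , + 1 ⟫
β₄  = ⟪ + 4 , + 0 ∣ ℤ.- + 13 , + 1 ⟫
β₄⁻ = ⟪ + 4 , + 0 ∣ + 13 , + 1 ⟫

hecke-reps₂ hecke-reps₃ : List GL₂⁺
hecke-reps₂ = gl ⟪ + 2 , + 0 ∣ + 0 , + 1 ⟫ ∷ gl ⟪ + 1 , + 0 ∣ + 0 , + 2 ⟫ ∷ gl α₂ ∷ []
hecke-reps₃ = gl ⟪ + 3 , + 0 ∣ + 0 , + 1 ⟫ ∷ gl ⟪ + 1 , + 0 ∣ + 0 , + 3 ⟫ ∷ gl α₃
            ∷ gl ⟪ + 1 , + 2 ∣ + 0 , + 3 ⟫ ∷ []

record Eigenform (f : ℋ → ℂ) (k : ℕ) : Set where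
  field
    even     : k ℕ./ 2 ℕ.+ k ℕ./ 2 ≡ k
    respects : Respects f
    periodic : f ∣⟨ k ⟩ gl Uᴹ ≐ f
    s        : ℂ
    s²       : s * s ≈ 1ᶜ
    fricke   : f ∣⟨ k ⟩ gl Hᴹ ≐ λ z → s * f z
    x₂ x₃    : ℂ
    hecke₂   : Sums.sumOver k f hecke-reps₂ ≐ λ z → x₂ * f z
    hecke₃   : Sums.sumOver k f hecke-reps₃ ≐ λ z → x₃ * f z

module Relations {f : ℋ → ℂ} {k : ℕ} (E : Eigenform f k) where
  open Eigenform E
  open Sums k

  F : ℤMat → ℋ → ℂ
  F M = f ∣⟨ k ⟩ gl M

  F-right : ∀ A B C → {True (entries A ⊡ entries B ∼? entries C)} → F A ∣⟨ k ⟩ gl B ≐ F C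
  F-right A B C {ok} = compose respects k even A B C {ok}

  F-left : ∀ {A} → F A ≐ f → ∀ B C → {True (entries A ⊡ entries B ∼? entries C)} → F C ≐ F B
  F-left {A} fA B C {ok} = ≐-trans (≐-sym (F-right A B C {ok})) (slash-resp k (gl B) fA)

  F-fricke : ∀ B C → {True (entries Hᴹ ⊡ entries B ∼? entries C)} → (λ z → s * F B z) ≐ F C
  F-fricke B C {ok} = ≐-trans (≐-sym (≐-trans (slash-resp k (gl B) fricke) (slash-* s f k (gl B)))) (F-right Hᴹ B C {ok})

  canon : ∀ {M X} C → Integral M X → {True (X ∼? entries C)} → f ∣⟨ k ⟩ M ≐ F C
  canon C I {ok} = slash-integral respects k even C I {ok}

  H-conj : ∀ {M X} → Integral M X → Integral (gl Hᴹ *ₘ M *ₘ gl Hᴹ) (entries Hᴹ ⊡ X ⊡ entries Hᴹ)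
  H-conj I = *ₘ-integral (*ₘ-integral (gl-integral Hᴹ) I) (gl-integral Hᴹ)

  canon-H : ∀ M C → {True (entries Hᴹ ⊡ entries M ⊡ entries Hᴹ ∼? entries C)} → f ∣⟨ k ⟩ (gl Hᴹ *ₘ gl M *ₘ gl Hᴹ) ≐ F C
  canon-H M C {ok} = canon C (H-conj (gl-integral M)) {ok}

  F-identity : F Iᴹ ≐ f
  F-identity = slash-identity respects k (gl Iᴹ) ≈ᵣ-refl ≈ᵣ-refl ≈ᵣ-refl ≈ᵣ-refl

  -- Up to a scalar W is H U H, so the Fricke eigenvalue occurs twice and s² = 1 removes it.
  F-W : F Wᴹ ≐ f
  F-W z = begin
    F Wᴹ z                                          ≈⟨ F-fricke ⟪ + 13 , -[1+ 0 ] ∣ + 13 , + 0 ⟫ Wᴹ z ⟨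
    s * F ⟪ + 13 , -[1+ 0 ] ∣ + 13 , + 0 ⟫ z        ≈⟨ ℂr.*-congˡ (F-left periodic Hᴹ ⟪ + 13 , -[1+ 0 ] ∣ + 13 , + 0 ⟫ z) ⟩
    s * F Hᴹ z                                      ≈⟨ ℂr.*-congˡ (fricke z) ⟩
    s * (s * f z)                                   ≈⟨ ℂr.*-assoc s s (f z) ⟨
    s * s * f z                                     ≈⟨ ≈-trans (ℂr.*-congʳ s²) (ℂr.*-identityˡ (f z)) ⟩
    f z                                             ∎
    where open ≈-Reasoning

  -- Conjugation by H exchanges the two diagonal representatives of the Hecke operator at 2. They
  -- cancel from the equality of f | T₂ with its conjugate, and a single term remains on each side.
  relation₂ : F α₂ ≐ F β₂
  relation₂ z = ≈-sym (cancel-sum (≈-trans (≈-sym (ℂr.+-cong (canon-H D₂ D₁ z) (ℂr.+-cong (canon-H D₁ D₂ z)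
        (ℂr.+-congʳ (canon-H α₂ β₂ z)))))
      (sumOver-conj respects {x = x₂} s² fricke hecke-reps₂ hecke₂ z)))
    where
      D₁ D₂ : ℤMat
      D₁ = ⟪ + 1 , + 0 ∣ + 0 , + 2 ⟫
      D₂ = ⟪ + 2 , + 0 ∣ + 0 , + 1 ⟫
      open ℂ-Solver
      cancel-sum : ∀ {p q x y} → q + (p + (x + 0ᶜ)) ≈ p + (q + (y + 0ᶜ)) → x ≈ y
      cancel-sum {p} {q} {x} {y} e = ≈-trans
        (solveℤ 3 (λ p q x → x ≔ (q :+ (p :+ (x :+ con (+ 0)))) :- (p :+ q)) refl (p ∷ q ∷ x ∷ []))
        (≈-trans (ℂr.+-congʳ e)
          (solveℤ 3 (λ p q y → (p :+ (q :+ (y :+ con (+ 0)))) :- (p :+ q) ≔ y) refl (p ∷ q ∷ y ∷ [])))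

  -- As for the prime 2, with two terms left on each side. The remaining representative (1 2; 0 3)
  -- is U α₃⁻, and its conjugate is W β₃⁻ up to a scalar; U and W fix f.
  relation₃ : ∀ z → F α₃ z + F α₃⁻ z
                  ≈ F β₃ z + F β₃⁻ z
  relation₃ z = ≈-sym (cancel-sum (≈-trans (≈-sym (ℂr.+-cong (canon-H D₃ D₁ z) (ℂr.+-cong (canon-H D₁ D₃ z)
        (ℂr.+-cong (canon-H α₃ β₃ z)
          (ℂr.+-congʳ (≈-trans (canon-H ⟪ + 1 , + 2 ∣ + 0 , + 3 ⟫ ⟪ + 3 , + 0 ∣ ℤ.- + 26 , + 1 ⟫ z)
            (F-left F-W β₃⁻ ⟪ + 3 , + 0 ∣ ℤ.- + 26 , + 1 ⟫ z)))))))
      (≈-trans (sumOver-conj respects {x = x₃} s² fricke hecke-reps₃ hecke₃ z)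
        (ℂr.+-congˡ (ℂr.+-congˡ (ℂr.+-congˡ (ℂr.+-congʳ
          (F-left periodic α₃⁻ ⟪ + 1 , + 2 ∣ + 0 , + 3 ⟫ z))))))))
    where
      D₁ D₃ : ℤMat
      D₁ = ⟪ + 1 , + 0 ∣ + 0 , + 3 ⟫
      D₃ = ⟪ + 3 , + 0 ∣ + 0 , + 1 ⟫
      open ℂ-Solver
      cancel-sum : ∀ {p q x x' y y'} → q + (p + (x + (x' + 0ᶜ))) ≈ p + (q + (y + (y' + 0ᶜ))) → x + x' ≈ y + y'
      cancel-sum {p} {q} {x} {x'} {y} {y'} e = ≈-trans
        (solveℤ 4 (λ p q x x' → x :+ x' ≔ (q :+ (p :+ (x :+ (x' :+ con (+ 0))))) :- (p :+ q)) refl (p ∷ q ∷ x ∷ x' ∷ []))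
        (≈-trans (ℂr.+-congʳ e)
          (solveℤ 4 (λ p q y y' → (p :+ (q :+ (y :+ (y' :+ con (+ 0))))) :- (p :+ q) ≔ y :+ y') refl (p ∷ q ∷ y ∷ y' ∷ [])))

  -- Of the nine products in the square of the Hecke operator at 2, three fix f and so do their
  -- conjugates, and the diagonal ones (4 0; 0 1) and (1 0; 0 4) are exchanged. `relation₂` turns (1
  -- 2; 0 4) into the conjugate of (2 1; 0 2), and the conjugate of (1 2; 0 4) into (2 1; 0 2).
  -- Everything then cancels except the terms with upper right entry ±1 and lower right entry 4.
  relation₄ : ∀ z → F α₄ z + F α₄⁻ z
                  ≈ F β₄ z + F β₄⁻ z
  relation₄ z = ≈-sym (cancel-sum (≈-trans (≈-sym conjugated) (≈-trans (sumOver-conj respects {x = x₂ * x₂} s² fricke Ms² eigen z) plain)))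
    where
      D₁ D₂ : ℤMat
      D₁ = ⟪ + 1 , + 0 ∣ + 0 , + 2 ⟫
      D₂ = ⟪ + 2 , + 0 ∣ + 0 , + 1 ⟫
      Ms² : List GL₂⁺
      Ms² = concatMap (λ N → map (_*ₘ N) hecke-reps₂) hecke-reps₂
      eigen : sumOver f Ms² ≐ λ z → x₂ * x₂ * f z
      eigen z = ≈-trans (≈-sym (sumOver-sumOver respects hecke-reps₂ hecke-reps₂ z)) (≈-trans (sumOver-resp hecke-reps₂ hecke₂ z)
        (≈-trans (sumOver-* x₂ f hecke-reps₂ z) (≈-trans (ℂr.*-congˡ (hecke₂ z)) (≈-sym (ℂr.*-assoc x₂ x₂ (f z))))))
      infixl 7 _·_
      _·_ : ∀ M N → Integral (gl M *ₘ gl N) (entries M ⊡ entries N)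
      M · N = *ₘ-integral (gl-integral M) (gl-integral N)
      L R T₂ V : ℤMat
      L  = ⟪ + 1 , + 0 ∣ + 0 , + 4 ⟫
      R  = ⟪ + 4 , + 0 ∣ + 0 , + 1 ⟫
      T₂ = ⟪ + 2 , + 1 ∣ + 0 , + 2 ⟫
      V  = ⟪ + 2 , + 0 ∣ ℤ.- + 13 , + 2 ⟫
      halves : F ⟪ + 1 , + 2 ∣ + 0 , + 4 ⟫ z ≈ F V z
      halves = ≈-trans (≈-sym (F-right α₂ D₁ ⟪ + 1 , + 2 ∣ + 0 , + 4 ⟫ z))
        (≈-trans (slash-resp k (gl D₁) relation₂ z) (F-right β₂ D₁ V z))
      plain : sumOver f Ms² z
        ≈ F R z + (f z + (F T₂ z + (f z + (F L z + (F V z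
          + (f z + (F α₄ z + (F α₄⁻ z + 0ᶜ))))))))
      plain = ℂr.+-cong (canon R (D₂ · D₂) z) (ℂr.+-cong (≈-trans (canon Iᴹ (D₁ · D₂) z) (F-identity z))
        (ℂr.+-cong (canon T₂ (α₂ · D₂) z) (ℂr.+-cong (≈-trans (canon Iᴹ (D₂ · D₁) z) (F-identity z))
        (ℂr.+-cong (canon L (D₁ · D₁) z) (ℂr.+-cong (≈-trans (canon ⟪ + 1 , + 2 ∣ + 0 , + 4 ⟫ (α₂ · D₁) z) halves)
        (ℂr.+-cong (≈-trans (canon Uᴹ (D₂ · α₂) z) (periodic z))
        (ℂr.+-cong (canon α₄ (D₁ · α₂) z)
        (ℂr.+-congʳ (≈-trans (canon ⟪ + 1 , + 3 ∣ + 0 , + 4 ⟫ (α₂ · α₂) z)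
          (F-left periodic α₄⁻ ⟪ + 1 , + 3 ∣ + 0 , + 4 ⟫ z))))))))))
      doubles : F ⟪ + 4 , + 0 ∣ ℤ.- + 26 , + 1 ⟫ z ≈ F T₂ z
      doubles = ≈-sym (≈-trans (≈-sym (F-right α₂ D₂ T₂ z))
        (≈-trans (slash-resp k (gl D₂) relation₂ z) (F-right β₂ D₂ ⟪ + 4 , + 0 ∣ ℤ.- + 26 , + 1 ⟫ z)))
      conjugated : sumOver f (map (λ M → gl Hᴹ *ₘ M *ₘ gl Hᴹ) Ms²) z
        ≈ F L z + (f z + (F V z + (f z + (F R z + (F T₂ z
          + (f z + (F β₄ z + (F β₄⁻ z + 0ᶜ))))))))
      conjugated = ℂr.+-cong (canon L (H-conj (D₂ · D₂)) z) (ℂr.+-cong (≈-trans (canon Iᴹ (H-conj (D₁ · D₂)) z) (F-identity z))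
        (ℂr.+-cong (canon V (H-conj (α₂ · D₂)) z) (ℂr.+-cong (≈-trans (canon Iᴹ (H-conj (D₂ · D₁)) z) (F-identity z))
        (ℂr.+-cong (canon R (H-conj (D₁ · D₁)) z) (ℂr.+-cong (≈-trans (canon ⟪ + 4 , + 0 ∣ ℤ.- + 26 , + 1 ⟫ (H-conj (α₂ · D₁)) z) doubles)
        (ℂr.+-cong (≈-trans (canon Wᴹ (H-conj (D₂ · α₂)) z) (F-W z))
        (ℂr.+-cong (canon β₄ (H-conj (D₁ · α₂)) z)
        (ℂr.+-congʳ (≈-trans (canon ⟪ + 4 , + 0 ∣ ℤ.- + 39 , + 1 ⟫ (H-conj (α₂ · α₂)) z)
          (F-left F-W β₄⁻ ⟪ + 4 , + 0 ∣ ℤ.- + 39 , + 1 ⟫ z))))))))))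
      open ℂ-Solver
      cancel-sum : ∀ {l r i t v x x' y y'} →
        l + (i + (v + (i + (r + (t + (i + (x + (x' + 0ᶜ)))))))) ≈ r + (i + (t + (i + (l + (v + (i + (y + (y' + 0ᶜ)))))))) →
        x + x' ≈ y + y'
      cancel-sum {l} {r} {i} {t} {v} {x} {x'} {y} {y'} e = ≈-trans
        (solveℤ 7 (λ l r i t v x x' → x :+ x' ≔ (l :+ (i :+ (v :+ (i :+ (r :+ (t :+ (i :+ (x :+ (x' :+ con (+ 0))))))))))
          :- (l :+ r :+ t :+ v :+ i :+ i :+ i)) refl (l ∷ r ∷ i ∷ t ∷ v ∷ x ∷ x' ∷ []))
        (≈-trans (ℂr.+-congʳ e)
          (solveℤ 7 (λ l r i t v y y' → (r :+ (i :+ (t :+ (i :+ (l :+ (v :+ (i :+ (y :+ (y' :+ con (+ 0))))))))))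
          :- (l :+ r :+ t :+ v :+ i :+ i :+ i) ≔ y :+ y') refl (l ∷ r ∷ i ∷ t ∷ v ∷ y ∷ y' ∷ [])))

-- Symmetries of f | (1 - γ)

module Symmetries {f : ℋ → ℂ} {k : ℕ} (E : Eigenform f k) where
  open Eigenform E
  open Relations E

  push : ∀ A B C D X A' B' C' D' →
         {True (entries A ⊡ entries X ∼? entries A')} → {True (entries B ⊡ entries X ∼? entries B')} →
         {True (entries C ⊡ entries X ∼? entries C')} → {True (entries D ⊡ entries X ∼? entries D')} →
         (∀ z → F A z + F B z ≈ F C z + F D z) → ∀ z → F A' z + F B' z ≈ F C' z + F D' z
  push A B C D X A' B' C' D' {a} {b} {c} {d} h z =
    ≈-trans (≈-sym (side A B A' B' {a} {b}))
      (≈-trans (slash-resp k (gl X) h z) (side C D C' D' {c} {d}))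
    where
      side : ∀ A B A' B' → {True (entries A ⊡ entries X ∼? entries A')} → {True (entries B ⊡ entries X ∼? entries B')} →
             ((λ z → F A z + F B z) ∣⟨ k ⟩ gl X) z ≈ F A' z + F B' z
      side A B A' B' {a} {b} = ≈-trans (slash-+ (F A) (F B) k (gl X) z) (ℂr.+-cong (F-right A X A' {a} z) (F-right B X B' {b} z))

  g : ℋ → ℂ
  g z = f z - F γᴹ z

  g-respects : Respects g
  g-respects z w p = ℂr.+-cong (respects z w p) (ℂr.-‿cong (slash-cong respects k (gl γᴹ) z w p))

  g-slash : ∀ B C → {True (entries γᴹ ⊡ entries B ∼? entries C)} → g ∣⟨ k ⟩ gl B ≐ λ z → F B z - F C z
  g-slash B C {ok} z = ≈-trans (slash-difference f (F γᴹ) k (gl B) z) (ℂr.+-congˡ (ℂr.-‿cong (F-right γᴹ B C {ok} z)))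

  g-right : ∀ A B C → {True (entries A ⊡ entries B ∼? entries C)} → g ∣⟨ k ⟩ gl A ∣⟨ k ⟩ gl B ≐ g ∣⟨ k ⟩ gl C
  g-right A B C {ok} = compose g-respects k even A B C {ok}

  -- The half-turns of the hyperbolic plane that generate the symmetries of g, up to scalars; ε₁ and ε₂
  -- are the matrices of the theorem.
  ε₁ᴹ ε₂ᴹ ε₃ᴹ : ℤMat
  ε₁ᴹ = ⟪ + 39 , + 14 ∣ ℤ.- + 117 , ℤ.- + 39 ⟫
  ε₂ᴹ = ⟪ ℤ.- + 26 , ℤ.- + 8 ∣ + 91 , + 26 ⟫
  ε₃ᴹ = ⟪ + 5 , + 2 ∣ ℤ.- + 13 , ℤ.- + 5 ⟫

  private
    open ℂ-Solver
    rearrange : ∀ {p q i c} → p + i ≈ c + q → i - c ≈ q - p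
    rearrange {p} {q} {i} {c} e = ≈-trans (solveℤ 3 (λ p i c → i :- c ≔ (p :+ i) :- p :- c) refl (p ∷ i ∷ c ∷ []))
      (≈-trans (ℂr.+-congʳ (ℂr.+-congʳ e)) (solveℤ 3 (λ p q c → (c :+ q) :- p :- c ≔ q :- p) refl (p ∷ q ∷ c ∷ [])))
    distrib : ∀ x p q → x * (p - q) ≈ x * p - x * q
    distrib x p q = solveℤ 3 (λ x p q → x :* (p :- q) ≔ x :* p :- x :* q) refl (x ∷ p ∷ q ∷ [])

  -- The Hecke relation rewrites g = f - f | γ as f | Q - f | P. Since HQ is ε₁ and HP is γε₁ up to
  -- scalars, the Fricke involution turns this difference into g | ε₁.
  g-ε₁ : g ∣⟨ k ⟩ gl ε₁ᴹ ≐ λ z → s * g z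
  g-ε₁ z = ≈-trans (g-slash ε₁ᴹ C z) (≈-sym (≈-trans (ℂr.*-congˡ (rearrange rel))
      (≈-trans (distrib s (F Q z) (F P z)) (ℂr.+-cong (F-fricke Q ε₁ᴹ z) (ℂr.-‿cong (F-fricke P C z))))))
    where
      P Q C : ℤMat
      P = ⟪ + 3 , + 2 ∣ + 0 , + 3 ⟫
      Q = ⟪ + 9 , + 3 ∣ + 39 , + 14 ⟫
      C = ⟪ + 0 , ℤ.- + 3 ∣ + 39 , + 26 ⟫
      rel : F P z + f z ≈ F γᴹ z + F Q z
      rel = ≈-trans (ℂr.+-congˡ (≈-sym (F-identity z)))
        -- The multiplier is 3 α₃⁻⁻¹ : it makes the second term f itself, and β₃ times it is a
        -- multiple of γ.
        (push α₃ α₃⁻ β₃ β₃⁻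
              ⟪ + 3 , + 1 ∣ + 0 , + 1 ⟫ P Iᴹ γᴹ Q relation₃ z)

  g-ε₂ : g ∣⟨ k ⟩ gl ε₂ᴹ ≐ λ z → s * g z
  g-ε₂ z = ≈-trans (g-slash ε₂ᴹ C z) (≈-sym (≈-trans (ℂr.*-congˡ (rearrange rel))
      (≈-trans (distrib s (F Q z) (F P z)) (ℂr.+-cong (F-fricke Q ε₂ᴹ z) (ℂr.-‿cong (F-fricke P C z))))))
    where
      P Q C : ℤMat
      P = ⟪ + 2 , + 0 ∣ + 13 , + 2 ⟫
      Q = ⟪ + 7 , + 2 ∣ + 26 , + 8 ⟫
      C = ⟪ + 13 , + 2 ∣ ℤ.- + 26 , + 0 ⟫
      rel : F P z + f z ≈ F γᴹ z + F Q z
      rel = ≈-trans (ℂr.+-congˡ (≈-sym (F-identity z))) (≈-trans (ℂr.+-comm _ _) (≈-trans (≈-sym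
        -- The multiplier is - 4 β₄⁻¹ : it makes the third term f itself, and α₄⁻ times it is a
        -- multiple of γ.
        (push α₄ α₄⁻ β₄ β₄⁻
              ⟪ -[1+ 0 ] , + 0 ∣ ℤ.- + 13 , ℤ.- + 4 ⟫ Q γᴹ Iᴹ P relation₄ z)) (ℂr.+-comm _ _)))

  private
    -- The one-term relation at 2 already gives an invariance of f: up to scalars, X carries β₂ to
    -- (2 1; -13 -6) and α₂ to the translation U.
    F-γ₂ : F ⟪ + 2 , + 1 ∣ ℤ.- + 13 , ℤ.- + 6 ⟫ ≐ f
    F-γ₂ z = ≈-trans (≈-sym (F-right β₂ X ⟪ + 2 , + 1 ∣ ℤ.- + 13 , ℤ.- + 6 ⟫ z))
        (≈-trans (slash-resp k (gl X) (≐-sym relation₂) z) (≈-trans (F-right α₂ X Uᴹ z) (periodic z)))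
      where
        X : ℤMat
        X = ⟪ + 2 , + 1 ∣ + 0 , + 1 ⟫

    F-γ₂⁻¹ : F ⟪ + 6 , + 1 ∣ ℤ.- + 13 , ℤ.- + 2 ⟫ ≐ f
    F-γ₂⁻¹ z = ≈-trans (≈-sym (F-left F-γ₂ ⟪ + 6 , + 1 ∣ ℤ.- + 13 , ℤ.- + 2 ⟫ Iᴹ z)) (F-identity z)

  -- With γ₂ = (2 1; -13 -6) one has γε₃ = γ₂ and ε₃ = - γ₂⁻¹γ. As γ₂ fixes f, the half-turn ε₃
  -- interchanges f and f | γ.
  g-ε₃ : g ∣⟨ k ⟩ gl ε₃ᴹ ≐ λ z → - 1ᶜ * g z
  g-ε₃ z = ≈-trans (g-slash ε₃ᴹ ⟪ + 2 , + 1 ∣ ℤ.- + 13 , ℤ.- + 6 ⟫ z)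
    (≈-trans (ℂr.+-cong (F-left F-γ₂⁻¹ γᴹ ε₃ᴹ z) (ℂr.-‿cong (F-γ₂ z)))
      (solveℤ 2 (λ c i → c :- i ≔ :- con (+ 1) :* (i :- c)) refl (F γᴹ z ∷ f z ∷ [])))

  slash-eigen : ∀ {M N x y} → (g ∣⟨ k ⟩ M ≐ λ z → x * g z) → (g ∣⟨ k ⟩ N ≐ λ z → y * g z) →
                g ∣⟨ k ⟩ M ∣⟨ k ⟩ N ≐ λ z → x * y * g z
  slash-eigen {M} {N} {x} {y} p q z = ≈-trans (slash-resp k N p z)
    (≈-trans (slash-* x g k N z) (≈-trans (ℂr.*-congˡ (q z)) (≈-sym (ℂr.*-assoc x y (g z)))))

  private
    unit-eigen : ∀ {M x} → x ≈ 1ᶜ → (g ∣⟨ k ⟩ M ≐ λ z → x * g z) → g ∣⟨ k ⟩ M ≐ g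
    unit-eigen e p z = ≈-trans (p z) (≈-trans (ℂr.*-congʳ e) (ℂr.*-identityˡ (g z)))

  -- With N = ⟪ 13 , 4 ∣ -39 , -13 ⟫, so that N² = 13, these are 7 + N and 19 - 5 N.
  Aᴹ Bᴹ : ℤMat
  Aᴹ = ⟪ + 20 , + 4 ∣ ℤ.- + 39 , ℤ.- + 6 ⟫
  Bᴹ = ⟪ ℤ.- + 46 , ℤ.- + 20 ∣ + 195 , + 84 ⟫

  g-A : g ∣⟨ k ⟩ gl Aᴹ ≐ g
  g-A = unit-eigen s² (≐-trans (≐-sym (g-right ε₁ᴹ ε₂ᴹ Aᴹ)) (slash-eigen g-ε₁ g-ε₂))

  -- The translations ε₁ε₃ and ε₂ε₃ each multiply g by - s, which may be -1; their product fixes g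
  -- for both signs. In terms of N they are -13 + 2N and 13 - 3N, with product -13 (19 - 5N).
  g-B : g ∣⟨ k ⟩ gl Bᴹ ≐ g
  g-B = unit-eigen (≈-trans (solveℤ 1 (λ s → (s :* :- con (+ 1)) :* (s :* :- con (+ 1)) ≔ s :* s) refl (s ∷ [])) s²)
      (≐-trans (≐-sym (g-right ⟪ + 13 , + 8 ∣ ℤ.- + 78 , ℤ.- + 39 ⟫ ⟪ ℤ.- + 26 , ℤ.- + 12 ∣ + 117 , + 52 ⟫ Bᴹ))
        (slash-eigen (≐-trans (≐-sym (g-right ε₁ᴹ ε₃ᴹ ⟪ + 13 , + 8 ∣ ℤ.- + 78 , ℤ.- + 39 ⟫)) (slash-eigen g-ε₁ g-ε₃))
                     (≐-trans (≐-sym (g-right ε₂ᴹ ε₃ᴹ ⟪ ℤ.- + 26 , ℤ.- + 12 ∣ + 117 , + 52 ⟫)) (slash-eigen g-ε₂ g-ε₃))))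

  γ²ᴹ : ℤMat
  γ²ᴹ = ⟪ ℤ.- + 4 , -[1+ 0 ] ∣ + 13 , + 3 ⟫

  g-order-3 : ∀ z → g z + (g ∣⟨ k ⟩ gl γᴹ) z + (g ∣⟨ k ⟩ gl γ²ᴹ) z ≈ 0ᶜ
  g-order-3 z = ≈-trans (ℂr.+-cong (ℂr.+-congˡ (g-slash γᴹ γ²ᴹ z)) (≈-trans (g-slash γ²ᴹ Iᴹ z) (ℂr.+-congˡ (ℂr.-‿cong (F-identity z)))))
    (solveℤ 3 (λ x y z → (x :- y) :+ (y :- z) :+ (z :- x) ≔ con (+ 0)) refl (f z ∷ F γᴹ z ∷ F γ²ᴹ z ∷ []))

  -- The matrix C is both PY and XP up to scalars, that is, Y is P⁻¹XP; this form avoids inverting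
  -- P.
  g-conj : ∀ P X Y C → {True (entries P ⊡ entries Y ∼? entries C)} → {True (entries X ⊡ entries P ∼? entries C)} →
           g ∣⟨ k ⟩ gl X ≐ g → g ∣⟨ k ⟩ gl P ∣⟨ k ⟩ gl Y ≐ g ∣⟨ k ⟩ gl P
  g-conj P X Y C {ok₁} {ok₂} gX = ≐-trans (g-right P Y C {ok₁}) (≐-trans (≐-sym (g-right X P C {ok₂})) (slash-resp k (gl P) gX))

-- The differential equation

open ℂ-Solver

module _ (M : GL₂⁺) {z : ℋ} where
  open GL₂⁺

  private
    ad-bc : ι (det M) ≈ ι (a M) * ι (d M) - ι (b M) * ι (c M)
    ad-bc = ≈-trans (ι-+ _ _) (ℂr.+-cong (ι-* (a M) (d M)) (≈-trans (ι-neg _) (ℂr.-‿cong (ι-* (b M) (c M)))))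

  lim-denInv : ∀ {w : ℕ → ℋ} → Lim (λ n → pt (w n)) (pt z) → Lim (λ n → denInv M (w n)) (denInv M z)
  lim-denInv {w} w→z = lim-invᶜ (λ n → den-pos M (w n)) (den-pos M z)
    (lim-+ (lim-* (lim-const (ι (c M))) w→z) (lim-const (ι (d M))))

  lim-möbius : ∀ {w : ℕ → ℋ} → Lim (λ n → pt (w n)) (pt z) → Lim (λ n → pt (möbius M (w n))) (pt (möbius M z))
  lim-möbius w→z = lim-* (lim-+ (lim-* (lim-const (ι (a M))) w→z) (lim-const (ι (b M)))) (lim-denInv w→z)

  deriv-denInv : HasDeriv (denInv M) z (- ι (c M) * denInv M z * denInv M z)
  deriv-denInv = mkDeriv λ w v w→z vw → lim-resp
      (λ n → ≈-sym (quotient-eq (ι (c M)) (ι (d M)) (pt (w n)) (pt z) (v n) (denInv-inverse M (w n)) (denInv-inverse M z) (vw n)))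
      ≈-refl (lim-* (lim-* (lim-const (- ι (c M))) (lim-denInv w→z)) (lim-const (denInv M z)))
    where
      quotient-eq : ∀ c d w z v {u t} → (c * w + d) * u ≈ 1ᶜ → (c * z + d) * t ≈ 1ᶜ → v * (w - z) ≈ 1ᶜ →
                    (u - t) * v ≈ - c * u * t
      quotient-eq c d w z v {u} {t} eu et ev = begin
        (u - t) * v
          ≈⟨ solveℤ 3 (λ u t v → (u :- t) :* v ≔ (u :* con (+ 1) :- t :* con (+ 1)) :* v) refl (u ∷ t ∷ v ∷ []) ⟩
        (u * 1ᶜ - t * 1ᶜ) * v
          ≈⟨ ℂr.*-congʳ (ℂr.+-cong (ℂr.*-congˡ (≈-sym et)) (ℂr.-‿cong (ℂr.*-congˡ (≈-sym eu)))) ⟩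
        (u * ((c * z + d) * t) - t * ((c * w + d) * u)) * v
          ≈⟨ solveℤ 7 (λ c d w z v u t → (u :* ((c :* z :+ d) :* t) :- t :* ((c :* w :+ d) :* u)) :* v
               ≔ :- c :* u :* t :* (v :* (w :- z))) refl (c ∷ d ∷ w ∷ z ∷ v ∷ u ∷ t ∷ []) ⟩
        - c * u * t * (v * (w - z)) ≈⟨ ≈-trans (ℂr.*-congˡ ev) (ℂr.*-identityʳ _) ⟩
        - c * u * t ∎
        where open ≈-Reasoning

  -- From Mw - Mz = det M (w - z) / ((cw + d)(cz + d)) the inverse difference of the image points is
  -- v (cw + d)(cz + d) / det M. Thus images of admissible sequences are admissible.
  deriv-∘möbius : ∀ {f L} → HasDeriv f (möbius M z) L →
                  HasDeriv (λ w → f (möbius M w)) z (L * (ι (det M) * denInv M z * denInv M z))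
  deriv-∘möbius {f} {L} D = mkDeriv λ w v w→z vw →
      let v′ = λ n → v n * den M (w n) * den M z * r in lim-resp
      (λ n → rescale (f (möbius M (w n)) - f (möbius M z)) (v n) (denInv-inverse M (w n)) (denInv-inverse M z))
      ≈-refl
      (lim-* (quotients D (λ n → möbius M (w n)) v′ (lim-möbius w→z)
          (λ n → invert (pt (w n)) (pt z) (v n) (denInv-inverse M (w n)) (denInv-inverse M z) (vw n)))
        (lim-* (lim-* (lim-const (ι (det M))) (lim-denInv w→z)) (lim-const (denInv M z))))
    where
      open ≈-Reasoning
      r : ℂ
      r = ι (invᵣ (det M) (det-pos M))
      det-r : ι (det M) * r ≈ 1ᶜ
      det-r = ≈-trans (≈-sym (ι-* _ _)) (ι-cong (invᵣ-inverse (det M) (det-pos M)))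
      rescale : ∀ X v {x y u t} → x * u ≈ 1ᶜ → y * t ≈ 1ᶜ → X * (v * x * y * r) * (ι (det M) * u * t) ≈ X * v
      rescale X v {x} {y} {u} {t} xu yt = begin
        X * (v * x * y * r) * (ι (det M) * u * t)
          ≈⟨ solveℤ 8 (λ X v x y r d u t → X :* (v :* x :* y :* r) :* (d :* u :* t) ≔ X :* v :* ((x :* u) :* (y :* t) :* (d :* r))) refl
               (X ∷ v ∷ x ∷ y ∷ r ∷ ι (det M) ∷ u ∷ t ∷ []) ⟩
        X * v * ((x * u) * (y * t) * (ι (det M) * r)) ≈⟨ ℂr.*-congˡ (ℂr.*-cong (ℂr.*-cong xu yt) det-r) ⟩
        X * v * (1ᶜ * 1ᶜ * 1ᶜ) ≈⟨ solveℤ 1 (λ x → x :* (con (+ 1) :* con (+ 1) :* con (+ 1)) ≔ x) refl (X * v ∷ []) ⟩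
        X * v ∎
      invert : ∀ w z v {u t} → (ι (c M) * w + ι (d M)) * u ≈ 1ᶜ → (ι (c M) * z + ι (d M)) * t ≈ 1ᶜ → v * (w - z) ≈ 1ᶜ →
                v * (ι (c M) * w + ι (d M)) * (ι (c M) * z + ι (d M)) * r * ((ι (a M) * w + ι (b M)) * u - (ι (a M) * z + ι (b M)) * t) ≈ 1ᶜ
      invert w z v {u} {t} eu et ev = begin
        v * x * y * r * (n * u - m * t)
          ≈⟨ solveℤ 8 (λ v x y r n m u t → v :* x :* y :* r :* (n :* u :- m :* t) ≔ v :* r :* (n :* y :* (x :* u) :- m :* x :* (y :* t))) refl
               (v ∷ x ∷ y ∷ r ∷ n ∷ m ∷ u ∷ t ∷ []) ⟩
        v * r * (n * y * (x * u) - m * x * (y * t))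
          ≈⟨ ℂr.*-congˡ (ℂr.+-cong (ℂr.*-congˡ eu) (ℂr.-‿cong (ℂr.*-congˡ et))) ⟩
        v * r * (n * y * 1ᶜ - m * x * 1ᶜ)
          ≈⟨ solveℤ 8 (λ a b c d w z v r → v :* r :* ((a :* w :+ b) :* (c :* z :+ d) :* con (+ 1) :- (a :* z :+ b) :* (c :* w :+ d) :* con (+ 1))
               ≔ (v :* (w :- z)) :* ((a :* d :- b :* c) :* r)) refl (ι (a M) ∷ ι (b M) ∷ ι (c M) ∷ ι (d M) ∷ w ∷ z ∷ v ∷ r ∷ []) ⟩
        v * (w - z) * ((ι (a M) * ι (d M) - ι (b M) * ι (c M)) * r)
          ≈⟨ ℂr.*-cong ev (≈-trans (ℂr.*-congʳ (≈-sym ad-bc)) det-r) ⟩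
        1ᶜ * 1ᶜ ≈⟨ ℂr.*-identityˡ 1ᶜ ⟩
        1ᶜ ∎
        where
          x y n m : ℂ
          x = ι (c M) * w + ι (d M)
          y = ι (c M) * z + ι (d M)
          n = ι (a M) * w + ι (b M)
          m = ι (a M) * z + ι (b M)

  deriv-slash : ∀ {f L} k → HasDeriv f (möbius M z) L → ∃ (HasDeriv (f ∣⟨ k ⟩ M) z)
  deriv-slash {f} k D = _ , deriv-resp (λ w → ≈-sym (slash-def f k M w))
    (deriv-* (deriv-* (deriv-const (ι (det M) ^ (k ℕ./ 2))) (proj₂ (deriv-^ deriv-denInv k))) (deriv-∘möbius D))

-- The element p + q N for N = ⟪ a , b ∣ c , - a ⟫ with N² = 13.
module Torus (a b c : ℤ) (N² : a ℤ.* a ℤ.+ b ℤ.* c ≡ + 13) where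

  private
    module Z = Data.Integer.Solver.+-*-Solver

  torus-entries : ℤ → ℤ → ℤ⁴
  torus-entries p q = (p ℤ.+ q ℤ.* a , q ℤ.* b) , (q ℤ.* c , p ℤ.- q ℤ.* a)

  opaque
    torus-det : ∀ p q → (p ℤ.+ q ℤ.* a) ℤ.* (p ℤ.- q ℤ.* a) ℤ.- (q ℤ.* b) ℤ.* (q ℤ.* c) ≡ norm p q
    torus-det p q = trans (Z.solve 5 (λ a b c p q → (p Z.:+ q Z.:* a) Z.:* (p Z.:- q Z.:* a) Z.:- (q Z.:* b) Z.:* (q Z.:* c)
        Z.:= p Z.:* p Z.:- (a Z.:* a Z.:+ b Z.:* c) Z.:* (q Z.:* q)) refl a b c p q) (cong (λ x → p ℤ.* p ℤ.- x ℤ.* (q ℤ.* q)) N²)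

  torus : ∀ p q → + 0 ℤ.< norm p q → GL₂⁺
  torus p q pos = intMat (p ℤ.+ q ℤ.* a) (q ℤ.* b) (q ℤ.* c) (p ℤ.- q ℤ.* a) (subst (+ 0 ℤ.<_) (sym (torus-det p q)) pos)

  torus-integral : ∀ p q pos → Integral (torus p q pos) (torus-entries p q)
  torus-integral p q pos = record { a≈ = ≈ᵣ-refl ; b≈ = ≈ᵣ-refl ; c≈ = ≈ᵣ-refl ; d≈ = ≈ᵣ-refl }

  opaque
    torus-* : ∀ p q p′ q′ → torus-entries p q ⊡ torus-entries p′ q′
      ≡ torus-entries (p ℤ.* p′ ℤ.+ + 13 ℤ.* (q ℤ.* q′)) (p ℤ.* q′ ℤ.+ q ℤ.* p′)
    torus-* p q p′ q′ = cong₂ _,_ (cong₂ _,_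
        (trans (Z.solve 7 (λ a b c p q p′ q′ → (p Z.:+ q Z.:* a) Z.:* (p′ Z.:+ q′ Z.:* a) Z.:+ (q Z.:* b) Z.:* (q′ Z.:* c)
          Z.:= p Z.:* p′ Z.:+ (a Z.:* a Z.:+ b Z.:* c) Z.:* (q Z.:* q′) Z.:+ (p Z.:* q′ Z.:+ q Z.:* p′) Z.:* a) refl a b c p q p′ q′)
          (cong (λ x → p ℤ.* p′ ℤ.+ x ℤ.* (q ℤ.* q′) ℤ.+ (p ℤ.* q′ ℤ.+ q ℤ.* p′) ℤ.* a) N²))
        (Z.solve 6 (λ a b p q p′ q′ → (p Z.:+ q Z.:* a) Z.:* (q′ Z.:* b) Z.:+ (q Z.:* b) Z.:* (p′ Z.:- q′ Z.:* a)
          Z.:= (p Z.:* q′ Z.:+ q Z.:* p′) Z.:* b) refl a b p q p′ q′))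
      (cong₂ _,_
        (Z.solve 6 (λ a c p q p′ q′ → (q Z.:* c) Z.:* (p′ Z.:+ q′ Z.:* a) Z.:+ (p Z.:- q Z.:* a) Z.:* (q′ Z.:* c)
          Z.:= (p Z.:* q′ Z.:+ q Z.:* p′) Z.:* c) refl a c p q p′ q′)
        (trans (Z.solve 7 (λ a b c p q p′ q′ → (q Z.:* c) Z.:* (q′ Z.:* b) Z.:+ (p Z.:- q Z.:* a) Z.:* (p′ Z.:- q′ Z.:* a)
          Z.:= p Z.:* p′ Z.:+ (a Z.:* a Z.:+ b Z.:* c) Z.:* (q Z.:* q′) Z.:- (p Z.:* q′ Z.:+ q Z.:* p′) Z.:* a) refl a b c p q p′ q′)
          (cong (λ x → p ℤ.* p′ ℤ.+ x ℤ.* (q ℤ.* q′) ℤ.- (p ℤ.* q′ ℤ.+ q ℤ.* p′) ℤ.* a) N²)))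

  module _ {G : ℋ → ℂ} (G-respects : Respects G) (k : ℕ) (even : k ℕ./ 2 ℕ.+ k ℕ./ 2 ≡ k)
           (G-A : ∀ pos → G ∣⟨ k ⟩ torus (+ 7) (+ 1) pos ≐ G)
           (G-B : ∀ pos → G ∣⟨ k ⟩ torus (+ 19) (ℤ.- + 5) pos ≐ G) where

    private
      slash-entries : ∀ {M N X} → Integral M X → Integral N X → G ∣⟨ k ⟩ M ≐ G ∣⟨ k ⟩ N
      slash-entries I J = slash-scale G-respects k even _ _ 1ᵣ 1ᵣ (ℝr.*-identityˡ 1ᵣ)
          (eq (Integral.a≈ I) (Integral.a≈ J)) (eq (Integral.b≈ I) (Integral.b≈ J))
          (eq (Integral.c≈ I) (Integral.c≈ J)) (eq (Integral.d≈ I) (Integral.d≈ J))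
        where
          eq : ∀ {x y i} → x ≈ᵣ i → y ≈ᵣ i → x ≈ᵣ 1ᵣ *ᵣ y
          eq x≈ y≈ = ℝr.trans x≈ (ℝr.trans (ℝr.sym y≈) (ℝr.sym (ℝr.*-identityˡ _)))

      times : ∀ {p q} p′ q′ {pos} pos′ → G ∣⟨ k ⟩ torus p q pos ≐ G → G ∣⟨ k ⟩ torus p′ q′ pos′ ≐ G →
              ∀ {r s} posᵣ → r ≡ p ℤ.* p′ ℤ.+ + 13 ℤ.* (q ℤ.* q′) → s ≡ p ℤ.* q′ ℤ.+ q ℤ.* p′ →
              G ∣⟨ k ⟩ torus r s posᵣ ≐ G
      times {p} {q} p′ q′ {pos} pos′ h h′ posᵣ refl refl z = ≈-trans (≈-sym (≈-trans (slash-∘ G-respects k (torus p q pos) (torus p′ q′ pos′) z)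
          (slash-entries (subst (Integral (torus p q pos *ₘ torus p′ q′ pos′)) (torus-* p q p′ q′) (*ₘ-integral (torus-integral p q pos) (torus-integral p′ q′ pos′)))
            (torus-integral (p ℤ.* p′ ℤ.+ + 13 ℤ.* (q ℤ.* q′)) (p ℤ.* q′ ℤ.+ q ℤ.* p′) posᵣ) z)))
        (≈-trans (slash-resp {G ∣⟨ k ⟩ torus p q pos} {G} k (torus p′ q′ pos′) h z) (h′ z))

      times-A : ∀ p q {pos} → G ∣⟨ k ⟩ torus p q pos ≐ G → ∀ pos′ → G ∣⟨ k ⟩ torus (+ 7 ℤ.* p ℤ.+ + 13 ℤ.* q) (p ℤ.+ + 7 ℤ.* q) pos′ ≐ G
      times-A p q {pos} h pos′ = times {p} {q} (+ 7) (+ 1) {pos} 0<36 h (G-A 0<36) pos′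
          (Z.solve 2 (λ p q → Z.con (+ 7) Z.:* p Z.:+ Z.con (+ 13) Z.:* q Z.:= p Z.:* Z.con (+ 7) Z.:+ Z.con (+ 13) Z.:* (q Z.:* Z.con (+ 1))) refl p q)
          (Z.solve 2 (λ p q → p Z.:+ Z.con (+ 7) Z.:* q Z.:= p Z.:* Z.con (+ 1) Z.:+ q Z.:* Z.con (+ 7)) refl p q)
        where
          0<36 : + 0 ℤ.< norm (+ 7) (+ 1)
          0<36 = ℤ.+<+ (s≤s z≤n)

      times-B : ∀ p q {pos} → G ∣⟨ k ⟩ torus p q pos ≐ G → ∀ pos′ → G ∣⟨ k ⟩ torus (+ 19 ℤ.* p ℤ.- + 65 ℤ.* q) (+ 19 ℤ.* q ℤ.- + 5 ℤ.* p) pos′ ≐ G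
      times-B p q {pos} h pos′ = times {p} {q} (+ 19) (ℤ.- + 5) {pos} 0<36 h (G-B 0<36) pos′
          (Z.solve 2 (λ p q → Z.con (+ 19) Z.:* p Z.:- Z.con (+ 65) Z.:* q Z.:= p Z.:* Z.con (+ 19) Z.:+ Z.con (+ 13) Z.:* (q Z.:* Z.con (ℤ.- + 5))) refl p q)
          (Z.solve 2 (λ p q → Z.con (+ 19) Z.:* q Z.:- Z.con (+ 5) Z.:* p Z.:= p Z.:* Z.con (ℤ.- + 5) Z.:+ q Z.:* Z.con (+ 19)) refl p q)
        where
          0<36 : + 0 ℤ.< norm (+ 19) (ℤ.- + 5)
          0<36 = ℤ.+<+ (s≤s z≤n)

    word-invariant : ∀ {n p q} → Word n p q → ∀ pos → G ∣⟨ k ⟩ torus p q pos ≐ G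
    word-invariant [] pos = slash-identity G-respects k (torus (+ 1) (+ 0) pos) ≈ᵣ-refl ≈ᵣ-refl ≈ᵣ-refl ≈ᵣ-refl
    word-invariant (_▹A {p = p} {q} w) pos = times-A p q (word-invariant w (norm-word w)) pos
    word-invariant (_▹B {p = p} {q} w) pos = times-B p q (word-invariant w (norm-word w)) pos

lim-^ : ∀ {s l} → Lim s l → ∀ n → Lim (λ i → s i ^ n) (l ^ n)
lim-^ L zero    = lim-const 1ᶜ
lim-^ L (suc n) = lim-* L (lim-^ L n)

-- This is (X^m - Y^m)/t written as a polynomial in X, Y and r = (X - Y)/t, so that no division by t
-- remains when t tends to 0. At X = Y = 1 it becomes m r.
power-quotient : ℂ → ℂ → ℂ → ℕ → ℂ
power-quotient X Y r zero    = 0ᶜ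
power-quotient X Y r (suc m) = X * power-quotient X Y r m + r * Y ^ m

power-quotient-correct : ∀ {X Y t r} → X - Y ≈ t * r → ∀ m → X ^ m - Y ^ m ≈ t * power-quotient X Y r m
power-quotient-correct {X} {Y} {t} {r} e zero = solveℤ 1 (λ t → con (+ 1) :- con (+ 1) ≔ t :* con (+ 0)) refl (t ∷ [])
power-quotient-correct {X} {Y} {t} {r} e (suc m) = begin
  X * X ^ m - Y * Y ^ m
    ≈⟨ solveℤ 4 (λ X Y p q → X :* p :- Y :* q ≔ X :* (p :- q) :+ (X :- Y) :* q) refl (X ∷ Y ∷ X ^ m ∷ Y ^ m ∷ []) ⟩
  X * (X ^ m - Y ^ m) + (X - Y) * Y ^ m
    ≈⟨ ℂr.+-cong (ℂr.*-congˡ (power-quotient-correct e m)) (ℂr.*-congʳ e) ⟩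
  X * (t * power-quotient X Y r m) + t * r * Y ^ m
    ≈⟨ solveℤ 5 (λ X t R r q → X :* (t :* R) :+ t :* r :* q ≔ t :* (X :* R :+ r :* q)) refl (X ∷ t ∷ power-quotient X Y r m ∷ r ∷ Y ^ m ∷ []) ⟩
  t * (X * power-quotient X Y r m + r * Y ^ m) ∎
  where open ≈-Reasoning

lim-power-quotient : ∀ {X Y r : ℕ → ℂ} {x y s} → Lim X x → Lim Y y → Lim r s → ∀ m →
                     Lim (λ n → power-quotient (X n) (Y n) (r n) m) (power-quotient x y s m)
lim-power-quotient LX LY Lr zero    = lim-const 0ᶜ
lim-power-quotient LX LY Lr (suc m) = lim-+ (lim-* LX (lim-power-quotient LX LY Lr m)) (lim-* Lr (lim-^ LY m))

power-quotient-1 : ∀ r m → power-quotient 1ᶜ 1ᶜ r m ≈ ιℤ (+ m) * r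
power-quotient-1 r zero    = solveℤ 1 (λ r → con (+ 0) ≔ con (+ 0) :* r) refl (r ∷ [])
power-quotient-1 r (suc m) = begin
  1ᶜ * power-quotient 1ᶜ 1ᶜ r m + r * 1ᶜ ^ m ≈⟨ ℂr.+-cong (ℂr.*-congˡ (power-quotient-1 r m)) (ℂr.*-congˡ (1^≈1 m)) ⟩
  1ᶜ * (ιℤ (+ m) * r) + r * 1ᶜ
    ≈⟨ solveℤ 2 (λ m r → con (+ 1) :* (m :* r) :+ r :* con (+ 1) ≔ (con (+ 1) :+ m) :* r) refl (ιℤ (+ m) ∷ r ∷ []) ⟩
  (1ᶜ + ιℤ (+ m)) * r ≈⟨ ℂr.*-congʳ (≈-trans (≈-sym (ι-+ 1ᵣ (fromℤ (+ m)))) (ι-cong (ℝr.sym (fromℤ-+ (+ 1) (+ m))))) ⟩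
  ιℤ (+ suc m) * r ∎
  where open ≈-Reasoning

module TorusODE (a b c : ℤ) (N² : a ℤ.* a ℤ.+ b ℤ.* c ≡ + 13) (z : ℋ) where
  open Torus a b c N²

  private
    A B C Z : ℂ
    A = ιℤ a
    B = ιℤ b
    C = ιℤ c
    Z = pt z

  -- The fixed points of N are the zeros of Q, and e = - Q′ / 2.
  opaque
    quadratic slope-form : ℂ
    quadratic  = B + (A + A) * Z - C * Z * Z
    slope-form = C * Z - A

    quadratic-def : quadratic ≈ ιℤ b + (ιℤ a + ιℤ a) * pt z - ιℤ c * pt z * pt z
    quadratic-def = ≈-refl

    slope-form-def : slope-form ≈ ιℤ c * pt z - ιℤ a
    slope-form-def = ≈-refl

  private
    Q e : ℂ
    Q = quadratic
    e = slope-form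

  opaque
    unfolding quadratic slope-form

    -- In terms of z = x + iy one has |Q|² = 52y² + S² with S real, where 52 = 4 (a² + bc) is the
    -- discriminant. Hence Q has no zero in the upper half-plane.
    quadratic-pos : 0ᵣ <ᵣ ∣ quadratic ∣²
    quadratic-pos = >0-resp (ℝr.sym eq)
        (>0-+≥0 {fromℤ (+ 52) *ᵣ (y *ᵣ y)} {S *ᵣ S} (>0-* (>0-fromℚ (ℚₚ.positive⁻¹ (+ 52 ℚ./ 1))) (>0-* (im-pos z) (im-pos z)))
          (λ n → 0≤a² (seq S n)))
      where
        open ℝ-Solver using () renaming (solveℤ to solveᵣ; con to conᵣ; _:+_ to _⊕_; _:*_ to _⊗_; _:-_ to _⊖_; _≔_ to _≔ᵣ_)
        x y a′ b′ c′ S : ℝ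
        x  = re Z
        y  = im Z
        a′ = fromℤ a
        b′ = fromℤ b
        c′ = fromℤ c
        S  = b′ +ᵣ (a′ +ᵣ a′) *ᵣ x -ᵣ c′ *ᵣ (x *ᵣ x +ᵣ y *ᵣ y)
        discriminant : a′ *ᵣ a′ +ᵣ b′ *ᵣ c′ ≈ᵣ fromℤ (+ 13)
        discriminant = ℝr.trans (ℝr.+-cong (ℝr.sym (fromℤ-* a a)) (ℝr.sym (fromℤ-* b c)))
          (ℝr.trans (ℝr.sym (fromℤ-+ (a ℤ.* a) (b ℤ.* c))) (ℝr.reflexive (cong fromℤ N²)))
        eq : ∣ quadratic ∣² ≈ᵣ fromℤ (+ 52) *ᵣ (y *ᵣ y) +ᵣ S *ᵣ S
        eq = ℝr.trans (∣∣²-cong {quadratic} {(b′ +ᵣ (a′ +ᵣ a′) *ᵣ x -ᵣ c′ *ᵣ (x *ᵣ x -ᵣ y *ᵣ y)) +i ((a′ +ᵣ a′) *ᵣ y -ᵣ c′ *ᵣ (x *ᵣ y +ᵣ y *ᵣ x))}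
              ( solveᵣ 5 (λ a b c x y → (b ⊕ ((a ⊕ a) ⊗ x ⊖ (conᵣ (+ 0) ⊕ conᵣ (+ 0)) ⊗ y))
                    ⊖ ((c ⊗ x ⊖ conᵣ (+ 0) ⊗ y) ⊗ x ⊖ (c ⊗ y ⊕ conᵣ (+ 0) ⊗ x) ⊗ y)
                    ≔ᵣ b ⊕ (a ⊕ a) ⊗ x ⊖ c ⊗ (x ⊗ x ⊖ y ⊗ y)) refl (a′ ∷ b′ ∷ c′ ∷ x ∷ y ∷ [])
              , solveᵣ 5 (λ a b c x y → (conᵣ (+ 0) ⊕ ((a ⊕ a) ⊗ y ⊕ (conᵣ (+ 0) ⊕ conᵣ (+ 0)) ⊗ x))
                    ⊖ ((c ⊗ x ⊖ conᵣ (+ 0) ⊗ y) ⊗ y ⊕ (c ⊗ y ⊕ conᵣ (+ 0) ⊗ x) ⊗ x)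
                    ≔ᵣ (a ⊕ a) ⊗ y ⊖ c ⊗ (x ⊗ y ⊕ y ⊗ x)) refl (a′ ∷ b′ ∷ c′ ∷ x ∷ y ∷ [])))
          (ℝr.trans (solveᵣ 5 (λ a b c x y →
              (b ⊕ (a ⊕ a) ⊗ x ⊖ c ⊗ (x ⊗ x ⊖ y ⊗ y)) ⊗ (b ⊕ (a ⊕ a) ⊗ x ⊖ c ⊗ (x ⊗ x ⊖ y ⊗ y))
                ⊕ ((a ⊕ a) ⊗ y ⊖ c ⊗ (x ⊗ y ⊕ y ⊗ x)) ⊗ ((a ⊕ a) ⊗ y ⊖ c ⊗ (x ⊗ y ⊕ y ⊗ x))
              ≔ᵣ conᵣ (+ 4) ⊗ (a ⊗ a ⊕ b ⊗ c) ⊗ (y ⊗ y)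
                ⊕ (b ⊕ (a ⊕ a) ⊗ x ⊖ c ⊗ (x ⊗ x ⊕ y ⊗ y)) ⊗ (b ⊕ (a ⊕ a) ⊗ x ⊖ c ⊗ (x ⊗ x ⊕ y ⊗ y))) refl (a′ ∷ b′ ∷ c′ ∷ x ∷ y ∷ []))
            (ℝr.+-congʳ (ℝr.*-congʳ (ℝr.trans (ℝr.*-congˡ discriminant) (ℝr.sym (fromℤ-* (+ 4) (+ 13)))))))

  quadratic⁻¹ : ℂ
  quadratic⁻¹ = invᶜ quadratic quadratic-pos

  quadratic-inverse : quadratic * quadratic⁻¹ ≈ 1ᶜ
  quadratic-inverse = invᶜ-inverse quadratic quadratic-pos

  module _ {G : ℋ → ℂ} (k : ℕ) (even : k ℕ./ 2 ℕ.+ k ℕ./ 2 ≡ k)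
           (invariant : ∀ {n p q} → Word n p q → ∀ pos → G ∣⟨ k ⟩ torus p q pos ≐ G) where
    private
      m : ℕ
      m = k ℕ./ 2
      Qi : ℂ
      Qi = quadratic⁻¹

    -- Taking out the scalar p leaves 1 + τN: the denominator of h is P x, its determinant is P² y,
    -- and h moves z by τ Q u with u = 1/x. So v is the inverse of the displacement, and ρ is (x² -
    -- y)/τ.
    module Approximation (n : ℕ) where
      open Slope (Slopes n)
      h : GL₂⁺
      h = torus p q (norm-word word)
      w : ℋ
      w = möbius h z
      P Q′ τ τ⁻¹ u x y ρ v : ℂ
      P   = ιℤ p
      Q′  = ιℤ q
      τ   = ι t
      τ⁻¹ = ι t⁻¹
      u   = P * denInv h z
      x   = 1ᶜ + τ * e
      y   = 1ᶜ - ιℤ (+ 13) * (τ * τ)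
      ρ   = e + e + τ * (e * e) + ιℤ (+ 13) * τ
      v   = x * Qi * τ⁻¹

      opaque
        unfolding quadratic slope-form

        τP : τ * P ≈ Q′
        τP = ≈-trans (≈-sym (ι-* t (fromℤ p))) (ι-cong tp≈q)

        τ-inverse : τ⁻¹ * τ ≈ 1ᶜ
        τ-inverse = ≈-trans (≈-sym (ι-* t⁻¹ t)) (ι-cong t⁻¹t)

        den≈ : den h z ≈ P * x
        den≈ = begin
          ιℤ (q ℤ.* c) * Z + ιℤ (p ℤ.- q ℤ.* a)
            ≈⟨ ℂr.+-cong (ℂr.*-congʳ (ιℤ-* q c)) (≈-trans (ιℤ-+ p (ℤ.- (q ℤ.* a))) (ℂr.+-congˡ (≈-trans (ιℤ-neg (q ℤ.* a)) (ℂr.-‿cong (ιℤ-* q a))))) ⟩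
          Q′ * C * Z + (P - Q′ * A)
            ≈⟨ ℂr.+-cong (ℂr.*-congʳ (ℂr.*-congʳ (≈-sym τP))) (ℂr.+-congˡ (ℂr.-‿cong (ℂr.*-congʳ (≈-sym τP)))) ⟩
          τ * P * C * Z + (P - τ * P * A)
            ≈⟨ solveℤ 5 (λ t P A C Z → t :* P :* C :* Z :+ (P :- t :* P :* A) ≔ P :* (con (+ 1) :+ t :* (C :* Z :- A))) refl (τ ∷ P ∷ A ∷ C ∷ Z ∷ []) ⟩
          P * x ∎
          where open ≈-Reasoning

        num≈ : num h z ≈ P * (Z + τ * (A * Z + B))
        num≈ = begin
          ιℤ (p ℤ.+ q ℤ.* a) * Z + ιℤ (q ℤ.* b)
            ≈⟨ ℂr.+-cong (ℂr.*-congʳ (≈-trans (ιℤ-+ p (q ℤ.* a)) (ℂr.+-congˡ (ιℤ-* q a)))) (ιℤ-* q b) ⟩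
          (P + Q′ * A) * Z + Q′ * B
            ≈⟨ ℂr.+-cong (ℂr.*-congʳ (ℂr.+-congˡ (ℂr.*-congʳ (≈-sym τP)))) (ℂr.*-congʳ (≈-sym τP)) ⟩
          (P + τ * P * A) * Z + τ * P * B
            ≈⟨ solveℤ 5 (λ t P A B Z → (P :+ t :* P :* A) :* Z :+ t :* P :* B ≔ P :* (Z :+ t :* (A :* Z :+ B))) refl (τ ∷ P ∷ A ∷ B ∷ Z ∷ []) ⟩
          P * (Z + τ * (A * Z + B)) ∎
          where open ≈-Reasoning

        xu : x * u ≈ 1ᶜ
        xu = ≈-trans (solveℤ 3 (λ x P d → x :* (P :* d) ≔ (P :* x) :* d) refl (x ∷ P ∷ denInv h z ∷ []))
          (≈-trans (ℂr.*-congʳ (≈-sym den≈)) (denInv-inverse h z))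

        w≈ : pt w ≈ (Z + τ * (A * Z + B)) * u
        w≈ = ≈-trans (ℂr.*-congʳ num≈) (solveℤ 3 (λ P n d → P :* n :* d ≔ n :* (P :* d)) refl (P ∷ (Z + τ * (A * Z + B)) ∷ denInv h z ∷ []))

        w-z : pt w - Z ≈ τ * Q * u
        w-z = begin
          pt w - Z                                       ≈⟨ ℂr.+-cong w≈ (ℂr.-‿cong (≈-sym (ℂr.*-identityʳ Z))) ⟩
          (Z + τ * (A * Z + B)) * u - Z * 1ᶜ             ≈⟨ ℂr.+-congˡ (ℂr.-‿cong (ℂr.*-congˡ (≈-sym xu))) ⟩
          (Z + τ * (A * Z + B)) * u - Z * (x * u)
            ≈⟨ solveℤ 6 (λ t A B C Z u → (Z :+ t :* (A :* Z :+ B)) :* u :- Z :* ((con (+ 1) :+ t :* (C :* Z :- A)) :* u)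
                 ≔ t :* (B :+ (A :+ A) :* Z :- C :* Z :* Z) :* u) refl (τ ∷ A ∷ B ∷ C ∷ Z ∷ u ∷ []) ⟩
          τ * Q * u ∎
          where open ≈-Reasoning

        vw : v * (pt w - Z) ≈ 1ᶜ
        vw = begin
          v * (pt w - Z)                      ≈⟨ ℂr.*-congˡ w-z ⟩
          x * Qi * τ⁻¹ * (τ * Q * u)          ≈⟨ solveℤ 6 (λ x Qi s t Q u → x :* Qi :* s :* (t :* Q :* u) ≔ (x :* u) :* (Q :* Qi) :* (s :* t)) refl (x ∷ Qi ∷ τ⁻¹ ∷ τ ∷ Q ∷ u ∷ []) ⟩
          (x * u) * (Q * Qi) * (τ⁻¹ * τ)      ≈⟨ ℂr.*-cong (ℂr.*-cong xu quadratic-inverse) τ-inverse ⟩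
          1ᶜ * 1ᶜ * 1ᶜ                        ≈⟨ solveℤ 0 (con (+ 1) :* con (+ 1) :* con (+ 1) ≔ con (+ 1)) refl [] ⟩
          1ᶜ                                  ∎
          where open ≈-Reasoning

        det≈ : ι (GL₂⁺.det h) ≈ P * P * y
        det≈ = begin
          ι (GL₂⁺.det h)                        ≈⟨ ι-cong detᵣ ⟩
          ιℤ (norm p q)                         ≈⟨ ≈-trans (ιℤ-+ (p ℤ.* p) (ℤ.- (+ 13 ℤ.* (q ℤ.* q)))) (ℂr.+-cong (ιℤ-* p p)
                (≈-trans (ιℤ-neg (+ 13 ℤ.* (q ℤ.* q))) (ℂr.-‿cong (≈-trans (ιℤ-* (+ 13) (q ℤ.* q)) (ℂr.*-congˡ {ιℤ (+ 13)} (ιℤ-* q q)))))) ⟩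
          P * P - ιℤ (+ 13) * (Q′ * Q′)         ≈⟨ ℂr.+-congˡ (ℂr.-‿cong (ℂr.*-congˡ (ℂr.*-cong (≈-sym τP) (≈-sym τP)))) ⟩
          P * P - ιℤ (+ 13) * ((τ * P) * (τ * P))
            ≈⟨ solveℤ 2 (λ P t → P :* P :- con (+ 13) :* ((t :* P) :* (t :* P)) ≔ P :* P :* (con (+ 1) :- con (+ 13) :* (t :* t))) refl (P ∷ τ ∷ []) ⟩
          P * P * y ∎
          where
            open ≈-Reasoning
            detᵣ : GL₂⁺.det h ≈ᵣ fromℤ (norm p q)
            detᵣ = ℝr.sym (ℝr.trans (ℝr.reflexive (cong fromℤ (sym (torus-det p q))))
              (ℝr.trans (fromℤ-+ ((p ℤ.+ q ℤ.* a) ℤ.* (p ℤ.- q ℤ.* a)) (ℤ.- ((q ℤ.* b) ℤ.* (q ℤ.* c))))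
                (ℝr.+-cong (fromℤ-* (p ℤ.+ q ℤ.* a) (p ℤ.- q ℤ.* a))
                  (ℝr.trans (fromℤ-neg ((q ℤ.* b) ℤ.* (q ℤ.* c))) (ℝr.-‿cong (fromℤ-* (q ℤ.* b) (q ℤ.* c)))))))

        transform : y ^ m * G w ≈ (x * x) ^ m * G z
        transform = ≈-sym (begin
          (x * x) ^ m * G z                                           ≈⟨ ℂr.*-congˡ (invariant word (norm-word word) z) ⟨
          (x * x) ^ m * (G ∣⟨ k ⟩ h) z                                ≈⟨ ℂr.*-congˡ (slash-def G k h z) ⟩
          (x * x) ^ m * (ι (GL₂⁺.det h) ^ m * denInv h z ^ k * G w)
            ≈⟨ ℂr.*-congˡ (ℂr.*-congʳ (ℂr.*-cong (≈-trans (^-congˡ m det≈) (≈-trans (^-distrib-* (P * P) y m) ≈-refl)) powers)) ⟩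
          (x * x) ^ m * ((P * P) ^ m * y ^ m * (denInv h z * denInv h z) ^ m * G w)
            ≈⟨ solveℤ 5 (λ X P y d g → X :* (P :* y :* d :* g) ≔ (X :* P :* d) :* (y :* g)) refl
                 ((x * x) ^ m ∷ (P * P) ^ m ∷ y ^ m ∷ (denInv h z * denInv h z) ^ m ∷ G w ∷ []) ⟩
          (x * x) ^ m * (P * P) ^ m * (denInv h z * denInv h z) ^ m * (y ^ m * G w)
            ≈⟨ ℂr.*-congʳ (≈-trans (ℂr.*-congʳ (≈-sym (^-distrib-* (x * x) (P * P) m))) (≈-sym (^-distrib-* _ _ m))) ⟩
          (x * x * (P * P) * (denInv h z * denInv h z)) ^ m * (y ^ m * G w)
            ≈⟨ ℂr.*-congʳ (≈-trans (^-congˡ m (≈-trans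
                 (solveℤ 3 (λ x P d → x :* x :* (P :* P) :* (d :* d) ≔ (x :* (P :* d)) :* (x :* (P :* d))) refl (x ∷ P ∷ denInv h z ∷ []))
                 (≈-trans (ℂr.*-cong xu xu) (ℂr.*-identityˡ 1ᶜ)))) (1^≈1 m)) ⟩
          1ᶜ * (y ^ m * G w)  ≈⟨ ℂr.*-identityˡ _ ⟩
          y ^ m * G w ∎)
          where
            open ≈-Reasoning
            powers : denInv h z ^ k ≈ (denInv h z * denInv h z) ^ m
            powers = ≈-trans (ℂr.reflexive (cong (denInv h z ^_) (sym even)))
              (≈-trans (^-homo-* (denInv h z) m m) (≈-sym (^-distrib-* (denInv h z) (denInv h z) m)))

        -- Invariance under h expresses the increment of G as a multiple of G z, and the factor τ of
        -- x^(2m) - y^m cancels against v. The power of y stays on the left, where it tends to 1 and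
        -- does not have to be inverted.
        quotient-value : y ^ m * ((G w - G z) * v) ≈ power-quotient (x * x) y ρ m * x * Qi * G z
        quotient-value = begin
          y ^ m * ((G w - G z) * v)
            ≈⟨ solveℤ 4 (λ y g g′ v → y :* ((g :- g′) :* v) ≔ (y :* g :- y :* g′) :* v) refl (y ^ m ∷ G w ∷ G z ∷ v ∷ []) ⟩
          (y ^ m * G w - y ^ m * G z) * v          ≈⟨ ℂr.*-congʳ (ℂr.+-congʳ transform) ⟩
          ((x * x) ^ m * G z - y ^ m * G z) * v
            ≈⟨ solveℤ 4 (λ X y g v → (X :* g :- y :* g) :* v ≔ (X :- y) :* g :* v) refl ((x * x) ^ m ∷ y ^ m ∷ G z ∷ v ∷ []) ⟩
          ((x * x) ^ m - y ^ m) * G z * v          ≈⟨ ℂr.*-congʳ (ℂr.*-congʳ (power-quotient-correct x²-y m)) ⟩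
          τ * R * G z * (x * Qi * τ⁻¹)
            ≈⟨ solveℤ 6 (λ t R g x Qi s → t :* R :* g :* (x :* Qi :* s) ≔ R :* x :* Qi :* g :* (s :* t)) refl (τ ∷ R ∷ G z ∷ x ∷ Qi ∷ τ⁻¹ ∷ []) ⟩
          R * x * Qi * G z * (τ⁻¹ * τ)             ≈⟨ ≈-trans (ℂr.*-congˡ τ-inverse) (ℂr.*-identityʳ _) ⟩
          R * x * Qi * G z ∎
          where
            open ≈-Reasoning
            R : ℂ
            R = power-quotient (x * x) y ρ m
            x²-y : x * x - y ≈ τ * ρ
            x²-y = solveℤ 2 (λ t e → (con (+ 1) :+ t :* e) :* (con (+ 1) :+ t :* e) :- (con (+ 1) :- con (+ 13) :* (t :* t))
              ≔ t :* (e :+ e :+ t :* (e :* e) :+ con (+ 13) :* t)) refl (τ ∷ e ∷ [])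

    open Approximation

    opaque
      lim-τ : Lim τ 0ᶜ
      lim-τ = lim-ι lim-slope

      lim-x : Lim x 1ᶜ
      lim-x = lim-resp (λ _ → ≈-refl) (solveℤ 1 (λ e → con (+ 1) :+ con (+ 0) :* e ≔ con (+ 1)) refl (e ∷ []))
        (lim-+ (lim-const 1ᶜ) (lim-* lim-τ (lim-const e)))

      lim-y : Lim y 1ᶜ
      lim-y = lim-resp (λ _ → ≈-refl) (solveℤ 0 (con (+ 1) :- con (+ 13) :* (con (+ 0) :* con (+ 0)) ≔ con (+ 1)) refl [])
        (lim-difference (lim-const 1ᶜ) (lim-* (lim-const (ιℤ (+ 13))) (lim-* lim-τ lim-τ)))

      lim-ρ : Lim ρ (e + e)
      lim-ρ = lim-resp (λ _ → ≈-refl) (solveℤ 1 (λ e → e :+ e :+ con (+ 0) :* (e :* e) :+ con (+ 13) :* con (+ 0) ≔ e :+ e) refl (e ∷ []))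
        (lim-+ (lim-+ (lim-const (e + e)) (lim-* lim-τ (lim-const (e * e)))) (lim-* (lim-const (ιℤ (+ 13))) lim-τ))

      lim-u : Lim u 1ᶜ
      lim-u = lim-resp (λ n → inverse-unique ≈-refl (invᶜ-inverse (x n) (x-pos n)) (xu n))
          (inverse-unique ≈-refl (invᶜ-inverse 1ᶜ 1-pos) (ℂr.*-identityˡ 1ᶜ)) (lim-invᶜ x-pos 1-pos lim-x)
        where
          x-pos : ∀ n → 0ᵣ <ᵣ ∣ x n ∣²
          x-pos n = invertible⇒∣∣²-pos {u n} {x n} (≈-trans (ℂr.*-comm (u n) (x n)) (xu n))
          1-pos : 0ᵣ <ᵣ ∣ 1ᶜ ∣²
          1-pos = invertible⇒∣∣²-pos {1ᶜ} {1ᶜ} (ℂr.*-identityˡ 1ᶜ)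

      lim-w : Lim (λ n → pt (w n)) Z
      lim-w = lim-resp (λ n → ≈-sym (w≈ n)) (solveℤ 3 (λ A B Z → (Z :+ con (+ 0) :* (A :* Z :+ B)) :* con (+ 1) ≔ Z) refl (A ∷ B ∷ Z ∷ []))
        (lim-* (lim-+ (lim-const Z) (lim-* lim-τ (lim-const (A * Z + B)))) lim-u)

      -- Invariance under elements 1 + t N with t → 0 gives Q G′ = k e G.
      torus-ode : ∀ {L} → HasDeriv G z L → L * quadratic ≈ ιℤ (+ m) * (slope-form + slope-form) * G z
      torus-ode {L} D = begin
          L * Q                                              ≈⟨ ℂr.*-congʳ (lim-unique left right) ⟩
          power-quotient 1ᶜ 1ᶜ (e + e) m * 1ᶜ * Qi * G z * Q ≈⟨ ℂr.*-congʳ (ℂr.*-congʳ (ℂr.*-congʳ (ℂr.*-congʳ (power-quotient-1 (e + e) m)))) ⟩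
          ιℤ (+ m) * (e + e) * 1ᶜ * Qi * G z * Q
            ≈⟨ solveℤ 4 (λ r Qi g Q → r :* con (+ 1) :* Qi :* g :* Q ≔ r :* g :* (Q :* Qi)) refl (ιℤ (+ m) * (e + e) ∷ Qi ∷ G z ∷ Q ∷ []) ⟩
          ιℤ (+ m) * (e + e) * G z * (Q * Qi)                ≈⟨ ≈-trans (ℂr.*-congˡ quadratic-inverse) (ℂr.*-identityʳ _) ⟩
          ιℤ (+ m) * (e + e) * G z                           ∎
        where
          open ≈-Reasoning
          left : Lim (λ n → y n ^ m * ((G (w n) - G z) * v n)) L
          left = lim-resp (λ _ → ≈-refl) (≈-trans (ℂr.*-congʳ (1^≈1 m)) (ℂr.*-identityˡ L))
            (lim-* (lim-^ lim-y m) (quotients D w v lim-w vw))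
          right : Lim (λ n → y n ^ m * ((G (w n) - G z) * v n)) (power-quotient 1ᶜ 1ᶜ (e + e) m * 1ᶜ * Qi * G z)
          right = lim-resp (λ n → ≈-sym (quotient-value n)) ≈-refl
            (lim-* (lim-* (lim-* (lim-power-quotient (lim-resp (λ _ → ≈-refl) (ℂr.*-identityˡ 1ᶜ) (lim-* lim-x lim-x)) lim-y lim-ρ m) lim-x)
              (lim-const Qi)) (lim-const (G z)))

-- Vanishing of f | (1 - γ)

opaque
  ℝ-reduced : ∀ {x} → x *ᵣ x ≈ᵣ 0ᵣ → x ≈ᵣ 0ᵣ
  ℝ-reduced {x} h = mk≈ λ ε 0<ε → let N , k = close h (ε ℚ.* ε) (*ε-pos 0<ε 0<ε) in N , λ n p →
    <l (cong ℚ.∣_∣ (sym (ℚₚ.+-identityʳ (seq x n)))) (sq<⇒∣∣< 0<ε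
      (ℚₚ.≤-<-trans (ℚₚ.≤-trans (≤∣∣ (seq x n ℚ.* seq x n)) (ℚₚ.≤-reflexive (cong ℚ.∣_∣ (sym (ℚₚ.+-identityʳ (seq x n ℚ.* seq x n)))))) (k n p)))

  ∣∣²≈0⇒≈0 : ∀ {z} → ∣ z ∣² ≈ᵣ 0ᵣ → z ≈ 0ᶜ
  ∣∣²≈0⇒≈0 {x +i y} h = mk≈ (part x y λ _ → refl) , mk≈ (part y x λ n → ℚₚ.+-comm (seq x n ℚ.* seq x n) (seq y n ℚ.* seq y n))
    where
      part : ∀ u v → (∀ n → seq ∣ x +i y ∣² n ≡ seq u n ℚ.* seq u n ℚ.+ seq v n ℚ.* seq v n) →
             ∀ ε → 0ℚ ℚ.< ε → ∃ λ N → ∀ n → N ℕ.≤ n → ℚ.∣ seq u n ℚ.- 0ℚ ∣ ℚ.< ε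
      part u v e ε 0<ε = let N , k = close h (ε ℚ.* ε) (*ε-pos 0<ε 0<ε) in N , λ n p →
        <l (cong ℚ.∣_∣ (sym (ℚₚ.+-identityʳ (seq u n)))) (sq<⇒∣∣< 0<ε
          (ℚₚ.≤-<-trans (ℚₚ.≤-trans (≤l (ℚₚ.+-identityʳ _) (ℚₚ.+-monoʳ-≤ (seq u n ℚ.* seq u n) (0≤a² (seq v n))))
              (≤l (e n) (ℚₚ.≤-trans (≤∣∣ (seq ∣ x +i y ∣² n)) (ℚₚ.≤-reflexive (cong ℚ.∣_∣ (sym (ℚₚ.+-identityʳ (seq ∣ x +i y ∣² n))))))))
            (k n p)))

  -- This replaces case distinctions on whether a complex number is 0, which cannot be made
  -- constructively.
  ℂ-reduced : ∀ {z} → z * z ≈ 0ᶜ → z ≈ 0ᶜ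
  ℂ-reduced {z} h = ∣∣²≈0⇒≈0 (ℝ-reduced (ℝr.trans (ℝr.sym (∣∣²-* z z)) (ℝr.trans (∣∣²-cong h) (≡⇒≈ᵣ λ _ → refl))))

cancel-unit : ∀ {u u⁻¹ x} → u * u⁻¹ ≈ 1ᶜ → u * x ≈ 0ᶜ → x ≈ 0ᶜ
cancel-unit {u} {u⁻¹} {x} uu h = begin
  x               ≈⟨ ℂr.*-identityˡ x ⟨
  1ᶜ * x          ≈⟨ ℂr.*-congʳ uu ⟨
  u * u⁻¹ * x     ≈⟨ solveℤ 3 (λ u v x → u :* v :* x ≔ v :* (u :* x)) refl (u ∷ u⁻¹ ∷ x ∷ []) ⟩
  u⁻¹ * (u * x)   ≈⟨ ℂr.*-congˡ h ⟩
  u⁻¹ * 0ᶜ        ≈⟨ ℂr.zeroʳ u⁻¹ ⟩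
  0ᶜ              ∎
  where open ≈-Reasoning

ιℤ-inverse : ∀ n → ∃ λ x → ιℤ (+ suc n) * x ≈ 1ᶜ
ιℤ-inverse n = κᶜ n , ≈-trans (ℂr.*-comm _ (κᶜ n)) (κN≈1 n)

≈⇒-≈0 : ∀ {x y} → x ≈ y → y - x ≈ 0ᶜ
≈⇒-≈0 {x} {y} e = ≈-trans (ℂr.+-congˡ (ℂr.-‿cong e)) (ℂr.-‿inverseʳ y)

-- The g i are solutions of Q i * L i = M * E i * g i
-- (with L i the derivative of g i and E i = - Q i ′) for i = 0 , 1 , 2, subject to g 0 + g 1 + g 2 = 0
-- and Q 0 + Q 1 + Q 2 = 0; w is proportional to the Wronskian E 0 Q 1 - E 1 Q 0.
module Elimination (M Q₀ Q₁ E₀ E₁ g₀ g₁ L₀ L₁ : ℂ)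
  (ode₀ : L₀ * Q₀ ≈ M * E₀ * g₀) (ode₁ : L₁ * Q₁ ≈ M * E₁ * g₁) where

  private
    d₀ d₁ Φ : ℂ
    d₀ = M * E₀ * g₀ - L₀ * Q₀
    d₁ = M * E₁ * g₁ - L₁ * Q₁
    Φ  = g₀ * Q₁ - g₁ * Q₀

  -- There are three linear equations for the two derivatives L₀ and L₁. Eliminating these leaves a
  -- relation between g₀ and g₁ alone, with the Wronskian as a factor.
  wronskian-kills : (L₀ + L₁) * (Q₀ + Q₁) ≈ M * (E₀ + E₁) * (g₀ + g₁) →
                    M * ((E₀ * Q₁ - E₁ * Q₀) * (g₀ * Q₁ - g₁ * Q₀)) ≈ 0ᶜ
  wronskian-kills ode₂ = begin
    M * ((E₀ * Q₁ - E₁ * Q₀) * Φ)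
      ≈⟨ solveℤ 9 (λ M Q₀ Q₁ E₀ E₁ g₀ g₁ L₀ L₁ → M :* ((E₀ :* Q₁ :- E₁ :* Q₀) :* (g₀ :* Q₁ :- g₁ :* Q₀))
           ≔ Q₁ :* Q₁ :* (M :* E₀ :* g₀ :- L₀ :* Q₀) :+ Q₀ :* Q₀ :* (M :* E₁ :* g₁ :- L₁ :* Q₁)
             :+ Q₀ :* Q₁ :* ((M :* E₀ :* g₀ :- L₀ :* Q₀) :+ (M :* E₁ :* g₁ :- L₁ :* Q₁)
                  :- (M :* (E₀ :+ E₁) :* (g₀ :+ g₁) :- (L₀ :+ L₁) :* (Q₀ :+ Q₁)))) refl
           (M ∷ Q₀ ∷ Q₁ ∷ E₀ ∷ E₁ ∷ g₀ ∷ g₁ ∷ L₀ ∷ L₁ ∷ []) ⟩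
    Q₁ * Q₁ * d₀ + Q₀ * Q₀ * d₁ + Q₀ * Q₁ * (d₀ + d₁ - d₂)
      ≈⟨ ℂr.+-cong (ℂr.+-cong (ℂr.*-congˡ (≈⇒-≈0 ode₀)) (ℂr.*-congˡ (≈⇒-≈0 ode₁)))
           (ℂr.*-congˡ (ℂr.+-cong (ℂr.+-cong (≈⇒-≈0 ode₀) (≈⇒-≈0 ode₁)) (ℂr.-‿cong (≈⇒-≈0 ode₂)))) ⟩
    Q₁ * Q₁ * 0ᶜ + Q₀ * Q₀ * 0ᶜ + Q₀ * Q₁ * (0ᶜ + 0ᶜ - 0ᶜ)
      ≈⟨ solveℤ 2 (λ Q₀ Q₁ → Q₁ :* Q₁ :* con (+ 0) :+ Q₀ :* Q₀ :* con (+ 0) :+ Q₀ :* Q₁ :* (con (+ 0) :+ con (+ 0) :- con (+ 0)) ≔ con (+ 0)) refl (Q₀ ∷ Q₁ ∷ []) ⟩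
    0ᶜ ∎
    where
      open ≈-Reasoning
      d₂ : ℂ
      d₂ = M * (E₀ + E₁) * (g₀ + g₁) - (L₀ + L₁) * (Q₀ + Q₁)

  -- Let Φ = g₀ Q₁ - g₁ Q₀. Multiplying the derivative of w Φ = 0 by w gives w² Φ′ = 0. By the
  -- differential equations and w Φ = 0, the product Q₀ Q₁ w² Φ′ equals w² (1 + M) Q₁ g₀ times the
  -- Wronskian c w, which accounts for the cube of w.
  derivative-kills : ∀ {w w′ c} → E₀ * Q₁ - E₁ * Q₀ ≈ c * w → w * (g₀ * Q₁ - g₁ * Q₀) ≈ 0ᶜ →
    w′ * (g₀ * Q₁ - g₁ * Q₀) + w * ((L₀ * Q₁ + g₀ * - E₁) - (L₁ * Q₀ + g₁ * - E₀)) ≈ 0ᶜ →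
    c * (1ᶜ + M) * Q₁ * (w * w * w * g₀) ≈ 0ᶜ
  derivative-kills {w} {w′} {c} W≈ wΦ D = begin
    c * (1ᶜ + M) * Q₁ * (w * w * w * g₀)
      ≈⟨ solveℤ 5 (λ c M Q₁ w g₀ → c :* (con (+ 1) :+ M) :* Q₁ :* (w :* w :* w :* g₀) ≔ (c :* w) :* ((con (+ 1) :+ M) :* Q₁ :* (w :* w :* g₀))) refl
           (c ∷ M ∷ Q₁ ∷ w ∷ g₀ ∷ []) ⟩
    (c * w) * ((1ᶜ + M) * Q₁ * (w * w * g₀)) ≈⟨ ℂr.*-congʳ W≈ ⟨
    (E₀ * Q₁ - E₁ * Q₀) * ((1ᶜ + M) * Q₁ * (w * w * g₀))
      ≈⟨ solveℤ 11 (λ M Q₀ Q₁ E₀ E₁ g₀ g₁ L₀ L₁ w w′ →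
           (E₀ :* Q₁ :- E₁ :* Q₀) :* ((con (+ 1) :+ M) :* Q₁ :* (w :* w :* g₀))
           ≔ Q₀ :* Q₁ :* (w :* (w′ :* (g₀ :* Q₁ :- g₁ :* Q₀) :+ w :* ((L₀ :* Q₁ :+ g₀ :* :- E₁) :- (L₁ :* Q₀ :+ g₁ :* :- E₀)))
                :- w′ :* (w :* (g₀ :* Q₁ :- g₁ :* Q₀)))
             :+ (w :* w :* Q₁ :* Q₁ :* (M :* E₀ :* g₀ :- L₀ :* Q₀) :- w :* w :* Q₀ :* Q₀ :* (M :* E₁ :* g₁ :- L₁ :* Q₁))
             :- w :* (w :* (g₀ :* Q₁ :- g₁ :* Q₀)) :* (M :* E₁ :* Q₀ :- E₀ :* Q₁)) refl
           (M ∷ Q₀ ∷ Q₁ ∷ E₀ ∷ E₁ ∷ g₀ ∷ g₁ ∷ L₀ ∷ L₁ ∷ w ∷ w′ ∷ []) ⟩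
    Q₀ * Q₁ * (w * D′ - w′ * (w * Φ)) + (w * w * Q₁ * Q₁ * d₀ - w * w * Q₀ * Q₀ * d₁) - w * (w * Φ) * R
      ≈⟨ ℂr.+-cong (ℂr.+-cong (ℂr.*-congˡ (ℂr.+-cong (ℂr.*-congˡ D) (ℂr.-‿cong (ℂr.*-congˡ wΦ))))
            (ℂr.+-cong (ℂr.*-congˡ (≈⇒-≈0 ode₀)) (ℂr.-‿cong (ℂr.*-congˡ (≈⇒-≈0 ode₁)))))
          (ℂr.-‿cong (ℂr.*-congʳ (ℂr.*-congˡ wΦ))) ⟩
    Q₀ * Q₁ * (w * 0ᶜ - w′ * 0ᶜ) + (w * w * Q₁ * Q₁ * 0ᶜ - w * w * Q₀ * Q₀ * 0ᶜ) - w * 0ᶜ * R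
      ≈⟨ solveℤ 5 (λ Q₀ Q₁ w w′ R → Q₀ :* Q₁ :* (w :* con (+ 0) :- w′ :* con (+ 0))
           :+ (w :* w :* Q₁ :* Q₁ :* con (+ 0) :- w :* w :* Q₀ :* Q₀ :* con (+ 0)) :- w :* con (+ 0) :* R ≔ con (+ 0)) refl (Q₀ ∷ Q₁ ∷ w ∷ w′ ∷ R ∷ []) ⟩
    0ᶜ ∎
    where
      open ≈-Reasoning
      D′ R : ℂ
      D′ = w′ * Φ + w * ((L₀ * Q₁ + g₀ * - E₁) - (L₁ * Q₀ + g₁ * - E₀))
      R  = M * E₁ * Q₀ - E₀ * Q₁

-- The fourth power of w x is a multiple of w³ x, and two applications of reducedness bring it down
-- to w x.
cube-kills : ∀ {w x} → w * w * w * x ≈ 0ᶜ → w * x ≈ 0ᶜ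
cube-kills {w} {x} h = ℂ-reduced (ℂ-reduced (≈-trans
  (solveℤ 2 (λ w x → (w :* x) :* (w :* x) :* ((w :* x) :* (w :* x)) ≔ (w :* w :* w :* x) :* (w :* x :* x :* x)) refl (w ∷ x ∷ []))
  (≈-trans (ℂr.*-congʳ h) (ℂr.zeroˡ _))))

deriv-≈ : ∀ {F z L M} → L ≈ M → HasDeriv F z L → HasDeriv F z M
deriv-≈ e D = mkDeriv λ w v w→z vw → lim-resp (λ _ → ≈-refl) e (quotients D w v w→z vw)

deriv-quadratic : ∀ x y t z → HasDeriv (λ w → x + y * pt w - t * pt w * pt w) z (y - (t + t) * pt z)
deriv-quadratic x y t z = deriv-≈
  (solveℤ 3 (λ y t z → con (+ 0) :+ (con (+ 0) :* z :+ y :* con (+ 1)) :+ :- ((con (+ 0) :* z :+ t :* con (+ 1)) :* z :+ t :* z :* con (+ 1))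
     ≔ y :- (t :+ t) :* z) refl (y ∷ t ∷ pt z ∷ []))
  (deriv-+ (deriv-+ (deriv-const x) (deriv-* (deriv-const y) deriv-id))
    (deriv-neg (deriv-* (deriv-* (deriv-const t) deriv-id) deriv-id)))

module T₀ = TorusODE (+ 13) (+ 4) (ℤ.- + 39) refl
module T₁ = TorusODE (+ 0) -[1+ 0 ] (ℤ.- + 13) refl
module T₂ = TorusODE (ℤ.- + 13) (ℤ.- + 3) (+ 52) refl

-- Three solutions of the differential equations attached to N, γ⁻¹ N γ and γ⁻² N γ² whose sum is 0.
module Uniqueness {g g₁ g₂ : ℋ → ℂ} {k m : ℕ} (even : k ℕ./ 2 ℕ.+ k ℕ./ 2 ≡ k) (m>0 : k ℕ./ 2 ≡ suc m)
  (g′ : ∀ z → ∃ (HasDeriv g z)) (g₁′ : ∀ z → ∃ (HasDeriv g₁ z)) (g₂′ : ∀ z → ∃ (HasDeriv g₂ z))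
  (invariant₀ : ∀ {n p q} → Word n p q → ∀ pos → g ∣⟨ k ⟩ Torus.torus (+ 13) (+ 4) (ℤ.- + 39) refl p q pos ≐ g)
  (invariant₁ : ∀ {n p q} → Word n p q → ∀ pos → g₁ ∣⟨ k ⟩ Torus.torus (+ 0) -[1+ 0 ] (ℤ.- + 13) refl p q pos ≐ g₁)
  (invariant₂ : ∀ {n p q} → Word n p q → ∀ pos → g₂ ∣⟨ k ⟩ Torus.torus (ℤ.- + 13) (ℤ.- + 3) (+ 52) refl p q pos ≐ g₂)
  (sum≈0 : ∀ z → g z + g₁ z + g₂ z ≈ 0ᶜ) where

  private
    -- w vanishes exactly at the fixed points of γ.
    w w′ : ℋ → ℂ
    w  z = 1ᶜ + ιℤ (+ 7) * pt z - ιℤ (ℤ.- + 13) * pt z * pt z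
    w′ z = ιℤ (+ 7) - (ιℤ (ℤ.- + 13) + ιℤ (ℤ.- + 13)) * pt z

    Mᶜ : ℂ
    Mᶜ = ιℤ (+ (k ℕ./ 2))

    module At (z : ℋ) where
      Q₀ Q₁ E₀ E₁ L₀ L₁ L₂ : ℂ
      Q₀ = T₀.quadratic z
      Q₁ = T₁.quadratic z
      E₀ = T₀.slope-form z + T₀.slope-form z
      E₁ = T₁.slope-form z + T₁.slope-form z
      L₀ = proj₁ (g′ z)
      L₁ = proj₁ (g₁′ z)
      L₂ = proj₁ (g₂′ z)
      opaque
        ode₀ : L₀ * Q₀ ≈ Mᶜ * E₀ * g z
        ode₀ = T₀.torus-ode z k even invariant₀ (proj₂ (g′ z))
        ode₁ : L₁ * Q₁ ≈ Mᶜ * E₁ * g₁ z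
        ode₁ = T₁.torus-ode z k even invariant₁ (proj₂ (g₁′ z))
        ode₂ : L₂ * T₂.quadratic z ≈ Mᶜ * (T₂.slope-form z + T₂.slope-form z) * g₂ z
        ode₂ = T₂.torus-ode z k even invariant₂ (proj₂ (g₂′ z))

        third : ∀ {x y t} → x + y + t ≈ 0ᶜ → - t ≈ x + y
        third {x} {y} {t} h = ≈-sym (≈-trans (solveℤ 3 (λ x y t → x :+ y ≔ (x :+ y :+ t) :- t) refl (x ∷ y ∷ t ∷ []))
          (≈-trans (ℂr.+-congʳ h) (ℂr.+-identityˡ (- t))))

        sum-L : L₀ + L₁ + L₂ ≈ 0ᶜ
        sum-L = deriv-0 sum≈0 (deriv-+ (deriv-+ (proj₂ (g′ z)) (proj₂ (g₁′ z))) (proj₂ (g₂′ z)))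

        q₀ : Q₀ ≈ ιℤ (+ 4) + (ιℤ (+ 13) + ιℤ (+ 13)) * pt z - ιℤ (ℤ.- + 39) * pt z * pt z
        q₀ = T₀.quadratic-def z
        q₁ : Q₁ ≈ ιℤ -[1+ 0 ] + (ιℤ (+ 0) + ιℤ (+ 0)) * pt z - ιℤ (ℤ.- + 13) * pt z * pt z
        q₁ = T₁.quadratic-def z
        ε₀ : E₀ ≈ (ιℤ (ℤ.- + 39) * pt z - ιℤ (+ 13)) + (ιℤ (ℤ.- + 39) * pt z - ιℤ (+ 13))
        ε₀ = ℂr.+-cong (T₀.slope-form-def z) (T₀.slope-form-def z)
        ε₁′ : E₁ ≈ (ιℤ (ℤ.- + 13) * pt z - ιℤ (+ 0)) + (ιℤ (ℤ.- + 13) * pt z - ιℤ (+ 0))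
        ε₁′ = ℂr.+-cong (T₁.slope-form-def z) (T₁.slope-form-def z)

        -- The matrices N, γ⁻¹Nγ and γ⁻²Nγ² add up to 0: their sum has trace 0 and commutes with γ,
        -- so it is a multiple of the traceless part of γ, and the multiple is 0 because tr(Nγ) = 0.
        sum-Q : Q₀ + Q₁ ≈ - T₂.quadratic z
        sum-Q = ≈-trans (ℂr.+-cong q₀ q₁) (≈-trans
          (solveℤ 1 (λ z → (con (+ 4) :+ (con (+ 13) :+ con (+ 13)) :* z :- con (ℤ.- + 39) :* z :* z)
            :+ (con -[1+ 0 ] :+ (con (+ 0) :+ con (+ 0)) :* z :- con (ℤ.- + 13) :* z :* z)
          ≔ :- (con (ℤ.- + 3) :+ (con (ℤ.- + 13) :+ con (ℤ.- + 13)) :* z :- con (+ 52) :* z :* z)) refl (pt z ∷ []))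
          (ℂr.-‿cong (≈-sym (T₂.quadratic-def z))))

        sum-E : E₀ + E₁ ≈ - (T₂.slope-form z + T₂.slope-form z)
        sum-E = ≈-trans (ℂr.+-cong ε₀ ε₁′) (≈-trans
          (solveℤ 1 (λ z → ((con (ℤ.- + 39) :* z :- con (+ 13)) :+ (con (ℤ.- + 39) :* z :- con (+ 13)))
            :+ ((con (ℤ.- + 13) :* z :- con (+ 0)) :+ (con (ℤ.- + 13) :* z :- con (+ 0)))
          ≔ :- ((con (+ 52) :* z :- con (ℤ.- + 13)) :+ (con (+ 52) :* z :- con (ℤ.- + 13)))) refl (pt z ∷ []))
          (ℂr.-‿cong (≈-sym (ℂr.+-cong (T₂.slope-form-def z) (T₂.slope-form-def z)))))

        ode₂′ : (L₀ + L₁) * (Q₀ + Q₁) ≈ Mᶜ * (E₀ + E₁) * (g z + g₁ z)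
        ode₂′ = begin
          (L₀ + L₁) * (Q₀ + Q₁)          ≈⟨ ℂr.*-cong (≈-sym (third sum-L)) sum-Q ⟩
          - L₂ * - T₂.quadratic z        ≈⟨ solveℤ 2 (λ x y → :- x :* :- y ≔ x :* y) refl (L₂ ∷ T₂.quadratic z ∷ []) ⟩
          L₂ * T₂.quadratic z            ≈⟨ ode₂ ⟩
          Mᶜ * E₂ * g₂ z                 ≈⟨ solveℤ 3 (λ M x y → M :* x :* y ≔ M :* (:- x) :* :- y) refl (Mᶜ ∷ E₂ ∷ g₂ z ∷ []) ⟩
          Mᶜ * - E₂ * - g₂ z             ≈⟨ ℂr.*-cong (ℂr.*-congˡ (≈-sym sum-E)) (third (sum≈0 z)) ⟩
          Mᶜ * (E₀ + E₁) * (g z + g₁ z)  ∎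
          where
            open ≈-Reasoning
            E₂ : ℂ
            E₂ = T₂.slope-form z + T₂.slope-form z

        wronskian : E₀ * Q₁ - E₁ * Q₀ ≈ ιℤ (+ 26) * w z
        wronskian = ≈-trans (ℂr.+-cong (ℂr.*-cong ε₀ q₁) (ℂr.-‿cong (ℂr.*-cong ε₁′ q₀))) (solveℤ 1 (λ z →
            ((con (ℤ.- + 39) :* z :- con (+ 13)) :+ (con (ℤ.- + 39) :* z :- con (+ 13)))
              :* (con -[1+ 0 ] :+ (con (+ 0) :+ con (+ 0)) :* z :- con (ℤ.- + 13) :* z :* z)
            :- ((con (ℤ.- + 13) :* z :- con (+ 0)) :+ (con (ℤ.- + 13) :* z :- con (+ 0)))
              :* (con (+ 4) :+ (con (+ 13) :+ con (+ 13)) :* z :- con (ℤ.- + 39) :* z :* z)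
          ≔ con (+ 26) :* (con (+ 1) :+ con (+ 7) :* z :- con (ℤ.- + 13) :* z :* z)) refl (pt z ∷ []))

        -- Positivity of the weight enters here; the differential equation then ties g to the
        -- quadratic form.
        M-inverse : Mᶜ * κᶜ m ≈ 1ᶜ
        M-inverse = ≈-trans (ℂr.*-congʳ (ℂr.reflexive (cong (λ n → ιℤ (+ n)) m>0))) (proj₂ (ιℤ-inverse m))

      open Elimination Mᶜ Q₀ Q₁ E₀ E₁ (g z) (g₁ z) L₀ L₁ ode₀ ode₁ public

    Φ : ℋ → ℂ
    Φ z = g z * T₁.quadratic z - g₁ z * T₀.quadratic z

    opaque
      wΦ≈0 : ∀ z → w z * Φ z ≈ 0ᶜ
      wΦ≈0 z = cancel-unit (proj₂ (ιℤ-inverse 25)) (cancel-unit M-inverse (≈-trans (ℂr.*-congˡ (≈-trans (≈-sym (ℂr.*-assoc _ (w z) (Φ z)))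
          (ℂr.*-congʳ (≈-sym wronskian)))) (wronskian-kills ode₂′)))
        where open At z

      deriv-w : ∀ z → HasDeriv w z (w′ z)
      deriv-w = deriv-quadratic 1ᶜ (ιℤ (+ 7)) (ιℤ (ℤ.- + 13))

      deriv-Q₀ : ∀ z → HasDeriv T₀.quadratic z (- At.E₀ z)
      deriv-Q₀ z = deriv-≈ (≈-trans (solveℤ 1 (λ z → con (+ 13) :+ con (+ 13) :- (con (ℤ.- + 39) :+ con (ℤ.- + 39)) :* z
          ≔ :- ((con (ℤ.- + 39) :* z :- con (+ 13)) :+ (con (ℤ.- + 39) :* z :- con (+ 13)))) refl (pt z ∷ [])) (ℂr.-‿cong (≈-sym (At.ε₀ z))))
        (deriv-resp (λ w → ≈-sym (T₀.quadratic-def w)) (deriv-quadratic (ιℤ (+ 4)) (ιℤ (+ 13) + ιℤ (+ 13)) (ιℤ (ℤ.- + 39)) z))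

      deriv-Q₁ : ∀ z → HasDeriv T₁.quadratic z (- At.E₁ z)
      deriv-Q₁ z = deriv-≈ (≈-trans (solveℤ 1 (λ z → con (+ 0) :+ con (+ 0) :- (con (ℤ.- + 13) :+ con (ℤ.- + 13)) :* z
          ≔ :- ((con (ℤ.- + 13) :* z :- con (+ 0)) :+ (con (ℤ.- + 13) :* z :- con (+ 0)))) refl (pt z ∷ [])) (ℂr.-‿cong (≈-sym (At.ε₁′ z))))
        (deriv-resp (λ w → ≈-sym (T₁.quadratic-def w)) (deriv-quadratic (ιℤ -[1+ 0 ]) (ιℤ (+ 0) + ιℤ (+ 0)) (ιℤ (ℤ.- + 13)) z))

      wg≈0 : ∀ z → w z * g z ≈ 0ᶜ
      wg≈0 z = cube-kills (cancel-unit Q₁-inverse (cancel-unit 1+M-inverse (cancel-unit (proj₂ (ιℤ-inverse 25))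
          (≈-trans (solveℤ 4 (λ c M Q x → c :* (M :* (Q :* x)) ≔ c :* M :* Q :* x) refl (ιℤ (+ 26) ∷ (1ᶜ + Mᶜ) ∷ Q₁ ∷ w z * w z * w z * g z ∷ []))
            (derivative-kills wronskian (wΦ≈0 z) (deriv-0 wΦ≈0 (deriv-* (deriv-w z)
              (deriv-+ (deriv-* (proj₂ (g′ z)) (deriv-Q₁ z)) (deriv-neg (deriv-* (proj₂ (g₁′ z)) (deriv-Q₀ z)))))))))))
        where
          open At z
          Q₁-inverse : Q₁ * T₁.quadratic⁻¹ z ≈ 1ᶜ
          Q₁-inverse = T₁.quadratic-inverse z
          1+M-inverse : (1ᶜ + Mᶜ) * κᶜ (suc m) ≈ 1ᶜ
          1+M-inverse = ≈-trans (ℂr.*-congʳ (≈-trans (ℂr.+-congˡ (ℂr.reflexive (cong (λ n → ιℤ (+ n)) m>0)))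
            (≈-sym (ιℤ-+ (+ 1) (+ suc m))))) (proj₂ (ιℤ-inverse (suc m)))

      -- The imaginary part of w′ = 7 + 26z is 26y > 0; in particular the zero of w in the upper
      -- half-plane is simple.
      w′-pos : ∀ z → 0ᵣ <ᵣ ∣ w′ z ∣²
      w′-pos z = >0-resp (ℝr.sym eq) (>0-+≥0 {(fromℤ (+ 26) *ᵣ y) *ᵣ (fromℤ (+ 26) *ᵣ y)} {S *ᵣ S} (>0-* 26y (26y)) (λ n → 0≤a² (seq S n)))
        where
          open ℝ-Solver using () renaming (solveℤ to solveᵣ; con to conᵣ; _:+_ to _⊕_; _:*_ to _⊗_; _:-_ to _⊖_; _≔_ to _≔ᵣ_)
          x y S : ℝ
          x = re (pt z)
          y = im (pt z)
          S = fromℤ (+ 7) +ᵣ fromℤ (+ 26) *ᵣ x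
          26y : 0ᵣ <ᵣ fromℤ (+ 26) *ᵣ y
          26y = >0-* (>0-fromℚ (ℚₚ.positive⁻¹ (+ 26 ℚ./ 1))) (im-pos z)
          eq : ∣ w′ z ∣² ≈ᵣ (fromℤ (+ 26) *ᵣ y) *ᵣ (fromℤ (+ 26) *ᵣ y) +ᵣ S *ᵣ S
          eq = ℝr.trans (∣∣²-cong {w′ z} {S +i (fromℤ (+ 26) *ᵣ y)}
              ( solveᵣ 2 (λ x y → conᵣ (+ 7) ⊖ ((conᵣ (ℤ.- + 13) ⊕ conᵣ (ℤ.- + 13)) ⊗ x ⊖ (conᵣ (+ 0) ⊕ conᵣ (+ 0)) ⊗ y)
                  ≔ᵣ conᵣ (+ 7) ⊕ conᵣ (+ 26) ⊗ x) refl (x ∷ y ∷ [])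
              , solveᵣ 2 (λ x y → conᵣ (+ 0) ⊖ ((conᵣ (ℤ.- + 13) ⊕ conᵣ (ℤ.- + 13)) ⊗ y ⊕ (conᵣ (+ 0) ⊕ conᵣ (+ 0)) ⊗ x)
                  ≔ᵣ conᵣ (+ 26) ⊗ y) refl (x ∷ y ∷ [])))
            (ℝr.+-comm _ _)

  -- Differentiating w g = 0 and multiplying by g leaves w′ g² = 0 at every point, so the zero of w
  -- does not have to be treated separately.
  g≈0 : ∀ z → g z ≈ 0ᶜ
  g≈0 z = ℂ-reduced (cancel-unit (invᶜ-inverse (w′ z) (w′-pos z)) (begin
      w′ z * (g z * g z)
        ≈⟨ solveℤ 4 (λ w′ w g L → w′ :* (g :* g) ≔ (w′ :* g :+ w :* L) :* g :- (w :* g) :* L) refl (w′ z ∷ w z ∷ g z ∷ proj₁ (g′ z) ∷ []) ⟩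
      (w′ z * g z + w z * proj₁ (g′ z)) * g z - (w z * g z) * proj₁ (g′ z)
        ≈⟨ ℂr.+-cong (ℂr.*-congʳ (deriv-0 wg≈0 (deriv-* (deriv-w z) (proj₂ (g′ z))))) (ℂr.-‿cong (ℂr.*-congʳ (wg≈0 z))) ⟩
      0ᶜ * g z - 0ᶜ * proj₁ (g′ z)
        ≈⟨ solveℤ 2 (λ g L → con (+ 0) :* g :- con (+ 0) :* L ≔ con (+ 0)) refl (g z ∷ proj₁ (g′ z) ∷ []) ⟩
      0ᶜ ∎))
    where open ≈-Reasoning

module Vanishing {f : ℋ → ℂ} {k m : ℕ} (E : Eigenform f k) (m>0 : k ℕ./ 2 ≡ suc m) (f′ : ∀ z → ∃ (HasDeriv f z)) where
  open Eigenform E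
  open Symmetries E

  private
    g₁ g₂ : ℋ → ℂ
    g₁ = g ∣⟨ k ⟩ gl γᴹ
    g₂ = g ∣⟨ k ⟩ gl γ²ᴹ

    via : ∀ {G} → Respects G → ∀ {M X} C → Integral M X → {True (X ∼? entries C)} → G ∣⟨ k ⟩ gl C ≐ G → G ∣⟨ k ⟩ M ≐ G
    via G-respects C I {ok} h = ≐-trans (slash-integral G-respects k even C I {ok}) h

    invariant₀ : ∀ {n p q} → Word n p q → ∀ pos → g ∣⟨ k ⟩ Torus.torus (+ 13) (+ 4) (ℤ.- + 39) refl p q pos ≐ g
    invariant₀ = Torus.word-invariant _ _ _ _ g-respects k even
      (λ pos → via g-respects Aᴹ (Torus.torus-integral _ _ _ refl _ _ pos) g-A)
      (λ pos → via g-respects Bᴹ (Torus.torus-integral _ _ _ refl _ _ pos) g-B)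

    invariant₁ : ∀ {n p q} → Word n p q → ∀ pos → g₁ ∣⟨ k ⟩ Torus.torus (+ 0) -[1+ 0 ] (ℤ.- + 13) refl p q pos ≐ g₁
    invariant₁ = Torus.word-invariant _ _ _ _ (slash-cong g-respects k (gl γᴹ)) k even
      -- Up to scalars, these matrices are the conjugates of `Aᴹ` and `Bᴹ` by γ; in terms of γ⁻¹Nγ
      -- they are 7 + γ⁻¹Nγ and 19 - 5 γ⁻¹Nγ.
      (λ pos → via (slash-cong g-respects k (gl γᴹ)) ⟪ + 7 , -[1+ 0 ] ∣ ℤ.- + 13 , + 7 ⟫ (Torus.torus-integral _ _ _ refl _ _ pos)
        (g-conj γᴹ Aᴹ _ ⟪ + 8 , + 4 ∣ ℤ.- + 39 , ℤ.- + 15 ⟫ g-A))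
      (λ pos → via (slash-cong g-respects k (gl γᴹ)) ⟪ + 19 , + 5 ∣ + 65 , + 19 ⟫ (Torus.torus-integral _ _ _ refl _ _ pos)
        (g-conj γᴹ Bᴹ _ ⟪ + 122 , + 34 ∣ ℤ.- + 507 , ℤ.- + 141 ⟫ g-B))

    invariant₂ : ∀ {n p q} → Word n p q → ∀ pos → g₂ ∣⟨ k ⟩ Torus.torus (ℤ.- + 13) (ℤ.- + 3) (+ 52) refl p q pos ≐ g₂
    invariant₂ = Torus.word-invariant _ _ _ _ (slash-cong g-respects k (gl γ²ᴹ)) k even
      (λ pos → via (slash-cong g-respects k (gl γ²ᴹ)) ⟪ ℤ.- + 6 , ℤ.- + 3 ∣ + 52 , + 20 ⟫ (Torus.torus-integral _ _ _ refl _ _ pos)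
        (g-conj γ²ᴹ Aᴹ _ ⟪ ℤ.- + 28 , ℤ.- + 8 ∣ + 78 , + 21 ⟫ g-A))
      (λ pos → via (slash-cong g-respects k (gl γ²ᴹ)) ⟪ + 84 , + 15 ∣ ℤ.- + 260 , ℤ.- + 46 ⟫ (Torus.torus-integral _ _ _ refl _ _ pos)
        (g-conj γ²ᴹ Bᴹ _ ⟪ ℤ.- + 76 , ℤ.- + 14 ∣ + 312 , + 57 ⟫ g-B))

    g′ : ∀ z → ∃ (HasDeriv g z)
    g′ z = _ , deriv-+ (proj₂ (f′ z)) (deriv-neg (proj₂ (deriv-slash (gl γᴹ) k (proj₂ (f′ (möbius (gl γᴹ) z))))))

    g₁′ : ∀ z → ∃ (HasDeriv g₁ z)
    g₁′ z = deriv-slash (gl γᴹ) k (proj₂ (g′ (möbius (gl γᴹ) z)))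

    g₂′ : ∀ z → ∃ (HasDeriv g₂ z)
    g₂′ z = deriv-slash (gl γ²ᴹ) k (proj₂ (g′ (möbius (gl γ²ᴹ) z)))

  g≈0 : ∀ z → g z ≈ 0ᶜ
  g≈0 = Uniqueness.g≈0 even m>0 g′ g₁′ g₂′ invariant₀ invariant₁ invariant₂ g-order-3

  γ-invariant : f ∣⟨ k ⟩ gl γᴹ ≐ f
  γ-invariant z = ≈-sym (≈-trans (solveℤ 2 (λ x y → x ≔ (x :- y) :+ y) refl (f z ∷ _ ∷ [])) (≈-trans (ℂr.+-congʳ (g≈0 z)) (ℂr.+-identityˡ _)))

-- From the group ring to the matrices of the proof

even-half : ∀ k → 2 ∣ k → k ℕ./ 2 ℕ.+ k ℕ./ 2 ≡ k
even-half .(q ℕ.* 2) (divides q refl) = trans (cong (λ n → n ℕ.+ n) (ℕ.m*n/n≡m q 2))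
  (trans (cong (q ℕ.+_) (sym (ℕₚ.+-identityʳ q))) (ℕₚ.*-comm 2 q))

positive-half : ∀ k .{{_ : NonZero k}} → k ℕ./ 2 ℕ.+ k ℕ./ 2 ≡ k → ∃ λ m → k ℕ./ 2 ≡ suc m
positive-half k@(suc _) e with k ℕ./ 2
... | suc m = m , refl
positive-half (suc _) () | zero

intMat-integral : ∀ {i j p q pos} → Integral (intMat i j p q pos) ((i , j) , (p , q))
intMat-integral = record { a≈ = ≈ᵣ-refl ; b≈ = ≈ᵣ-refl ; c≈ = ≈ᵣ-refl ; d≈ = ≈ᵣ-refl }

module _ {f : ℋ → ℂ} (f-respects : Respects f) (k : ℕ) (even : k ℕ./ 2 ℕ.+ k ℕ./ 2 ≡ k) where

  -- The terms of `T` carry their own proofs of positivity and coefficients such as `χ₀ p * 1ᶜ`, so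
  -- they are matched with the Hecke representatives by their action and not by equality.
  record _Represents_ (vM : ℂ × GL₂⁺) (N : GL₂⁺) : Set where
    constructor represents
    field
      coefficient : proj₁ vM ≈ 1ᶜ
      action      : f ∣⟨ k ⟩ proj₂ vM ≐ f ∣⟨ k ⟩ N
  open _Represents_

  ∥-sumOver : ∀ {x Ms} → Pointwise _Represents_ x Ms → f ∥[ k ] x ≐ Sums.sumOver k f Ms
  ∥-sumOver []       z = ≈-refl
  ∥-sumOver (r ∷ rs) z = ℂr.+-cong (≈-trans (ℂr.*-cong (coefficient r) (≈-sym (slash-≐ f k _ z)))
    (≈-trans (ℂr.*-identityˡ _) (action r z))) (∥-sumOver rs z)

  represent : ∀ {v} M N → v ≈ 1ᶜ → Integral M (entries N) → {True (entries N ∼? entries N)} → (v , M) Represents gl N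
  represent M N v≈1 I {ok} = represents v≈1 (slash-integral f-respects k even N I {ok})

  ∥-T₂ : f ∥[ k ] T 2 ≐ Sums.sumOver k f hecke-reps₂
  ∥-T₂ = ∥-sumOver {T 2} {hecke-reps₂}
    ( represent (intMat (+ 2) (+ 0) (+ 0) (+ 1) (diag-pos 2)) ⟪ + 2 , + 0 ∣ + 0 , + 1 ⟫ (ℂr.*-identityˡ 1ᶜ) intMat-integral
    ∷ represent (intMat (+ 1) (+ 0) (+ 0) (+ 2) (upper-pos 2 0)) ⟪ + 1 , + 0 ∣ + 0 , + 2 ⟫ ≈-refl intMat-integral
    ∷ represent (intMat (+ 1) (+ 1) (+ 0) (+ 2) (upper-pos 2 1)) ⟪ + 1 , + 1 ∣ + 0 , + 2 ⟫ ≈-refl intMat-integral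
    ∷ [])

  ∥-T₃ : f ∥[ k ] T 3 ≐ Sums.sumOver k f hecke-reps₃
  ∥-T₃ = ∥-sumOver {T 3} {hecke-reps₃}
    ( represent (intMat (+ 3) (+ 0) (+ 0) (+ 1) (diag-pos 3)) ⟪ + 3 , + 0 ∣ + 0 , + 1 ⟫ (ℂr.*-identityˡ 1ᶜ) intMat-integral
    ∷ represent (intMat (+ 1) (+ 0) (+ 0) (+ 3) (upper-pos 3 0)) ⟪ + 1 , + 0 ∣ + 0 , + 3 ⟫ ≈-refl intMat-integral
    ∷ represent (intMat (+ 1) (+ 1) (+ 0) (+ 3) (upper-pos 3 1)) ⟪ + 1 , + 1 ∣ + 0 , + 3 ⟫ ≈-refl intMat-integral
    ∷ represent (intMat (+ 1) (+ 2) (+ 0) (+ 3) (upper-pos 3 2)) ⟪ + 1 , + 2 ∣ + 0 , + 3 ⟫ ≈-refl intMat-integral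
    ∷ [])

  slash-translation : (∀ {z w} → pt w ≈ pt z + 1ᶜ → f z ≈ f w) → f ∣⟨ k ⟩ gl Uᴹ ≐ f
  slash-translation periodic z = begin
    (f ∣⟨ k ⟩ gl Uᴹ) z                              ≈⟨ slash-value f-respects k (gl Uᴹ) z {1ᶜ} z+1 den≈ num≈ ⟩
    ι (GL₂⁺.det (gl Uᴹ)) ^ (k ℕ./ 2) * 1ᶜ ^ k * f z+1
      ≈⟨ ℂr.*-cong (ℂr.*-cong (≈-trans (^-congˡ (k ℕ./ 2) (ι-cong (≡⇒≈ᵣ λ _ → refl))) (1^≈1 (k ℕ./ 2))) (1^≈1 k)) (≈-sym (periodic ≈-refl)) ⟩
    1ᶜ * 1ᶜ * f z                                   ≈⟨ solveℤ 1 (λ y → con (+ 1) :* con (+ 1) :* y ≔ y) refl (f z ∷ []) ⟩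
    f z                                             ∎
    where
      open ≈-Reasoning
      z+1 : ℋ
      z+1 = pt z + 1ᶜ , >0-resp (ℝr.sym (ℝr.+-identityʳ (im (pt z)))) (im-pos z)
      den≈ : den (gl Uᴹ) z * 1ᶜ ≈ 1ᶜ
      den≈ = solveℤ 1 (λ z → (con (+ 0) :* z :+ con (+ 1)) :* con (+ 1) ≔ con (+ 1)) refl (pt z ∷ [])
      num≈ : pt z+1 ≈ num (gl Uᴹ) z * 1ᶜ
      num≈ = solveℤ 1 (λ z → z :+ con (+ 1) ≔ (con (+ 1) :* z :+ con (+ 1)) :* con (+ 1)) refl (pt z ∷ [])

  -- Expanding the product gives the terms f, - f | ε, - f | γ and f | γε, which cancel in pairs
  -- once f | γ = f.
  ∥-annihilated : f ∣⟨ k ⟩ γ ≐ f → ∀ ε → f ∥[ k ] ((𝟏 ⊟ ⟦ γ ⟧) ⊠ (𝟏 ⊟ ⟦ ε ⟧)) ≐ λ z → 0ᶜ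
  ∥-annihilated fγ ε z = ≈-trans
      (ℂr.+-cong (term (1ᶜ * 1ᶜ) (via-identity fI))
        (ℂr.+-cong (term (1ᶜ * (- 1ᶜ * 1ᶜ)) (via-slash fI))
          (ℂr.+-cong (term (- 1ᶜ * 1ᶜ * 1ᶜ) (via-identity fγ))
            (ℂr.+-congʳ (term (- 1ᶜ * 1ᶜ * (- 1ᶜ * 1ᶜ)) (via-slash fγ))))))
      (cancel (f z) ((f ∣⟨ k ⟩ ε) z))
    where
      cancel : ∀ x y → 1ᶜ * 1ᶜ * x + (1ᶜ * (- 1ᶜ * 1ᶜ) * y + (- 1ᶜ * 1ᶜ * 1ᶜ * x + (- 1ᶜ * 1ᶜ * (- 1ᶜ * 1ᶜ) * y + 0ᶜ))) ≈ 0ᶜ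
      cancel x y = solveℤ 2 (λ x y → con (+ 1) :* con (+ 1) :* x :+ (con (+ 1) :* (:- con (+ 1) :* con (+ 1)) :* y
        :+ (:- con (+ 1) :* con (+ 1) :* con (+ 1) :* x :+ (:- con (+ 1) :* con (+ 1) :* (:- con (+ 1) :* con (+ 1)) :* y :+ con (+ 0)))) ≔ con (+ 0)) refl (x ∷ y ∷ [])
      term : ∀ v {M s} → (f ∣⟨ k ⟩ M) z ≈ s → v * (f ∣[ k ] M) z ≈ v * s
      term v {M} e = ℂr.*-congˡ (≈-trans (≈-sym (slash-≐ f k M z)) e)
      fI : f ∣⟨ k ⟩ Iₘ ≐ f
      fI = slash-identity f-respects k Iₘ ≈ᵣ-refl ≈ᵣ-refl ≈ᵣ-refl ≈ᵣ-refl
      via-slash : ∀ {M} → f ∣⟨ k ⟩ M ≐ f → (f ∣⟨ k ⟩ (M *ₘ ε)) z ≈ (f ∣⟨ k ⟩ ε) z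
      via-slash {M} h = ≈-trans (≈-sym (slash-∘ f-respects k M ε z)) (slash-resp k ε h z)
      via-identity : ∀ {M} → f ∣⟨ k ⟩ M ≐ f → (f ∣⟨ k ⟩ (M *ₘ Iₘ)) z ≈ f z
      via-identity {M} h = ≈-trans (≈-sym (slash-∘ f-respects k M Iₘ z)) (≈-trans (slash-resp k Iₘ h z) (fI z))

mainTheorem1 : (π : ℝ) → IsPi π →
    (k : ℕ) → .{{_ : NonZero k}} → 2 ∣ k →
    (f : ℋ → ℂ) → Congruent _≈ℋ_ _≈_ f → Holomorphic f →
    (a : ℕ → ℂ) → FourierExpansion π a f →
    (f ∣[ k ] H₁₃ ≐ f) ⊎ (f ∣[ k ] H₁₃ ≐ λ z → - f z) →
    (∀ p → .{{_ : NonZero p}} → Prime p → f ∥[ k ] T p ≐ λ z → heckeScalar k p * a p * f z) →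
    ∀ ε → ⟨ ε₁ , ε₂ ⟩ ε →
    f ∥[ k ] ((𝟏 ⊟ ⟦ γ ⟧) ⊠ (𝟏 ⊟ ⟦ ε ⟧)) ≐ λ z → 0ᶜ
mainTheorem1 π isPi k 2∣k f f-cong hol a fourier fricke hecke ε _ =
    ∥-annihilated respects k even
      (≐-trans (slash-integral respects k even γᴹ intMat-integral) (Vanishing.γ-invariant eigenform (proj₂ half) (holomorphic⇒hasDeriv hol))) ε
  where
    respects : Respects f
    respects z w = f-cong {z} {w}
    even : k ℕ./ 2 ℕ.+ k ℕ./ 2 ≡ k
    even = even-half k 2∣k
    half : ∃ λ m → k ℕ./ 2 ≡ suc m
    half = positive-half k even
    H≐ : f ∣⟨ k ⟩ gl Hᴹ ≐ f ∣[ k ] H₁₃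
    H≐ z = ≈-trans (≈-sym (slash-integral respects k even Hᴹ intMat-integral z)) (slash-≐ f k H₁₃ z)
    sign : (f ∣[ k ] H₁₃ ≐ f) ⊎ (f ∣[ k ] H₁₃ ≐ λ z → - f z) → ∃ λ s → s * s ≈ 1ᶜ × (f ∣⟨ k ⟩ gl Hᴹ ≐ λ z → s * f z)
    sign (inj₁ h) = 1ᶜ , ℂr.*-identityˡ 1ᶜ , λ z → ≈-trans (H≐ z) (≈-trans (h z) (≈-sym (ℂr.*-identityˡ (f z))))
    sign (inj₂ h) = - 1ᶜ , solveℤ 0 (:- con (+ 1) :* :- con (+ 1) ≔ con (+ 1)) refl []
      , λ z → ≈-trans (H≐ z) (≈-trans (h z) (solveℤ 1 (λ y → :- y ≔ :- con (+ 1) :* y) refl (f z ∷ [])))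
    eigenform : Eigenform f k
    eigenform = record
      { even = even ; respects = respects
      ; periodic = slash-translation respects k even λ {z} {w} → fourier-periodic isPi {a} {f} fourier {z} {w}
      ; s = proj₁ (sign fricke) ; s² = proj₁ (proj₂ (sign fricke)) ; fricke = proj₂ (proj₂ (sign fricke))
      ; hecke₂ = λ z → ≈-trans (≈-sym (∥-T₂ respects k even z)) (hecke 2 (from-yes (prime? 2)) z)
      ; hecke₃ = λ z → ≈-trans (≈-sym (∥-T₃ respects k even z)) (hecke 3 (from-yes (prime? 3)) z) }
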